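{- For every constant $\delta>0$ there is an algorithm that, given a rooted tree with $N$ nodes, a probability distribution on its leaves, and a known block size $B$, runs in $O(N)$ time (with the implied constant depending only on $\delta$) and computes a layout with block size $B$ whose expected block cost is at most $1+\delta$ more than the expected block cost of the optimal layout with block size $B$.
   Context: The tree is a finite rooted tree with fixed parent/child structure (arbitrary degrees) and a given probability distribution on its leaves. A layout with block size $B$ is a partition of the nodes into blocks, each containing at most $B$ nodes. The expected block cost of a layout is the expected number of (distinct) blocks containing nodes of the root-to-leaf path, when the leaf is selected at random according to the given distribution. The optimal layout with block size $B$ minimizes the expected block cost over all layouts with block size $B$. Running time is measured on a RAM.
   Formalization: The probabilities of the leaves are rational numbers, each given to the RAM as numerator and denominator in lowest terms (with word length at least a constant, depending on δ, times the bit length of each input number); δ is rational, which loses nothing. -}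

module Defs where

open import Data.Bool.Base using (if_then_else_)
open import Data.Fin.Base using (Fin; toℕ; finToFun; funToFin)
open import Data.Fin.Properties using (_≟_; all?; finToFun-funToFin)
open import Data.Integer.Base as ℤ using (+_; ∣_∣)
open import Data.List.Base
  using (List; []; _∷_; length; filter; deduplicate; map; iterate; allFin; concatMap; drop; head; mapMaybe)
open import Data.List.Properties using (map-cong; filter-≐)
open import Data.List.Membership.Propositional using (_∈_)
open import Data.List.Membership.Propositional.Properties using (∈-allFin)
import Data.List.Extrema as Extrema
open import Data.List.Relation.Unary.All as All using (All)
open import Data.List.Relation.Unary.Any using (here; there)
open import Data.List.Relation.Unary.AllPairs using (_∷_)
open import Data.List.Relation.Unary.Unique.Propositional using (Unique)
open import Data.List.Relation.Unary.Unique.Propositional.Properties using (allFin⁺; filter⁺)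
open import Data.List.Relation.Unary.All.Properties using (all-filter)
open import Data.Maybe.Base using (Maybe; just; nothing)
open import Data.Nat.Base as ℕ using (ℕ; zero; suc; NonZero; _^_)
import Data.Nat.Properties as ℕ
open import Data.Nat.DivMod using (_/_; _%_)
open import Data.Product using (∃; ∃-syntax; Σ; _×_; _,_; proj₁; proj₂)
open import Data.Rational.Base as ℚ using (ℚ; 0ℚ; 1ℚ; ↥_; ↧ₙ_)
import Data.Rational.Properties as ℚ
open import Function.Base using (_∘_)
open import Relation.Nullary using (Dec; yes; no; does; ¬_; contradiction)
open import Relation.Binary.Bundles using (DecTotalOrder)
open import Relation.Binary.PropositionalEquality
open import Algebra.Properties.CommutativeMonoid.Sum ℚ.+-0-commutativeMonoid using (sum; sum-cong-≗)

infixr 8 _^[_]_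

_^[_]_ : {A : Set} → (A → A) → ℕ → A → A
f ^[ zero  ] x = x
f ^[ suc k ] x = f ^[ k ] f x

-- The parent map is made total by sending the root to itself; the nodes are
-- numbered arbitrarily (a parent may have a larger number than its child).
record RootedTree (n : ℕ) : Set where
  field
    root       : Fin n
    parent     : Fin n → Fin n
    rootParent : parent root ≡ root
    reachRoot  : ∀ v → ∃[ k ] parent ^[ k ] v ≡ root

  IsLeaf : Fin n → Set
  IsLeaf v = ∀ u → u ≢ root → parent u ≢ v

  -- n steps always suffice to reach the root; if they overshoot, the root is
  -- repeated at the end of the list.
  pathToRoot : Fin n → List (Fin n)
  pathToRoot v = iterate parent v n

open RootedTree public

record LeafDistribution {n} (T : RootedTree n) : Set where
  field
    prob        : Fin n → ℚ
    nonNegative : ∀ v → 0ℚ ℚ.≤ prob v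
    onLeaves    : ∀ v → ¬ IsLeaf T v → prob v ≡ 0ℚ
    total       : sum prob ≡ 1ℚ

open LeafDistribution public

blockSize : ∀ {n} → (Fin n → Fin n) → Fin n → ℕ
blockSize {n} f k = length (filter (λ v → f v ≟ k) (allFin n))

-- A partition of n nodes is given by labelling each node with its block. It
-- has at most n blocks, so labels from Fin n suffice; labels may be unused.
record Layout (n B : ℕ) : Set where
  field
    block    : Fin n → Fin n
    capacity : ∀ k → blockSize block k ℕ.≤ B

open Layout public

module _ {n} (T : RootedTree n) where

  blocksOnPath : (Fin n → Fin n) → Fin n → ℕ
  blocksOnPath f v = length (deduplicate _≟_ (map f (pathToRoot T v)))

  module _ (p : LeafDistribution T) where

    expectedCost : ∀ {B} → Layout n B → ℚ
    expectedCost L = sum λ v → prob p v ℚ.* (+ blocksOnPath (block L) v ℚ./ 1)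

    IsOptimal : ∀ {B} → Layout n B → Set
    IsOptimal {B} L = ∀ (L′ : Layout n B) → expectedCost L ℚ.≤ expectedCost L′

private
  blockSize-cong : ∀ {n} {f g : Fin n → Fin n} → f ≗ g → ∀ k → blockSize f k ≡ blockSize g k
  blockSize-cong {n} f≗g k = cong length
    (filter-≐ _ _ ((λ {v} → trans (sym (f≗g v))) , (λ {v} → trans (f≗g v))) (allFin n))

  expectedCost-cong : ∀ {n B} (T : RootedTree n) p (L L′ : Layout n B) → block L ≗ block L′ →
                      expectedCost T p L ≡ expectedCost T p L′
  expectedCost-cong T p L L′ eq = sum-cong-≗ λ v →
    cong (λ xs → prob p v ℚ.* (+ length (deduplicate _≟_ xs) ℚ./ 1))
         (map-cong eq (pathToRoot T v))

  ∈-mapMaybe : ∀ {A C : Set} (f : A → Maybe C) {x y xs} → x ∈ xs → f x ≡ just y → y ∈ mapMaybe f xs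
  ∈-mapMaybe f {xs = x ∷ xs} (here refl) eq rewrite eq = here refl
  ∈-mapMaybe f {xs = x ∷ xs} (there i)   eq with f x
  ... | just _  = there (∈-mapMaybe f i eq)
  ... | nothing = ∈-mapMaybe f i eq

  unique-constant : ∀ {A : Set} {k : A} (xs : List A) → Unique xs → All (_≡ k) xs → length xs ℕ.≤ 1
  unique-constant []           _                    _ = ℕ.z≤n
  unique-constant (x ∷ [])     _                    _ = ℕ.s≤s ℕ.z≤n
  unique-constant (x ∷ y ∷ xs) ((x≢y All.∷ _) ∷ _) (refl All.∷ refl All.∷ _) =
    contradiction refl x≢y

  singletons : ∀ n B → .{{NonZero B}} → Layout n B
  singletons n B = record
    { block    = λ v → v
    ; capacity = λ k → ℕ.≤-trans
        (unique-constant _ (filter⁺ (_≟ k) (allFin⁺ n)) (all-filter (_≟ k) (allFin n)))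
        (ℕ.>-nonZero⁻¹ B)
    }

  module _ (n B : ℕ) where

    fits? : (f : Fin n → Fin n) → Dec (∀ k → blockSize f k ℕ.≤ B)
    fits? f = all? λ k → blockSize f k ℕ.≤? B

    decode : Fin (n ^ n) → Maybe (Layout n B)
    decode i with fits? (finToFun i)
    ... | yes c = just (record { block = finToFun i ; capacity = c })
    ... | no _  = nothing

    decode-complete : (L : Layout n B) →
      ∃[ L′ ] decode (funToFin (block L)) ≡ just L′ × block L′ ≗ block L
    decode-complete L with fits? (finToFun (funToFin (block L)))
    ... | yes c = _ , refl , finToFun-funToFin (block L)
    ... | no ¬c = contradiction
      (λ k → subst (ℕ._≤ B) (sym (blockSize-cong (finToFun-funToFin (block L)) k)) (capacity L k)) ¬c

    layouts : List (Layout n B)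
    layouts = mapMaybe decode (allFin (n ^ n))

    layouts-complete : (L : Layout n B) → ∃[ L′ ] L′ ∈ layouts × block L′ ≗ block L
    layouts-complete L =
      let L′ , eq , L′≗L = decode-complete L
      in L′ , ∈-mapMaybe decode {xs = allFin (n ^ n)} (∈-allFin (funToFin (block L))) eq , L′≗L

  minimiser : ∀ {A : Set} (f : A → ℚ) (x : A) (xs : List A) →
              ∃[ y ] (∀ {z} → z ∈ xs → f y ℚ.≤ f z)
  minimiser f x xs = argmin f x xs , All.lookup (f[argmin]≤f[xs] {f = f} x xs)
    where open Extrema (DecTotalOrder.totalOrder ℚ.≤-decTotalOrder)

optimalLayoutExists : ∀ {n} (T : RootedTree n) (p : LeafDistribution T) (B : ℕ) .{{_ : NonZero B}} →
                      Σ (Layout n B) (IsOptimal T p)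
optimalLayoutExists {n} T p B =
  let best , best≤ = minimiser (expectedCost T p) (singletons n B) (layouts n B)
  in best , λ L →
    let L′ , L′∈layouts , L′≗L = layouts-complete n B L
    in subst (expectedCost T p best ℚ.≤_) (expectedCost-cong T p L′ L L′≗L) (best≤ L′∈layouts)

-- A unit-cost word RAM: registers and memory cells hold w-bit words, and every
-- instruction takes one time step. Programs are finite and do not depend on w.
Reg : Set
Reg = ℕ

data Op : Set where
  add sub mul div : Op

data Instr : Set where
  const : Reg → ℕ → Instr               -- r ← c
  arith : Op → Reg → Reg → Reg → Instr  -- r ← a op b
  load  : Reg → Reg → Instr             -- r ← mem[a]
  store : Reg → Reg → Instr             -- mem[a] ← r   (store a r)
  jzero : Reg → ℕ → Instr               -- if r = 0, continue at instruction ℓ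

Program : Set
Program = List Instr

record State : Set where
  constructor ⟨_,_,_⟩
  field
    pc  : ℕ
    reg : ℕ → ℕ
    mem : ℕ → ℕ

open State public

_[_↦_] : (ℕ → ℕ) → ℕ → ℕ → (ℕ → ℕ)
(f [ i ↦ x ]) j = if does (j ℕ.≟ i) then x else f j

fetch : Program → ℕ → Maybe Instr
fetch P i = head (drop i P)

-- Subtraction is truncated at 0 and division rounds down, with a / 0 = 0.
⟦_⟧ : Op → ℕ → ℕ → ℕ
⟦ add ⟧ a b       = a ℕ.+ b
⟦ sub ⟧ a b       = a ℕ.∸ b
⟦ mul ⟧ a b       = a ℕ.* b
⟦ div ⟧ a zero    = zero
⟦ div ⟧ a (suc b) = a / suc b

module _ (w : ℕ) where

  word : ℕ → ℕ
  word x = _%_ x (2 ^ w) {{ℕ.m^n≢0 2 w}}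

  exec : Instr → State → State
  exec (const r c)     ⟨ i , R , M ⟩ = ⟨ suc i , R [ r ↦ word c ] , M ⟩
  exec (arith o r a b) ⟨ i , R , M ⟩ = ⟨ suc i , R [ r ↦ word (⟦ o ⟧ (R a) (R b)) ] , M ⟩
  exec (load r a)      ⟨ i , R , M ⟩ = ⟨ suc i , R [ r ↦ M (R a) ] , M ⟩
  exec (store a r)     ⟨ i , R , M ⟩ = ⟨ suc i , R , M [ R a ↦ R r ] ⟩
  exec (jzero r ℓ)     ⟨ i , R , M ⟩ = ⟨ if does (R r ℕ.≟ 0) then ℓ else suc i , R , M ⟩

  step : Program → State → State
  step P s with fetch P (pc s)
  ... | just ins = exec ins s
  ... | nothing  = s

  -- The state after t time steps, or at halting if that comes earlier.
  run : Program → ℕ → State → State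
  run P t s = step P ^[ t ] s

-- A program halts by leaving its range of instructions.
Halted : Program → State → Set
Halted P s = fetch P (pc s) ≡ nothing

-- The tree is an array of parent pointers. Each probability is a pair
-- (numerator, denominator) in lowest terms; the probability stored for an
-- internal node is 0/1.
inputCells : ∀ {n} (T : RootedTree n) → LeafDistribution T → ℕ → List ℕ
inputCells {n} T p B = n ∷ B ∷ concatMap
  (λ v → toℕ (parent T v) ∷ ∣ ↥ prob p v ∣ ∷ ↧ₙ (prob p v) ∷ [])
  (allFin n)

contents : List ℕ → ℕ → ℕ
contents []       _       = 0
contents (x ∷ xs) zero    = x
contents (x ∷ xs) (suc a) = contents xs a

initial : ∀ {n} (T : RootedTree n) → LeafDistribution T → ℕ → State
initial T p B = ⟨ 0 , (λ _ → 0) , contents (inputCells T p B) ⟩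

-- The usual convention that the word length is at least a sufficiently large
-- constant κ times the bit length of every input number: κ log₂ (1 + x) ≤ w.
-- Numerators and parent pointers are bounded by the numbers listed here, and
-- n ≥ 1 forces w ≥ κ.
WordsLargeEnough : ∀ {n} (κ w : ℕ) (T : RootedTree n) → LeafDistribution T → ℕ → Set
WordsLargeEnough {n} κ w T p B =
  suc n ^ κ ℕ.≤ 2 ^ w × suc B ^ κ ℕ.≤ 2 ^ w × (∀ v → suc (↧ₙ (prob p v)) ^ κ ℕ.≤ 2 ^ w)

-- The block label of node v is left in memory cell v.
Outputs : ∀ {n B} → State → Layout n B → Set
Outputs s L = ∀ v → mem s (toℕ v) ≡ toℕ (block L v)

module Submission where

open import Defs
open import Data.Bool.Base using (Bool; true; false; if_then_else_; T; _∧_; _∨_; not)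
open import Data.Bool.Properties using (T-∧; T-∨; T-≡)
open import Data.Empty using (⊥; ⊥-elim)
open import Data.Fin.Base as Fin using (Fin; toℕ; fromℕ<)
open import Data.Fin.Properties as Fin using (toℕ-fromℕ<; fromℕ<-toℕ; toℕ<n; toℕ-injective; injective⇒≤)
open import Data.Integer.Base as ℤ using (∣_∣)
import Data.Integer.Properties as ℤ
open import Data.List.Base using (List; []; _∷_; _++_; length; drop; head; map; filter; tabulate; deduplicate; iterate; concatMap)
open import Data.List.Membership.Propositional using (_∈_)
open import Data.List.Membership.Propositional.Properties using (∈-map⁺; ∈-map⁻; ∈-deduplicate⁺; ∈-deduplicate⁻)
open import Data.List.Properties using (length-++; ++-assoc; ++-identityʳ; drop-drop)
open import Data.List.Relation.Unary.All as All using ()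
open import Data.List.Relation.Unary.AllPairs using ([]; _∷_)
open import Data.List.Relation.Unary.Any as Any using ()
open import Data.List.Relation.Unary.Unique.DecPropositional.Properties using (deduplicate-!)
open import Data.List.Relation.Unary.Unique.Propositional using (Unique)
open import Data.Maybe.Base using (Maybe; just; nothing)
open import Data.Nat.Base using (ℕ; zero; suc; _+_; _*_; _∸_; _^_; _⊔_; _⊓_; _≤_; _<_; z≤n; s≤s; _≤ᵇ_; _<ᵇ_; _≡ᵇ_; NonZero; >-nonZero; >-nonZero⁻¹)
open import Data.Nat.DivMod using (_/_; _%_; m%n≡m∸m/n*n; [m+kn]%n≡m%n; m<n⇒m%n≡m; m%n<n; %-distribˡ-+; m/n*n≤m; m/n≤m; m≡m%n+[m/n]*n)
open import Data.Nat.Properties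
open import Data.Product using (Σ; ∃-syntax; _×_; _,_; proj₁; proj₂)
open import Data.Rational.Base as ℚ using (ℚ; 0ℚ; 1ℚ; mkℚ; ↥_; ↧ₙ_; toℚᵘ)
import Data.Rational.Properties as ℚ
open import Data.Rational.Unnormalised.Base as ℚᵘ using (mkℚᵘ; *≡*; *≤*)
import Data.Rational.Unnormalised.Properties as ℚᵘ
open import Data.Sum.Base using (_⊎_; inj₁; inj₂)
open import Data.Unit.Base using (tt)
open import Function.Base using (_∘_)
open import Function.Bundles using (Equivalence)
open import Relation.Binary.Definitions using (tri<; tri≈; tri>)
open import Relation.Binary.PropositionalEquality
open import Relation.Nullary using (Dec; yes; no; does; ¬_; contradiction)
open import Relation.Unary using (Decidable)
open import Algebra.Properties.CommutativeMonoid.Sum ℚ.+-0-commutativeMonoid using (sum)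

-- Every subtree with more than B nodes gets a vector f, where f k is the cost of
-- the subtree when its root may use k free cells of its parent's block; merging a
-- child is a min-plus convolution. Exact vectors are too expensive. But the sparser
-- side of a merge only has to be sampled where it drops by a fixed fraction of the
-- mass of its subtree. With l the smaller Strahler rank of the two sides, a fraction
-- 1 / (C (l + 1) (l + 2)) gives O(B l²) time per merge and errors that telescope to
-- 1 / C of the total mass; a potential that is quadratic in the rank, together with
-- the at least B nodes below every vector, bounds the time of all merges by O(N).
-- Subtrees with at most B nodes are put into blocks of their own, for an extra cost
-- of at most 1. Probabilities are rounded down to multiples of 1 / (C N²), which
-- costs at most 1 / C, and C is chosen such that 2 / C ≤ δ. The algorithm is written
-- in a small imperative language with a clock and compiled to the RAM.

-- Why ranks work: a vector of rank `a` may carry an error of `a/(a+1)` of its mass over `C`, and a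
-- grain adds `1/((a+1)(a+2))`, which gives exactly `(a+1)/(a+2)`. The sampled side leaves the merge
-- with a larger rank, so its mass is charged at most once per level. A long chain of big nodes
-- involves no merge, so prepending an entry must take constant time; hence ring buffers. Their many
-- cells need no clearing, because memory behind the input is 0. The lower bound has to cover
-- layouts whose blocks are scattered over a path. In it `k` counts the free cells of all blocks met
-- so far and may exceed `B`. Opening a block costs the mass of a subtree and buys `B` cells, while
-- an exact vector drops by at most this mass over `B` places; so taking a free cell first is never
-- worse, and contiguous blocks lose nothing against scattered ones.

infixl 6 _⊞_
infixl 7 _⊠_
infix 4 _≼_

-- Linear arithmetic over polynomials with natural coefficients

data Poly : Set where
  κ       : ℕ → Poly
  at      : ℕ → Poly
  _⊞_ _⊠_ : Poly → Poly → Poly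

nth : List ℕ → ℕ → ℕ
nth []       _       = 0
nth (x ∷ _)  zero    = x
nth (_ ∷ xs) (suc i) = nth xs i

module _ (ρ : List ℕ) where

  ⟦_⟧ₚ : Poly → ℕ
  ⟦ κ c ⟧ₚ   = c
  ⟦ at i ⟧ₚ  = nth ρ i
  ⟦ p ⊞ q ⟧ₚ = ⟦ p ⟧ₚ + ⟦ q ⟧ₚ
  ⟦ p ⊠ q ⟧ₚ = ⟦ p ⟧ₚ * ⟦ q ⟧ₚ

Monomial : Set
Monomial = List ℕ

insertAtom : ℕ → Monomial → Monomial
insertAtom i []       = i ∷ []
insertAtom i (j ∷ js) = if i ≤ᵇ j then i ∷ j ∷ js else j ∷ insertAtom i js

mergeMono : Monomial → Monomial → Monomial
mergeMono []       ks = ks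
mergeMono (j ∷ js) ks = insertAtom j (mergeMono js ks)

sameMono : Monomial → Monomial → Bool
sameMono []       []       = true
sameMono (i ∷ is) (j ∷ js) = (i ≡ᵇ j) ∧ sameMono is js
sameMono _        _        = false

Terms : Set
Terms = List (ℕ × Monomial)

addTerm : ℕ → Monomial → Terms → Terms
addTerm c m []             = (c , m) ∷ []
addTerm c m ((d , k) ∷ ts) = if sameMono m k then (c + d , k) ∷ ts else (d , k) ∷ addTerm c m ts

addTerms : Terms → Terms → Terms
addTerms []             us = us
addTerms ((c , m) ∷ ts) us = addTerm c m (addTerms ts us)

scaleTerms : ℕ → Monomial → Terms → Terms
scaleTerms c m []             = []
scaleTerms c m ((d , k) ∷ ts) = addTerm (c * d) (mergeMono m k) (scaleTerms c m ts)

mulTerms : Terms → Terms → Terms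
mulTerms []             us = []
mulTerms ((c , m) ∷ ts) us = addTerms (scaleTerms c m us) (mulTerms ts us)

norm : Poly → Terms
norm (κ c)   = (c , []) ∷ []
norm (at i)  = (1 , i ∷ []) ∷ []
norm (p ⊞ q) = addTerms (norm p) (norm q)
norm (p ⊠ q) = mulTerms (norm p) (norm q)

-- Subtracting one term at a time spares a canonical order of the terms. `nothing` means that the
-- available coefficient is too small; a zero coefficient needs no partner.
removeTerm : ℕ → Monomial → Terms → Maybe Terms
removeTerm zero    m us             = just us
removeTerm (suc c) m []             = nothing
removeTerm (suc c) m ((d , k) ∷ us) with sameMono m k
... | true  = if c <ᵇ d then just ((d ∸ suc c , k) ∷ us) else nothing
... | false with removeTerm (suc c) m us
...   | just vs = just ((d , k) ∷ vs)
...   | nothing = nothing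

-- Sufficient for `≤` at every assignment, because all values are natural numbers, but not
-- necessary: `2xy ≤ x² + y²` is out of reach.
below : Terms → Terms → Bool
below []             us = true
below ((c , m) ∷ ts) us with removeTerm c m us
... | just vs = below ts vs
... | nothing = false

module _ (ρ : List ℕ) where

  private
    mono : Monomial → ℕ
    mono []       = 1
    mono (i ∷ is) = nth ρ i * mono is

    terms : Terms → ℕ
    terms []             = 0
    terms ((c , m) ∷ ts) = c * mono m + terms ts

    lemma₁ : ∀ a b c → a * (b * c) ≡ b * (a * c)
    lemma₁ a b c = trans (sym (*-assoc a b c)) (trans (cong (_* c) (*-comm a b)) (*-assoc b a c))

    insert-mono : ∀ i m → mono (insertAtom i m) ≡ nth ρ i * mono m
    insert-mono i []       = refl
    insert-mono i (j ∷ js) with i ≤ᵇ j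
    ... | true  = refl
    ... | false = trans (cong (nth ρ j *_) (insert-mono i js)) (lemma₁ (nth ρ j) (nth ρ i) (mono js))

    merge-mono : ∀ m k → mono (mergeMono m k) ≡ mono m * mono k
    merge-mono []       k = sym (+-identityʳ _)
    merge-mono (j ∷ js) k = trans (insert-mono j (mergeMono js k))
      (trans (cong (nth ρ j *_) (merge-mono js k)) (sym (*-assoc (nth ρ j) (mono js) (mono k))))

    same-mono : ∀ m k → sameMono m k ≡ true → mono m ≡ mono k
    same-mono []       []       _  = refl
    same-mono (i ∷ is) (j ∷ js) eq with i ≡ᵇ j in e | eq
    ... | true  | eq′ = cong₂ (λ x y → nth ρ x * y)
      (≡ᵇ⇒≡ i j (Equivalence.from T-≡ e)) (same-mono is js eq′)

    lemma₂ : ∀ a b c d → (a + b) * c + d ≡ a * c + (b * c + d)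
    lemma₂ a b c d = trans (cong (_+ d) (*-distribʳ-+ c a b)) (+-assoc (a * c) (b * c) d)

    lemma₃ : ∀ a b c → a + (b + c) ≡ b + (a + c)
    lemma₃ a b c = trans (sym (+-assoc a b c)) (trans (cong (_+ c) (+-comm a b)) (+-assoc b a c))

    add-term : ∀ c m ts → terms (addTerm c m ts) ≡ c * mono m + terms ts
    add-term c m []             = refl
    add-term c m ((d , k) ∷ ts) with sameMono m k in e
    ... | true rewrite same-mono m k e = lemma₂ c d (mono k) (terms ts)
    ... | false = trans (cong (d * mono k +_) (add-term c m ts)) (lemma₃ (d * mono k) (c * mono m) (terms ts))

    add-terms : ∀ ts us → terms (addTerms ts us) ≡ terms ts + terms us
    add-terms []             us = refl
    add-terms ((c , m) ∷ ts) us = trans (add-term c m (addTerms ts us))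
      (trans (cong (c * mono m +_) (add-terms ts us)) (sym (+-assoc (c * mono m) _ _)))

    lemma₄ : ∀ a b c d e → (a * b) * (c * d) + (a * c) * e ≡ (a * c) * (b * d + e)
    lemma₄ a b c d e = trans (cong (_+ a * c * e) ([m*n]*[o*p]≡[m*o]*[n*p] a b c d)) (sym (*-distribˡ-+ (a * c) (b * d) e))

    scale-terms : ∀ c m ts → terms (scaleTerms c m ts) ≡ c * mono m * terms ts
    scale-terms c m []             = sym (*-zeroʳ (c * mono m))
    scale-terms c m ((d , k) ∷ ts) = trans (add-term (c * d) (mergeMono m k) (scaleTerms c m ts))
      (trans (cong₂ _+_ (cong (c * d *_) (merge-mono m k)) (scale-terms c m ts))
        (lemma₄ c d (mono m) (mono k) (terms ts)))

    mul-terms : ∀ ts us → terms (mulTerms ts us) ≡ terms ts * terms us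
    mul-terms []             us = refl
    mul-terms ((c , m) ∷ ts) us = trans (add-terms (scaleTerms c m us) (mulTerms ts us))
      (trans (cong₂ _+_ (scale-terms c m us) (mul-terms ts us))
        (sym (*-distribʳ-+ (terms us) (c * mono m) (terms ts))))

    norm-sound : ∀ p → terms (norm p) ≡ ⟦_⟧ₚ ρ p
    norm-sound (κ c)   = trans (+-identityʳ _) (*-identityʳ c)
    norm-sound (at i)  = trans (+-identityʳ _) (trans (*-identityˡ _) (*-identityʳ _))
    norm-sound (p ⊞ q) = trans (add-terms (norm p) (norm q)) (cong₂ _+_ (norm-sound p) (norm-sound q))
    norm-sound (p ⊠ q) = trans (mul-terms (norm p) (norm q)) (cong₂ _*_ (norm-sound p) (norm-sound q))

    remove-term : ∀ c m us vs → removeTerm c m us ≡ just vs → terms us ≡ c * mono m + terms vs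
    remove-term zero    m us             _  refl = refl
    remove-term (suc c) m ((d , k) ∷ us) vs eq with sameMono m k in e | eq
    ... | true | eq′ with c <ᵇ d in l | eq′
    ...   | true | refl rewrite same-mono m k e =
              trans (cong (λ z → z * mono k + terms us) (sym (m+[n∸m]≡n (<ᵇ⇒< c d (Equivalence.from T-≡ l)))))
                    (lemma₂ (suc c) (d ∸ suc c) (mono k) (terms us))
    remove-term (suc c) m ((d , k) ∷ us) vs eq | false | eq′ with removeTerm (suc c) m us in r | eq′
    ... | just ws | refl = trans (cong (d * mono k +_) (remove-term (suc c) m us ws r)) (lemma₃ (d * mono k) (suc c * mono m) (terms ws))

    below-sound : ∀ ts us → T (below ts us) → terms ts ≤ terms us
    below-sound []             us _ = z≤n
    below-sound ((c , m) ∷ ts) us b with removeTerm c m us in r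
    ... | just vs rewrite remove-term c m us vs r = +-monoʳ-≤ (c * mono m) (below-sound ts vs b)

  below-≤ : ∀ p q → T (below (norm p) (norm q)) → ⟦_⟧ₚ ρ p ≤ ⟦_⟧ₚ ρ q
  below-≤ p q b = subst₂ _≤_ (norm-sound p) (norm-sound q) (below-sound (norm p) (norm q) b)

record Claim : Set where
  constructor _≼_
  field lhs rhs : Poly

lefts rights : List Claim → Poly
lefts  []             = κ 0
lefts  ((l ≼ r) ∷ hs) = l ⊞ lefts hs
rights []             = κ 0
rights ((l ≼ r) ∷ hs) = r ⊞ rights hs

Hyps : List ℕ → List Claim → Set → Set
Hyps ρ []             G = G
Hyps ρ ((l ≼ r) ∷ hs) G = ⟦_⟧ₚ ρ l ≤ ⟦_⟧ₚ ρ r → Hyps ρ hs G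

private
  hyps : ∀ ρ hs {G : Set} → (⟦_⟧ₚ ρ (lefts hs) ≤ ⟦_⟧ₚ ρ (rights hs) → G) → Hyps ρ hs G
  hyps ρ []             k = k z≤n
  hyps ρ ((l ≼ r) ∷ hs) k = λ h → hyps ρ hs (λ h′ → k (+-mono-≤ h h′))

-- The hypotheses imply the goal because their sum does so coefficientwise.
lin-by : ∀ ρ hs g → T (below (norm (Claim.lhs g ⊞ rights hs)) (norm (Claim.rhs g ⊞ lefts hs))) →
         Hyps ρ hs (⟦_⟧ₚ ρ (Claim.lhs g) ≤ ⟦_⟧ₚ ρ (Claim.rhs g))
lin-by ρ hs (a ≼ b) ok = hyps ρ hs λ h →
  +-cancelʳ-≤ (⟦_⟧ₚ ρ (rights hs)) _ _
    (≤-trans (below-≤ ρ (a ⊞ rights hs) (b ⊞ lefts hs) ok) (+-monoʳ-≤ (⟦_⟧ₚ ρ b) h))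

infix 3 _⊢_

record Problem : Set where
  constructor _⊢_
  field
    given : List Claim
    goal  : Claim

Curried : ℕ → Set
Curried zero    = Problem
Curried (suc k) = Poly → Curried k

fill : ∀ k → ℕ → Curried k → Problem
fill zero    i p = p
fill (suc k) i p = fill k (suc i) (p (at i))

Checked : Problem → Set
Checked (hs ⊢ a ≼ b) = T (below (norm (a ⊞ rights hs)) (norm (b ⊞ lefts hs)))

ForAll : ℕ → (List ℕ → Set) → List ℕ → Set
ForAll zero    P ρ = P ρ
ForAll (suc k) P ρ = ∀ x → ForAll k (λ σ → P (x ∷ σ)) ρ

private
  forAll : ∀ k (P : List ℕ → Set) ρ → (∀ σ → P σ) → ForAll k P ρ
  forAll zero    P ρ h = h ρ
  forAll (suc k) P ρ h = λ x → forAll k (λ σ → P (x ∷ σ)) ρ (λ σ → h (x ∷ σ))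

-- The problem is a function of `k` polynomials, instantiated with atoms; the result quantifies over
-- `k` numbers and takes the hypotheses as arguments. The check is a closed boolean, so `ok` is
-- found by evaluation. Each hypothesis is added exactly once: a multiple must be supplied as a
-- hypothesis of its own, and products must be formed beforehand.
lin : ∀ k (p : Curried k) {ok : Checked (fill k 0 p)} →
      ForAll k (λ ρ → Hyps ρ (Problem.given (fill k 0 p))
        (⟦_⟧ₚ ρ (Claim.lhs (Problem.goal (fill k 0 p))) ≤ ⟦_⟧ₚ ρ (Claim.rhs (Problem.goal (fill k 0 p))))) []
lin k p {ok} = forAll k _ [] (λ ρ → lin-by ρ (Problem.given (fill k 0 p)) (Problem.goal (fill k 0 p)) ok)

CheckedBoth : Problem → Set
CheckedBoth (_ ⊢ a ≼ b) = T (below (norm a) (norm b) ∧ below (norm b) (norm a))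

ring : ∀ k (p : Curried k) {ok : CheckedBoth (fill k 0 p)} →
       ForAll k (λ ρ → ⟦_⟧ₚ ρ (Claim.lhs (Problem.goal (fill k 0 p))) ≡ ⟦_⟧ₚ ρ (Claim.rhs (Problem.goal (fill k 0 p)))) []
ring k p {ok} = forAll k _ [] λ ρ →
  let a = Claim.lhs (Problem.goal (fill k 0 p)) ; b = Claim.rhs (Problem.goal (fill k 0 p))
      l , r = Equivalence.to (T-∧ {below (norm a) (norm b)}) ok
  in ≤-antisym (below-≤ ρ a b l) (below-≤ ρ b a r)

-- Imperative programs and their weakest preconditions

upd : {A : Set} → (ℕ → A) → ℕ → A → ℕ → A
upd f i x j = if i ≡ᵇ j then x else f j

≡ᵇ-refl : ∀ i → (i ≡ᵇ i) ≡ true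
≡ᵇ-refl i = Equivalence.to T-≡ (≡⇒≡ᵇ i i refl)

≢⇒≡ᵇ : ∀ {i j} → i ≢ j → (i ≡ᵇ j) ≡ false
≢⇒≡ᵇ {i} {j} i≢j with i ≡ᵇ j in e
... | true  = contradiction (≡ᵇ⇒≡ i j (Equivalence.from T-≡ e)) i≢j
... | false = refl

upd-same : ∀ {A : Set} (f : ℕ → A) i x → upd f i x i ≡ x
upd-same f i x rewrite ≡ᵇ-refl i = refl

upd-other : ∀ {A : Set} (f : ℕ → A) {i j} x → i ≢ j → upd f i x j ≡ f j
upd-other f x i≢j rewrite ≢⇒≡ᵇ i≢j = refl

infix  6 _≔_
infixr 5 _⨾_
infixl 8 _⊕_ _⊖_
infixl 9 _⊛_ _⊘_

-- Constants up to 8 are kept apart: they fit below every bound used later, whereas a `con` carries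
-- a proof obligation. `raw` addresses the cells of input and output, `arr` one of sixteen
-- two-dimensional arrays; a one-dimensional array is the column 0 of such an array.
data Expr : Set where
  lit : (c : ℕ) {small : T (c ≤ᵇ 8)} → Expr
  con : ℕ → Expr
  var : ℕ → Expr
  op  : Op → Expr → Expr → Expr
  raw : Expr → Expr
  arr : (a : ℕ) {small : T (a <ᵇ 16)} → Expr → Expr → Expr

pattern _⊕_ x y = op add x y
pattern _⊖_ x y = op sub x y
pattern _⊛_ x y = op mul x y
pattern _⊘_ x y = op div x y

fld : (a : ℕ) {small : T (a <ᵇ 16)} → Expr → Expr
fld a {s} i = arr a {s} i (lit 0)

data Stmt : Set where
  skip  : Stmt
  _≔_   : ℕ → Expr → Stmt
  put   : (a : ℕ) {small : T (a <ᵇ 16)} → Expr → Expr → Expr → Stmt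
  raw≔  : Expr → Expr → Stmt
  _⨾_   : Stmt → Stmt → Stmt
  ite   : Expr → Stmt → Stmt → Stmt
  while : Expr → Stmt → Stmt

record Store : Set where
  constructor store
  field
    vr  : ℕ → ℕ
    ar  : ℕ → ℕ → ℕ → ℕ
    rw  : ℕ → ℕ
    clk : ℕ

open Store public

tick : ℕ → Store → Store
tick k (store v a r c) = store v a r (k + c)

setv : ℕ → ℕ → Store → Store
setv x n (store v a r c) = store (upd v x n) a r c

seta : ℕ → ℕ → ℕ → ℕ → Store → Store
seta k i j n (store v a r c) = store v (upd a k (upd (a k) i (upd (a k i) j n))) r c

setr : ℕ → ℕ → Store → Store
setr i n (store v a r c) = store v a (upd r i n) c

eval : Expr → Store → ℕ
eval (lit c)     σ = c
eval (con c)     σ = c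
eval (var x)     σ = vr σ x
eval (op o a b)  σ = ⟦ o ⟧ (eval a σ) (eval b σ)
eval (raw i)     σ = rw σ (eval i σ)
eval (arr a i j) σ = ar σ a (eval i σ) (eval j σ)

-- The number of instructions emitted. An array access takes seven for the address and one for the
-- load.
ce : Expr → ℕ
ce (lit c)     = 1
ce (con c)     = 1
ce (var x)     = 1
ce (op o a b)  = ce a + ce b + 1
ce (raw i)     = ce i + 1
ce (arr a i j) = ce i + ce j + 8

isZero : Expr → Bool
isZero (lit 0) = true
isZero _       = false

-- Rows of two-dimensional arrays have indices 0 … B, raw cells have addresses
-- below rawSize, and every value that is ever computed must be at most V.
module Logic (B V rawSize : ℕ) where

  opOk : Op → ℕ → ℕ → Set → Set
  opOk add x y K = x + y ≤ V × K
  opOk sub x y K = K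
  opOk mul x y K = x * y ≤ V × K
  opOk div x y K = K

  ok : Expr → Store → Set → Set
  ok (lit c)     σ K = K
  ok (con c)     σ K = c ≤ V × K
  ok (var x)     σ K = K
  ok (op o a b)  σ K = ok a σ (ok b σ (opOk o (eval a σ) (eval b σ) K))
  ok (raw i)     σ K = ok i σ (eval i σ < rawSize × K)
  ok (arr a i j) σ K = ok i σ (ok j σ (if isZero j then K else (eval j σ ≤ B × K)))

  mutual
    -- Total correctness: a loop needs a number of rounds as witness. The extra `tick 1` after the
    -- first branch of a conditional and after a loop body is the jump that the compiler emits
    -- there; thus the clock agrees with the machine exactly.
    wp : Stmt → (Store → Set) → Store → Set
    wp skip            Q σ = Q σ
    wp (x ≔ e)         Q σ = ok e σ (Q (setv x (eval e σ) (tick (ce e + 1) σ)))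
    wp (put a i j e)   Q σ = ok i σ (ok j σ (ok e σ
      ((if isZero j then Q₁ else (eval j σ ≤ B × Q₁)))))
      where
      Q₁ : Set
      Q₁ = Q (seta a (eval i σ) (eval j σ) (eval e σ) (tick (ce i + ce j + ce e + 8) σ))
    wp (raw≔ i e)      Q σ = ok i σ (ok e σ (eval i σ < rawSize × Q (setr (eval i σ) (eval e σ) (tick (ce i + ce e + 1) σ))))
    wp (s ⨾ t)         Q σ = wp s (wp t Q) σ
    wp (ite e s t)     Q σ = ok e σ
      ((eval e σ ≢ 0 → wp s (λ σ′ → Q (tick 1 σ′)) (tick (ce e + 1) σ)) ×
       (eval e σ ≡ 0 → wp t Q (tick (ce e + 1) σ)))
    wp (while e s)     Q σ = Σ ℕ λ k → loop e s Q k σ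

    loop : Expr → Stmt → (Store → Set) → ℕ → Store → Set
    loop e s Q zero    σ = ⊥
    loop e s Q (suc k) σ = ok e σ
      ((eval e σ ≢ 0 → wp s (λ σ′ → loop e s Q k (tick 1 σ′)) (tick (ce e + 1) σ)) ×
       (eval e σ ≡ 0 → Q (tick (ce e + 1) σ)))

  opOk-mono : ∀ o x y {K L} → (K → L) → opOk o x y K → opOk o x y L
  opOk-mono add x y f (b , k) = b , f k
  opOk-mono sub x y f k       = f k
  opOk-mono mul x y f (b , k) = b , f k
  opOk-mono div x y f k       = f k

  inRow-mono : ∀ b {P K L : Set} → (K → L) → (if b then K else (P × K)) → (if b then L else (P × L))
  inRow-mono true  f k       = f k
  inRow-mono false f (p , k) = p , f k

  ok-mono : ∀ e σ {K L} → (K → L) → ok e σ K → ok e σ L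
  ok-mono (lit c)     σ f k       = f k
  ok-mono (con c)     σ f (b , k) = b , f k
  ok-mono (var x)     σ f k       = f k
  ok-mono (op o a b)  σ f k       = ok-mono a σ (ok-mono b σ (opOk-mono o (eval a σ) (eval b σ) f)) k
  ok-mono (raw i)     σ f k       = ok-mono i σ (λ { (b , k′) → b , f k′ }) k
  ok-mono (arr a i j) σ f k       = ok-mono i σ (ok-mono j σ (inRow-mono (isZero j) f)) k

  mutual
    wp-mono : ∀ s {Q R} → (∀ σ → Q σ → R σ) → ∀ σ → wp s Q σ → wp s R σ
    wp-mono skip          f σ w = f σ w
    wp-mono (x ≔ e)       f σ w = ok-mono e σ (f _) w
    wp-mono (put a i j e) f σ w =
      ok-mono i σ (ok-mono j σ (ok-mono e σ (inRow-mono (isZero j) (f _)))) w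
    wp-mono (raw≔ i e)    f σ w = ok-mono i σ (ok-mono e σ (λ { (b , q) → b , f _ q })) w
    wp-mono (s ⨾ t)       f σ w = wp-mono s (wp-mono t f) σ w
    wp-mono (ite e s t)   f σ w = ok-mono e σ (λ { (p , q) →
      (λ ne → wp-mono s (λ σ′ → f (tick 1 σ′)) _ (p ne)) , (λ eq → wp-mono t f _ (q eq)) }) w
    wp-mono (while e s)   f σ (k , w) = k , loop-mono e s f k σ w

    loop-mono : ∀ e s {Q R} → (∀ σ → Q σ → R σ) → ∀ k σ → loop e s Q k σ → loop e s R k σ
    loop-mono e s f (suc k) σ w = ok-mono e σ (λ { (p , q) →
      (λ ne → wp-mono s (λ σ′ → loop-mono e s f k (tick 1 σ′)) _ (p ne)) , (λ z → f _ (q z)) }) w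

  wv : Stmt → ℕ → Bool
  wv skip          y = false
  wv (x ≔ e)       y = x ≡ᵇ y
  wv (put a i j e) y = false
  wv (raw≔ i e)    y = false
  wv (s ⨾ t)       y = wv s y ∨ wv t y
  wv (ite e s t)   y = wv s y ∨ wv t y
  wv (while e s)   y = wv s y

  wa : Stmt → ℕ → Bool
  wa skip          b = false
  wa (x ≔ e)       b = false
  wa (put a i j e) b = a ≡ᵇ b
  wa (raw≔ i e)    b = false
  wa (s ⨾ t)       b = wa s b ∨ wa t b
  wa (ite e s t)   b = wa s b ∨ wa t b
  wa (while e s)   b = wa s b

  wr : Stmt → Bool
  wr skip          = false
  wr (x ≔ e)       = false
  wr (put a i j e) = false
  wr (raw≔ i e)    = true
  wr (s ⨾ t)       = wr s ∨ wr t
  wr (ite e s t)   = wr s ∨ wr t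
  wr (while e s)   = wr s

  -- What `s` may write is read off its syntax, so the premises `wv s x ≡ false` hold by evaluation
  -- and unchanged facts are carried over with `refl`.
  record Frame (s : Stmt) (σ σ′ : Store) : Set where
    field
      fv : ∀ x → wv s x ≡ false → vr σ′ x ≡ vr σ x
      fa : ∀ a → wa s a ≡ false → ar σ′ a ≡ ar σ a
      fr : wr s ≡ false → rw σ′ ≡ rw σ

  open Frame public

  Frame-refl : ∀ s σ k → Frame s σ (tick k σ)
  Frame-refl s σ k = record { fv = λ _ _ → refl ; fa = λ _ _ → refl ; fr = λ _ → refl }

  Frame-trans : ∀ {s σ σ′ σ″} → Frame s σ σ′ → Frame s σ′ σ″ → Frame s σ σ″
  Frame-trans f g = record
    { fv = λ x p → trans (fv g x p) (fv f x p)
    ; fa = λ a p → trans (fa g a p) (fa f a p)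
    ; fr = λ p → trans (fr g p) (fr f p) }

  private
    ∨ˡ : ∀ {a b} → a ∨ b ≡ false → a ≡ false
    ∨ˡ {false} e = refl

    ∨ʳ : ∀ {a b} → a ∨ b ≡ false → b ≡ false
    ∨ʳ {false} e = e

    upd-false : ∀ {A : Set} (f : ℕ → A) i x j → (i ≡ᵇ j) ≡ false → upd f i x j ≡ f j
    upd-false f i x j e rewrite e = refl

    weaken : ∀ {s t σ σ′} → (∀ x → wv t x ≡ false → wv s x ≡ false) → (∀ a → wa t a ≡ false → wa s a ≡ false) →
             (wr t ≡ false → wr s ≡ false) → Frame s σ σ′ → Frame t σ σ′
    weaken p q r f = record { fv = λ x e → fv f x (p x e) ; fa = λ a e → fa f a (q a e) ; fr = λ e → fr f (r e) }

    left : ∀ {s t σ σ′} → Frame s σ σ′ → Frame (s ⨾ t) σ σ′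
    left f = weaken (λ _ → ∨ˡ) (λ _ → ∨ˡ) ∨ˡ f

    right : ∀ {s t σ σ′} → Frame t σ σ′ → Frame (s ⨾ t) σ σ′
    right {s} f = weaken (λ x → ∨ʳ {wv s x}) (λ a → ∨ʳ {wa s a}) (∨ʳ {wr s}) f

    ⟨⟩tick : ∀ {s σ σ′} k → Frame s σ σ′ → Frame s σ (tick k σ′)
    ⟨⟩tick {s} {σ′ = σ′} k f = Frame-trans f (Frame-refl s σ′ k)

    tick⟨⟩ : ∀ {s σ σ′} k → Frame s (tick k σ) σ′ → Frame s σ σ′
    tick⟨⟩ {s} {σ} k f = Frame-trans (Frame-refl s σ k) f

  mutual
    wp-frame : ∀ s {Q} σ → wp s Q σ → wp s (λ σ′ → Q σ′ × Frame s σ σ′) σ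
    wp-frame skip          σ w = w , Frame-refl skip σ 0
    wp-frame (x ≔ e)       σ w = ok-mono e σ (λ q → q , record
      { fv = λ y p → upd-false (vr σ) x _ y p ; fa = λ _ _ → refl ; fr = λ _ → refl }) w
    wp-frame (put a i j e) σ w = ok-mono i σ (ok-mono j σ (ok-mono e σ (inRow-mono (isZero j) (λ q → q , record
      { fv = λ _ _ → refl ; fa = λ b p → upd-false (ar σ) a _ b p ; fr = λ _ → refl })))) w
    wp-frame (raw≔ i e)    σ w = ok-mono i σ (ok-mono e σ (λ { (b , q) → b , q , record
      { fv = λ _ _ → refl ; fa = λ _ _ → refl ; fr = λ () } })) w
    wp-frame (s ⨾ t)       σ w = wp-mono s (λ σ₁ (w₁ , f) → wp-mono t (λ σ₂ (q , g) →
      q , Frame-trans {s ⨾ t} (left f) (right {s} g)) σ₁ (wp-frame t σ₁ w₁)) σ (wp-frame s σ w)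
    wp-frame (ite e s t)   σ w = ok-mono e σ (λ { (p , q) →
      (λ ne → wp-mono s (λ σ′ (q′ , f) → q′ , weaken (λ _ → ∨ˡ) (λ _ → ∨ˡ) ∨ˡ (⟨⟩tick 1 (tick⟨⟩ (ce e + 1) f)))
        _ (wp-frame s _ (p ne))) ,
      (λ eq → wp-mono t (λ σ′ (q′ , f) → q′ ,
        weaken (λ x → ∨ʳ {wv s x}) (λ a → ∨ʳ {wa s a}) (∨ʳ {wr s}) (tick⟨⟩ (ce e + 1) f)) _ (wp-frame t _ (q eq))) }) w
    wp-frame (while e s)   σ (k , w) = k , loop-mono e s
      (λ σ′ (q , f) → q , weaken (λ _ p → p) (λ _ p → p) (λ p → p) f) k σ (loop-frame e s k σ w)

    loop-frame : ∀ e s {Q} k σ → loop e s Q k σ → loop e s (λ σ′ → Q σ′ × Frame s σ σ′) k σ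
    loop-frame e s (suc k) σ w = ok-mono e σ (λ { (p , q) →
      (λ ne → wp-mono s (λ σ₁ (w₁ , f) →
        loop-mono e s (λ σ₂ (q′ , g) → q′ , Frame-trans (⟨⟩tick 1 (tick⟨⟩ (ce e + 1) f)) g) k (tick 1 σ₁)
          (loop-frame e s k (tick 1 σ₁) w₁)) _ (wp-frame s _ (p ne))) ,
      (λ z → q z , Frame-refl s σ (ce e + 1)) }) w

  Free : Expr → Set₁
  Free e = ∀ σ (K : Set) → K → ok e σ K

  -- The index of `Inv` is a variant that falls in every round. The frame always refers to the store
  -- before the loop, so the invariant only has to mention what the body writes.
  while-rule : ∀ e s {Q} (Inv : ℕ → Store → Set) → Free e → ∀ σ₀ →
    (∀ k σ → Frame s σ₀ σ → Inv k σ →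
       (eval e σ ≡ 0 → Q (tick (ce e + 1) σ)) ×
       (eval e σ ≢ 0 → wp s (λ σ′ → Σ ℕ λ k′ → k′ < k × Inv k′ (tick 1 σ′)) (tick (ce e + 1) σ))) →
    ∀ k → Inv k σ₀ → wp (while e s) Q σ₀
  -- The final evaluation of the condition counts as a round, hence one more than the variant.
  while-rule e s {Q} Inv free σ₀ step k₀ inv₀ = suc k₀ , go (suc k₀) k₀ σ₀ ≤-refl (Frame-refl s σ₀ 0) inv₀
    where
    go : ∀ fuel k σ → k < fuel → Frame s σ₀ σ → Inv k σ → loop e s Q fuel σ
    go (suc fuel) k σ (s≤s k≤) f inv = free σ _
      ( (λ nz → wp-mono s
          (λ σ′ ((k′ , k′<k , inv′) , g) →
            go fuel k′ (tick 1 σ′) (≤-trans k′<k k≤) (Frame-trans f (⟨⟩tick 1 (tick⟨⟩ (ce e + 1) g))) inv′)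
          _ (wp-frame s _ (proj₂ (step k σ f inv) nz)))
      , proj₁ (step k σ f inv) )

  for : ℕ → ℕ → Stmt → Stmt
  for x y s = while (var y ⊖ var x) (s ⨾ x ≔ var x ⊕ lit 1)

  -- A round has an overhead of 9: four steps for the test, whose truncated difference is zero as
  -- soon as `x` has reached `y`, four for the increment and one for the jump back.
  for-rule : ∀ x y s {Q} (Inv : ℕ → Store → Set) (i₀ n : ℕ) → wv s x ≡ false → wv s y ≡ false → (x ≡ᵇ y) ≡ false →
    n ≤ V → ∀ σ₀ → vr σ₀ x ≡ i₀ → vr σ₀ y ≡ n →
    (∀ i σ → Frame (s ⨾ x ≔ var x ⊕ lit 1) σ₀ σ → vr σ x ≡ i → i₀ ≤ i → i < n → Inv i σ →
       wp s (λ σ′ → Inv (suc i) (setv x (suc i) (tick 5 σ′))) (tick 4 σ)) →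
    (∀ i σ → Frame (s ⨾ x ≔ var x ⊕ lit 1) σ₀ σ → vr σ x ≡ i → i₀ ≤ i → n ≤ i → Inv i σ → Q (tick 4 σ)) →
    Inv i₀ σ₀ → wp (for x y s) Q σ₀
  for-rule x y s {Q} Inv i₀ n wx wy x≢y n≤V σ₀ x₀ y₀ body done inv₀ =
    while-rule _ _ (λ k σ → Σ ℕ λ i → vr σ x ≡ i × i₀ ≤ i × k ≡ n ∸ i × Inv i σ) (λ _ _ k → k) σ₀ each
      (n ∸ i₀) (i₀ , x₀ , ≤-refl , refl , inv₀)
    where
    s′ : Stmt
    s′ = s ⨾ x ≔ var x ⊕ lit 1
    wy′ : wv s y ∨ (x ≡ᵇ y) ≡ false
    wy′ rewrite wy = x≢y
    each : ∀ k σ → Frame s′ σ₀ σ → (Σ ℕ λ i → vr σ x ≡ i × i₀ ≤ i × k ≡ n ∸ i × Inv i σ) →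
      (vr σ y ∸ vr σ x ≡ 0 → Q (tick 4 σ)) ×
      (vr σ y ∸ vr σ x ≢ 0 → wp s′ (λ σ′ → Σ ℕ λ k′ → k′ < k × Σ ℕ λ i → vr σ′ x ≡ i × i₀ ≤ i × k′ ≡ n ∸ i × Inv i (tick 1 σ′)) (tick 4 σ))
    each k σ f (i , refl , i₀≤ , refl , inv) rewrite trans (fv f y wy′) y₀ =
      (λ z → done i σ f refl i₀≤ (m∸n≡0⇒m≤n z) inv) ,
      (λ nz → let i<n = m∸n≢0⇒n<m nz in
        wp-mono s (λ σ₁ (inv₁ , g) →
            subst (λ z → z + 1 ≤ V) (sym (fv g x wx)) (≤-trans (≤-reflexive (+-comm i 1)) (≤-trans i<n n≤V)) ,
            (n ∸ suc i) , ∸-monoʳ-< ≤-refl i<n , suc i ,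
            trans (upd-same (vr σ₁) x _) (trans (cong (_+ 1) (fv g x wx)) (+-comm i 1)) , ≤-trans i₀≤ (n≤1+n i) , refl ,
            subst (λ z → Inv (suc i) (setv x z (tick 5 σ₁))) (sym (trans (cong (_+ 1) (fv g x wx)) (+-comm i 1))) inv₁)
          _ (wp-frame s _ (body i σ f refl i₀≤ i<n inv)))

  loopFree : Stmt → Bool
  loopFree (s ⨾ t)     = loopFree s ∧ loopFree t
  loopFree (ite e s t) = loopFree s ∧ loopFree t
  loopFree (while e s) = false
  loopFree _           = true

  -- An upper bound in which a conditional is charged for both branches. The 0 of a loop is a
  -- default that `loopFree` excludes in `wp-clk`.
  cost : Stmt → ℕ
  cost skip          = 0
  cost (x ≔ e)       = ce e + 1
  cost (put a i j e) = ce i + ce j + ce e + 8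
  cost (raw≔ i e)    = ce i + ce e + 1
  cost (s ⨾ t)       = cost s + cost t
  cost (ite e s t)   = ce e + 2 + (cost s + cost t)
  cost (while e s)   = 0

  wp-clk : ∀ s {Q} σ → T (loopFree s) → wp s Q σ → wp s (λ σ′ → Q σ′ × clk σ′ ≤ cost s + clk σ) σ
  wp-clk skip          σ l w = w , ≤-refl
  wp-clk (x ≔ e)       σ l w = ok-mono e σ (λ q → q , ≤-refl) w
  wp-clk (put a i j e) σ l w = ok-mono i σ (ok-mono j σ (ok-mono e σ (inRow-mono (isZero j) (λ q → q , ≤-refl)))) w
  wp-clk (raw≔ i e)    σ l w = ok-mono i σ (ok-mono e σ (λ { (b , q) → b , q , ≤-refl })) w
  wp-clk (s ⨾ t)       σ l w = wp-mono s (λ σ₁ (w₁ , c₁) → wp-mono t (λ σ₂ (q , c₂) → q , ≤-trans c₂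
      (lin 4 (λ a b x y → (x ≼ a ⊞ y) ∷ [] ⊢ b ⊞ x ≼ a ⊞ b ⊞ y) (cost s) (cost t) (clk σ₁) (clk σ) c₁))
      σ₁ (wp-clk t σ₁ (proj₂ (Equivalence.to T-∧ l)) w₁)) σ (wp-clk s σ (proj₁ (Equivalence.to (T-∧ {loopFree s}) l)) w)
  wp-clk (ite e s t)   σ l w = ok-mono e σ (λ { (p , q) →
    (λ ne → wp-mono s (λ σ′ (q′ , h) → q′ , lin 5 (λ c x y a b → (c ≼ a ⊞ (x ⊞ κ 1 ⊞ y)) ∷ [] ⊢ κ 1 ⊞ c ≼ x ⊞ κ 2 ⊞ (a ⊞ b) ⊞ y)
        (clk σ′) (ce e) (clk σ) (cost s) (cost t) h)
      _ (wp-clk s _ (proj₁ (Equivalence.to (T-∧ {loopFree s}) l)) (p ne))) ,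
    (λ eq → wp-mono t (λ σ′ (q′ , h) → q′ , lin 5 (λ c x y a b → (c ≼ b ⊞ (x ⊞ κ 1 ⊞ y)) ∷ [] ⊢ c ≼ x ⊞ κ 2 ⊞ (a ⊞ b) ⊞ y)
        (clk σ′) (ce e) (clk σ) (cost s) (cost t) h)
      _ (wp-clk t _ (proj₂ (Equivalence.to (T-∧ {loopFree s}) l)) (q eq))) }) w

  for-clk : ∀ x y s {Q} (Inv : ℕ → Store → Set) (i₀ n : ℕ) → wv s x ≡ false → wv s y ≡ false → (x ≡ᵇ y) ≡ false →
    n ≤ V → T (loopFree s) → i₀ ≤ n → ∀ σ₀ → vr σ₀ x ≡ i₀ → vr σ₀ y ≡ n →
    (∀ i σ → Frame (s ⨾ x ≔ var x ⊕ lit 1) σ₀ σ → vr σ x ≡ i → i₀ ≤ i → i < n → Inv i σ →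
       wp s (λ σ′ → Inv (suc i) (setv x (suc i) (tick 5 σ′))) (tick 4 σ)) →
    (∀ σ → Frame (s ⨾ x ≔ var x ⊕ lit 1) σ₀ σ → Inv n σ →
       clk σ ≤ (n ∸ i₀) * (cost s + 9) + clk σ₀ → Q (tick 4 σ)) →
    Inv i₀ σ₀ → wp (for x y s) Q σ₀
  for-clk x y s {Q} Inv i₀ n wx wy x≢y n≤V free i₀≤n σ₀ x₀ y₀ body done inv₀ =
    for-rule x y s (λ i σ → i ≤ n × Inv i σ × clk σ ≤ (i ∸ i₀) * (cost s + 9) + clk σ₀) i₀ n wx wy x≢y n≤V σ₀ x₀ y₀
      (λ i σ f xi i₀≤ i<n (_ , inv , c) → wp-mono s (λ σ′ (inv′ , c′) → i<n , inv′ , time i i₀≤ c c′)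
        _ (wp-clk s _ free (body i σ f xi i₀≤ i<n inv)))
      (λ i σ f xi i₀≤ n≤i (i≤n , inv , c) → finish i σ f (≤-antisym i≤n n≤i) inv c)
      (i₀≤n , inv₀ , m≤n+m _ ((i₀ ∸ i₀) * (cost s + 9)))
    where
    finish : ∀ i σ → Frame (s ⨾ x ≔ var x ⊕ lit 1) σ₀ σ → i ≡ n → Inv i σ → clk σ ≤ (i ∸ i₀) * (cost s + 9) + clk σ₀ → Q (tick 4 σ)
    finish i σ f refl = done σ f
    time : ∀ i {c c′} → i₀ ≤ i → c ≤ (i ∸ i₀) * (cost s + 9) + clk σ₀ → c′ ≤ cost s + (4 + c) →
           5 + c′ ≤ (suc i ∸ i₀) * (cost s + 9) + clk σ₀
    time i {c} {c′} i₀≤ h h′ rewrite +-∸-assoc 1 i₀≤ =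
      lin 5 (λ c c′ k d z → (c ≼ d ⊠ (k ⊞ κ 9) ⊞ z) ∷ (c′ ≼ k ⊞ (κ 4 ⊞ c)) ∷ [] ⊢ κ 5 ⊞ c′ ≼ (κ 1 ⊞ d) ⊠ (k ⊞ κ 9) ⊞ z)
        c c′ (cost s) (i ∸ i₀) (clk σ₀) h h′

  -- wp s Q σ computes, which hides Q from unification; Ends does not.
  record Ends (s : Stmt) (Q : Store → Set) (σ : Store) : Set where
    constructor ends
    field holds : wp s Q σ

  andThen : ∀ {s Q σ} (R : Store → Set) → Ends s Q σ → (∀ σ′ → Q σ′ → Frame s σ σ′ → R σ′) → wp s R σ
  andThen {s} {Q} {σ} R (ends h) f = wp-mono s {λ σ′ → Q σ′ × Frame s σ σ′} {R} (λ σ′ (q , fr′) → f σ′ q fr′) σ (wp-frame s {Q} σ h)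

  andThenTimed : ∀ {s Q σ} (R : Store → Set) → T (loopFree s) → Ends s Q σ →
                 (∀ σ′ → Q σ′ → Frame s σ σ′ → clk σ′ ≤ cost s + clk σ → R σ′) → wp s R σ
  andThenTimed {s} {Q} {σ} R l (ends h) f = andThen {s} {λ σ′ → Q σ′ × clk σ′ ≤ cost s + clk σ} R
    (ends (wp-clk s {Q} σ l h)) (λ σ′ (q , t) fr′ → f σ′ q fr′ t)

  ensure : ∀ {s Q R σ} → Ends s Q σ → (∀ σ′ → Q σ′ → Frame s σ σ′ → R σ′) → Ends s R σ
  ensure {R = R} e f = ends (andThen R e f)

  ensureTimed : ∀ {s Q R σ} → T (loopFree s) → Ends s Q σ → (∀ σ′ → Q σ′ → Frame s σ σ′ → clk σ′ ≤ cost s + clk σ → R σ′) → Ends s R σ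
  ensureTimed {R = R} l e f = ends (andThenTimed R l e f)

  seq : ∀ {s t Q R σ} → Ends s Q σ → (∀ σ′ → Q σ′ → Frame s σ σ′ → Ends t R σ′) → Ends (s ⨾ t) R σ
  seq {t = t} {R = R} e f = ends (andThen (wp t R) e (λ σ′ q fr′ → Ends.holds (f σ′ q fr′)))

  seqTimed : ∀ {s t Q R σ} → T (loopFree s) → Ends s Q σ →
    (∀ σ′ → Q σ′ → Frame s σ σ′ → clk σ′ ≤ cost s + clk σ → Ends t R σ′) → Ends (s ⨾ t) R σ
  seqTimed {t = t} {R = R} l e f = ends (andThenTimed (wp t R) l e (λ σ′ q fr′ c → Ends.holds (f σ′ q fr′ c)))

  branch : ∀ {x s t R σ} → (vr σ x ≢ 0 → Ends s (λ σ′ → R (tick 1 σ′)) (tick 2 σ)) → (vr σ x ≡ 0 → Ends t R (tick 2 σ)) →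
           Ends (ite (var x) s t) R σ
  branch p q = ends ((λ ne → Ends.holds (p ne)) , (λ eq → Ends.holds (q eq)))

-- Compilation to the RAM and its correctness

usr tmp : ℕ → ℕ
usr x = 2 * x
tmp d = suc (2 * d)

-- The temporaries 0, 1 and 2 permanently hold 0, B + 1 and the number of
-- input cells; array a, row i, column j lives behind the input.
addressOf : (p q width start a : ℕ) → List Instr
addressOf p q width start a =
  arith mul p p width ∷ arith add p p q ∷ const q 16 ∷ arith mul p p q ∷
  const q a ∷ arith add p p q ∷ arith add p p start ∷ []

addressCode : ℕ → ℕ → List Instr
addressCode a d = addressOf (tmp d) (tmp (suc d)) (tmp 1) (tmp 2) a

-- The value ends in temporary `d`, and only temporaries from `d` on are written: they form an
-- evaluation stack in the odd registers, apart from the variables in the even ones. A variable is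
-- copied by adding temporary 0 to it.
code : Expr → ℕ → List Instr
code (lit c)     d = const (tmp d) c ∷ []
code (con c)     d = const (tmp d) c ∷ []
code (var x)     d = arith add (tmp d) (usr x) (tmp 0) ∷ []
code (op o a b)  d = code a d ++ code b (suc d) ++ arith o (tmp d) (tmp d) (tmp (suc d)) ∷ []
code (raw i)     d = code i d ++ load (tmp d) (tmp d) ∷ []
code (arr a i j) d = code i d ++ code j (suc d) ++ addressCode a d ++ load (tmp d) (tmp d) ∷ []

size : Stmt → ℕ
size skip          = 0
size (x ≔ e)       = ce e + 1
size (put a i j e) = ce i + (ce j + (ce e + 8))
size (raw≔ i e)    = ce i + (ce e + 1)
size (s ⨾ t)       = size s + size t
size (ite e s t)   = ce e + (1 + (size s + (1 + size t)))
size (while e s)   = ce e + (1 + (size s + 1))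

-- Jump targets are absolute, so the address `o` of the first instruction is a parameter. Temporary
-- 0 holds zero, which turns `jzero (tmp 0)` into an unconditional jump.
compile : Stmt → ℕ → List Instr
compile skip          o = []
compile (x ≔ e)       o = code e 3 ++ arith add (usr x) (tmp 3) (tmp 0) ∷ []
compile (put a i j e) o = code i 3 ++ code j 4 ++ code e 5 ++ addressCode a 3 ++ store (tmp 3) (tmp 5) ∷ []
compile (raw≔ i e)    o = code i 3 ++ code e 4 ++ store (tmp 3) (tmp 4) ∷ []
compile (s ⨾ t)       o = compile s o ++ compile t (o + size s)
compile (ite e s t)   o =
  code e 3 ++ jzero (tmp 3) (o + ce e + 1 + size s + 1) ∷ compile s (o + ce e + 1) ++
  jzero (tmp 0) (o + size (ite e s t)) ∷ compile t (o + ce e + 1 + size s + 1)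
compile (while e s)   o =
  code e 3 ++ jzero (tmp 3) (o + size (while e s)) ∷ compile s (o + ce e + 1) ++ jzero (tmp 0) o ∷ []

length-code : ∀ e d → length (code e d) ≡ ce e
length-code (lit c)     d = refl
length-code (con c)     d = refl
length-code (var x)     d = refl
length-code (op o a b)  d = trans (length-++ (code a d)) (trans (cong₂ _+_ (length-code a d)
  (trans (length-++ (code b (suc d))) (cong (_+ 1) (length-code b (suc d))))) (sym (+-assoc (ce a) _ _)))
length-code (raw i)     d = trans (length-++ (code i d)) (cong (_+ 1) (length-code i d))
length-code (arr a i j) d = trans (length-++ (code i d)) (trans (cong₂ _+_ (length-code i d)
  (trans (length-++ (code j (suc d))) (cong (_+ 8) (length-code j (suc d))))) (sym (+-assoc (ce i) _ _)))

length-compile : ∀ s o → length (compile s o) ≡ size s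
length-compile skip          o = refl
length-compile (x ≔ e)       o = trans (length-++ (code e 3)) (cong (_+ 1) (length-code e 3))
length-compile (put a i j e) o = trans (length-++ (code i 3)) (cong₂ _+_ (length-code i 3)
  (trans (length-++ (code j 4)) (cong₂ _+_ (length-code j 4)
    (trans (length-++ (code e 5)) (cong (_+ 8) (length-code e 5))))))
length-compile (raw≔ i e)    o = trans (length-++ (code i 3)) (cong₂ _+_ (length-code i 3)
  (trans (length-++ (code e 4)) (cong (_+ 1) (length-code e 4))))
length-compile (s ⨾ t)       o = trans (length-++ (compile s o))
  (cong₂ _+_ (length-compile s o) (length-compile t _))
length-compile (ite e s t)   o = trans (length-++ (code e 3)) (cong₂ _+_ (length-code e 3) (cong suc
  (trans (length-++ (compile s _)) (cong₂ _+_ (length-compile s _) (cong suc (length-compile t _))))))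
length-compile (while e s)   o = trans (length-++ (code e 3)) (cong₂ _+_ (length-code e 3) (cong suc
  (trans (length-++ (compile s _)) (cong (_+ 1) (length-compile s _)))))

CodeAt : Program → ℕ → List Instr → Set
CodeAt P o c = Σ (List Instr) λ post → drop o P ≡ c ++ post

codeAt-++ : ∀ P o c d k → length c ≡ k → CodeAt P o (c ++ d) → CodeAt P o c × CodeAt P (o + k) d
codeAt-++ P o c d k refl (post , eq) =
  (d ++ post , trans eq (++-assoc c d post)) ,
  (post , trans (sym (drop-drop o (length c) P))
    (trans (cong (drop (length c)) (trans eq (++-assoc c d post))) (drop-++ c (d ++ post))))
  where
  drop-++ : ∀ (xs ys : List Instr) → drop (length xs) (xs ++ ys) ≡ ys
  drop-++ []       ys = refl
  drop-++ (x ∷ xs) ys = drop-++ xs ys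

codeAt-∷ : ∀ P o i c → CodeAt P o (i ∷ c) → fetch P o ≡ just i × CodeAt P (suc o) c
codeAt-∷ P o i c at′ = cong head (proj₂ at′) ,
  subst (λ z → CodeAt P z c) (+-comm o 1) (proj₂ (codeAt-++ P o (i ∷ []) c 1 refl at′))

tmp-injective : ∀ {d k} → tmp d ≡ tmp k → d ≡ k
tmp-injective {d} {k} e = *-cancelˡ-≡ d k 2 (suc-injective e)

usr-injective : ∀ {x y} → usr x ≡ usr y → x ≡ y
usr-injective {x} {y} = *-cancelˡ-≡ x y 2

usr≢tmp : ∀ {x d} → usr x ≢ tmp d
usr≢tmp {x} {d} = even≢odd x d

set-same : ∀ (f : ℕ → ℕ) i x → (f [ i ↦ x ]) i ≡ x
set-same f i x rewrite ≡ᵇ-refl i = refl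

set-other : ∀ (f : ℕ → ℕ) {i j} x → j ≢ i → (f [ i ↦ x ]) j ≡ f j
set-other f x ne rewrite ≢⇒≡ᵇ ne = refl

module Machine (w B V R : ℕ) (fits : R + 16 * (V * suc B + B) + 32 ≤ 2 ^ w) (P : Program) where

  open Logic B V R

  address : ℕ → ℕ → ℕ → ℕ
  address a i j = (i * suc B + j) * 16 + a + R

  word-small : ∀ {x} → x < 2 ^ w → word w x ≡ x
  word-small {x} h = m<n⇒m%n≡m {n = 2 ^ w} ⦃ m^n≢0 2 w ⦄ h

  V<2^w : V < 2 ^ w
  V<2^w = ≤-trans (lin 4 (λ V B R VB → (V ≼ VB) ∷ [] ⊢ κ 1 ⊞ V ≼ R ⊞ κ 16 ⊠ (VB ⊞ B) ⊞ κ 32) V B R (V * suc B) (m≤m*n V (suc B))) fits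

  16<2^w : ∀ {c} → c ≤ 16 → c < 2 ^ w
  16<2^w c≤ = ≤-trans (s≤s c≤) (≤-trans (≤-trans (m≤n+m 17 15) (m≤n+m 32 _)) fits)

  address<2^w : ∀ {a i j} → a < 16 → i ≤ V → j ≤ B → address a i j < 2 ^ w
  address<2^w {a} {i} {j} a< i≤ j≤ = ≤-trans
    -- The factor 16 of the row term is composed of four copies of the hypothesis and one copy
    -- scaled by 12.
    (lin 6 (λ R V′ B j a i′ → (i′ ≼ V′) ∷ (i′ ≼ V′) ∷ (i′ ≼ V′) ∷ (i′ ≼ V′) ∷ (κ 1 ⊞ a ≼ κ 16) ∷ (κ 16 ⊠ j ≼ κ 16 ⊠ B) ∷ (κ 12 ⊠ i′ ≼ κ 12 ⊠ V′) ∷ [] ⊢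
       κ 1 ⊞ ((i′ ⊞ j) ⊠ κ 16 ⊞ a ⊞ R) ≼ R ⊞ κ 16 ⊠ (V′ ⊞ B) ⊞ κ 32)
       R (V * suc B) B j a (i * suc B) h h h h a< (*-monoʳ-≤ 16 j≤) (*-monoʳ-≤ 12 h))
    fits
    where
    h : i * suc B ≤ V * suc B
    h = *-monoˡ-≤ (suc B) i≤

  run-+ : ∀ t u s → run w P (t + u) s ≡ run w P u (run w P t s)
  run-+ zero    u s = refl
  run-+ (suc t) u s = run-+ t u (step w P s)

  -- A record, since `run` computes and would hide its arguments from unification.
  record Steps (t : ℕ) (s s′ : State) : Set where
    constructor steps
    field ran-eq : run w P t s ≡ s′

  open Steps public

  infixr 5 _▸_
  infixl 4 _▹_

  _▸_ : ∀ {t u s s′ s″} → Steps t s s′ → Steps u s′ s″ → Steps (t + u) s s″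
  _▸_ {t} {u} {s} (steps refl) (steps q) = steps (trans (run-+ t u s) q)

  _▹_ : ∀ {t s s′ s″} → Steps t s s′ → s′ ≡ s″ → Steps t s s″
  p ▹ refl = p

  retime : ∀ {t u s s′} → t ≡ u → Steps t s s′ → Steps u s s′
  retime refl p = p

  one : ∀ s i → fetch P (pc s) ≡ just i → Steps 1 s (exec w i s)
  one s i e = steps (go e)
    where
    go : fetch P (pc s) ≡ just i → run w P 1 s ≡ exec w i s
    go e with fetch P (pc s)
    go refl | just .i = refl

  isJump : Instr → Bool
  isJump (jzero _ _) = true
  isJump _           = false

  execs : List Instr → State → State
  execs []       s = s
  execs (i ∷ is) s = execs is (exec w i s)

  jumpFree : List Instr → Bool
  jumpFree []       = true
  jumpFree (i ∷ is) = not (isJump i) ∧ jumpFree is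

  run-straight : ∀ c → T (jumpFree c) → ∀ s → CodeAt P (pc s) c → Steps (length c) s (execs c s)
  run-straight []      _ s at′ = steps refl
  run-straight (i ∷ c) j s at′ with codeAt-∷ P (pc s) i c at′
  run-straight (const _ _ ∷ c)     j s at′ | f , at″ = one s _ f ▸ run-straight c j _ at″
  run-straight (arith _ _ _ _ ∷ c) j s at′ | f , at″ = one s _ f ▸ run-straight c j _ at″
  run-straight (load _ _ ∷ c)      j s at′ | f , at″ = one s _ f ▸ run-straight c j _ at″
  run-straight (store _ _ ∷ c)     j s at′ | f , at″ = one s _ f ▸ run-straight c j _ at″

  -- The bounds belong to the relation, so a loaded value needs no check. Sums and products are
  -- checked where they are formed; differences and quotients are bounded by their operands.
  record Memory (σ : Store) (M : ℕ → ℕ) : Set where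
    field
      cells : ∀ a i j → a < 16 → j ≤ B → M (address a i j) ≡ ar σ a i j
      input : ∀ r → r < R → M r ≡ rw σ r
      boundA : ∀ a i j → ar σ a i j ≤ V
      boundR : ∀ r → r < R → rw σ r ≤ V

  record Registers (σ : Store) (ρ : ℕ → ℕ) : Set where
    field
      user  : ∀ x → ρ (usr x) ≡ vr σ x
      boundV : ∀ x → vr σ x ≤ V
      zero′ : ρ (tmp 0) ≡ 0
      width : ρ (tmp 1) ≡ suc B
      start : ρ (tmp 2) ≡ R

  open Memory
  open Registers

  record SameBelow (d : ℕ) (ρ ρ′ : ℕ → ℕ) : Set where
    field
      sameTmp : ∀ k → k < d → ρ′ (tmp k) ≡ ρ (tmp k)
      sameUsr : ∀ x → ρ′ (usr x) ≡ ρ (usr x)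

  open SameBelow

  SB-trans : ∀ {d ρ ρ′ ρ″} → SameBelow d ρ ρ′ → SameBelow d ρ′ ρ″ → SameBelow d ρ ρ″
  SB-trans p q = record { sameTmp = λ k l → trans (sameTmp q k l) (sameTmp p k l) ; sameUsr = λ x → trans (sameUsr q x) (sameUsr p x) }

  SB-weaken : ∀ {d ρ ρ′} → SameBelow (suc d) ρ ρ′ → SameBelow d ρ ρ′
  SB-weaken p = record { sameTmp = λ k l → sameTmp p k (m≤n⇒m≤1+n l) ; sameUsr = sameUsr p }

  SB-set : ∀ d ρ x → SameBelow d ρ (ρ [ tmp d ↦ x ])
  SB-set d ρ x = record { sameTmp = λ k l → set-other ρ x (λ e → <⇒≢ l (tmp-injective e)) ; sameUsr = λ y → set-other ρ x (usr≢tmp {y} {d}) }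

  Registers-below : ∀ {d σ ρ ρ′} → 3 ≤ d → Registers σ ρ → SameBelow d ρ ρ′ → Registers σ ρ′
  Registers-below 3≤d r sb = record
    { user = λ x → trans (sameUsr sb x) (user r x) ; boundV = boundV r
    ; zero′ = trans (sameTmp sb 0 (≤-trans (s≤s z≤n) 3≤d)) (zero′ r)
    ; width = trans (sameTmp sb 1 (≤-trans (s≤s (s≤s z≤n)) 3≤d)) (width r)
    ; start = trans (sameTmp sb 2 3≤d) (start r) }

  record Evaluates (s : State) (t d x : ℕ) : Set where
    field
      regs   : ℕ → ℕ
      ran    : Steps t s ⟨ pc s + t , regs , mem s ⟩
      result : regs (tmp d) ≡ x
      keeps  : SameBelow d (reg s) regs
      small  : x ≤ V

  open Evaluates

  inRow : ∀ j σ {K : Set} → (if isZero j then K else (eval j σ ≤ B × K)) → eval j σ ≤ B × K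
  inRow (lit zero)      σ k = z≤n , k
  inRow (lit (suc _))   σ k = k
  inRow (con _)         σ k = k
  inRow (var _)         σ k = k
  inRow (op _ _ _)      σ k = k
  inRow (raw _)         σ k = k
  inRow (arr _ _ _)     σ k = k

  opOk-small : ∀ o {x y K} → x ≤ V → y ≤ V → opOk o x y K → ⟦ o ⟧ x y ≤ V × K
  opOk-small add {x} {y} _ _ (b , k) = b , k
  opOk-small sub {x} {y} p _ k       = ≤-trans (m∸n≤m x y) p , k
  opOk-small mul {x} {y} _ _ (b , k) = b , k
  opOk-small div {x} {zero} p _ k    = z≤n , k
  opOk-small div {x} {suc y} p _ k   = ≤-trans (m/n≤m x (suc y)) p , k

  private
    addressRegs : (ρ : ℕ → ℕ) (p q m b a : ℕ) → ℕ → ℕ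
    addressRegs ρ p q m b a = reg (execs (addressOf p q m b a) ⟨ 0 , ρ , ρ ⟩)

    addressRegs-other : ∀ ρ p q m b a r → r ≢ p → r ≢ q → addressRegs ρ p q m b a r ≡ ρ r
    addressRegs-other ρ p q m b a r r≢p r≢q rewrite ≢⇒≡ᵇ r≢p | ≢⇒≡ᵇ r≢q = refl

    addressRegs-result : ∀ ρ p q m b a → p ≢ q → b ≢ p → b ≢ q → ρ m ≡ suc B → ρ b ≡ R →
      a < 16 → ρ p ≤ V → ρ q ≤ B → addressRegs ρ p q m b a p ≡ address a (ρ p) (ρ q)
    addressRegs-result ρ p q m b a p≢q b≢p b≢q rm rb a< i≤ j≤
      rewrite ≡ᵇ-refl p | ≡ᵇ-refl q | ≢⇒≡ᵇ p≢q | ≢⇒≡ᵇ (p≢q ∘ sym) | ≢⇒≡ᵇ b≢p | ≢⇒≡ᵇ b≢q | rm | rb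
      = begin
          word w (word w (word w (word w (word w (i * suc B) + j) * word w 16) + word w a) + R)
            ≡⟨ cong₂ (λ x y → word w (word w (word w (word w (word w (i * suc B) + j) * x) + y) + R))
                 (word-small (16<2^w ≤-refl)) (word-small (16<2^w (<⇒≤ a<))) ⟩
          word w (word w (word w (word w (word w (i * suc B) + j) * 16) + a) + R)
            ≡⟨ cong (λ x → word w (word w (word w (word w (x + j) * 16) + a) + R))
                 (word-small (<-of (≤-trans (m≤m+n _ j) (≤-trans (m≤m*n _ 16) (≤-trans (m≤m+n _ a) (m≤m+n _ R)))))) ⟩
          word w (word w (word w (word w (i * suc B + j) * 16) + a) + R)
            ≡⟨ cong (λ x → word w (word w (word w (x * 16) + a) + R))
                 (word-small (<-of (≤-trans (m≤m*n _ 16) (≤-trans (m≤m+n _ a) (m≤m+n _ R))))) ⟩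
          word w (word w (word w ((i * suc B + j) * 16) + a) + R)
            ≡⟨ cong (λ x → word w (word w (x + a) + R)) (word-small (<-of (≤-trans (m≤m+n _ a) (m≤m+n _ R)))) ⟩
          word w (word w ((i * suc B + j) * 16 + a) + R)
            ≡⟨ cong (λ x → word w (x + R)) (word-small (<-of (m≤m+n _ R))) ⟩
          word w ((i * suc B + j) * 16 + a + R)
            ≡⟨ word-small (address<2^w a< i≤ j≤) ⟩
          address a i j ∎
      where
      open ≡-Reasoning
      i j : ℕ
      i = ρ p
      j = ρ q
      <-of : ∀ {x} → x ≤ address a i j → x < 2 ^ w
      <-of h = ≤-trans (s≤s h) (address<2^w a< i≤ j≤)

  address-run : ∀ a d s → a < 16 → 3 ≤ d → reg s (tmp d) ≤ V → reg s (tmp (suc d)) ≤ B →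
    reg s (tmp 1) ≡ suc B → reg s (tmp 2) ≡ R → CodeAt P (pc s) (addressCode a d) →
    Σ (ℕ → ℕ) λ regs → Steps 7 s ⟨ pc s + 7 , regs , mem s ⟩ ×
      regs (tmp d) ≡ address a (reg s (tmp d)) (reg s (tmp (suc d))) × SameBelow d (reg s) regs ×
      (∀ k → suc d < k → regs (tmp k) ≡ reg s (tmp k))
  address-run a d ⟨ o , ρ , M ⟩ a< 3≤d i≤ j≤ r1 r2 c =
    addressRegs ρ p q (tmp 1) (tmp 2) a ,
    (run-straight (addressCode a d) _ ⟨ o , ρ , M ⟩ c ▹ cong (λ z → ⟨ z , addressRegs ρ p q (tmp 1) (tmp 2) a , M ⟩) (+-comm 7 o)) ,
    addressRegs-result ρ p q (tmp 1) (tmp 2) a (ne (<⇒≢ ≤-refl)) (ne (<⇒≢ 3≤d)) (ne (<⇒≢ (m≤n⇒m≤1+n 3≤d)))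
      r1 r2 a< i≤ j≤ ,
    record { sameTmp = λ k l → addressRegs-other ρ p q (tmp 1) (tmp 2) a (tmp k) (ne (<⇒≢ l)) (ne (<⇒≢ (m≤n⇒m≤1+n l)))
      ; sameUsr = λ x → addressRegs-other ρ p q (tmp 1) (tmp 2) a (usr x) (usr≢tmp {x} {d}) (usr≢tmp {x} {suc d}) } ,
    (λ k l → addressRegs-other ρ p q (tmp 1) (tmp 2) a (tmp k) (ne (≢-sym (<⇒≢ (<-trans ≤-refl l)))) (ne (≢-sym (<⇒≢ l))))
    where
    p q : ℕ
    p = tmp d
    q = tmp (suc d)
    ne : ∀ {x y} → x ≢ y → tmp x ≢ tmp y
    ne x≢y e = x≢y (tmp-injective e)

  private
    single : ∀ i s ρ → CodeAt P (pc s) (i ∷ []) → exec w i s ≡ ⟨ suc (pc s) , ρ , mem s ⟩ →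
             Steps 1 s ⟨ pc s + 1 , ρ , mem s ⟩
    single i s ρ at′ e = one s i (proj₁ (codeAt-∷ P (pc s) i [] at′)) ▹
      trans e (cong (λ z → ⟨ z , ρ , mem s ⟩) (+-comm 1 (pc s)))

  set-tmp : ∀ s t d x {y} (ρ : ℕ → ℕ) → Steps t s ⟨ pc s + t , ρ [ tmp d ↦ y ] , mem s ⟩ → y ≡ x →
            SameBelow d (reg s) ρ → x ≤ V → Evaluates s t d x
  set-tmp s t d x {y} ρ r refl sb b = record
    { regs = ρ [ tmp d ↦ y ] ; ran = r ; result = set-same ρ (tmp d) y
    ; keeps = SB-trans {d} sb (SB-set d ρ y) ; small = b }

  SB-refl : ∀ d ρ → SameBelow d ρ ρ
  SB-refl d ρ = record { sameTmp = λ _ _ → refl ; sameUsr = λ _ → refl }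

  -- Every intermediate value is at most `V` and hence below `2 ^ w`, so reduction modulo the word
  -- size is the identity and the machine computes with natural numbers.
  sound-e : ∀ e d σ s {K : Set} → 3 ≤ d → 8 ≤ V → CodeAt P (pc s) (code e d) → Registers σ (reg s) → Memory σ (mem s) →
            ok e σ K → Evaluates s (ce e) d (eval e σ) × K
  sound-e (lit c {small}) d σ s 3≤d 8≤V at′ r m k =
    set-tmp s 1 d c (reg s) (single _ s _ at′ refl) (word-small (16<2^w (≤-trans c≤8 (m≤n+m 8 8)))) (SB-refl d (reg s)) (≤-trans c≤8 8≤V) , k
    where
    c≤8 : c ≤ 8
    c≤8 = ≤ᵇ⇒≤ c 8 small
  sound-e (con c) d σ s 3≤d 8≤V at′ r m (b , k) =
    set-tmp s 1 d c (reg s) (single _ s _ at′ refl) (word-small (≤-<-trans b V<2^w)) (SB-refl d (reg s)) b , k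
  sound-e (var x) d σ s 3≤d 8≤V at′ r m k =
    set-tmp s 1 d (vr σ x) (reg s) (single _ s _ at′ refl)
      (trans (cong (word w) (trans (cong₂ _+_ (user r x) (zero′ r)) (+-identityʳ _))) (word-small (≤-<-trans (boundV r x) V<2^w)))
      (SB-refl d (reg s)) (boundV r x) , k
  sound-e (op o a b) d σ s {K} 3≤d 8≤V at′ r m k = after-a (sound-e a d σ s 3≤d 8≤V (proj₁ split) r m k)
    where
    split : CodeAt P (pc s) (code a d) × CodeAt P (pc s + ce a) (code b (suc d) ++ arith o (tmp d) (tmp d) (tmp (suc d)) ∷ [])
    split = codeAt-++ P (pc s) (code a d) _ (ce a) (length-code a d) at′
    split₂ : CodeAt P (pc s + ce a) (code b (suc d)) × CodeAt P (pc s + ce a + ce b) (arith o (tmp d) (tmp d) (tmp (suc d)) ∷ [])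
    split₂ = codeAt-++ P (pc s + ce a) (code b (suc d)) _ (ce b) (length-code b (suc d)) (proj₂ split)
    Result : Set
    Result = Evaluates s (ce a + ce b + 1) d (⟦ o ⟧ (eval a σ) (eval b σ)) × K
    after-a : Evaluates s (ce a) d (eval a σ) × ok b σ (opOk o (eval a σ) (eval b σ) K) → Result
    after-a (evA , k₁) = after-b (sound-e b (suc d) σ s₁ (m≤n⇒m≤1+n 3≤d) 8≤V (proj₁ split₂) (Registers-below 3≤d r (keeps evA)) m k₁)
      where
      s₁ : State
      s₁ = ⟨ pc s + ce a , regs evA , mem s ⟩
      after-b : Evaluates s₁ (ce b) (suc d) (eval b σ) × opOk o (eval a σ) (eval b σ) K → Result
      after-b (evB , k₂) = set-tmp s _ d _ (regs evB) runs′ value′ (SB-trans {d} (keeps evA) (SB-weaken {d} (keeps evB))) (proj₁ checked) , proj₂ checked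
        where
        checked : ⟦ o ⟧ (eval a σ) (eval b σ) ≤ V × K
        checked = opOk-small o (small evA) (small evB) k₂
        y : ℕ
        y = word w (⟦ o ⟧ (regs evB (tmp d)) (regs evB (tmp (suc d))))
        runs′ : Steps (ce a + ce b + 1) s ⟨ pc s + (ce a + ce b + 1) , regs evB [ tmp d ↦ y ] , mem s ⟩
        runs′ = retime (sym (+-assoc (ce a) (ce b) 1))
          (ran evA ▸ ran evB ▸ single _ ⟨ pc s + ce a + ce b , regs evB , mem s ⟩ _ (proj₂ split₂) refl) ▹
            cong (λ z → ⟨ z , regs evB [ tmp d ↦ y ] , mem s ⟩)
              (ring 3 (λ p a b → [] ⊢ p ⊞ a ⊞ b ⊞ κ 1 ≼ p ⊞ (a ⊞ b ⊞ κ 1)) (pc s) (ce a) (ce b))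
        value′ : y ≡ ⟦ o ⟧ (eval a σ) (eval b σ)
        value′ = trans (cong₂ (λ x y → word w (⟦ o ⟧ x y)) (trans (sameTmp (keeps evB) d ≤-refl) (result evA)) (result evB))
                   (word-small (≤-<-trans (proj₁ checked) V<2^w))
  sound-e (raw i) d σ s {K} 3≤d 8≤V at′ r m k = after-i (sound-e i d σ s 3≤d 8≤V (proj₁ split) r m k)
    where
    split : CodeAt P (pc s) (code i d) × CodeAt P (pc s + ce i) (load (tmp d) (tmp d) ∷ [])
    split = codeAt-++ P (pc s) (code i d) _ (ce i) (length-code i d) at′
    after-i : Evaluates s (ce i) d (eval i σ) × (eval i σ < R × K) → Evaluates s (ce i + 1) d (rw σ (eval i σ)) × K
    after-i (evI , (b , k₁)) = set-tmp s _ d _ (regs evI)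
      (ran evI ▸ single _ ⟨ pc s + ce i , regs evI , mem s ⟩ _ (proj₂ split) refl ▹
        cong (λ z → ⟨ z , regs evI [ tmp d ↦ mem s (regs evI (tmp d)) ] , mem s ⟩) (+-assoc (pc s) (ce i) 1))
      (trans (cong (mem s) (result evI)) (input m _ b)) (keeps evI) (boundR m _ b) , k₁
  sound-e (arr a {a<} i j) d σ s {K} 3≤d 8≤V at′ r m k = after-i (sound-e i d σ s 3≤d 8≤V (proj₁ split) r m k)
    where
    Rest₁ Rest₂ : List Instr
    Rest₂ = addressCode a d ++ load (tmp d) (tmp d) ∷ []
    Rest₁ = code j (suc d) ++ Rest₂
    split : CodeAt P (pc s) (code i d) × CodeAt P (pc s + ce i) Rest₁
    split = codeAt-++ P (pc s) (code i d) Rest₁ (ce i) (length-code i d) at′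
    split₂ : CodeAt P (pc s + ce i) (code j (suc d)) × CodeAt P (pc s + ce i + ce j) Rest₂
    split₂ = codeAt-++ P (pc s + ce i) (code j (suc d)) Rest₂ (ce j) (length-code j (suc d)) (proj₂ split)
    split₃ : CodeAt P (pc s + ce i + ce j) (addressCode a d) × CodeAt P (pc s + ce i + ce j + 7) (load (tmp d) (tmp d) ∷ [])
    split₃ = codeAt-++ P (pc s + ce i + ce j) (addressCode a d) _ 7 refl (proj₂ split₂)
    Result : Set
    Result = Evaluates s (ce i + ce j + 8) d (ar σ a (eval i σ) (eval j σ)) × K
    after-i : Evaluates s (ce i) d (eval i σ) × ok j σ (if isZero j then K else (eval j σ ≤ B × K)) → Result
    after-i (evI , k₁) = after-j (sound-e j (suc d) σ s₁ (m≤n⇒m≤1+n 3≤d) 8≤V (proj₁ split₂) (Registers-below 3≤d r (keeps evI)) m k₁)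
      where
      s₁ : State
      s₁ = ⟨ pc s + ce i , regs evI , mem s ⟩
      after-j : Evaluates s₁ (ce j) (suc d) (eval j σ) × (if isZero j then K else (eval j σ ≤ B × K)) → Result
      after-j (evJ , k₂) = loaded (address-run a d s₂ (<ᵇ⇒< a 16 a<) 3≤d
          (subst (_≤ V) (sym i≡) (small evI)) (subst (_≤ B) (sym (result evJ)) (proj₁ checked)) (width r₂) (start r₂) (proj₁ split₃))
        where
        s₂ : State
        s₂ = ⟨ pc s + ce i + ce j , regs evJ , mem s ⟩
        checked : eval j σ ≤ B × K
        checked = inRow j σ k₂
        i≡ : regs evJ (tmp d) ≡ eval i σ
        i≡ = trans (sameTmp (keeps evJ) d ≤-refl) (result evI)
        r₂ : Registers σ (regs evJ)
        r₂ = Registers-below (m≤n⇒m≤1+n 3≤d) (Registers-below 3≤d r (keeps evI)) (keeps evJ)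
        loaded : (Σ (ℕ → ℕ) λ regs′ → Steps 7 s₂ ⟨ pc s₂ + 7 , regs′ , mem s ⟩ ×
          regs′ (tmp d) ≡ address a (regs evJ (tmp d)) (regs evJ (tmp (suc d))) × SameBelow d (regs evJ) regs′ ×
          (∀ k → suc d < k → regs′ (tmp k) ≡ regs evJ (tmp k))) → Result
        loaded (ρ , runA , res , kp , _) = set-tmp s _ d _ ρ
          (retime (sym (+-assoc (ce i) (ce j) 8))
            (ran evI ▸ ran evJ ▸ runA ▸ single _ ⟨ pc s + ce i + ce j + 7 , ρ , mem s ⟩ _ (proj₂ split₃) refl) ▹
              cong (λ z → ⟨ z , ρ [ tmp d ↦ mem s (ρ (tmp d)) ] , mem s ⟩)
                (ring 3 (λ p i j → [] ⊢ p ⊞ i ⊞ j ⊞ κ 7 ⊞ κ 1 ≼ p ⊞ (i ⊞ j ⊞ κ 8)) (pc s) (ce i) (ce j)))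
          (trans (cong (mem s) (trans res (cong₂ (address a) i≡ (result evJ))))
            (cells m a _ _ (<ᵇ⇒< a 16 a<) (proj₁ checked)))
          (SB-trans {d} (keeps evI) (SB-trans {d} (SB-weaken {d} (keeps evJ)) kp)) (boundA m a _ _) , proj₂ checked

  -- Division with remainder by 16 recovers the array, and a second one by `suc B` the column and
  -- the row.
  address-injective : ∀ {a b i i′ j j′} → a < 16 → b < 16 → j ≤ B → j′ ≤ B → address a i j ≡ address b i′ j′ →
                      a ≡ b × i ≡ i′ × j ≡ j′
  address-injective {a} {b} {i} {i′} {j} {j′} a< b< j≤ j′≤ e =
    let a≡b , x≡ = split 16 a b (i * suc B + j) (i′ * suc B + j′) a< b< (+-cancelʳ-≡ R _ _ e)
        j≡j′ , i≡ = split (suc B) j j′ i i′ (s≤s j≤) (s≤s j′≤) x≡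
    in a≡b , i≡ , j≡j′
    where
    split : ∀ m a b x y .⦃ _ : NonZero m ⦄ → a < m → b < m → x * m + a ≡ y * m + b → a ≡ b × x ≡ y
    split m a b x y a< b< e = a≡b , *-cancelʳ-≡ x y m (+-cancelʳ-≡ b _ _ (trans (cong (x * m +_) (sym a≡b)) e))
      where
      rem : ∀ a x → a < m → (x * m + a) % m ≡ a
      rem a x a< = trans (cong (_% m) (+-comm (x * m) a)) (trans ([m+kn]%n≡m%n a x m) (m<n⇒m%n≡m a<))
      a≡b : a ≡ b
      a≡b = trans (sym (rem a x a<)) (trans (cong (_% m) e) (rem b y b<))

  Reg-setv : ∀ σ ρ x v → Registers σ ρ → v ≤ V → ∀ k → Registers (setv x v (tick k σ)) (ρ [ usr x ↦ v ])
  Reg-setv σ ρ x v r v≤ k = record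
    { user = λ y → look y ; boundV = bound
    ; zero′ = trans (set-other ρ v (≢-sym (usr≢tmp {x} {0}))) (zero′ r)
    ; width = trans (set-other ρ v (≢-sym (usr≢tmp {x} {1}))) (width r)
    ; start = trans (set-other ρ v (≢-sym (usr≢tmp {x} {2}))) (start r) }
    where
    look : ∀ y → (ρ [ usr x ↦ v ]) (usr y) ≡ upd (vr σ) x v y
    look y with x Data.Nat.Properties.≟ y
    ... | yes refl = trans (set-same ρ (usr x) v) (sym (upd-same (vr σ) x v))
    ... | no x≢y   = trans (set-other ρ v (λ e → x≢y (sym (usr-injective e)))) (trans (user r y) (sym (upd-other (vr σ) v x≢y)))
    bound : ∀ y → upd (vr σ) x v y ≤ V
    bound y with x ≡ᵇ y
    ... | true  = v≤
    ... | false = boundV r y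

  Mem-seta : ∀ σ M a i j v → a < 16 → j ≤ B → Memory σ M → v ≤ V → ∀ k →
             Memory (seta a i j v (tick k σ)) (M [ address a i j ↦ v ])
  Mem-seta σ M a i j v a< j≤ m v≤ k = record
    { cells = look
    ; input = λ r r< → trans (set-other M v (<⇒≢ (≤-trans r< (m≤n+m R _)))) (input m r r<)
    ; boundA = bound ; boundR = boundR m }
    where
    look : ∀ b i′ j′ → b < 16 → j′ ≤ B → (M [ address a i j ↦ v ]) (address b i′ j′) ≡ upd (ar σ) a (upd (ar σ a) i (upd (ar σ a i) j v)) b i′ j′
    look b i′ j′ b< j′≤ with a Data.Nat.Properties.≟ b
    ... | no a≢b = trans (set-other M v (λ e → a≢b (sym (proj₁ (address-injective {i = i′} {i} b< a< j′≤ j≤ e)))))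
      (trans (cells m b i′ j′ b< j′≤) (sym (cong (λ f → f i′ j′) (upd-other (ar σ) _ a≢b))))
    ... | yes refl rewrite upd-same (ar σ) a (upd (ar σ a) i (upd (ar σ a i) j v)) with i Data.Nat.Properties.≟ i′
    ...   | no i≢ = trans (set-other M v (λ e → i≢ (sym (proj₁ (proj₂ (address-injective {i = i′} {i} b< a< j′≤ j≤ e))))))
      (trans (cells m b i′ j′ b< j′≤) (sym (cong (λ f → f j′) (upd-other (ar σ a) _ i≢))))
    ...   | yes refl rewrite upd-same (ar σ a) i (upd (ar σ a i) j v) with j Data.Nat.Properties.≟ j′
    ...     | no j≢ = trans (set-other M v (λ e → j≢ (sym (proj₂ (proj₂ (address-injective {a} {a} {i} {i} b< a< j′≤ j≤ e))))))
      (trans (cells m b i′ j′ b< j′≤) (sym (upd-other (ar σ a i) v j≢)))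
    ...     | yes refl = trans (set-same M _ v) (sym (upd-same (ar σ a i) j v))
    bound : ∀ b i′ j′ → upd (ar σ) a (upd (ar σ a) i (upd (ar σ a i) j v)) b i′ j′ ≤ V
    bound b i′ j′ with a ≡ᵇ b
    ... | false = boundA m b i′ j′
    ... | true with i ≡ᵇ i′
    ...   | false = boundA m a i′ j′
    ...   | true with j ≡ᵇ j′
    ...     | false = boundA m a i j′
    ...     | true  = v≤

  Mem-setr : ∀ σ M i v → i < R → Memory σ M → v ≤ V → ∀ k → Memory (setr i v (tick k σ)) (M [ i ↦ v ])
  Mem-setr σ M i v i< m v≤ k = record
    { cells = λ a i′ j a< j≤ → trans (set-other M v (≢-sym (<⇒≢ (≤-trans i< (m≤n+m R _))))) (cells m a i′ j a< j≤)
    ; input = look ; boundA = boundA m ; boundR = bound }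
    where
    look : ∀ r → r < R → (M [ i ↦ v ]) r ≡ upd (rw σ) i v r
    look r r< with i Data.Nat.Properties.≟ r
    ... | yes refl = trans (set-same M i v) (sym (upd-same (rw σ) i v))
    ... | no i≢r   = trans (set-other M v (≢-sym i≢r)) (trans (input m r r<) (sym (upd-other (rw σ) v i≢r)))
    bound : ∀ r → r < R → upd (rw σ) i v r ≤ V
    bound r r< with i ≡ᵇ r
    ... | true  = v≤
    ... | false = boundR m r r<

  Registers-tick : ∀ {σ ρ} k → Registers σ ρ → Registers (tick k σ) ρ
  Registers-tick k r = record { user = user r ; boundV = boundV r ; zero′ = zero′ r ; width = width r ; start = start r }

  Memory-tick : ∀ {σ M} k → Memory σ M → Memory (tick k σ) M
  Memory-tick k m = record { cells = cells m ; input = input m ; boundA = boundA m ; boundR = boundR m }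

  record Reaches (s : State) (len : ℕ) (σ : Store) (Q : Store → Set) : Set where
    field
      time   : ℕ
      final  : Store
      fregs  : ℕ → ℕ
      fmem   : ℕ → ℕ
      runs   : Steps time s ⟨ pc s + len , fregs , fmem ⟩
      regsOk : Registers final fregs
      memOk  : Memory final fmem
      post   : Q final
      timeOk : clk final ≡ time + clk σ

  open Reaches

  private
    jump : ∀ o ρ M r ℓ c → CodeAt P o (jzero r ℓ ∷ c) → ρ r ≡ 0 → Steps 1 ⟨ o , ρ , M ⟩ ⟨ ℓ , ρ , M ⟩
    jump o ρ M r ℓ c at′ e = one ⟨ o , ρ , M ⟩ _ (proj₁ (codeAt-∷ P o _ c at′)) ▹ taken
      where
      taken : exec w (jzero r ℓ) ⟨ o , ρ , M ⟩ ≡ ⟨ ℓ , ρ , M ⟩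
      taken rewrite e = refl

    noJump : ∀ o ρ M r ℓ c → CodeAt P o (jzero r ℓ ∷ c) → ρ r ≢ 0 → Steps 1 ⟨ o , ρ , M ⟩ ⟨ o + 1 , ρ , M ⟩
    noJump o ρ M r ℓ c at′ ne = one ⟨ o , ρ , M ⟩ _ (proj₁ (codeAt-∷ P o _ c at′)) ▹ taken
      where
      taken : exec w (jzero r ℓ) ⟨ o , ρ , M ⟩ ≡ ⟨ o + 1 , ρ , M ⟩
      taken rewrite ≢⇒≡ᵇ ne = cong (λ z → ⟨ z , ρ , M ⟩) (+-comm 1 o)

    afterTest : ∀ t k (σ : Store) → k + (t + clk σ) ≡ t + k + clk σ
    afterTest t k σ = ring 3 (λ k t c → [] ⊢ k ⊞ (t ⊞ c) ≼ t ⊞ k ⊞ c) k t (clk σ)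

  3≤3 : 3 ≤ 3
  3≤3 = ≤-refl

  module _ (8≤V : 8 ≤ V) where

    mutual
      -- Simulation by induction on the statement and, for loops, on the number of rounds. The time
      -- is an equation: the clock of the store counts the executed instructions.
      sound : ∀ s {Q} o σ ρ M → CodeAt P o (compile s o) → Registers σ ρ → Memory σ M → wp s Q σ →
              Reaches ⟨ o , ρ , M ⟩ (size s) σ Q
      sound skip o σ ρ M at′ r m k = record
        { time = 0 ; final = σ ; fregs = ρ ; fmem = M ; runs = steps (cong (λ z → ⟨ z , ρ , M ⟩) (sym (+-identityʳ o)))
        ; regsOk = r ; memOk = m ; post = k ; timeOk = refl }
      sound (x ≔ e) {Q} o σ ρ M at′ r m k = after-e (sound-e e 3 σ ⟨ o , ρ , M ⟩ 3≤3 8≤V (proj₁ split) r m k)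
        where
        σ′ : Store
        σ′ = setv x (eval e σ) (tick (ce e + 1) σ)
        split : CodeAt P o (code e 3) × CodeAt P (o + ce e) (arith add (usr x) (tmp 3) (tmp 0) ∷ [])
        split = codeAt-++ P o (code e 3) _ (ce e) (length-code e 3) at′
        after-e : Evaluates ⟨ o , ρ , M ⟩ (ce e) 3 (eval e σ) × Q σ′ → Reaches ⟨ o , ρ , M ⟩ (ce e + 1) σ Q
        after-e (ev , q) = record
          { time = ce e + 1 ; final = σ′ ; fregs = regs ev [ usr x ↦ eval e σ ] ; fmem = M
          ; runs = ran ev ▸ single _ ⟨ o + ce e , regs ev , M ⟩ _ (proj₂ split) refl ▹
              cong₂ (λ y z → ⟨ y , regs ev [ usr x ↦ z ] , M ⟩) (+-assoc o (ce e) 1)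
                (trans (cong (word w) (trans (cong₂ _+_ (result ev) (zero′ r′)) (+-identityʳ _))) (word-small (≤-<-trans (small ev) V<2^w)))
          ; regsOk = Reg-setv σ (regs ev) x (eval e σ) r′ (small ev) (ce e + 1)
          ; memOk = record { cells = cells m ; input = input m ; boundA = boundA m ; boundR = boundR m }
          ; post = q ; timeOk = refl }
          where
          r′ : Registers σ (regs ev)
          r′ = Registers-below 3≤3 r (keeps ev)
      sound (put a {a<} i j e) {Q} o σ ρ M at′ r m k = after-i (sound-e i 3 σ ⟨ o , ρ , M ⟩ 3≤3 8≤V (proj₁ split) r m k)
        where
        σ′ : Store
        σ′ = seta a (eval i σ) (eval j σ) (eval e σ) (tick (ce i + ce j + ce e + 8) σ)
        Guarded : Set
        Guarded = if isZero j then Q σ′ else (eval j σ ≤ B × Q σ′)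
        R₁ R₂ R₃ : List Instr
        R₃ = addressCode a 3 ++ store (tmp 3) (tmp 5) ∷ []
        R₂ = code e 5 ++ R₃
        R₁ = code j 4 ++ R₂
        split : CodeAt P o (code i 3) × CodeAt P (o + ce i) R₁
        split = codeAt-++ P o (code i 3) R₁ (ce i) (length-code i 3) at′
        split₂ : CodeAt P (o + ce i) (code j 4) × CodeAt P (o + ce i + ce j) R₂
        split₂ = codeAt-++ P (o + ce i) (code j 4) R₂ (ce j) (length-code j 4) (proj₂ split)
        split₃ : CodeAt P (o + ce i + ce j) (code e 5) × CodeAt P (o + ce i + ce j + ce e) R₃
        split₃ = codeAt-++ P (o + ce i + ce j) (code e 5) R₃ (ce e) (length-code e 5) (proj₂ split₂)
        split₄ : CodeAt P (o + ce i + ce j + ce e) (addressCode a 3) × CodeAt P (o + ce i + ce j + ce e + 7) (store (tmp 3) (tmp 5) ∷ [])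
        split₄ = codeAt-++ P (o + ce i + ce j + ce e) (addressCode a 3) _ 7 refl (proj₂ split₃)
        Result : Set
        Result = Reaches ⟨ o , ρ , M ⟩ (ce i + (ce j + (ce e + 8))) σ Q
        after-i : Evaluates ⟨ o , ρ , M ⟩ (ce i) 3 (eval i σ) × ok j σ (ok e σ Guarded) → Result
        after-i (evI , k₁) = after-j (sound-e j 4 σ s₁ (m≤m+n 3 1) 8≤V (proj₁ split₂) (Registers-below 3≤3 r (keeps evI)) m k₁)
          where
          s₁ : State
          s₁ = ⟨ o + ce i , regs evI , M ⟩
          after-j : Evaluates s₁ (ce j) 4 (eval j σ) × ok e σ Guarded → Result
          after-j (evJ , k₂) = after-e (sound-e e 5 σ s₂ (m≤m+n 3 2) 8≤V (proj₁ split₃) r₂ m k₂)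
            where
            s₂ : State
            s₂ = ⟨ o + ce i + ce j , regs evJ , M ⟩
            r₂ : Registers σ (regs evJ)
            r₂ = Registers-below (m≤m+n 3 1) (Registers-below 3≤3 r (keeps evI)) (keeps evJ)
            after-e : Evaluates s₂ (ce e) 5 (eval e σ) × Guarded → Result
            after-e (evE , k₃) = stored (address-run a 3 s₃ (<ᵇ⇒< a 16 a<) 3≤3
                (subst (_≤ V) (sym i≡) (small evI)) (subst (_≤ B) (sym j≡) (proj₁ checked)) (width r₃) (start r₃) (proj₁ split₄))
              where
              s₃ : State
              s₃ = ⟨ o + ce i + ce j + ce e , regs evE , M ⟩
              checked : eval j σ ≤ B × Q σ′
              checked = inRow j σ k₃
              i≡ : regs evE (tmp 3) ≡ eval i σ
              i≡ = trans (sameTmp (keeps evE) 3 (m≤m+n 4 1)) (trans (sameTmp (keeps evJ) 3 ≤-refl) (result evI))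
              j≡ : regs evE (tmp 4) ≡ eval j σ
              j≡ = trans (sameTmp (keeps evE) 4 ≤-refl) (result evJ)
              r₃ : Registers σ (regs evE)
              r₃ = Registers-below (m≤m+n 3 2) r₂ (keeps evE)
              cong₃ : ∀ {ρ′ x x′ y y′ z z′} → x ≡ x′ → y ≡ y′ → z ≡ z′ → ⟨ x , ρ′ , M [ y ↦ z ] ⟩ ≡ ⟨ x′ , ρ′ , M [ y′ ↦ z′ ] ⟩
              cong₃ refl refl refl = refl
              stored : (Σ (ℕ → ℕ) λ regs′ → Steps 7 s₃ ⟨ pc s₃ + 7 , regs′ , M ⟩ ×
                regs′ (tmp 3) ≡ address a (regs evE (tmp 3)) (regs evE (tmp 4)) × SameBelow 3 (regs evE) regs′ ×
                (∀ k → 4 < k → regs′ (tmp k) ≡ regs evE (tmp k))) → Result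
              stored (ρ′ , runA , res , kp , above) = record
                { time = ce i + (ce j + (ce e + 8)) ; final = σ′
                ; fregs = ρ′ ; fmem = M [ address a (eval i σ) (eval j σ) ↦ eval e σ ]
                ; runs = ran evI ▸ ran evJ ▸ ran evE ▸ runA ▸
                    one ⟨ o + ce i + ce j + ce e + 7 , ρ′ , M ⟩ _ (proj₁ (codeAt-∷ P (o + ce i + ce j + ce e + 7) _ [] (proj₂ split₄))) ▹
                    cong₃ (ring 4 (λ o i j e → [] ⊢ κ 1 ⊞ (o ⊞ i ⊞ j ⊞ e ⊞ κ 7) ≼ o ⊞ (i ⊞ (j ⊞ (e ⊞ κ 8)))) o (ce i) (ce j) (ce e))
                      (trans res (cong₂ (address a) i≡ j≡)) (trans (above 5 ≤-refl) (result evE))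
                ; regsOk = record { user = user r₄ ; boundV = boundV r₄ ; zero′ = zero′ r₄ ; width = width r₄ ; start = start r₄ }
                ; memOk = Mem-seta σ M a (eval i σ) (eval j σ) (eval e σ) (<ᵇ⇒< a 16 a<) (proj₁ checked) m (small evE) _
                ; post = proj₂ checked
                ; timeOk = cong (_+ clk σ) (ring 3 (λ i j e → [] ⊢ i ⊞ j ⊞ e ⊞ κ 8 ≼ i ⊞ (j ⊞ (e ⊞ κ 8))) (ce i) (ce j) (ce e)) }
                where
                r₄ : Registers σ ρ′
                r₄ = Registers-below 3≤3 r₃ kp
      sound (raw≔ i e) {Q} o σ ρ M at′ r m k = after-i (sound-e i 3 σ ⟨ o , ρ , M ⟩ 3≤3 8≤V (proj₁ split) r m k)
        where
        σ′ : Store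
        σ′ = setr (eval i σ) (eval e σ) (tick (ce i + ce e + 1) σ)
        split : CodeAt P o (code i 3) × CodeAt P (o + ce i) (code e 4 ++ store (tmp 3) (tmp 4) ∷ [])
        split = codeAt-++ P o (code i 3) _ (ce i) (length-code i 3) at′
        split₂ : CodeAt P (o + ce i) (code e 4) × CodeAt P (o + ce i + ce e) (store (tmp 3) (tmp 4) ∷ [])
        split₂ = codeAt-++ P (o + ce i) (code e 4) _ (ce e) (length-code e 4) (proj₂ split)
        Result : Set
        Result = Reaches ⟨ o , ρ , M ⟩ (ce i + (ce e + 1)) σ Q
        after-i : Evaluates ⟨ o , ρ , M ⟩ (ce i) 3 (eval i σ) × ok e σ (eval i σ < R × Q σ′) → Result
        after-i (evI , k₁) = after-e (sound-e e 4 σ ⟨ o + ce i , regs evI , M ⟩ (m≤m+n 3 1) 8≤V (proj₁ split₂) (Registers-below 3≤3 r (keeps evI)) m k₁)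
          where
          after-e : Evaluates ⟨ o + ce i , regs evI , M ⟩ (ce e) 4 (eval e σ) × (eval i σ < R × Q σ′) → Result
          after-e (evE , (i< , q)) = record
            { time = ce i + (ce e + 1) ; final = σ′ ; fregs = regs evE ; fmem = M [ eval i σ ↦ eval e σ ]
            ; runs = ran evI ▸ ran evE ▸ one ⟨ o + ce i + ce e , regs evE , M ⟩ _ (proj₁ (codeAt-∷ P (o + ce i + ce e) _ [] (proj₂ split₂))) ▹
                cong₃ (ring 3 (λ o i e → [] ⊢ κ 1 ⊞ (o ⊞ i ⊞ e) ≼ o ⊞ (i ⊞ (e ⊞ κ 1))) o (ce i) (ce e))
                  (trans (sameTmp (keeps evE) 3 ≤-refl) (result evI)) (result evE)
            ; regsOk = record { user = user r′ ; boundV = boundV r′ ; zero′ = zero′ r′ ; width = width r′ ; start = start r′ }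
            ; memOk = Mem-setr σ M (eval i σ) (eval e σ) i< m (small evE) _
            ; post = q
            ; timeOk = cong (_+ clk σ) (+-assoc (ce i) (ce e) 1) }
            where
            r′ : Registers σ (regs evE)
            r′ = Registers-below (m≤m+n 3 1) (Registers-below 3≤3 r (keeps evI)) (keeps evE)
            cong₃ : ∀ {x x′ y y′ z z′} → x ≡ x′ → y ≡ y′ → z ≡ z′ → ⟨ x , regs evE , M [ y ↦ z ] ⟩ ≡ ⟨ x′ , regs evE , M [ y′ ↦ z′ ] ⟩
            cong₃ refl refl refl = refl
      sound (s ⨾ t) {Q} o σ ρ M at′ r m k = after-s (sound s o σ ρ M (proj₁ split) r m k)
        where
        split : CodeAt P o (compile s o) × CodeAt P (o + size s) (compile t (o + size s))
        split = codeAt-++ P o (compile s o) _ (size s) (length-compile s o) at′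
        after-s : Reaches ⟨ o , ρ , M ⟩ (size s) σ (wp t Q) → Reaches ⟨ o , ρ , M ⟩ (size s + size t) σ Q
        after-s R₁ = both (sound t (o + size s) (final R₁) (fregs R₁) (fmem R₁) (proj₂ split) (regsOk R₁) (memOk R₁) (post R₁))
          where
          both : Reaches ⟨ o + size s , fregs R₁ , fmem R₁ ⟩ (size t) (final R₁) Q → Reaches ⟨ o , ρ , M ⟩ (size s + size t) σ Q
          both R₂ = record
            { time = time R₁ + time R₂ ; final = final R₂ ; fregs = fregs R₂ ; fmem = fmem R₂
            ; runs = runs R₁ ▸ runs R₂ ▹ cong (λ z → ⟨ z , fregs R₂ , fmem R₂ ⟩) (+-assoc o (size s) (size t))
            ; regsOk = regsOk R₂ ; memOk = memOk R₂ ; post = post R₂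
            ; timeOk = trans (timeOk R₂) (trans (cong (time R₂ +_) (timeOk R₁)) (afterTest (time R₁) (time R₂) σ)) }
      sound (ite e s t) {Q} o σ ρ M at′ r m k = after-e (sound-e e 3 σ ⟨ o , ρ , M ⟩ 3≤3 8≤V (proj₁ split) r m k) (eval e σ Data.Nat.Properties.≟ 0)
        where
        σ₁ : Store
        σ₁ = tick (ce e + 1) σ
        oS oT : ℕ
        oS = o + ce e + 1
        oT = oS + size s + 1
        T₁ T₂ : List Instr
        T₂ = jzero (tmp 0) (o + size (ite e s t)) ∷ compile t oT
        T₁ = jzero (tmp 3) oT ∷ compile s oS ++ T₂
        split : CodeAt P o (code e 3) × CodeAt P (o + ce e) T₁
        split = codeAt-++ P o (code e 3) T₁ (ce e) (length-code e 3) at′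
        atS : CodeAt P oS (compile s oS ++ T₂)
        atS = proj₂ (codeAt-++ P (o + ce e) (jzero (tmp 3) oT ∷ []) _ 1 refl (proj₂ split))
        split₂ : CodeAt P oS (compile s oS) × CodeAt P (oS + size s) T₂
        split₂ = codeAt-++ P oS (compile s oS) T₂ (size s) (length-compile s oS) atS
        atT : CodeAt P oT (compile t oT)
        atT = proj₂ (codeAt-++ P (oS + size s) (jzero (tmp 0) (o + size (ite e s t)) ∷ []) _ 1 refl (proj₂ split₂))
        Result : Set
        Result = Reaches ⟨ o , ρ , M ⟩ (size (ite e s t)) σ Q
        after-e : Evaluates ⟨ o , ρ , M ⟩ (ce e) 3 (eval e σ) × ((eval e σ ≢ 0 → wp s (λ σ′ → Q (tick 1 σ′)) σ₁) × (eval e σ ≡ 0 → wp t Q σ₁)) →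
                  Dec (eval e σ ≡ 0) → Result
        after-e (ev , (k₁ , k₂)) (no ne) = build (sound s oS σ₁ (regs ev) M (proj₁ split₂) (Registers-tick (ce e + 1) (Registers-below 3≤3 r (keeps ev))) (Memory-tick (ce e + 1) m) (k₁ ne))
          where
          build : Reaches ⟨ oS , regs ev , M ⟩ (size s) σ₁ (λ σ′ → Q (tick 1 σ′)) → Result
          build R₁ = record
            { time = ce e + (1 + (time R₁ + 1)) ; final = tick 1 (final R₁) ; fregs = fregs R₁ ; fmem = fmem R₁
            ; runs = ran ev ▸ noJump (o + ce e) (regs ev) M _ _ _ (proj₂ split) (λ z → ne (trans (sym (result ev)) z)) ▸
                runs R₁ ▸ jump _ (fregs R₁) (fmem R₁) (tmp 0) _ _ (proj₂ split₂) (zero′ (regsOk R₁))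
            ; regsOk = Registers-tick 1 (regsOk R₁) ; memOk = Memory-tick 1 (memOk R₁) ; post = post R₁
            ; timeOk = trans (cong suc (timeOk R₁)) (ring 3 (λ t c e → [] ⊢ κ 1 ⊞ (t ⊞ (e ⊞ κ 1 ⊞ c)) ≼ e ⊞ (κ 1 ⊞ (t ⊞ κ 1)) ⊞ c) (time R₁) (clk σ) (ce e)) }
        after-e (ev , (k₁ , k₂)) (yes z) = build (sound t oT σ₁ (regs ev) M atT (Registers-tick (ce e + 1) (Registers-below 3≤3 r (keeps ev))) (Memory-tick (ce e + 1) m) (k₂ z))
          where
          build : Reaches ⟨ oT , regs ev , M ⟩ (size t) σ₁ Q → Result
          build R₁ = record
            { time = ce e + (1 + time R₁) ; final = final R₁ ; fregs = fregs R₁ ; fmem = fmem R₁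
            ; runs = ran ev ▸ jump (o + ce e) (regs ev) M _ _ _ (proj₂ split) (trans (result ev) z) ▸ runs R₁ ▹
                cong (λ z → ⟨ z , fregs R₁ , fmem R₁ ⟩)
                  (ring 4 (λ o e s t → [] ⊢ o ⊞ e ⊞ κ 1 ⊞ s ⊞ κ 1 ⊞ t ≼ o ⊞ (e ⊞ (κ 1 ⊞ (s ⊞ (κ 1 ⊞ t))))) o (ce e) (size s) (size t))
            ; regsOk = regsOk R₁ ; memOk = memOk R₁ ; post = post R₁
            ; timeOk = trans (timeOk R₁) (ring 3 (λ t c e → [] ⊢ t ⊞ (e ⊞ κ 1 ⊞ c) ≼ e ⊞ (κ 1 ⊞ t) ⊞ c) (time R₁) (clk σ) (ce e)) }
      sound (while e s) o σ ρ M at′ r m (k , l) = soundLoop e s k o σ ρ M at′ r m l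

      soundLoop : ∀ e s {Q} k o σ ρ M → CodeAt P o (compile (while e s) o) → Registers σ ρ → Memory σ M → loop e s Q k σ →
                  Reaches ⟨ o , ρ , M ⟩ (size (while e s)) σ Q
      soundLoop e s {Q} (suc k) o σ ρ M at′ r m l = after-e (sound-e e 3 σ ⟨ o , ρ , M ⟩ 3≤3 8≤V (proj₁ split) r m l) (eval e σ Data.Nat.Properties.≟ 0)
        where
        σ₁ : Store
        σ₁ = tick (ce e + 1) σ
        oS : ℕ
        oS = o + ce e + 1
        T₁ : List Instr
        T₁ = jzero (tmp 3) (o + size (while e s)) ∷ compile s oS ++ jzero (tmp 0) o ∷ []
        split : CodeAt P o (code e 3) × CodeAt P (o + ce e) T₁
        split = codeAt-++ P o (code e 3) T₁ (ce e) (length-code e 3) at′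
        split₂ : CodeAt P oS (compile s oS) × CodeAt P (oS + size s) (jzero (tmp 0) o ∷ [])
        split₂ = codeAt-++ P oS (compile s oS) _ (size s) (length-compile s oS)
          (proj₂ (codeAt-++ P (o + ce e) (jzero (tmp 3) (o + size (while e s)) ∷ []) _ 1 refl (proj₂ split)))
        Result : Set
        Result = Reaches ⟨ o , ρ , M ⟩ (size (while e s)) σ Q
        Again : Store → Set
        Again σ′ = loop e s Q k (tick 1 σ′)
        after-e : Evaluates ⟨ o , ρ , M ⟩ (ce e) 3 (eval e σ) × ((eval e σ ≢ 0 → wp s Again σ₁) × (eval e σ ≡ 0 → Q σ₁)) → Dec (eval e σ ≡ 0) → Result
        after-e (ev , (k₁ , k₂)) (yes z) = record
          { time = ce e + 1 ; final = σ₁ ; fregs = regs ev ; fmem = M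
          ; runs = ran ev ▸ jump (o + ce e) (regs ev) M _ _ _ (proj₂ split) (trans (result ev) z)
          ; regsOk = Registers-tick (ce e + 1) (Registers-below 3≤3 r (keeps ev)) ; memOk = Memory-tick (ce e + 1) m ; post = k₂ z ; timeOk = refl }
        after-e (ev , (k₁ , k₂)) (no ne) = after-s (sound s oS σ₁ (regs ev) M (proj₁ split₂) (Registers-tick (ce e + 1) (Registers-below 3≤3 r (keeps ev))) (Memory-tick (ce e + 1) m) (k₁ ne))
          where
          after-s : Reaches ⟨ oS , regs ev , M ⟩ (size s) σ₁ Again → Result
          after-s R₁ = build (soundLoop e s k o (tick 1 (final R₁)) (fregs R₁) (fmem R₁) at′ (Registers-tick 1 (regsOk R₁)) (Memory-tick 1 (memOk R₁)) (post R₁))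
            where
            build : Reaches ⟨ o , fregs R₁ , fmem R₁ ⟩ (size (while e s)) (tick 1 (final R₁)) Q → Result
            build R₂ = record
              { time = ce e + (1 + (time R₁ + (1 + time R₂))) ; final = final R₂ ; fregs = fregs R₂ ; fmem = fmem R₂
              ; runs = ran ev ▸ noJump (o + ce e) (regs ev) M _ _ _ (proj₂ split) (λ z → ne (trans (sym (result ev)) z)) ▸
                  runs R₁ ▸ jump _ (fregs R₁) (fmem R₁) (tmp 0) _ _ (proj₂ split₂) (zero′ (regsOk R₁)) ▸ runs R₂
              ; regsOk = regsOk R₂ ; memOk = memOk R₂ ; post = post R₂
              ; timeOk = trans (timeOk R₂) (trans (cong (λ z → time R₂ + suc z) (timeOk R₁))
                  (ring 4 (λ t u c e → [] ⊢ u ⊞ (κ 1 ⊞ (t ⊞ (e ⊞ κ 1 ⊞ c))) ≼ e ⊞ (κ 1 ⊞ (t ⊞ (κ 1 ⊞ u))) ⊞ c) (time R₁) (time R₂) (clk σ) (ce e))) }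

    sound-ends : ∀ {s Q} o {σ ρ M} → CodeAt P o (compile s o) → Registers σ ρ → Memory σ M → Ends s Q σ →
                 Reaches ⟨ o , ρ , M ⟩ (size s) σ Q
    sound-ends {s} {Q} o {σ} {ρ} {M} at′ r m e = sound s {Q} o σ ρ M at′ r m (Ends.holds e)

-- Costs of forests and the lower bound for arbitrary layouts

data Forest : Set where
  nil  : Forest
  node : (i : ℕ) (children rest : Forest) → Forest

nodes : Forest → ℕ
nodes nil           = 0
nodes (node i cs r) = suc (nodes cs + nodes r)

ind : Bool → ℕ
ind b = if b then 1 else 0

add-label : (ℕ → Bool) → ℕ → ℕ → Bool
add-label S ℓ x = (ℓ ≡ᵇ x) ∨ S x

-- Min-plus convolution; later proofs reach it through `conv-≤` and `conv-attained`.
conv : (ℕ → ℕ) → (ℕ → ℕ) → ℕ → ℕ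
conv f g zero    = f 0 + g 0
conv f g (suc k) = (f 0 + g (suc k)) ⊓ conv (f ∘ suc) g k

conv-≤ : ∀ f g i j → conv f g (i + j) ≤ f i + g j
conv-≤ f g zero    zero    = ≤-refl
conv-≤ f g zero    (suc j) = m⊓n≤m _ _
conv-≤ f g (suc i) j       = ≤-trans (m⊓n≤n _ _) (conv-≤ (f ∘ suc) g i j)

conv-attained : ∀ f g k → Σ ℕ λ i → Σ ℕ λ j → i + j ≡ k × f i + g j ≤ conv f g k
conv-attained f g zero    = 0 , 0 , refl , ≤-refl
conv-attained f g (suc k) with ⊓-sel (f 0 + g (suc k)) (conv (f ∘ suc) g k)
... | inj₁ e = 0 , suc k , refl , ≤-reflexive (sym e)
... | inj₂ e with conv-attained (f ∘ suc) g k
...   | i , j , eq , h = suc i , j , cong suc eq , ≤-trans h (≤-reflexive (sym e))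

Decreasing : (ℕ → ℕ) → Set
Decreasing f = ∀ k → f (suc k) ≤ f k

decreasing-≤ : ∀ {f} → Decreasing f → ∀ {i j} → i ≤ j → f j ≤ f i
decreasing-≤ {f} d {i} {j} i≤j = subst (λ z → f z ≤ f i) (m+[n∸m]≡n i≤j) (go (j ∸ i))
  where
  go : ∀ k → f (i + k) ≤ f i
  go zero    = ≤-reflexive (cong f (+-identityʳ i))
  go (suc k) = ≤-trans (≤-reflexive (cong f (+-suc i k))) (≤-trans (d (i + k)) (go k))

conv-decreasing : ∀ {f g} → Decreasing g → Decreasing (conv f g)
conv-decreasing {f} {g} d k with conv-attained f g k
... | i , j , refl , h = ≤-trans (subst (λ z → conv f g z ≤ f i + g (suc j)) (+-suc i j) (conv-≤ f g i (suc j)))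
                           (≤-trans (+-monoʳ-≤ (f i) (d j)) h)

-- The places `k` and `B + k` differ by one whole block; `M` will be the mass, the price of opening
-- it.
Range : ℕ → (ℕ → ℕ) → ℕ → Set
Range B f M = ∀ k → f k ≤ f (B + k) + M

-- An optimal split of `B + k` cells gives at least `B` to the first side, which can then return a
-- whole block, or at most `B`. In the latter case the first side is cut down to 0 at a loss of `M`,
-- and the second side gets `k` at a loss of `N`.
conv-range : ∀ {B f g M N} → Decreasing f → Decreasing g → Range B f M → Range B g N → Range B (conv f g) (M + N)
conv-range {B} {f} {g} {M} {N} df dg rf rg k with conv-attained f g (B + k)
... | i , j , eq , h with ≤-total B i
...   | inj₁ B≤i = ≤-trans (subst (λ z → conv f g z ≤ f (i ∸ B) + g j) e (conv-≤ f g (i ∸ B) j))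
          (lin 6 (λ a b c d M N → (a ≼ b ⊞ M) ∷ (b ⊞ c ≼ d) ∷ [] ⊢ a ⊞ c ≼ d ⊞ (M ⊞ N)) (f (i ∸ B)) (f i) (g j) (conv f g (B + k)) M N
            (≤-trans (rf (i ∸ B)) (≤-reflexive (cong (λ z → f z + M) (m+[n∸m]≡n B≤i)))) h)
  where
  e : i ∸ B + j ≡ k
  e = +-cancelˡ-≡ B _ _ (trans (sym (+-assoc B (i ∸ B) j)) (trans (cong (_+ j) (m+[n∸m]≡n B≤i)) eq))
...   | inj₂ i≤B = ≤-trans (conv-≤ f g 0 k)
          (lin 7 (λ a b c d e M N → (a ≼ b ⊞ M) ∷ (c ≼ d ⊞ N) ∷ (b ⊞ d ≼ e) ∷ [] ⊢ a ⊞ c ≼ e ⊞ (M ⊞ N)) (f 0) (f i) (g k) (g j) (conv f g (B + k)) M N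
            (≤-trans (rf 0) (+-monoˡ-≤ M (decreasing-≤ df (≤-trans i≤B (m≤m+n B 0)))))
            (≤-trans (rg k) (+-monoˡ-≤ N (decreasing-≤ dg j≤))) h)
  where
  j≤ : j ≤ B + k
  j≤ = subst (j ≤_) eq (m≤n+m j i)

-- Blocks have suc b cells; w gives the weights of the nodes.
module Costs (b : ℕ) (w : ℕ → ℕ) where

  B : ℕ
  B = suc b

  mass : Forest → ℕ
  mass nil           = 0
  mass (node i cs r) = w i + mass cs + mass r

  -- The root is not part of `cs`, so this says that its subtree exceeds a block.
  big : Forest → Bool
  big cs = B ≤ᵇ nodes cs

  -- shift t F k: cost of a tree of mass t over children with cost F, if the
  -- block of the parent has k free cells for it; at k = 0 a new block is opened.
  shift : ℕ → (ℕ → ℕ) → ℕ → ℕ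
  shift t F zero    = t + F b
  shift t F (suc k) = F k

  exact : Forest → ℕ → ℕ
  exact nil           k = 0
  exact (node i cs r) k = if big cs then conv (shift (w i + mass cs) (exact cs)) (exact r) k else exact r k

  shift-decreasing : ∀ {t M F} → M ≤ t → Decreasing F → F 0 ≤ F b + M → Decreasing (shift t F)
  shift-decreasing {t} {M} {F} M≤t d r zero = ≤-trans r (≤-trans (≤-reflexive (+-comm (F b) M)) (+-monoˡ-≤ (F b) M≤t))
  shift-decreasing M≤t d r (suc k) = d k

  -- Both facts go through the induction together: that `shift` decreases from 0 to 1 is an instance
  -- of the range of the children.
  exact-facts : ∀ t → Decreasing (exact t) × Range B (exact t) (mass t)
  exact-shift : ∀ i cs → Decreasing (shift (w i + mass cs) (exact cs)) × Range B (shift (w i + mass cs) (exact cs)) (w i + mass cs)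

  exact-shift i cs with exact-facts cs
  ... | d , r = shift-decreasing {M = mass cs} (m≤n+m (mass cs) (w i)) d
                  (≤-trans (r 0) (+-monoˡ-≤ (mass cs) (decreasing-≤ d (≤-trans (n≤1+n b) (m≤m+n B 0))))) , range
    where
    range : Range B (shift (w i + mass cs) (exact cs)) (w i + mass cs)
    range zero    = ≤-reflexive (trans (+-comm (w i + mass cs) (exact cs b)) (cong (λ z → exact cs z + (w i + mass cs)) (sym (+-identityʳ b))))
    range (suc k) = ≤-trans (r k) (subst (λ z → exact cs z + mass cs ≤ exact cs (b + suc k) + (w i + mass cs)) (+-suc b k)
                      (+-monoʳ-≤ (exact cs (b + suc k)) (m≤n+m (mass cs) (w i))))

  exact-facts nil = (λ _ → ≤-refl) , (λ _ → ≤-refl)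
  exact-facts (node i cs r) with big cs | exact-facts r | exact-shift i cs
  ... | true  | dr , rr | ds , rs = conv-decreasing {shift (w i + mass cs) (exact cs)} dr ,
                                    conv-range {B} {shift (w i + mass cs) (exact cs)} ds dr rs rr
  ... | false | dr , rr | _ = dr , λ k → ≤-trans (rr k) (+-monoʳ-≤ _ (m≤n+m (mass r) (w i + mass cs)))

  module _ (lab : ℕ → ℕ) where

    -- weighted number of labels on the paths of a forest that are not in S
    paths : Forest → (ℕ → Bool) → ℕ
    paths nil           S = 0
    paths (node i cs r) S = ind (not (S (lab i))) * (w i + mass cs) + paths cs (add-label S (lab i)) + paths r S

    labelled : ℕ → Forest → ℕ
    labelled ℓ nil           = 0
    labelled ℓ (node i cs r) = ind (lab i ≡ᵇ ℓ) + labelled ℓ cs + labelled ℓ r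

    -- nodes of big subtrees with a label in S
    covered : Forest → (ℕ → Bool) → ℕ
    covered nil           S = 0
    covered (node i cs r) S = (if big cs then ind (S (lab i)) + covered cs S else 0) + covered r S

    -- Only a label outside `S` adds cells, and at most as many as there are nodes that carry it.
    -- This is how the capacity of a block enters the lower bound.
    covered-add : ∀ t S ℓ → covered t (add-label S ℓ) ≤ covered t S + (if S ℓ then 0 else labelled ℓ t)
    covered-add nil           S ℓ = z≤n
    covered-add (node i cs r) S ℓ with big cs | covered-add cs S ℓ | covered-add r S ℓ | here
      where
      here : ind (add-label S ℓ (lab i)) ≤ ind (S (lab i)) + (if S ℓ then 0 else ind (lab i ≡ᵇ ℓ))
      here with ℓ ≡ᵇ lab i in e
      ... | false = m≤m+n _ _
      ... | true rewrite sym (≡ᵇ⇒≡ ℓ (lab i) (Equivalence.from T-≡ e)) with S ℓ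
      ...   | true = ≤-refl
      ...   | false rewrite ≡ᵇ-refl ℓ = ≤-refl
    ... | false | _  | h₂ | _ with S ℓ
    ...   | true  = h₂
    ...   | false = ≤-trans h₂ (+-monoʳ-≤ (covered r S) (m≤n+m (labelled ℓ r) _))
    covered-add (node i cs r) S ℓ | true | h₁ | h₂ | h₃ with S ℓ
    ...   | true  = lin 6 (λ a a′ b b′ c c′ → (a ≼ a′ ⊞ κ 0) ∷ (b ≼ b′ ⊞ κ 0) ∷ (c ≼ c′ ⊞ κ 0) ∷ [] ⊢ a ⊞ b ⊞ c ≼ a′ ⊞ b′ ⊞ c′ ⊞ κ 0)
                     _ (ind (S (lab i))) _ (covered cs S) _ (covered r S) h₃ h₁ h₂
    ...   | false = lin 9 (λ a a′ b b′ c c′ l m n → (a ≼ a′ ⊞ l) ∷ (b ≼ b′ ⊞ m) ∷ (c ≼ c′ ⊞ n) ∷ [] ⊢ a ⊞ b ⊞ c ≼ a′ ⊞ b′ ⊞ c′ ⊞ (l ⊞ m ⊞ n))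
                     _ (ind (S (lab i))) _ (covered cs S) _ (covered r S) (ind (lab i ≡ᵇ ℓ)) (labelled ℓ cs) (labelled ℓ r) h₃ h₁ h₂

    -- `S` holds the labels met on the way down, and `k` is the number of nodes below that lie in
    -- any of these blocks. A node with a label in `S` uses up one such cell. A node with a new
    -- label pays its mass and makes at most `b` further cells available, since it occupies one cell
    -- of its block itself.
    exact-lower : ∀ t S → (∀ ℓ → labelled ℓ t ≤ B) → exact t (covered t S) ≤ paths t S
    exact-lower nil           S cap = z≤n
    exact-lower (node i cs r) S cap with big cs | exact-facts cs | exact-lower cs (add-label S (lab i)) capCs
                                          | exact-lower r S capR | covered-add cs S (lab i) | capHead
      where
      capCs : ∀ ℓ → labelled ℓ cs ≤ B
      capCs ℓ = ≤-trans (≤-trans (m≤n+m _ (ind (lab i ≡ᵇ ℓ))) (m≤m+n _ _)) (cap ℓ)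
      capR : ∀ ℓ → labelled ℓ r ≤ B
      capR ℓ = ≤-trans (m≤n+m _ (ind (lab i ≡ᵇ ℓ) + labelled ℓ cs)) (cap ℓ)
      capHead : labelled (lab i) cs ≤ b
      capHead with cap (lab i)
      ... | h rewrite ≡ᵇ-refl (lab i) = ≤-pred (≤-trans (m≤m+n _ _) h)
    ... | false | _ | _ | hr | _ | _ = ≤-trans hr (m≤n+m _ _)
    ... | true | d , rg | hc | hr | ha | hh with S (lab i)
    ...   | true  = ≤-trans (conv-≤ (shift (w i + mass cs) (exact cs)) (exact r) (1 + covered cs S) (covered r S))
                      (+-mono-≤ (≤-trans (decreasing-≤ d (≤-trans ha (≤-reflexive (+-identityʳ _)))) hc) hr)
    ...   | false = ≤-trans (conv-≤ (shift (w i + mass cs) (exact cs)) (exact r) (covered cs S) (covered r S))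
                      (+-mono-≤ (≤-trans (open-block (covered cs S)) (+-mono-≤ (≤-reflexive (sym (+-identityʳ _)))
                        (≤-trans (decreasing-≤ d (≤-trans ha (+-monoʳ-≤ (covered cs S) hh))) hc))) hr)
      where
      -- While cells are free, `shift` takes one of them instead of opening a block; the range of
      -- the children bounds what the `B` cells of a new block could save by their mass.
      open-block : ∀ k → shift (w i + mass cs) (exact cs) k ≤ (w i + mass cs) + exact cs (k + b)
      open-block zero    = ≤-refl
      open-block (suc k) = ≤-trans (rg k) (≤-trans (≤-reflexive (+-comm _ (mass cs)))
        (+-mono-≤ (m≤n+m (mass cs) (w i)) (≤-reflexive (cong (λ z → exact cs (suc z)) (+-comm b k)))))

-- Min-plus convolution of x and y in which x is only sampled at the points
-- where it has dropped by more than g since the previous sample.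
module Scan (x y : ℕ → ℕ) (g : ℕ) where

  last : ℕ → ℕ
  last zero    = x 0
  last (suc j) = if x (suc j) + g <ᵇ last j then x (suc j) else last j

  drops : ℕ → Bool
  drops j = x (suc j) + g <ᵇ last j

  samples : ℕ → ℕ
  samples zero    = 0
  samples (suc j) = if drops j then suc (samples j) else samples j

  value choice : ℕ → ℕ → ℕ
  value zero    k = x 0 + y k
  value (suc j) k = if drops j ∧ ((j <ᵇ k) ∧ (x (suc j) + y (k ∸ suc j) <ᵇ value j k))
                    then x (suc j) + y (k ∸ suc j) else value j k
  choice zero    k = 0
  choice (suc j) k = if drops j ∧ ((j <ᵇ k) ∧ (x (suc j) + y (k ∸ suc j) <ᵇ value j k))
                     then suc j else choice j k

  value-step : ∀ j k → value (suc j) k ≤ value j k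
  value-step j k with drops j ∧ ((j <ᵇ k) ∧ (x (suc j) + y (k ∸ suc j) <ᵇ value j k)) in e
  ... | false = ≤-refl
  ... | true with drops j | j <ᵇ k | e
  ...   | true | true | e′ = <⇒≤ (<ᵇ⇒< _ _ (Equivalence.from T-≡ e′))

  value-sample : ∀ j k → drops j ≡ true → suc j ≤ k → value (suc j) k ≤ x (suc j) + y (k ∸ suc j)
  value-sample j k d j<k rewrite d | Equivalence.to T-≡ (<⇒<ᵇ j<k)
    with x (suc j) + y (k ∸ suc j) <ᵇ value j k in e
  ... | true  = ≤-refl
  ... | false = ≮⇒≥ (λ h → subst T e (<⇒<ᵇ h))

  choice-sound : ∀ j k → choice j k ≤ k × x (choice j k) + y (k ∸ choice j k) ≤ value j k
  choice-sound zero    k = z≤n , ≤-refl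
  choice-sound (suc j) k with drops j | j <ᵇ k in e | x (suc j) + y (k ∸ suc j) <ᵇ value j k
  ... | false | _     | _     = choice-sound j k
  ... | true  | false | _     = choice-sound j k
  ... | true  | true  | false = choice-sound j k
  ... | true  | true  | true  = <ᵇ⇒< j k (Equivalence.from T-≡ e) , ≤-refl

  module _ (dy : Decreasing y) where

    private
      antitone-∸ : ∀ k j → y (suc k ∸ j) ≤ y (k ∸ j)
      antitone-∸ k j = decreasing-≤ dy (∸-monoˡ-≤ j (n≤1+n k))

    value-decreasing : ∀ j → Decreasing (value j)
    value-decreasing zero    k = +-monoʳ-≤ (x 0) (dy k)
    value-decreasing (suc j) k with drops j in d
    ... | false = value-decreasing j k
    ... | true with j <ᵇ k in e
    ...   | false = beyond
      where
      beyond : (if (j <ᵇ suc k) ∧ (x (suc j) + y (k ∸ j) <ᵇ value j (suc k)) then x (suc j) + y (k ∸ j) else value j (suc k)) ≤ value j k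
      beyond with j <ᵇ suc k | x (suc j) + y (k ∸ j) <ᵇ value j (suc k) in e′
      ... | false | _     = value-decreasing j k
      ... | true  | false = value-decreasing j k
      ... | true  | true  = ≤-trans (<⇒≤ (<ᵇ⇒< _ _ (Equivalence.from T-≡ e′))) (value-decreasing j k)
    ...   | true with j<k
      where
      j<k : j < k
      j<k = <ᵇ⇒< j k (Equivalence.from T-≡ e)
    ...     | lt rewrite Equivalence.to T-≡ (<⇒<ᵇ (m≤n⇒m≤1+n lt))
            with x (suc j) + y (k ∸ j) <ᵇ value j (suc k) in e₁ | x (suc j) + y (k ∸ suc j) <ᵇ value j k in e₂
    ...       | true  | true  = +-monoʳ-≤ (x (suc j)) (antitone-∸ k (suc j))
    ...       | true  | false = ≤-trans (<⇒≤ (<ᵇ⇒< _ _ (Equivalence.from T-≡ e₁))) (value-decreasing j k)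
    ...       | false | false = value-decreasing j k
    ...       | false | true  = ≤-trans (≮⇒≥ (λ h → subst T e₁ (<⇒<ᵇ h))) (+-monoʳ-≤ (x (suc j)) (antitone-∸ k (suc j)))

    last-sample : ∀ j → Σ ℕ λ i → i ≤ j × last j ≡ x i × (∀ k → i ≤ k → value j k ≤ last j + y (k ∸ i))
    last-sample zero = 0 , z≤n , refl , λ k _ → ≤-refl
    last-sample (suc j) with x (suc j) + g <ᵇ last j in d
    ... | true  = suc j , ≤-refl , refl , λ k le → subst (_≤ x (suc j) + y (k ∸ suc j)) (cong (λ z → if z ∧ ((j <ᵇ k) ∧ (x (suc j) + y (k ∸ suc j) <ᵇ value j k)) then x (suc j) + y (k ∸ suc j) else value j k) d) (value-sample j k d le)
    ... | false with last-sample j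
    ...   | i , i≤j , e , h = i , m≤n⇒m≤1+n i≤j , e , h

    -- If `j` was skipped, the last sample `i` before it has `x i ≤ x j + g`, and
    -- `y (k ∸ i) ≤ y (k ∸ j)` because `y` decreases: stopping earlier leaves more cells to the
    -- other side. So a skipped point costs at most `g`.
    value-complete : ∀ J j k → j ≤ J → j ≤ k → value J k ≤ x j + g + y (k ∸ j)
    value-complete zero    .0 k z≤n _ = +-monoˡ-≤ (y k) (m≤m+n (x 0) g)
    value-complete (suc J) j  k j≤ j≤k with m≤n⇒m<n∨m≡n j≤
    ... | inj₁ (s≤s j≤J) = ≤-trans (value-step J k) (value-complete J j k j≤J j≤k)
    ... | inj₂ refl with drops J in d
    ...   | true  = ≤-trans (subst (_≤ x (suc J) + y (k ∸ suc J)) (cong (λ z → if z ∧ ((J <ᵇ k) ∧ (x (suc J) + y (k ∸ suc J) <ᵇ value J k)) then x (suc J) + y (k ∸ suc J) else value J k) d) (value-sample J k d j≤k))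
                      (+-monoˡ-≤ (y (k ∸ suc J)) (m≤m+n (x (suc J)) g))
    ...   | false with last-sample J
    ...     | i , i≤J , e , h = ≤-trans (h k (≤-trans i≤J (<⇒≤ j≤k)))
                (+-mono-≤ (≮⇒≥ (λ l → subst T d (<⇒<ᵇ l))) (decreasing-≤ dy (∸-monoʳ-≤ k (m≤n⇒m≤1+n i≤J))))

  value-≤ : ∀ j k → value j k ≤ x 0 + y k
  value-≤ zero    k = ≤-refl
  value-≤ (suc j) k = ≤-trans (value-step j k) (value-≤ j k)

  -- Every sample lies more than `g` below the previous one, so the samples share the total drop of
  -- `x` among them.
  samples-drop : ∀ j → suc g * samples j + last j ≤ x 0
  samples-drop zero    = ≤-reflexive (cong (_+ x 0) (*-zeroʳ g))
  samples-drop (suc j) with x (suc j) + g <ᵇ last j in d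
  ... | false = samples-drop j
  ... | true  = lin 5 (λ X L g s x₀ → (κ 1 ⊞ (X ⊞ g) ≼ L) ∷ (((κ 1 ⊞ g) ⊠ s) ⊞ L ≼ x₀) ∷ [] ⊢ ((κ 1 ⊞ g) ⊠ (κ 1 ⊞ s)) ⊞ X ≼ x₀)
                  (x (suc j)) (last j) g (samples j) (x 0) (<ᵇ⇒< _ _ (Equivalence.from T-≡ d)) (samples-drop j)

  last-index : ∀ j → Σ ℕ λ i → i ≤ j × last j ≡ x i
  last-index zero = 0 , z≤n , refl
  last-index (suc j) with x (suc j) + g <ᵇ last j
  ... | true  = suc j , ≤-refl , refl
  ... | false with last-index j
  ...   | i , i≤j , e = i , m≤n⇒m≤1+n i≤j , e

-- Approximate vectors, their error and the time of the merges

⊔-bound : ∀ {x y z} → x ≤ z → y ≤ z → x ⊔ y ≤ z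
⊔-bound = ⊔-lub

-- The rank of a vector is a Strahler number: merging two vectors gives a rank
-- larger than the smaller of both, and at least the larger.
module Approximation (b c : ℕ) (w : ℕ → ℕ) where

  open Costs b w public

  C : ℕ
  C = suc c

  -- Rank 0 is reserved for forests without a big subtree, whose vector is zero. Passing through a
  -- big node makes the rank positive.
  childRank : ℕ → ℕ
  childRank r = 1 ⊔ r

  lighter : ℕ → ℕ → Bool
  lighter x y = y <ᵇ x

  low high joinRank : ℕ → ℕ → ℕ
  low  x y = if lighter x y then y else x
  high x y = if lighter x y then x else y
  joinRank x y = if y ≡ᵇ 0 then x else high x y ⊔ suc (low x y)

  rank : Forest → ℕ
  rank nil           = 0
  rank (node i cs r) = if big cs then joinRank (childRank (rank cs)) (rank r) else rank r

  quota : ℕ → ℕ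
  quota l = C * (suc l * suc (suc l))

  -- The mass is that of the side which is sampled, the one of smaller rank; on a tie this is the
  -- first side.
  grain : ℕ → ℕ → ℕ → ℕ → ℕ
  grain M x N y = ⟦ div ⟧ (if lighter x y then N else M) (quota (low x y))

  module _ (F G : ℕ → ℕ) (M N x y : ℕ) where

    sparse dense : ℕ → ℕ
    sparse = if lighter x y then G else F
    dense  = if lighter x y then F else G

    open Scan sparse dense (grain M x N y)

    merged mergedAmount : ℕ → ℕ
    merged k       = value B k
    mergedAmount k = if lighter x y then k ∸ choice B k else choice B k

    mergedSamples : ℕ
    mergedSamples = samples B

  approx : Forest → ℕ → ℕ
  approx nil           k = 0
  approx (node i cs r) k =
    if big cs
    then (if rank r ≡ᵇ 0 then shift (w i + mass cs) (approx cs) k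
          else merged (shift (w i + mass cs) (approx cs)) (approx r) (w i + mass cs) (mass r)
                 (childRank (rank cs)) (rank r) k)
    else approx r k

  above : ℕ → Forest → ℕ → ℕ
  above i cs = shift (w i + mass cs) (approx cs)

  amount : ℕ → Forest → Forest → ℕ → ℕ
  amount i cs r k = if rank r ≡ᵇ 0 then k
    else mergedAmount (above i cs) (approx r) (w i + mass cs) (mass r) (childRank (rank cs)) (rank r) k

  -- In contrast to `Range` this concerns the entries up to `B` only, where the scan stops. That the
  -- whole drop is within the mass limits the number of samples.
  Vector : (ℕ → ℕ) → ℕ → Set
  Vector f M = Decreasing f × (∀ k → k ≤ B → f 0 ≤ f k + M)

  merged-vector : ∀ {F G M N} x y → Vector F M → Vector G N → Vector (merged F G M N x y) (M + N)
  merged-vector {F} {G} {M} {N} x y (dF , rF) (dG , rG) with lighter x y | grain M x N y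
  ... | true  | g = Scan.value-decreasing G F g dF B , λ k k≤ →
    let i = Scan.choice G F g B k ; i≤ , s = Scan.choice-sound G F g B k in
    lin 8 (λ v a b c d e M N → (v ≼ a ⊞ b) ∷ (a ≼ c ⊞ N) ∷ (b ≼ d ⊞ M) ∷ (c ⊞ d ≼ e) ∷ [] ⊢ v ≼ e ⊞ (M ⊞ N))
      (Scan.value G F g B 0) (G 0) (F 0) (G i) (F (k ∸ i)) (Scan.value G F g B k) M N
      (Scan.value-≤ G F g B 0) (rG i (≤-trans i≤ k≤)) (rF (k ∸ i) (≤-trans (m∸n≤m k i) k≤)) s
  ... | false | g = Scan.value-decreasing F G g dG B , λ k k≤ →
    let i = Scan.choice F G g B k ; i≤ , s = Scan.choice-sound F G g B k in
    lin 8 (λ v a b c d e M N → (v ≼ a ⊞ b) ∷ (a ≼ c ⊞ M) ∷ (b ≼ d ⊞ N) ∷ (c ⊞ d ≼ e) ∷ [] ⊢ v ≼ e ⊞ (M ⊞ N))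
      (Scan.value F G g B 0) (F 0) (G 0) (F i) (G (k ∸ i)) (Scan.value F G g B k) M N
      (Scan.value-≤ F G g B 0) (rF i (≤-trans i≤ k≤)) (rG (k ∸ i) (≤-trans (m∸n≤m k i) k≤)) s

  shift-vector : ∀ {t M F} → M ≤ t → Vector F M → Vector (shift t F) t
  shift-vector {t} {M} {F} M≤t (d , r) = shift-decreasing {M = M} M≤t d (r b (n≤1+n b)) , range
    where
    range : ∀ k → k ≤ B → shift t F 0 ≤ shift t F k + t
    range zero    _        = m≤m+n _ t
    range (suc k) (s≤s k≤) = ≤-trans (≤-reflexive (+-comm t (F b))) (+-monoˡ-≤ t (decreasing-≤ d k≤))

  approx-vector : ∀ t → Vector (approx t) (mass t)
  above-vector : ∀ i cs → Vector (above i cs) (w i + mass cs)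

  above-vector i cs = shift-vector (m≤n+m (mass cs) (w i)) (approx-vector cs)

  approx-vector nil = (λ _ → ≤-refl) , (λ _ _ → ≤-refl)
  approx-vector (node i cs r) with big cs | above-vector i cs | approx-vector r
  ... | false | _ | dr , rr = dr , λ k k≤ → ≤-trans (rr k k≤) (+-monoʳ-≤ _ (m≤n+m (mass r) _))
  ... | true | va@(da , ra) | vr with rank r ≡ᵇ 0
  ...   | true  = da , λ k k≤ → ≤-trans (ra k k≤) (+-monoʳ-≤ (above i cs k) (m≤m+n (w i + mass cs) (mass r)))
  ...   | false = merged-vector (childRank (rank cs)) (rank r) va vr

  joinRank≢0 : ∀ x y → joinRank (childRank x) y ≢ 0
  joinRank≢0 zero    zero ()
  joinRank≢0 (suc x) zero ()
  joinRank≢0 x    (suc y) e =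
    n≮0 (≤-trans (m≤n⊔m (high (childRank x) (suc y)) (suc (low (childRank x) (suc y)))) (≤-reflexive e))

  approx-rank0 : ∀ t k → rank t ≡ 0 → approx t k ≡ 0
  approx-rank0 nil           k e = refl
  approx-rank0 (node i cs r) k e with big cs
  ... | false = approx-rank0 r k e
  ... | true  = contradiction e (joinRank≢0 (rank cs) (rank r))

  merged-sound : ∀ F G M N x y k → mergedAmount F G M N x y k ≤ k ×
    F (mergedAmount F G M N x y k) + G (k ∸ mergedAmount F G M N x y k) ≤ merged F G M N x y k
  merged-sound F G M N x y k with lighter x y | grain M x N y
  ... | false | g = Scan.choice-sound F G g B k
  ... | true  | g with Scan.choice G F g B k | Scan.choice-sound G F g B k
  ...   | j | j≤ , s = m∸n≤m k j , ≤-trans (≤-reflexive (trans (+-comm (F (k ∸ j)) _) (cong (λ z → G z + F (k ∸ j)) (m∸[m∸n]≡n j≤)))) s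

  amount-sound : ∀ i cs r k → big cs ≡ true →
    amount i cs r k ≤ k × above i cs (amount i cs r k) + approx r (k ∸ amount i cs r k) ≤ approx (node i cs r) k
  amount-sound i cs r k bc rewrite bc with rank r in e
  ... | zero  = ≤-refl , ≤-reflexive (trans (cong (above i cs k +_) (approx-rank0 r (k ∸ k) e)) (+-identityʳ _))
  ... | suc y = merged-sound (above i cs) (approx r) (w i + mass cs) (mass r) (childRank (rank cs)) (suc y) k

  merged-complete : ∀ {F G} M N x y → Decreasing F → Decreasing G → ∀ i j → i + j ≤ B →
    merged F G M N x y (i + j) ≤ F i + grain M x N y + G j
  merged-complete {F} {G} M N x y dF dG i j i+j≤ with lighter x y | grain M x N y
  ... | false | g = subst (λ z → Scan.value F G g B (i + j) ≤ F i + g + G z) (m+n∸m≡n i j)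
                      (Scan.value-complete F G g dG B i (i + j) (≤-trans (m≤m+n i j) i+j≤) (m≤m+n i j))
  ... | true  | g = ≤-trans (subst (λ z → Scan.value G F g B (i + j) ≤ G j + g + F z) (m+n∸n≡m i j)
                      (Scan.value-complete G F g dF B j (i + j) (≤-trans (m≤n+m j i) i+j≤) (m≤n+m j i)))
                      (≤-reflexive (ring 3 (λ a g f → [] ⊢ a ⊞ g ⊞ f ≼ f ⊞ g ⊞ a) (G j) g (F i)))

  grainAt : ℕ → Forest → Forest → ℕ
  grainAt i cs r = grain (w i + mass cs) (childRank (rank cs)) (mass r) (rank r)

  -- Prepending an entry and taking over a single vector are exact; a merge loses at most its grain.
  err : Forest → ℕ
  err nil           = 0
  err (node i cs r) = if big cs then (if rank r ≡ᵇ 0 then err cs else err cs + err r + grainAt i cs r) else err r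

  approx-exact : ∀ t k → k ≤ B → approx t k ≤ exact t k + err t
  above-exact : ∀ i cs k → k ≤ B → above i cs k ≤ shift (w i + mass cs) (exact cs) k + err cs

  above-exact i cs zero    k≤       = ≤-trans (+-monoʳ-≤ (w i + mass cs) (approx-exact cs b (n≤1+n b)))
                                        (≤-reflexive (sym (+-assoc (w i + mass cs) _ (err cs))))
  above-exact i cs (suc k) (s≤s k≤) = approx-exact cs k (m≤n⇒m≤1+n k≤)

  approx-exact nil           k k≤ = z≤n
  approx-exact (node i cs r) k k≤ with big cs
  ... | false = approx-exact r k k≤
  ... | true with conv-attained (shift (w i + mass cs) (exact cs)) (exact r) k
  ...   | p , q , refl , h with rank r ≡ᵇ 0
  ...     | true  = ≤-trans (above-exact i cs (p + q) k≤) (+-monoˡ-≤ (err cs)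
                      (≤-trans (decreasing-≤ (proj₁ (exact-shift i cs)) (m≤m+n p q)) (≤-trans (m≤m+n _ (exact r q)) h)))
  ...     | false = lin 9 (λ v a g b a′ e b′ f z → (v ≼ a ⊞ g ⊞ b) ∷ (a ≼ a′ ⊞ e) ∷ (b ≼ b′ ⊞ f) ∷ (a′ ⊞ b′ ≼ z) ∷ [] ⊢ v ≼ z ⊞ (e ⊞ f ⊞ g))
      _ (above i cs p) (grainAt i cs r) (approx r q) (shift (w i + mass cs) (exact cs) p) (err cs) (exact r q) (err r) _
      (merged-complete (w i + mass cs) (mass r) (childRank (rank cs)) (rank r) (proj₁ (above-vector i cs)) (proj₁ (approx-vector r)) p q k≤)
      (above-exact i cs p (≤-trans (m≤m+n p q) k≤)) (approx-exact r q (≤-trans (m≤n+m q p) k≤)) h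

  private
    -- The invariant reads `e ≤ (M / C) · a / (a + 1)`, and `a / (a + 1)` increases with `a`.
    raise : ∀ {e M a a′} → e * (C * suc a) ≤ M * a → a ≤ a′ → e * (C * suc a′) ≤ M * a′
    raise {e} {M} {a} {a′} h a≤ = subst (λ z → e * (C * suc z) ≤ M * z) (m+[n∸m]≡n a≤) (go (a′ ∸ a))
      where
      eC≤M : e * C ≤ M
      eC≤M = *-cancelʳ-≤ (e * C) M (suc a) (≤-trans (≤-reflexive (*-assoc e C (suc a))) (≤-trans h (*-monoʳ-≤ M (n≤1+n a))))
      go : ∀ d → e * (C * suc (a + d)) ≤ M * (a + d)
      go d = lin 5 (λ e C M a d → (e ⊠ (C ⊠ (κ 1 ⊞ a)) ≼ M ⊠ a) ∷ (e ⊠ C ⊠ d ≼ M ⊠ d) ∷ [] ⊢ e ⊠ (C ⊠ (κ 1 ⊞ (a ⊞ d))) ≼ M ⊠ (a ⊞ d))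
               e C M a d h (*-monoˡ-≤ d eC≤M)

    -- After multiplication by `a + 1` this is `a (a + 2) + 1 = (a + 1)²`.
    absorb : ∀ {e g M a} → e * (C * suc a) ≤ M * a → g * quota a ≤ M → (e + g) * (C * suc (suc a)) ≤ M * suc a
    absorb {e} {g} {M} {a} h k = *-cancelʳ-≤ _ _ (suc a)
      (lin 5 (λ e g C M a → (e ⊠ (C ⊠ (κ 1 ⊞ a)) ⊠ (κ 2 ⊞ a) ≼ M ⊠ a ⊠ (κ 2 ⊞ a)) ∷ (g ⊠ (C ⊠ ((κ 1 ⊞ a) ⊠ (κ 2 ⊞ a))) ≼ M) ∷ [] ⊢
          (e ⊞ g) ⊠ (C ⊠ (κ 2 ⊞ a)) ⊠ (κ 1 ⊞ a) ≼ M ⊠ (κ 1 ⊞ a) ⊠ (κ 1 ⊞ a)) e g C M a (*-monoˡ-≤ (2 + a) h) k)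

    div-≤ : ∀ M q → ⟦ div ⟧ M q * q ≤ M
    div-≤ M zero    = z≤n
    div-≤ M (suc q) = m/n*n≤m M (suc q)

    -- The sampled side absorbs the grain on its way to the next rank, which the new rank reaches;
    -- the error of the other side merely has to be raised.
    merge-err : ∀ {e f M N} x y → e * (C * suc x) ≤ M * x → f * (C * suc y) ≤ N * y →
      (e + f + grain M x N y) * (C * suc (high x y ⊔ suc (low x y))) ≤ (M + N) * (high x y ⊔ suc (low x y))
    merge-err {e} {f} {M} {N} x y h₁ h₂ with lighter x y
    ... | true  = combine e (f + g) (raise {e} {M} h₁ (m≤m⊔n x (suc y))) (raise {f + ⟦ div ⟧ N (quota y)} {N} {a = suc y} (absorb {f} {_} {N} {y} h₂ (div-≤ N (quota y))) (m≤n⊔m x (suc y)))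
                    (ring 3 (λ e f g → [] ⊢ e ⊞ f ⊞ g ≼ e ⊞ (f ⊞ g)) e f g)
      where
      g : ℕ
      g = ⟦ div ⟧ N (quota y)
      combine : ∀ p q {s R} → p * R ≤ M * (x ⊔ suc y) → q * R ≤ N * (x ⊔ suc y) → s ≡ p + q → s * R ≤ (M + N) * (x ⊔ suc y)
      combine p q {R = R} u v refl = subst₂ _≤_ (sym (*-distribʳ-+ R p q)) (sym (*-distribʳ-+ (x ⊔ suc y) M N)) (+-mono-≤ u v)
    ... | false = combine (e + g) f (raise {e + ⟦ div ⟧ M (quota x)} {M} {a = suc x} (absorb {e} {_} {M} {x} h₁ (div-≤ M (quota x))) (m≤n⊔m y (suc x))) (raise {f} {N} h₂ (m≤m⊔n y (suc x)))
                    (ring 3 (λ e f g → [] ⊢ e ⊞ f ⊞ g ≼ e ⊞ g ⊞ f) e f g)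
      where
      g : ℕ
      g = ⟦ div ⟧ M (quota x)
      combine : ∀ p q {s R} → p * R ≤ M * (y ⊔ suc x) → q * R ≤ N * (y ⊔ suc x) → s ≡ p + q → s * R ≤ (M + N) * (y ⊔ suc x)
      combine p q {R = R} u v refl = subst₂ _≤_ (sym (*-distribʳ-+ R p q)) (sym (*-distribʳ-+ (y ⊔ suc x) M N)) (+-mono-≤ u v)

  err-bound : ∀ t → err t * (C * suc (rank t)) ≤ mass t * rank t
  err-bound nil = z≤n
  err-bound (node i cs r) with big cs | err-bound cs | err-bound r
  ... | false | _ | hr = ≤-trans hr (*-monoˡ-≤ (rank r) (m≤n+m (mass r) (w i + mass cs)))
  ... | true | hc | hr with rank r
  ...   | zero  = ≤-trans (raise {err cs} {mass cs} hc (m≤n⊔m 1 (rank cs))) (*-monoˡ-≤ (childRank (rank cs))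
                    (≤-trans (m≤n+m (mass cs) (w i)) (m≤m+n _ (mass r))))
  ...   | suc y = merge-err {err cs} {err r} {w i + mass cs} {mass r} (childRank (rank cs)) (suc y)
                    (≤-trans (raise {err cs} {mass cs} hc (m≤n⊔m 1 (rank cs))) (*-monoˡ-≤ (childRank (rank cs)) (m≤n+m (mass cs) (w i)))) hr

  err-≤ : ∀ t → err t * C ≤ mass t
  err-≤ t = *-cancelʳ-≤ _ _ (suc (rank t)) (≤-trans (≤-reflexive (*-assoc (err t) C (suc (rank t))))
              (≤-trans (err-bound t) (*-monoʳ-≤ (mass t) (n≤1+n (rank t)))))

  private
    div-< : ∀ M q → M < suc (⟦ div ⟧ M (suc q)) * suc q
    div-< M q = ≤-trans (≤-reflexive (cong suc (m≡m%n+[m/n]*n M (suc q)))) (+-monoˡ-≤ (M / suc q * suc q) (m%n<n M (suc q)))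

  -- A sample drops by at least one more than the rounded grain. This number times the quota exceeds
  -- the mass, which in turn bounds the total drop.
  samples-≤ : ∀ {F G M N} x y → Vector F M → Vector G N → mergedSamples F G M N x y ≤ quota (low x y)
  samples-≤ {F} {G} {M} {N} x y (_ , rF) (_ , rG) with lighter x y
  ... | true  = few G F N y rG
    where
    few : ∀ X Y L l → (∀ k → k ≤ B → X 0 ≤ X k + L) → Scan.samples X Y (⟦ div ⟧ L (quota l)) B ≤ quota l
    few X Y L l rX with Scan.last-index X Y (⟦ div ⟧ L (quota l)) B | Scan.samples-drop X Y (⟦ div ⟧ L (quota l)) B
    ... | i , i≤ , e | d = *-cancelˡ-≤ (suc (⟦ div ⟧ L (quota l))) (≤-trans
      (lin 4 (λ s X₀ z L → (s ⊞ z ≼ X₀) ∷ (X₀ ≼ z ⊞ L) ∷ [] ⊢ s ≼ L) _ (X 0) (Scan.last X Y (⟦ div ⟧ L (quota l)) B) L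
        d (subst (λ z → X 0 ≤ z + L) (sym e) (rX i i≤))) (<⇒≤ (div-< L _)))
  ... | false = few F G M x rF
    where
    few : ∀ X Y L l → (∀ k → k ≤ B → X 0 ≤ X k + L) → Scan.samples X Y (⟦ div ⟧ L (quota l)) B ≤ quota l
    few X Y L l rX with Scan.last-index X Y (⟦ div ⟧ L (quota l)) B | Scan.samples-drop X Y (⟦ div ⟧ L (quota l)) B
    ... | i , i≤ , e | d = *-cancelˡ-≤ (suc (⟦ div ⟧ L (quota l))) (≤-trans
      (lin 4 (λ s X₀ z L → (s ⊞ z ≼ X₀) ∷ (X₀ ≼ z ⊞ L) ∷ [] ⊢ s ≼ L) _ (X 0) (Scan.last X Y (⟦ div ⟧ L (quota l)) B) L
        d (subst (λ z → X 0 ≤ z + L) (sym e) (rX i i≤))) (<⇒≤ (div-< L _)))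

  -- A crude bound on all entries, which keeps them within machine words.
  approx-≤ : ∀ t W → mass t ≤ W → ∀ k → approx t k ≤ nodes t * W
  above-≤ : ∀ i cs W → w i + mass cs ≤ W → ∀ k → above i cs k ≤ suc (nodes cs) * W

  above-≤ i cs W h zero    = +-mono-≤ h (approx-≤ cs W (≤-trans (m≤n+m (mass cs) (w i)) h) b)
  above-≤ i cs W h (suc k) = ≤-trans (approx-≤ cs W (≤-trans (m≤n+m (mass cs) (w i)) h) k) (m≤n+m _ W)

  approx-≤ nil           W h k = z≤n
  approx-≤ (node i cs r) W h k with big cs
  ... | false = ≤-trans (approx-≤ r W (≤-trans (m≤n+m (mass r) _) h) k) (*-monoˡ-≤ W (m≤n⇒m≤1+n (m≤n+m (nodes r) (nodes cs))))
  ... | true with rank r ≡ᵇ 0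
  ...   | true  = ≤-trans (above-≤ i cs W (≤-trans (m≤m+n _ (mass r)) h) k) (*-monoˡ-≤ W (s≤s (m≤m+n (nodes cs) (nodes r))))
  ...   | false with lighter (childRank (rank cs)) (rank r) | grain (w i + mass cs) (childRank (rank cs)) (mass r) (rank r)
  ...     | true  | g = ≤-trans (Scan.value-≤ (approx r) (above i cs) g B k) (≤-trans
                      (+-mono-≤ (approx-≤ r W (≤-trans (m≤n+m (mass r) _) h) 0) (above-≤ i cs W (≤-trans (m≤m+n _ (mass r)) h) k))
                      (≤-reflexive (ring 3 (λ n m W → [] ⊢ m ⊠ W ⊞ (κ 1 ⊞ n) ⊠ W ≼ (κ 1 ⊞ (n ⊞ m)) ⊠ W) (nodes cs) (nodes r) W)))
  ...     | false | g = ≤-trans (Scan.value-≤ (above i cs) (approx r) g B k) (≤-trans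
                      (+-mono-≤ (above-≤ i cs W (≤-trans (m≤m+n _ (mass r)) h) 0) (approx-≤ r W (≤-trans (m≤n+m (mass r) _) h) k))
                      (≤-reflexive (ring 3 (λ n m W → [] ⊢ (κ 1 ⊞ n) ⊠ W ⊞ m ⊠ W ≼ (κ 1 ⊞ (n ⊞ m)) ⊠ W) (nodes cs) (nodes r) W)))

  rank-≤ : ∀ t → rank t ≤ nodes t
  rank-≤ nil = z≤n
  rank-≤ (node i cs r) with big cs | rank-≤ cs | rank-≤ r
  ... | false | _ | hr = ≤-trans hr (m≤n⇒m≤1+n (m≤n+m (nodes r) (nodes cs)))
  ... | true | hc | hr with rank r ≡ᵇ 0
  ...   | true  = ⊔-bound (s≤s z≤n) (≤-trans hc (m≤n⇒m≤1+n (m≤m+n (nodes cs) (nodes r))))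
  ...   | false with childRank (rank cs) | ⊔-bound {1} {rank cs} {suc (nodes cs)} (s≤s z≤n) (m≤n⇒m≤1+n hc)
  ...     | x | hx with rank r <ᵇ x in e
  ...       | true  = ⊔-bound (≤-trans hx (s≤s (m≤m+n (nodes cs) (nodes r)))) (≤-trans (s≤s hr) (s≤s (m≤n+m (nodes r) (nodes cs))))
  ...       | false = ⊔-bound (≤-trans hr (m≤n⇒m≤1+n (m≤n+m (nodes r) (nodes cs))))
                       (≤-trans (s≤s (≤-trans (≮⇒≥ (λ l → subst T e (<⇒<ᵇ l))) hr)) (s≤s (m≤n+m (nodes r) (nodes cs))))

  -- E bounds the cost of a merge, per vector entry and per (l + 1)(l + 2).
  module Time (E : ℕ) where

    -- The polynomial `q(r) = r² + 5r + 8` solves `2 q(l) = q(l + 1) + (l + 1)(l + 2)`: two vectors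
    -- of equal rank pay for their merge and for the potential of the result without remainder.
    pot : ℕ → ℕ
    pot zero    = 0
    pot (suc r) = E * (suc r * suc r + 5 * suc r + 8)

    mergeTime : ℕ → ℕ → ℕ
    mergeTime x y = if y ≡ᵇ 0 then 0 else suc B * (E * (suc (low x y) * suc (suc (low x y))))

    time : Forest → ℕ
    time nil           = 0
    time (node i cs r) = if big cs then time cs + time r + mergeTime (childRank (rank cs)) (rank r) else time r

    private
      pot-mono : ∀ {x y} → x ≤ y → pot x ≤ pot y
      pot-mono {zero}  _    = z≤n
      pot-mono {suc x} {suc y} x≤y = *-monoʳ-≤ E (+-monoˡ-≤ 8 (+-mono-≤ (*-mono-≤ x≤y x≤y) (*-monoʳ-≤ 5 x≤y)))

      pot-merge : ∀ l h → 1 ≤ l → l ≤ h → pot (h ⊔ suc l) + E * (suc l * suc (suc l)) ≤ pot h + pot l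
      pot-merge (suc l) h 1≤l l≤h with m≤n⇒m<n∨m≡n l≤h
      -- The rank stays `h` and the vector of rank `l` disappears; its potential alone pays for the
      -- merge.
      ... | inj₁ l<h rewrite m≥n⇒m⊔n≡m l<h = +-monoʳ-≤ (pot h)
        (≤-trans (≤-reflexive refl) (*-monoʳ-≤ E (lin 1 (λ l → [] ⊢ (κ 2 ⊞ l) ⊠ (κ 3 ⊞ l) ≼ (κ 1 ⊞ l) ⊠ (κ 1 ⊞ l) ⊞ κ 5 ⊠ (κ 1 ⊞ l) ⊞ κ 8) l)))
      ... | inj₂ refl rewrite m≤n⇒m⊔n≡n (n≤1+n l) = ≤-reflexive
        (ring 2 (λ E l → [] ⊢ E ⊠ ((κ 2 ⊞ l) ⊠ (κ 2 ⊞ l) ⊞ κ 5 ⊠ (κ 2 ⊞ l) ⊞ κ 8) ⊞ E ⊠ ((κ 2 ⊞ l) ⊠ (κ 3 ⊞ l))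
          ≼ E ⊠ ((κ 1 ⊞ l) ⊠ (κ 1 ⊞ l) ⊞ κ 5 ⊠ (κ 1 ⊞ l) ⊞ κ 8) ⊞ E ⊠ ((κ 1 ⊞ l) ⊠ (κ 1 ⊞ l) ⊞ κ 5 ⊠ (κ 1 ⊞ l) ⊞ κ 8)) E l)

    mergeTime-≤ : ∀ x y → 1 ≤ x → 1 ≤ y →
      suc B * (E * (suc (low x y) * suc (suc (low x y)))) + suc B * pot (high x y ⊔ suc (low x y)) ≤ suc B * pot x + suc B * pot y
    mergeTime-≤ x y 1≤x 1≤y with y <ᵇ x in e
    ... | true  = ≤-trans (≤-reflexive (sym (*-distribˡ-+ (suc B) (E * _) (pot (x ⊔ suc y)))))
                    (≤-trans (*-monoʳ-≤ (suc B) (≤-trans (≤-reflexive (+-comm (E * _) (pot (x ⊔ suc y))))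
                      (pot-merge y x 1≤y (<⇒≤ (<ᵇ⇒< y x (Equivalence.from T-≡ e)))))) (≤-reflexive (*-distribˡ-+ (suc B) (pot x) (pot y))))
    ... | false = ≤-trans (≤-reflexive (sym (*-distribˡ-+ (suc B) (E * _) (pot (y ⊔ suc x)))))
                    (≤-trans (*-monoʳ-≤ (suc B) (≤-trans (≤-reflexive (+-comm (E * _) (pot (y ⊔ suc x))))
                      (≤-trans (pot-merge x y 1≤x (≮⇒≥ (λ l → subst T e (<⇒<ᵇ l)))) (≤-reflexive (+-comm (pot y) (pot x))))))
                      (≤-reflexive (*-distribˡ-+ (suc B) (pot x) (pot y))))

    time-rank0 : ∀ t → rank t ≡ 0 → time t ≡ 0
    time-rank0 nil           e = refl
    time-rank0 (node i cs r) e with big cs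
    ... | false = time-rank0 r e
    ... | true  = contradiction e (joinRank≢0 (rank cs) (rank r))

    private
      -- The factor 14 is `1 + 5 + 8`, the potential of rank 1 in units of `E`. The first vector
      -- arises above at least `B` nodes; together with the root of their tree they pay for its
      -- `B + 1` entries.
      open-rank : ∀ x T N → B ≤ N → (x ≡ 0 → T ≡ 0) → T + suc B * pot x ≤ 14 * E * N →
                  T + suc B * pot (childRank x) ≤ 14 * E * suc N
      open-rank (suc x) T N _   _ h = ≤-trans h (*-monoʳ-≤ (14 * E) (n≤1+n N))
      open-rank zero    T N B≤N z _ rewrite z refl =
        lin 3 (λ B E N → (B ⊠ (κ 14 ⊠ E) ≼ N ⊠ (κ 14 ⊠ E)) ∷ [] ⊢ (κ 1 ⊞ B) ⊠ (E ⊠ κ 14) ≼ κ 14 ⊠ E ⊠ (κ 1 ⊞ N))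
          B E N (*-monoˡ-≤ (14 * E) B≤N)

      join-time : ∀ x y T U N M → T + suc B * pot (childRank x) ≤ 14 * E * suc N → U + suc B * pot y ≤ 14 * E * M →
        T + U + mergeTime (childRank x) y + suc B * pot (joinRank (childRank x) y) ≤ 14 * E * suc (N + M)
      join-time x zero T U N M h k =
        lin 7 (λ tc tr p E n m z → (tc ⊞ p ≼ κ 14 ⊠ E ⊠ (κ 1 ⊞ n)) ∷ (tr ⊞ z ≼ κ 14 ⊠ E ⊠ m) ∷ [] ⊢ tc ⊞ tr ⊞ κ 0 ⊞ p ≼ κ 14 ⊠ E ⊠ (κ 1 ⊞ (n ⊞ m)))
          T U (suc B * pot (childRank x)) E N M (suc B * 0) h k
      join-time x (suc y) T U N M h k =
        lin 9 (λ tc tr p q s u E n m → (tc ⊞ p ≼ κ 14 ⊠ E ⊠ (κ 1 ⊞ n)) ∷ (tr ⊞ q ≼ κ 14 ⊠ E ⊠ m) ∷ (s ⊞ u ≼ p ⊞ q) ∷ [] ⊢ tc ⊞ tr ⊞ s ⊞ u ≼ κ 14 ⊠ E ⊠ (κ 1 ⊞ (n ⊞ m)))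
          T U (suc B * pot (childRank x)) (suc B * pot (suc y)) _ _ E N M h k
          (mergeTime-≤ (childRank x) (suc y) (m≤m⊔n 1 x) (s≤s z≤n))

    time-≤ : ∀ t → time t + suc B * pot (rank t) ≤ 14 * E * nodes t
    time-≤ nil rewrite *-zeroʳ B = z≤n
    time-≤ (node i cs r) with big cs in bc | time-≤ cs | time-≤ r
    ... | false | _ | hr = ≤-trans hr (*-monoʳ-≤ (14 * E) (m≤n⇒m≤1+n (m≤n+m (nodes r) (nodes cs))))
    ... | true | hc | hr = join-time (rank cs) (rank r) (time cs) (time r) (nodes cs) (nodes r)
      (open-rank (rank cs) (time cs) (nodes cs) (≤ᵇ⇒≤ B (nodes cs) (Equivalence.from T-≡ bc)) (time-rank0 cs) hc) hr

-- Elimination of the nodes in reverse order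

sumN : ℕ → (ℕ → ℕ) → ℕ
sumN zero    f = 0
sumN (suc n) f = sumN n f + f n

sumN-cong : ∀ n {f g} → (∀ v → v < n → f v ≡ g v) → sumN n f ≡ sumN n g
sumN-cong zero    h = refl
sumN-cong (suc n) h = cong₂ _+_ (sumN-cong n (λ v v< → h v (m≤n⇒m≤1+n v<))) (h n ≤-refl)

sumN-mono : ∀ n {f g} → (∀ v → v < n → f v ≤ g v) → sumN n f ≤ sumN n g
sumN-mono zero    h = z≤n
sumN-mono (suc n) h = +-mono-≤ (sumN-mono n (λ v v< → h v (m≤n⇒m≤1+n v<))) (h n ≤-refl)

sumN-zero : ∀ n {f} → (∀ v → v < n → f v ≡ 0) → sumN n f ≡ 0
sumN-zero zero    h = refl
sumN-zero (suc n) h = cong₂ _+_ (sumN-zero n (λ v v< → h v (m≤n⇒m≤1+n v<))) (h n ≤-refl)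

sumN-≥ : ∀ n f v → v < n → f v ≤ sumN n f
sumN-≥ (suc n) f v v< with m≤n⇒m<n∨m≡n v<
... | inj₁ (s≤s v<n) = ≤-trans (sumN-≥ n f v v<n) (m≤m+n _ (f n))
... | inj₂ refl      = m≤n+m (f n) _

-- Stated without subtraction: the one summand that changes is exchanged between the two sides.
sumN-update : ∀ n p f g → p < n → (∀ v → v < n → v ≢ p → f v ≡ g v) → sumN n f + g p ≡ sumN n g + f p
sumN-update (suc n) p f g p< h with p Data.Nat.Properties.≟ n
... | yes refl = trans (+-assoc (sumN n f) (f n) (g n)) (trans (cong₂ _+_
        (sumN-cong n (λ v v< → h v (m≤n⇒m≤1+n v<) (<⇒≢ v<))) (+-comm (f n) (g n))) (sym (+-assoc (sumN n g) (g n) (f n))))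
... | no p≢n   = trans (swap (sumN n f) (f n) (g p)) (trans (cong₂ _+_
        (sumN-update n p f g (≤∧≢⇒< (≤-pred p<) p≢n) (λ v v< → h v (m≤n⇒m≤1+n v<))) (h n ≤-refl (λ e → p≢n (sym e))))
        (swap (sumN n g) (f p) (g n)))
  where
  swap : ∀ a b c → a + b + c ≡ a + c + b
  swap = ring 3 (λ a b c → [] ⊢ a ⊞ b ⊞ c ≼ a ⊞ c ⊞ b)

module Staged (n : ℕ) (par : ℕ → ℕ) (par< : ∀ i → 1 ≤ i → i < n → par i < i) where

  -- Recursion on the number of eliminated nodes replaces recursion on the tree. Children have
  -- larger numbers than their parent, so the forest below a node is complete when its turn comes.
  stage : ℕ → ℕ → Forest
  stage zero    v = nil
  stage (suc k) v = if par (n ∸ suc k) ≡ᵇ v then node (n ∸ suc k) (stage k (n ∸ suc k)) (stage k v) else stage k v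

  -- acc i v: the part of the subtree of v below v whose nodes are all connected
  -- to v by nodes numbered i or higher
  acc : ℕ → ℕ → Forest
  acc i v = stage (n ∸ i) v

  acc-n : ∀ v → acc n v ≡ nil
  acc-n v rewrite n∸n≡0 n = refl

  private
    acc-step : ∀ i v → i < n →
      acc i v ≡ (if par i ≡ᵇ v then node i (acc (suc i) i) (acc (suc i) v) else acc (suc i) v)
    acc-step i v i<n = subst (λ k → stage k v ≡ (if par i ≡ᵇ v then node i (acc (suc i) i) (acc (suc i) v) else acc (suc i) v))
      (sym (+-∸-assoc 1 i<n)) (unfold (n ∸ suc (n ∸ suc i)) back)
      where
      back : n ∸ suc (n ∸ suc i) ≡ i
      back = trans (cong (n ∸_) (sym (+-∸-assoc 1 i<n))) (m∸[m∸n]≡n (<⇒≤ i<n))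
      unfold : ∀ j → j ≡ i → (if par j ≡ᵇ v then node j (acc (suc i) j) (acc (suc i) v) else acc (suc i) v) ≡
                             (if par i ≡ᵇ v then node i (acc (suc i) i) (acc (suc i) v) else acc (suc i) v)
      unfold j refl = refl

  acc-par : ∀ i → i < n → acc i (par i) ≡ node i (acc (suc i) i) (acc (suc i) (par i))
  acc-par i i<n = trans (acc-step i (par i) i<n)
    (cong (λ b → if b then node i (acc (suc i) i) (acc (suc i) (par i)) else acc (suc i) (par i)) (≡ᵇ-refl (par i)))

  acc-other : ∀ i v → i < n → par i ≢ v → acc i v ≡ acc (suc i) v
  acc-other i v i<n ne = trans (acc-step i v i<n)
    (cong (λ b → if b then node i (acc (suc i) i) (acc (suc i) v) else acc (suc i) v) (≢⇒≡ᵇ ne))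

  Φ : (ℕ → Forest → ℕ) → ℕ → ℕ
  Φ φ i = sumN i (λ v → φ v (acc i v))

  -- Eliminating `i` affects the forest of its parent only and removes the summand of `i`. Both
  -- sides are sums, in order to avoid subtraction.
  Φ-step : ∀ φ i → 1 ≤ i → i < n →
    Φ φ (suc i) + φ (par i) (node i (acc (suc i) i) (acc (suc i) (par i))) ≡
    Φ φ i + (φ (par i) (acc (suc i) (par i)) + φ i (acc (suc i) i))
  Φ-step φ i 1≤i i<n = begin
    sumN i old + φ i (acc (suc i) i) + φ p (node i (acc (suc i) i) (acc (suc i) p))
      ≡⟨ cong (λ t → sumN i old + φ i (acc (suc i) i) + φ p t) (sym (acc-par i i<n)) ⟩
    sumN i old + φ i (acc (suc i) i) + φ p (acc i p)
      ≡⟨ swap (sumN i old) _ _ ⟩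
    sumN i old + φ p (acc i p) + φ i (acc (suc i) i)
      ≡⟨ cong (_+ φ i (acc (suc i) i)) (sumN-update i p old (λ v → φ v (acc i v)) (par< i 1≤i i<n)
           (λ v v< v≢p → cong (φ v) (sym (acc-other i v i<n (λ e → v≢p (sym e)))))) ⟩
    Φ φ i + φ p (acc (suc i) p) + φ i (acc (suc i) i)
      ≡⟨ +-assoc (Φ φ i) _ _ ⟩
    Φ φ i + (φ p (acc (suc i) p) + φ i (acc (suc i) i)) ∎
    where
    open ≡-Reasoning
    p : ℕ
    p = par i
    old : ℕ → ℕ
    old v = φ v (acc (suc i) v)
    swap : ∀ a b c → a + b + c ≡ a + c + b
    swap = ring 3 (λ a b c → [] ⊢ a ⊞ b ⊞ c ≼ a ⊞ c ⊞ b)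

  -- Φ does not change if eliminating a node only moves contributions.
  Φ-constant : ∀ φ → (∀ i cs r → 1 ≤ i → i < n → φ (par i) (node i cs r) ≡ φ (par i) r + φ i cs) →
               ∀ i → 1 ≤ i → i ≤ n → Φ φ i ≡ Φ φ n
  Φ-constant φ h i 1≤i i≤n = go (n ∸ i) i 1≤i (m+[n∸m]≡n i≤n)
    where
    go : ∀ k i → 1 ≤ i → i + k ≡ n → Φ φ i ≡ Φ φ n
    go zero    i 1≤i e = cong (Φ φ) (trans (sym (+-identityʳ i)) e)
    go (suc k) i 1≤i e = trans
      (+-cancelʳ-≡ _ _ _ (trans (cong (Φ φ i +_) (h i _ _ 1≤i i<n)) (sym (Φ-step φ i 1≤i i<n))))
      (go k (suc i) (m≤n⇒m≤1+n 1≤i) (trans (sym (+-suc i k)) e))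
      where
      i<n : i < n
      i<n = ≤-trans (s≤s (m≤m+n i k)) (≤-reflexive (trans (sym (+-suc i k)) e))

  Φ-n : ∀ φ f → (∀ v → φ v nil ≡ f v) → Φ φ n ≡ sumN n f
  Φ-n φ f h = sumN-cong n (λ v _ → trans (cong (φ v) (acc-n v)) (h v))

  -- Each node counts once, by itself as long as it remains and within the forest of an ancestor
  -- afterwards, so the sum does not depend on the stage.
  additive : ∀ (f : ℕ → ℕ) (μ : Forest → ℕ) → μ nil ≡ 0 → (∀ i cs r → μ (node i cs r) ≡ f i + μ cs + μ r) →
             ∀ i → 1 ≤ i → i ≤ n → sumN i (λ v → f v + μ (acc i v)) ≡ sumN n f
  additive f μ μ0 μn i 1≤i i≤n = trans
    (Φ-constant (λ v t → f v + μ t) (λ i cs r _ _ → trans (cong (f (par i) +_) (μn i cs r))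
      (ring 4 (λ a b c d → [] ⊢ a ⊞ (b ⊞ c ⊞ d) ≼ a ⊞ d ⊞ (b ⊞ c)) (f (par i)) (f i) (μ cs) (μ r))) i 1≤i i≤n)
    (Φ-n (λ v t → f v + μ t) f (λ v → trans (cong (f v +_) μ0) (+-identityʳ _)))

  acc-antitone : ∀ (μ : Forest → ℕ) → (∀ i cs r → μ r ≤ μ (node i cs r)) → ∀ i j v → i ≤ j → j ≤ n → μ (acc j v) ≤ μ (acc i v)
  acc-antitone μ h i j v i≤j j≤n = subst (λ z → μ (acc z v) ≤ μ (acc i v)) (m+[n∸m]≡n i≤j)
      (go (j ∸ i) (subst (_≤ n) (sym (m+[n∸m]≡n i≤j)) j≤n))
    where
    one-step : ∀ k → k < n → μ (acc (suc k) v) ≤ μ (acc k v)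
    one-step k k<n with par k Data.Nat.Properties.≟ v
    ... | yes refl = ≤-trans (h k (acc (suc k) k) _) (≤-reflexive (cong μ (sym (acc-par k k<n))))
    ... | no ne    = ≤-reflexive (cong μ (sym (acc-other k v k<n ne)))
    go : ∀ d → i + d ≤ n → μ (acc (i + d) v) ≤ μ (acc i v)
    go zero    _ = ≤-reflexive (cong (λ z → μ (acc z v)) (+-identityʳ i))
    go (suc d) l = ≤-trans (≤-trans (≤-reflexive (cong (λ z → μ (acc z v)) (+-suc i d)))
                     (one-step (i + d) (≤-trans (≤-reflexive (sym (+-suc i d))) l))) (go d (≤-trans (+-monoʳ-≤ i (n≤1+n d)) l))

  -- Course-of-values recursion along the parents: the table of stage `k` is final for all nodes up
  -- to `k`.
  module Down {A : Set} (start : A) (next : ℕ → A → A) where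

    table : ℕ → ℕ → A
    table zero    e = start
    table (suc k) e = upd (table k) (suc k) (next (suc k) (table k (par (suc k)))) e

    down : ℕ → A
    down e = table e e

    private
      table-stable : ∀ k e → e ≤ k → table k e ≡ down e
      table-stable zero    .0 z≤n = refl
      table-stable (suc k) e e≤ with m≤n⇒m<n∨m≡n e≤
      ... | inj₂ refl      = refl
      ... | inj₁ (s≤s e≤k) = trans (upd-other (table k) _ (≢-sym (<⇒≢ (s≤s e≤k)))) (table-stable k e e≤k)

    down-suc : ∀ i → 1 ≤ i → i < n → down i ≡ next i (down (par i))
    down-suc (suc k) 1≤i i<n = trans (upd-same (table k) (suc k) _)
      (cong (next (suc k)) (table-stable k (par (suc k)) (≤-pred (par< (suc k) 1≤i i<n))))

  module _ (lab : ℕ → ℕ) where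

    open Down (add-label (λ _ → false) (lab 0)) (λ i S → add-label S (lab i)) renaming (down to seen; down-suc to seen-suc) public

    distinct : ℕ → ℕ
    distinct e = sumN n (λ ℓ → ind (seen e ℓ))

    private
      count-add : ∀ m S ℓ → ℓ < m → sumN m (λ x → ind (add-label S ℓ x)) ≡ sumN m (λ x → ind (S x)) + ind (not (S ℓ))
      count-add m S ℓ ℓ<m = +-cancelʳ-≡ (ind (S ℓ)) _ _
        (trans (sumN-update m ℓ (λ x → ind (add-label S ℓ x)) (λ x → ind (S x)) ℓ<m other)
          (trans (cong (λ z → sumN m (λ x → ind (S x)) + z) same) (sym (+-assoc (sumN m (λ x → ind (S x))) _ _))))
        where
        other : ∀ v → v < m → v ≢ ℓ → ind (add-label S ℓ v) ≡ ind (S v)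
        other v _ v≢ℓ rewrite ≢⇒≡ᵇ (v≢ℓ ∘ sym) = refl
        same : ind (add-label S ℓ ℓ) ≡ ind (not (S ℓ)) + ind (S ℓ)
        same rewrite ≡ᵇ-refl ℓ with S ℓ
        ... | true  = refl
        ... | false = refl

    distinct-suc : ∀ i → 1 ≤ i → i < n → lab i < n → distinct i ≡ distinct (par i) + ind (not (seen (par i) (lab i)))
    distinct-suc i 1≤i i<n l<n rewrite seen-suc i 1≤i i<n = count-add n (seen (par i)) (lab i) l<n

    distinct-0 : lab 0 < n → distinct 0 ≡ 1
    distinct-0 l<n = trans (count-add n (λ _ → false) (lab 0) l<n) (cong (_+ 1) (sumN-zero n (λ _ _ → refl)))

  module Lower (b : ℕ) (a : ℕ → ℕ) (1≤n : 1 ≤ n) (lab : ℕ → ℕ) (lab< : ∀ v → v < n → lab v < n)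
               (capacity′ : ∀ ℓ → sumN n (λ v → ind (lab v ≡ᵇ ℓ)) ≤ suc b) where

    open Costs b a

    total-mass : a 0 + mass (acc 1 0) ≡ sumN n a
    total-mass = additive a mass refl (λ _ _ _ → refl) 1 ≤-refl 1≤n

    -- A remaining node `v` stands for its own weight and for all mass eliminated into it. This mass
    -- has met `distinct lab v` labels down to `v`, and `paths` adds those that are new below;
    -- elimination only moves such contributions.
    paths-total : distinct lab 0 * (a 0 + mass (acc 1 0)) + paths lab (acc 1 0) (seen lab 0) ≡ sumN n (λ v → a v * distinct lab v)
    paths-total = trans (Φ-constant φ move 1 ≤-refl 1≤n) (Φ-n φ _ (λ v → trans (+-identityʳ _) (trans (cong (distinct lab v *_) (+-identityʳ (a v))) (*-comm (distinct lab v) (a v)))))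
      where
      φ : ℕ → Forest → ℕ
      φ v t = distinct lab v * (a v + mass t) + paths lab t (seen lab v)
      move : ∀ i cs r → 1 ≤ i → i < n → φ (par i) (node i cs r) ≡ φ (par i) r + φ i cs
      move i cs r 1≤i i<n rewrite distinct-suc lab i 1≤i i<n (lab< i i<n) | seen-suc lab i 1≤i i<n =
        ring 8 (λ D ap ai mc mr f pc pr → [] ⊢ D ⊠ (ap ⊞ (ai ⊞ mc ⊞ mr)) ⊞ (f ⊠ (ai ⊞ mc) ⊞ pc ⊞ pr) ≼
                  D ⊠ (ap ⊞ mr) ⊞ pr ⊞ ((D ⊞ f) ⊠ (ai ⊞ mc) ⊞ pc))
          (distinct lab (par i)) (a (par i)) (a i) (mass cs) (mass r) (ind (not (seen lab (par i) (lab i))))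
          (paths lab cs (add-label (seen lab (par i)) (lab i))) (paths lab r (seen lab (par i)))

    labelled-total : ∀ ℓ → ind (lab 0 ≡ᵇ ℓ) + labelled lab ℓ (acc 1 0) ≤ suc b
    labelled-total ℓ = ≤-trans (≤-reflexive (additive (λ v → ind (lab v ≡ᵇ ℓ)) (labelled lab ℓ) refl (λ _ _ _ → refl) 1 ≤-refl 1≤n)) (capacity′ ℓ)

    covered-none : ∀ t → covered lab t (λ _ → false) ≡ 0
    covered-none nil = refl
    covered-none (node i cs r) with big cs
    ... | true  = cong₂ _+_ (covered-none cs) (covered-none r)
    ... | false = covered-none r

    -- Every path meets the block of the root, which gives the first summand; at most `b` cells of
    -- this block remain for other nodes.
    optimum-bound : sumN n a + exact (acc 1 0) b ≤ sumN n (λ v → a v * distinct lab v)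
    optimum-bound = subst₂ _≤_ (cong (_+ exact (acc 1 0) b) total-mass) paths-total
      (+-mono-≤ (≤-reflexive (sym (trans (cong (_* (a 0 + mass (acc 1 0))) (distinct-0 lab (lab< 0 1≤n))) (+-identityʳ _))))
        (≤-trans (decreasing-≤ (proj₁ (exact-facts (acc 1 0))) root-block)
          (exact-lower lab (acc 1 0) (seen lab 0) (λ ℓ → ≤-trans (m≤n+m _ _) (labelled-total ℓ)))))
      where
      root-block : covered lab (acc 1 0) (seen lab 0) ≤ b
      root-block = ≤-trans (covered-add lab (acc 1 0) (λ _ → false) (lab 0))
        (≤-trans (≤-reflexive (cong (_+ labelled lab (lab 0) (acc 1 0)) (covered-none (acc 1 0))))
          (≤-pred (subst (λ z → ind z + labelled lab (lab 0) (acc 1 0) ≤ suc b) (≡ᵇ-refl (lab 0)) (labelled-total (lab 0)))))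

-- Placing the nodes from the root downwards

module TopDown (n : ℕ) (par : ℕ → ℕ) (par< : ∀ i → 1 ≤ i → i < n → par i < i) (1≤n : 1 ≤ n)
               (b c : ℕ) (a : ℕ → ℕ) where

  open Staged n par par<
  open Approximation b c a

  isBig : ℕ → Bool
  isBig v = big (acc (suc v) v)

  -- The big nodes form a connected part at the top of the tree.
  isBig-par : ∀ i → 1 ≤ i → i < n → isBig i ≡ true → isBig (par i) ≡ true
  isBig-par i 1≤i i<n e = Equivalence.to T-≡ (≤⇒≤ᵇ (≤-trans
    (≤ᵇ⇒≤ B (nodes (acc (suc i) i)) (Equivalence.from T-≡ e))
    (≤-trans (≤-trans (m≤n⇒m≤1+n (m≤m+n _ _)) (≤-reflexive (cong nodes (sym (acc-par i i<n)))))
      (acc-antitone nodes (λ j cs r → m≤n⇒m≤1+n (m≤n+m (nodes r) (nodes cs))) (suc (par i)) i (par i) (par< i 1≤i i<n) (<⇒≤ i<n)))))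

  -- The cells kept in the block of `v` for nodes below it that are not placed yet: the share
  -- granted to a big node, or the whole rest of a small subtree.
  free : (ℕ → ℕ) → ℕ → Forest → ℕ
  free rem v t = if isBig v then rem v else nodes t

  occupied : (lab rem : ℕ → ℕ) → ℕ → ℕ → Forest → ℕ
  occupied lab rem ℓ v t = if lab v ≡ᵇ ℓ then suc (free rem v t) else 0

  -- Small subtrees get a block of their own; this block is paid in advance by
  -- every node outside of small subtrees.
  spent : (H rem : ℕ → ℕ) → ℕ → Forest → ℕ
  spent H rem v t = (a v + mass t) * (H v + ind (isBig v)) + (if isBig v then approx t (rem v) else 0)

  W : ℕ
  W = sumN n a

  -- `H v` bounds the number of blocks on the path to `v`. A block is labelled by the node that
  -- opened it, so by `lab≤` the number of the next node is a fresh label.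
  record Top (i : ℕ) (lab H rem : ℕ → ℕ) : Set where
    field
      lab≤  : ∀ v → v < i → lab v ≤ v
      room  : ∀ ℓ → sumN i (λ v → occupied lab rem ℓ v (acc i v)) ≤ B
      cost  : sumN i (λ v → spent H rem v (acc i v)) ≤ W + W + approx (acc 1 0) b
      heads : ∀ v → 1 ≤ v → v < i → (lab v ≡ lab (par v) × H v ≡ H (par v)) ⊎ H v ≡ suc (H (par v))
      head₀ : H 0 ≡ 1
      rem≤  : ∀ v → v < i → isBig v ≡ true → rem v ≤ b

  open Top

  top-start : ∀ lab H rem → lab 0 ≡ 0 → H 0 ≡ 1 → rem 0 ≡ b → Top 1 lab H rem
  top-start lab H rem l h r = record
    { lab≤ = λ { .0 (s≤s z≤n) → ≤-reflexive l }
    ; room = room₁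
    ; cost = cost₁
    ; heads = λ { (suc _) _ (s≤s ()) }
    ; head₀ = h
    ; rem≤ = λ { .0 (s≤s z≤n) _ → ≤-reflexive r } }
    where
    room₁ : ∀ ℓ → occupied lab rem ℓ 0 (acc 1 0) ≤ B
    room₁ ℓ with lab 0 ≡ᵇ ℓ
    ... | false = z≤n
    ... | true with big (acc 1 0) in e
    ...   | true  = s≤s (≤-reflexive r)
    ...   | false = ≰⇒> (λ le → subst T e (≤⇒≤ᵇ le))
    whole : a 0 + mass (acc 1 0) ≡ W
    whole = additive a mass refl (λ _ _ _ → refl) 1 ≤-refl 1≤n
    cost₁ : spent H rem 0 (acc 1 0) ≤ W + W + approx (acc 1 0) b
    -- One `W` is for the block of the root, the other for the block that a big root prepays.
    cost₁ rewrite whole | h | r with big (acc 1 0)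
    ... | true  = +-monoˡ-≤ (approx (acc 1 0) b) (≤-reflexive (ring 1 (λ w → [] ⊢ w ⊠ κ 2 ≼ w ⊞ w) W))
    ... | false = ≤-trans (≤-reflexive (ring 1 (λ w → [] ⊢ w ⊠ κ 1 ⊞ κ 0 ≼ w) W)) (≤-trans (m≤m+n W W) (m≤m+n _ _))

  private
    sum-step : ∀ i p old new → p < i → (∀ v → v < i → v ≢ p → new v ≡ old v) → new p + new i ≤ old p →
               sumN (suc i) new ≤ sumN i old
    sum-step i p old new p<i h le = +-cancelʳ-≤ (old p) _ _
      (lin 5 (λ sn ni op so np → (sn ⊞ op ≼ so ⊞ np) ∷ (np ⊞ ni ≼ op) ∷ [] ⊢ sn ⊞ ni ⊞ op ≼ so ⊞ op)
        (sumN i new) (new i) (old p) (sumN i old) (new p) (≤-reflexive (sumN-update i p new old p<i h)) le)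

  -- For a small node `rem′` stays open: its reserve is the size of its own subtree. The share
  -- computed by the vectors decides between `opens` and `joins`.
  data Move (i k : ℕ) (lab H rem lab′ H′ rem′ : ℕ → ℕ) : Set where
    opens : isBig i ≡ true → amount i (acc (suc i) i) (acc (suc i) (par i)) k ≡ 0 →
            lab′ i ≡ i → H′ i ≡ suc (H (par i)) → rem′ i ≡ b → rem′ (par i) ≡ k → Move i k lab H rem lab′ H′ rem′
    joins : ∀ j → isBig i ≡ true → amount i (acc (suc i) i) (acc (suc i) (par i)) k ≡ suc j →
            lab′ i ≡ lab (par i) → H′ i ≡ H (par i) → rem′ i ≡ j → rem′ (par i) ≡ k ∸ suc j → Move i k lab H rem lab′ H′ rem′
    small : isBig i ≡ false → isBig (par i) ≡ true → rem′ (par i) ≡ k →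
            lab′ i ≡ i → H′ i ≡ suc (H (par i)) → Move i k lab H rem lab′ H′ rem′
    inner : isBig i ≡ false → isBig (par i) ≡ false →
            lab′ i ≡ lab (par i) → H′ i ≡ H (par i) → Move i k lab H rem lab′ H′ rem′

  top-step : ∀ i lab H rem lab′ H′ rem′ → 1 ≤ i → i < n → Top i lab H rem →
    (∀ v → v < i → lab′ v ≡ lab v) → (∀ v → v < i → H′ v ≡ H v) → (∀ v → v < i → v ≢ par i → rem′ v ≡ rem v) →
    Move i (rem (par i)) lab H rem lab′ H′ rem′ → Top (suc i) lab′ H′ rem′
  top-step i lab H rem lab′ H′ rem′ 1≤i i<n top same-lab same-H same-rem move = record
    { lab≤ = lab≤′ ; room = room′ move ; cost = ≤-trans cost′ (cost top) ; heads = heads′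
    ; head₀ = trans (same-H 0 1≤i) (head₀ top) ; rem≤ = rem≤′ }
    where
    p : ℕ
    p = par i
    p<i : p < i
    p<i = par< i 1≤i i<n
    cs r : Forest
    cs = acc (suc i) i
    r  = acc (suc i) p

    new-lab : lab′ i ≤ i
    new-lab = go move
      where
      go : Move i (rem p) lab H rem lab′ H′ rem′ → lab′ i ≤ i
      go (opens _ _ e _ _ _)   = ≤-reflexive e
      go (joins _ _ _ e _ _ _) = ≤-trans (≤-reflexive e) (≤-trans (lab≤ top p p<i) (<⇒≤ p<i))
      go (small _ _ _ e _)     = ≤-reflexive e
      go (inner _ _ e _)       = ≤-trans (≤-reflexive e) (≤-trans (lab≤ top p p<i) (<⇒≤ p<i))

    split : ∀ {Q : ℕ → Set} → (∀ v → v < i → Q v) → Q i → ∀ v → v < suc i → Q v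
    split h hi v v< with m≤n⇒m<n∨m≡n v<
    ... | inj₁ (s≤s v<i) = h v v<i
    ... | inj₂ refl      = hi

    lab≤′ : ∀ v → v < suc i → lab′ v ≤ v
    lab≤′ = split (λ v v<i → ≤-trans (≤-reflexive (same-lab v v<i)) (lab≤ top v v<i)) new-lab

    heads′ : ∀ v → 1 ≤ v → v < suc i → (lab′ v ≡ lab′ (par v) × H′ v ≡ H′ (par v)) ⊎ H′ v ≡ suc (H′ (par v))
    heads′ v 1≤v v< = split {λ v → 1 ≤ v → (lab′ v ≡ lab′ (par v) × H′ v ≡ H′ (par v)) ⊎ H′ v ≡ suc (H′ (par v))} old (λ _ → new move) v v< 1≤v
      where
      old : ∀ v → v < i → 1 ≤ v → (lab′ v ≡ lab′ (par v) × H′ v ≡ H′ (par v)) ⊎ H′ v ≡ suc (H′ (par v))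
      old v v<i 1≤v with par< v 1≤v (<-trans v<i i<n)
      ... | pv<v rewrite same-lab v v<i | same-H v v<i | same-lab (par v) (<-trans pv<v v<i) | same-H (par v) (<-trans pv<v v<i) = heads top v 1≤v v<i
      new : Move i (rem p) lab H rem lab′ H′ rem′ → (lab′ i ≡ lab′ p × H′ i ≡ H′ p) ⊎ H′ i ≡ suc (H′ p)
      new (opens _ _ _ e _ _)    = inj₂ (trans e (cong suc (sym (same-H p p<i))))
      new (joins _ _ _ e f _ _)  = inj₁ (trans e (sym (same-lab p p<i)) , trans f (sym (same-H p p<i)))
      new (small _ _ _ _ e)      = inj₂ (trans e (cong suc (sym (same-H p p<i))))
      new (inner _ _ e f)        = inj₁ (trans e (sym (same-lab p p<i)) , trans f (sym (same-H p p<i)))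

    k≤b : isBig p ≡ true → rem p ≤ b
    k≤b = rem≤ top p p<i

    rem≤′ : ∀ v → v < suc i → isBig v ≡ true → rem′ v ≤ b
    rem≤′ = split {λ v → isBig v ≡ true → rem′ v ≤ b} old (new move)
      where
      old : ∀ v → v < i → isBig v ≡ true → rem′ v ≤ b
      old v v<i e with v Data.Nat.Properties.≟ p
      ... | no v≢p  = ≤-trans (≤-reflexive (same-rem v v<i v≢p)) (rem≤ top v v<i e)
      ... | yes refl = go move
        where
        go : Move i (rem p) lab H rem lab′ H′ rem′ → rem′ p ≤ b
        go (opens _ _ _ _ _ f)   = ≤-trans (≤-reflexive f) (k≤b e)
        go (joins j _ _ _ _ _ f) = ≤-trans (≤-reflexive f) (≤-trans (m∸n≤m (rem p) (suc j)) (k≤b e))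
        go (small _ _ f _ _)     = ≤-trans (≤-reflexive f) (k≤b e)
        go (inner _ f _ _)       = contradiction (trans (sym e) f) (λ ())
      new : Move i (rem p) lab H rem lab′ H′ rem′ → isBig i ≡ true → rem′ i ≤ b
      new (opens _ _ _ _ f _) _     = ≤-reflexive f
      new (joins j g am _ _ f _) _  = ≤-trans (≤-reflexive f) (≤-trans (n≤1+n j) (≤-trans (≤-reflexive (sym am))
        (≤-trans (proj₁ (amount-sound i cs r (rem p) g)) (k≤b (isBig-par i 1≤i i<n g)))))
      new (small f _ _ _ _) e       = contradiction (trans (sym e) f) (λ ())
      new (inner f _ _ _) e         = contradiction (trans (sym e) f) (λ ())

    cost′ : sumN (suc i) (λ v → spent H′ rem′ v (acc (suc i) v)) ≤ sumN i (λ v → spent H rem v (acc i v))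
    cost′ = sum-step i p _ _ p<i
      (λ v v<i v≢p → cong₃′ v (same-H v v<i) (same-rem v v<i v≢p) (sym (acc-other i v i<n (λ e → v≢p (sym e)))))
      (subst (λ t → spent H′ rem′ p r + spent H′ rem′ i cs ≤ spent H rem p t) (sym (acc-par i i<n)) (balance move))
      where
      cong₃′ : ∀ v {t u} → H′ v ≡ H v → rem′ v ≡ rem v → t ≡ u → spent H′ rem′ v t ≡ spent H rem v u
      cong₃′ v h q refl rewrite h | q = refl
      balance : Move i (rem p) lab H rem lab′ H′ rem′ → spent H′ rem′ p r + spent H′ rem′ i cs ≤ spent H rem p (node i cs r)
      -- With `amount` 0 the vector of the child enters as its mass plus the entry `b` of its
      -- children; this mass pays for the new block.
      balance (opens bi am _ h ri rp) with isBig-par i 1≤i i<n bi | amount-sound i cs r (rem p) bi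
      ... | bp | _ , s rewrite am | bi | bp | h | ri | rp | same-H p p<i =
        lin 8 (λ ap ai mc mr H fr fc f → (ai ⊞ mc ⊞ fc ⊞ fr ≼ f) ∷ [] ⊢
                 (ap ⊞ mr) ⊠ (H ⊞ κ 1) ⊞ fr ⊞ ((ai ⊞ mc) ⊠ (κ 1 ⊞ H ⊞ κ 1) ⊞ fc) ≼ (ap ⊞ (ai ⊞ mc ⊞ mr)) ⊠ (H ⊞ κ 1) ⊞ f)
          (a p) (a i) (mass cs) (mass r) (H p) (approx r (rem p)) (approx cs b) _ s
      balance (joins j bi am _ h ri rp) with isBig-par i 1≤i i<n bi | amount-sound i cs r (rem p) bi
      ... | bp | _ , s rewrite am | bi | bp | h | ri | rp | same-H p p<i =
        lin 8 (λ ap ai mc mr H fr fc f → (fc ⊞ fr ≼ f) ∷ [] ⊢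
                 (ap ⊞ mr) ⊠ (H ⊞ κ 1) ⊞ fr ⊞ ((ai ⊞ mc) ⊠ (H ⊞ κ 1) ⊞ fc) ≼ (ap ⊞ (ai ⊞ mc ⊞ mr)) ⊠ (H ⊞ κ 1) ⊞ f)
          (a p) (a i) (mass cs) (mass r) (H p) (approx r (rem p ∸ suc j)) (approx cs j) _ s
      -- The new block is paid with the unit prepaid by the big parent; a small node prepays nothing
      -- itself.
      balance (small bi bp rp _ h) rewrite bi | bp | h | rp | same-H p p<i =
        lin 6 (λ ap ai mc mr H fr → [] ⊢
                 (ap ⊞ mr) ⊠ (H ⊞ κ 1) ⊞ fr ⊞ ((ai ⊞ mc) ⊠ (κ 1 ⊞ H ⊞ κ 0) ⊞ κ 0) ≼ (ap ⊞ (ai ⊞ mc ⊞ mr)) ⊠ (H ⊞ κ 1) ⊞ fr)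
          (a p) (a i) (mass cs) (mass r) (H p) (approx r (rem p))
      balance (inner bi bp _ h) rewrite bi | bp | h | same-H p p<i =
        lin 5 (λ ap ai mc mr H → [] ⊢
                 (ap ⊞ mr) ⊠ (H ⊞ κ 0) ⊞ κ 0 ⊞ ((ai ⊞ mc) ⊠ (H ⊞ κ 0) ⊞ κ 0) ≼ (ap ⊞ (ai ⊞ mc ⊞ mr)) ⊠ (H ⊞ κ 0) ⊞ κ 0)
          (a p) (a i) (mass cs) (mass r) (H p)

    occupied-same : ∀ ℓ v → v < i → v ≢ p → occupied lab′ rem′ ℓ v (acc (suc i) v) ≡ occupied lab rem ℓ v (acc i v)
    occupied-same ℓ v v<i v≢p rewrite same-lab v v<i | same-rem v v<i v≢p | acc-other i v i<n (λ e → v≢p (sym e)) = refl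

    -- Only the summands of `p` and `i` change, so it suffices that both together stay within the
    -- former reserve of `p`.
    share : ∀ ℓ → occupied lab′ rem′ ℓ p r + occupied lab′ rem′ ℓ i cs ≤ occupied lab rem ℓ p (node i cs r) →
            sumN (suc i) (λ v → occupied lab′ rem′ ℓ v (acc (suc i) v)) ≤ B
    share ℓ h = ≤-trans (sum-step i p _ _ p<i (occupied-same ℓ)
      (subst (λ t → occupied lab′ rem′ ℓ p r + occupied lab′ rem′ ℓ i cs ≤ occupied lab rem ℓ p t) (sym (acc-par i i<n)) h)) (room top ℓ)

    fresh : lab′ i ≡ i → isBig p ≡ true → rem′ p ≡ rem p → free rem′ i cs ≤ b → ∀ ℓ →
            sumN (suc i) (λ v → occupied lab′ rem′ ℓ v (acc (suc i) v)) ≤ B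
    fresh li bp rp fi ℓ with i Data.Nat.Properties.≟ ℓ
    ... | no i≢ℓ = share ℓ keep
      where
      keep : occupied lab′ rem′ ℓ p r + occupied lab′ rem′ ℓ i cs ≤ occupied lab rem ℓ p (node i cs r)
      keep rewrite li | ≢⇒≡ᵇ i≢ℓ | same-lab p p<i | bp | rp = ≤-reflexive (+-identityʳ _)
    ... | yes refl = ≤-trans (+-mono-≤ (≤-reflexive (sumN-zero i none)) own) ≤-refl
      where
      none : ∀ v → v < i → occupied lab′ rem′ i v (acc (suc i) v) ≡ 0
      none v v<i rewrite ≢⇒≡ᵇ (<⇒≢ (≤-<-trans (≤-trans (≤-reflexive (same-lab v v<i)) (lab≤ top v v<i)) v<i)) = refl
      own : occupied lab′ rem′ i i cs ≤ B
      own rewrite li | ≡ᵇ-refl i = s≤s fi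

    room′ : Move i (rem p) lab H rem lab′ H′ rem′ → ∀ ℓ → sumN (suc i) (λ v → occupied lab′ rem′ ℓ v (acc (suc i) v)) ≤ B
    room′ (opens bi am li h ri rp) = fresh li (isBig-par i 1≤i i<n bi) rp own
      where
      own : free rem′ i cs ≤ b
      own rewrite bi = ≤-reflexive ri
    room′ (small bi bp rp li h) = fresh li bp rp own
      where
      own : free rem′ i cs ≤ b
      own with big cs in e
      ... | false = ≤-pred (≰⇒> (λ le → subst T e (≤⇒≤ᵇ le)))
    room′ (joins j bi am li h ri rp) ℓ = share ℓ merge
      where
      sj≤ : suc j ≤ rem p
      sj≤ = subst (_≤ rem p) am (proj₁ (amount-sound i cs r (rem p) bi))
      merge : occupied lab′ rem′ ℓ p r + occupied lab′ rem′ ℓ i cs ≤ occupied lab rem ℓ p (node i cs r)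
      merge rewrite li | same-lab p p<i | bi | isBig-par i 1≤i i<n bi | ri | rp with lab p ≡ᵇ ℓ
      ... | true  = ≤-reflexive (cong suc (m∸n+n≡m sj≤))
      ... | false = z≤n
    room′ (inner bi bp li h) ℓ = share ℓ merge
      where
      merge : occupied lab′ rem′ ℓ p r + occupied lab′ rem′ ℓ i cs ≤ occupied lab rem ℓ p (node i cs r)
      merge rewrite li | same-lab p p<i | bi | bp with lab p ≡ᵇ ℓ
      ... | true  = ≤-reflexive (ring 2 (λ x y → [] ⊢ κ 1 ⊞ x ⊞ (κ 1 ⊞ y) ≼ κ 1 ⊞ (κ 1 ⊞ (y ⊞ x))) (nodes r) (nodes cs))
      ... | false = z≤n

  module Finish {lab H rem : ℕ → ℕ} (top : Top n lab H rem) where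

    lab< : ∀ v → v < n → lab v < n
    lab< v v< = ≤-<-trans (lab≤ top v v<) v<

    block-size : ∀ ℓ → sumN n (λ v → ind (lab v ≡ᵇ ℓ)) ≤ B
    block-size ℓ = ≤-trans (sumN-mono n (λ v _ → one′ v)) (room top ℓ)
      where
      one′ : ∀ v → ind (lab v ≡ᵇ ℓ) ≤ occupied lab rem ℓ v (acc n v)
      one′ v with lab v ≡ᵇ ℓ
      ... | true  = s≤s z≤n
      ... | false = z≤n

    distinct-≤ : ∀ v → v < n → distinct lab v ≤ H v
    distinct-≤ v v<n = go (suc v) v ≤-refl v<n
      where
      go : ∀ fuel v → v < fuel → v < n → distinct lab v ≤ H v
      go (suc fuel) zero    _ v<n = ≤-reflexive (trans (distinct-0 lab (lab< 0 v<n)) (sym (head₀ top)))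
      go (suc fuel) v@(suc _) (s≤s v≤) v<n with par< v (s≤s z≤n) v<n
      ... | p<v with go fuel (par v) (≤-trans p<v v≤) (<-trans p<v v<n) | heads top v (s≤s z≤n) v<n
      ...   | ih | inj₂ e = ≤-trans (≤-reflexive (distinct-suc lab v (s≤s z≤n) v<n (lab< v v<n)))
                (≤-trans (+-mono-≤ ih (ind≤1 (not (seen lab (par v) (lab v))))) (≤-reflexive (trans (+-comm (H (par v)) 1) (sym e))))
        where
        ind≤1 : ∀ x → ind x ≤ 1
        ind≤1 true  = ≤-refl
        ind≤1 false = z≤n
      ...   | ih | inj₁ (l , e) = ≤-trans (≤-reflexive (distinct-suc lab v (s≤s z≤n) v<n (lab< v v<n)))
                (≤-trans (≤-reflexive (cong (λ z → distinct lab (par v) + ind (not z)) (trans (cong (seen lab (par v)) l) (own (par v) (<-trans p<v v<n)))))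
                  (≤-trans (≤-reflexive (+-identityʳ _)) (≤-trans ih (≤-reflexive (sym e)))))
        where
        own : ∀ u → u < n → seen lab u (lab u) ≡ true
        own zero    _ rewrite ≡ᵇ-refl (lab 0) = refl
        own u@(suc _) u<n rewrite seen-suc lab u (s≤s z≤n) u<n | ≡ᵇ-refl (lab u) = refl

    cost-≤ : sumN n (λ v → a v * distinct lab v) ≤ W + W + approx (acc 1 0) b
    cost-≤ = ≤-trans (sumN-mono n each) (cost top)
      where
      each : ∀ v → v < n → a v * distinct lab v ≤ spent H rem v (acc n v)
      each v v<n = ≤-trans (*-mono-≤ (m≤m+n (a v) (mass (acc n v))) (≤-trans (distinct-≤ v v<n) (m≤m+n (H v) (ind (isBig v))))) (m≤m+n _ _)

    -- The approximate entry exceeds the exact one by at most `err`, and `W` plus the exact entry is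
    -- a lower bound for every layout. The second `W` is the additive 1 of the result.
    near-optimal : ∀ lab* → (∀ v → v < n → lab* v < n) → (∀ ℓ → sumN n (λ v → ind (lab* v ≡ᵇ ℓ)) ≤ B) →
      Σ ℕ λ e → e * C ≤ W × sumN n (λ v → a v * distinct lab v) ≤ sumN n (λ v → a v * distinct lab* v) + W + e
    near-optimal lab* lab*< cap* = err (acc 1 0) ,
      ≤-trans (err-≤ (acc 1 0)) (≤-trans (m≤n+m _ (a 0)) (≤-reflexive (additive a mass refl (λ _ _ _ → refl) 1 ≤-refl 1≤n))) ,
      lin 6 (λ ours W ap ex e opt → (ours ≼ W ⊞ W ⊞ ap) ∷ (ap ≼ ex ⊞ e) ∷ (W ⊞ ex ≼ opt) ∷ [] ⊢ ours ≼ opt ⊞ W ⊞ e)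
        _ W _ _ (err (acc 1 0)) _ cost-≤ (approx-exact (acc 1 0) b (n≤1+n b)) (Lower.optimum-bound b a 1≤n lab* lab*< cap*)

-- The program

module Names where

  vN vB vM vW vRt vV vU vD vCnt vE vI vP vS vT vG vSl vOf vRx vRy vSw vXs vXo vYs vYo vLo vHi vMm vGr vNs vLast vK vJ vXj vVal vMg vZ vOld vX : ℕ
  vN = 0 ; vB = 1 ; vM = 2 ; vW = 3 ; vRt = 4 ; vV = 5 ; vU = 6 ; vD = 7 ; vCnt = 8 ; vE = 9
  vI = 10 ; vP = 11 ; vS = 12 ; vT = 13 ; vG = 14 ; vSl = 15 ; vOf = 16 ; vRx = 17 ; vRy = 18 ; vSw = 19
  vXs = 20 ; vXo = 21 ; vYs = 22 ; vYo = 23 ; vLo = 24 ; vHi = 25 ; vMm = 26 ; vGr = 27 ; vNs = 28 ; vLast = 29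
  vK = 30 ; vJ = 31 ; vXj = 32 ; vVal = 33 ; vMg = 34 ; vZ = 35 ; vOld = 36 ; vX = 37

  aORD aPOS aPAR aWT aSZ aTAU aBIG aRK aSL aOF aMG aVEC aCH aLAB aREM : ℕ
  aORD = 0 ; aPOS = 1 ; aPAR = 2 ; aWT = 3 ; aSZ = 4 ; aTAU = 5 ; aBIG = 6 ; aRK = 7 ; aSL = 8 ; aOF = 9
  aMG = 10 ; aVEC = 11 ; aCH = 12 ; aLAB = 13 ; aREM = 14

module Code (B V R C : ℕ) where

  open Logic B V R
  open Names

  -- Vectors are stored in rows of aVEC as ring buffers with an offset, so that
  -- prepending an entry takes constant time.
  ring-index : ℕ → Expr
  ring-index z = var z ⊖ (var z ⊘ var vM) ⊛ var vM

  fetchRing : (target row : ℕ) (index : Expr) → Stmt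
  fetchRing x s e = vZ ≔ e ⨾ x ≔ arr aVEC (var s) (ring-index vZ)

  improve : Stmt
  improve =
    fetchRing vVal vYs (var vYo ⊕ (var vK ⊖ var vJ)) ⨾
    vVal ≔ var vXj ⊕ var vVal ⨾
    vOld ≔ arr aVEC (var vNs) (var vK) ⨾
    ite (var vOld ⊖ var vVal) (put aVEC (var vNs) (var vK) (var vVal) ⨾ put aCH (var vI) (var vK) (var vJ)) skip

  -- The inner loop starts at `vJ`, as a candidate that uses `j` cells is of no use below. It is
  -- entered at sampled points only, which makes the time proportional to their number.
  sampleAt : Stmt
  sampleAt =
    fetchRing vXj vXs (var vXo ⊕ var vJ) ⨾
    ite (var vLast ⊖ (var vXj ⊕ var vGr)) (vLast ≔ var vXj ⨾ vK ≔ var vJ ⨾ for vK vM improve) skip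

  firstRow : Stmt
  firstRow =
    fetchRing vVal vYs (var vYo ⊕ var vK) ⨾
    put aVEC (var vNs) (var vK) (var vLast ⊕ var vVal) ⨾
    put aCH (var vI) (var vK) (lit 0)

  convolve : Stmt
  convolve =
    fetchRing vLast vXs (var vXo) ⨾ vK ≔ lit 0 ⨾ for vK vM firstRow ⨾
    vJ ≔ lit 1 ⨾ for vJ vM sampleAt

  pickSides prepareMerge : Stmt
  pickSides =
    vSw ≔ var vRx ⊖ var vRy ⨾
    ite (var vSw)
      (vXs ≔ fld aSL (var vP) ⨾ vXo ≔ fld aOF (var vP) ⨾ vYs ≔ var vSl ⨾ vYo ≔ var vOf ⨾
       vLo ≔ var vRy ⨾ vHi ≔ var vRx ⨾ vMm ≔ fld aTAU (var vP) ⨾ put aMG (var vI) (lit 0) (lit 2))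
      (vXs ≔ var vSl ⨾ vXo ≔ var vOf ⨾ vYs ≔ fld aSL (var vP) ⨾ vYo ≔ fld aOF (var vP) ⨾
       vLo ≔ var vRx ⨾ vHi ≔ var vRy ⨾ vMm ≔ var vT ⨾ put aMG (var vI) (lit 0) (lit 1))
  prepareMerge =
    vGr ≔ var vMm ⊘ (con C ⊛ ((var vLo ⊕ lit 1) ⊛ (var vLo ⊕ lit 2))) ⨾
    vNs ≔ var vN ⊕ var vI

  storeMerge mergeInto : Stmt
  storeMerge =
    -- `h + (l ∸ h)` with truncated subtraction computes the maximum.
    put aRK (var vP) (lit 0) (var vHi ⊕ ((var vLo ⊕ lit 1) ⊖ var vHi)) ⨾
    put aSL (var vP) (lit 0) (var vNs) ⨾
    put aOF (var vP) (lit 0) (lit 0)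
  mergeInto =
    pickSides ⨾ prepareMerge ⨾ convolve ⨾
    storeMerge

  moveInto : Stmt
  moveInto =
    put aRK (var vP) (lit 0) (var vRx) ⨾
    put aSL (var vP) (lit 0) (var vSl) ⨾
    put aOF (var vP) (lit 0) (var vOf)

  -- When a node of rank 0 is reached, its row has never been written and serves as the zero vector.
  locate extend : Stmt
  locate =
    vRx ≔ fld aRK (var vI) ⨾
    ite (var vRx)
      (vSl ≔ fld aSL (var vI) ⨾ vOf ≔ fld aOF (var vI))
      (vRx ≔ lit 1 ⨾ vSl ≔ var vI ⨾ vOf ≔ lit 0)
  extend =
    fetchRing vX vSl (var vOf ⊕ (var vB ⊖ lit 1)) ⨾
    -- Adding `B` steps back by one modulo `B + 1`, so the new entry 0 replaces the old entry `B`.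
    -- The offset is never reduced; it stays within `B` times the number of nodes.
    vOf ≔ var vOf ⊕ var vB ⨾
    put aVEC (var vSl) (ring-index vOf) (var vT ⊕ var vX) ⨾
    vRy ≔ fld aRK (var vP)

  bigNode : Stmt
  bigNode = locate ⨾ extend ⨾ ite (var vRy) mergeInto moveInto

  examine enter settle eliminate : Stmt
  examine =
    vP ≔ fld aPAR (var vI) ⨾
    vS ≔ fld aSZ (var vI) ⊕ lit 1 ⨾
    vT ≔ fld aWT (var vI) ⊕ fld aTAU (var vI) ⨾
    vG ≔ var vS ⊖ var vB ⨾
    put aBIG (var vI) (lit 0) (var vG)
  enter = vI ≔ var vI ⊖ lit 1 ⨾ examine
  settle =
    put aSZ (var vP) (lit 0) (fld aSZ (var vP) ⊕ var vS) ⨾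
    put aTAU (var vP) (lit 0) (fld aTAU (var vP) ⊕ var vT)
  eliminate = enter ⨾ ite (var vG) bigNode skip ⨾ settle

  bottomUp : Stmt
  bottomUp = vI ≔ var vN ⨾ while (var vI ⊖ lit 1) eliminate

  findShare placeBig placeSmall : Stmt
  findShare =
    vK ≔ fld aREM (var vP) ⨾
    vMg ≔ fld aMG (var vI) ⨾
    vJ ≔ var vK ⨾
    ite (var vMg)
      (vJ ≔ arr aCH (var vI) (var vK) ⨾ ite (var vMg ⊖ lit 1) (vJ ≔ var vK ⊖ var vJ) skip) skip
  placeBig =
    findShare ⨾
    put aREM (var vP) (lit 0) (var vK ⊖ var vJ) ⨾
    ite (var vJ)
      (put aLAB (var vI) (lit 0) (fld aLAB (var vP)) ⨾ put aREM (var vI) (lit 0) (var vJ ⊖ lit 1))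
      (put aLAB (var vI) (lit 0) (var vI) ⨾ put aREM (var vI) (lit 0) (var vB ⊖ lit 1))
  placeSmall =
    ite (var vS) (put aLAB (var vI) (lit 0) (var vI)) (put aLAB (var vI) (lit 0) (fld aLAB (var vP)))

  place : Stmt
  place =
    vP ≔ fld aPAR (var vI) ⨾
    vG ≔ fld aBIG (var vI) ⨾
    vS ≔ fld aBIG (var vP) ⨾
    ite (var vG) placeBig placeSmall

  topDown : Stmt
  topDown =
    -- The bottom-up loop does not eliminate the root, so the entry of the root is set here.
    put aBIG (lit 0) (lit 0) ((fld aSZ (lit 0) ⊕ lit 1) ⊖ var vB) ⨾
    put aLAB (lit 0) (lit 0) (lit 0) ⨾
    put aREM (lit 0) (lit 0) (var vB ⊖ lit 1) ⨾
    vI ≔ lit 1 ⨾ for vI vN place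

  parentOf : ℕ → Expr
  parentOf u = raw (lit 2 ⊕ lit 3 ⊛ var u)

  findRoot : Stmt
  findRoot = vV ≔ lit 0 ⨾ for vV vN (vX ≔ parentOf vV ⨾ ite ((var vX ⊖ var vV) ⊕ (var vV ⊖ var vX)) skip (vRt ≔ var vV))

  -- The chain of unnumbered ancestors is walked twice, to find its length and to number it
  -- downwards from the largest number, so that parents receive smaller numbers. Every node gets its
  -- number on one such chain only, whence linear time.
  climb assign : Stmt
  climb = while (lit 1 ⊖ fld aPOS (var vU)) (vD ≔ var vD ⊕ lit 1 ⨾ vU ≔ parentOf vU)
  assign = while (var vD)
    (vD ≔ var vD ⊖ lit 1 ⨾ vE ≔ var vE ⊖ lit 1 ⨾
     put aORD (var vE) (lit 0) (var vU) ⨾ put aPOS (var vU) (lit 0) (var vE ⊕ lit 1) ⨾ vU ≔ parentOf vU)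

  order : Stmt
  order =
    findRoot ⨾
    put aORD (lit 0) (lit 0) (var vRt) ⨾ put aPOS (var vRt) (lit 0) (lit 1) ⨾ vCnt ≔ lit 1 ⨾
    vV ≔ lit 0 ⨾ for vV vN
      (vU ≔ var vV ⨾ vD ≔ lit 0 ⨾ climb ⨾ vE ≔ var vCnt ⊕ var vD ⨾ vCnt ≔ var vE ⨾ vU ≔ var vV ⨾ assign)

  relabel : Stmt
  relabel =
    vW ≔ con C ⊛ (var vN ⊛ var vN) ⨾
    vE ≔ lit 0 ⨾ for vE vN
      (vV ≔ fld aORD (var vE) ⨾ vX ≔ parentOf vV ⨾
       put aPAR (var vE) (lit 0) (fld aPOS (var vX) ⊖ lit 1) ⨾
       put aWT (var vE) (lit 0) (raw (lit 3 ⊕ lit 3 ⊛ var vV) ⊛ var vW ⊘ raw (lit 4 ⊕ lit 3 ⊛ var vV)))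

  output : Stmt
  output = vV ≔ lit 0 ⨾ for vV vN (vX ≔ fld aPOS (var vV) ⊖ lit 1 ⨾ raw≔ (var vV) (fld aLAB (var vX)))

  main : Stmt
  main = vM ≔ var vB ⊕ lit 1 ⨾ order ⨾ relabel ⨾ bottomUp ⨾ topDown ⨾ output

-- Verification of the merge loop

module Convolution (b V R c : ℕ) (X Y : ℕ → ℕ) (g : ℕ)
  (XY≤V : ∀ j k → j ≤ suc b → k ≤ suc b → X j + Y k ≤ V) (Xg≤V : ∀ j → j ≤ suc b → X j + g ≤ V) (m≤V : suc (suc b) ≤ V) where

  B : ℕ
  B = suc b

  open Logic B V R
  open Names
  open Code B V R (suc c)
  open Scan X Y g

  ring-ok : ∀ {z m} → m ≡ suc B → z ≤ V →
            ⟦ div ⟧ z m * m ≤ V × z ∸ ⟦ div ⟧ z m * m ≤ B × z ∸ ⟦ div ⟧ z m * m ≡ z % suc B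
  ring-ok {z} refl z≤ = ≤-trans (m/n*n≤m z (suc B)) z≤ ,
    ≤-trans (≤-reflexive (sym (m%n≡m∸m/n*n z (suc B)))) (≤-pred (m%n<n z (suc B))) , sym (m%n≡m∸m/n*n z (suc B))

  record Sides (m xo yo xs ys ns gr : ℕ) (rowX rowY : ℕ → ℕ) : Set where
    field
      width : m ≡ suc B
      isX   : ∀ k → k ≤ B → rowX ((xo + k) % suc B) ≡ X k
      isY   : ∀ k → k ≤ B → rowY ((yo + k) % suc B) ≡ Y k
      xo≤   : xo + B ≤ V
      yo≤   : yo + B ≤ V
      ns≢xs : ns ≢ xs
      ns≢ys : ns ≢ ys
      isG   : gr ≡ g

  open Sides

  sides : Store → Set
  sides σ = Sides (vr σ vM) (vr σ vXo) (vr σ vYo) (vr σ vXs) (vr σ vYs) (vr σ vNs) (vr σ vGr)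
                  (ar σ aVEC (vr σ vXs)) (ar σ aVEC (vr σ vYs))

  record Local (σ₀ : Store) (ns i : ℕ) (vec ch : ℕ → ℕ → ℕ) : Set where
    field
      vecs : ∀ s → ns ≢ s → vec s ≡ ar σ₀ aVEC s
      chs  : ∀ s → i ≢ s → ch s ≡ ar σ₀ aCH s

  open Local

  Local-refl : ∀ σ ns i → Local σ ns i (ar σ aVEC) (ar σ aCH)
  Local-refl σ ns i = record { vecs = λ _ _ → refl ; chs = λ _ _ → refl }

  Local-vec : ∀ {σ₀ ns i vec ch} row → Local σ₀ ns i vec ch → Local σ₀ ns i (upd vec ns row) ch
  Local-vec {vec = vec} row l = record { vecs = λ s ne → trans (upd-other vec row ne) (vecs l s ne) ; chs = chs l }

  Local-ch : ∀ {σ₀ ns i vec ch} row → Local σ₀ ns i vec ch → Local σ₀ ns i vec (upd ch i row)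
  Local-ch {ch = ch} row l = record { vecs = vecs l ; chs = λ s ne → trans (upd-other ch row ne) (chs l s ne) }

  Sides-vec : ∀ {m xo yo xs ys ns gr} vec row → Sides m xo yo xs ys ns gr (vec xs) (vec ys) →
              Sides m xo yo xs ys ns gr (upd vec ns row xs) (upd vec ns row ys)
  Sides-vec vec row s rewrite upd-other vec row (ns≢xs s) | upd-other vec row (ns≢ys s) = s

  Rows : (vec ch : ℕ → ℕ) → (J K : ℕ → ℕ → Set) → Set
  Rows vec ch J K = ∀ l → l ≤ B → J l (vec l) × K l (ch l)

  private
    -- Sample `suc j` is out of reach for `l ≤ j`, which justifies the start of the inner loop at
    -- `suc j`.
    value-low : ∀ j l → l < suc j → value (suc j) l ≡ value j l × choice (suc j) l ≡ choice j l
    value-low j l (s≤s l≤j) with drops j | j <ᵇ l in e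
    ... | false | _     = refl , refl
    ... | true  | false = refl , refl
    ... | true  | true  = contradiction (<ᵇ⇒< j l (Equivalence.from T-≡ e)) (≤⇒≯ l≤j)

  record Improving (σ₀ : Store) (j k ns i vj xj : ℕ) (vec ch : ℕ → ℕ → ℕ) : Set where
    field
      isJ   : vj ≡ suc j
      isXj  : xj ≡ X (suc j)
      done  : ∀ l → l < k → l ≤ B → vec ns l ≡ value (suc j) l × ch i l ≡ choice (suc j) l
      todo  : ∀ l → k ≤ l → l ≤ B → vec ns l ≡ value j l × ch i l ≡ choice j l
      local : Local σ₀ ns i vec ch

  open Improving

  private
    upd₂ : (f : ℕ → ℕ → ℕ) → ℕ → ℕ → ℕ → ℕ → ℕ → ℕ
    upd₂ f i j x = upd f i (upd (f i) j x)

    upd₂-same : ∀ f i j x l → upd₂ f i j x i l ≡ upd (f i) j x l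
    upd₂-same f i j x l = cong (λ h → h l) (upd-same f i (upd (f i) j x))

    advance : ∀ {σ₀ j k ns i vj xj} vec ch x y → Improving σ₀ j k ns i vj xj vec ch → k ≤ B →
              x ≡ value (suc j) k → y ≡ choice (suc j) k →
              Improving σ₀ j (suc k) ns i vj xj (upd₂ vec ns k x) (upd₂ ch i k y)
    advance {σ₀} {j} {k} {ns} {i} vec ch x y im k≤B ex ey = record
      { isJ = isJ im ; isXj = isXj im ; done = done′ ; todo = todo′
      ; local = Local-ch _ (Local-vec _ (local im)) }
      where
      done′ : ∀ l → l < suc k → l ≤ B → upd₂ vec ns k x ns l ≡ value (suc j) l × upd₂ ch i k y i l ≡ choice (suc j) l
      done′ l l< l≤ rewrite upd₂-same vec ns k x l | upd₂-same ch i k y l with k Data.Nat.Properties.≟ l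
      ... | yes refl rewrite ≡ᵇ-refl k = ex , ey
      ... | no k≢l rewrite ≢⇒≡ᵇ k≢l = done im l (≤∧≢⇒< (≤-pred l<) (k≢l ∘ sym)) l≤
      todo′ : ∀ l → suc k ≤ l → l ≤ B → upd₂ vec ns k x ns l ≡ value j l × upd₂ ch i k y i l ≡ choice j l
      todo′ l k<l l≤ rewrite upd₂-same vec ns k x l | upd₂-same ch i k y l | ≢⇒≡ᵇ (<⇒≢ k<l) = todo im l (<⇒≤ k<l) l≤

    keep : ∀ {σ₀ j k ns i vj xj vec ch} → Improving σ₀ j k ns i vj xj vec ch → k ≤ B →
           value j k ≡ value (suc j) k → choice j k ≡ choice (suc j) k →
           Improving σ₀ j (suc k) ns i vj xj vec ch
    keep {j = j} {k} {ns} {i} {vec = vec} {ch} im k≤B ex ey = record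
      { isJ = isJ im ; isXj = isXj im ; done = done′ ; todo = λ l k<l → todo im l (<⇒≤ k<l) ; local = local im }
      where
      done′ : ∀ l → l < suc k → l ≤ B → vec ns l ≡ value (suc j) l × ch i l ≡ choice (suc j) l
      done′ l l< l≤ with k Data.Nat.Properties.≟ l
      ... | yes refl = let u , v = todo im k ≤-refl k≤B in trans u ex , trans v ey
      ... | no k≢l   = done im l (≤∧≢⇒< (≤-pred l<) (k≢l ∘ sym)) l≤

  improving : Store → ℕ → ℕ → Store → Set
  improving σ₀ j k σ = Improving σ₀ j k (vr σ vNs) (vr σ vI) (vr σ vJ) (vr σ vXj) (ar σ aVEC) (ar σ aCH)

  improve-step : ∀ σ₀ j k σ → drops j ≡ true → suc j ≤ k → k ≤ B → vr σ vK ≡ k → sides σ → improving σ₀ j k σ →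
    Ends improve (λ σ′ → sides σ′ × improving σ₀ j (suc k) σ′) σ
  improve-step σ₀ j k σ dj j<k k≤B refl sd im = ends (
    z≤V , proj₁ rk , proj₁ (proj₂ rk) , subst (_≤ V) (sym new≡) (XY≤V (suc j) (k ∸ suc j) (≤-trans j<k k≤B) kj≤) ,
    k≤B ,
    (λ ne → k≤B , k≤B , Sides-vec (ar σ aVEC) _ sd , advance (ar σ aVEC) (ar σ aCH) _ _ im k≤B
       (trans new≡ (sym (proj₁ (better (m∸n≢0⇒n<m (subst₂ (λ x y → x ∸ y ≢ 0) (proj₁ (todo im k ≤-refl k≤B)) new≡ ne))))))
       (trans (isJ im) (sym (proj₂ (better (m∸n≢0⇒n<m (subst₂ (λ x y → x ∸ y ≢ 0) (proj₁ (todo im k ≤-refl k≤B)) new≡ ne))))))) ,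
    (λ eq → sd , let w = worse (m∸n≡0⇒m≤n (subst₂ (λ x y → x ∸ y ≡ 0) (proj₁ (todo im k ≤-refl k≤B)) new≡ eq)) in
       keep im k≤B (sym (proj₁ w)) (sym (proj₂ w))))
    where
    z : ℕ
    z = vr σ vYo + (k ∸ vr σ vJ)
    kj≤ : k ∸ suc j ≤ B
    kj≤ = ≤-trans (m∸n≤m k (suc j)) k≤B
    z≤V : z ≤ V
    z≤V = ≤-trans (+-monoʳ-≤ (vr σ vYo) (≤-trans (m∸n≤m k (vr σ vJ)) k≤B)) (yo≤ sd)
    rk : ⟦ div ⟧ z (vr σ vM) * vr σ vM ≤ V × z ∸ ⟦ div ⟧ z (vr σ vM) * vr σ vM ≤ B × z ∸ ⟦ div ⟧ z (vr σ vM) * vr σ vM ≡ z % suc B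
    rk = ring-ok (width sd) z≤V
    new≡ : vr σ vXj + ar σ aVEC (vr σ vYs) (z ∸ ⟦ div ⟧ z (vr σ vM) * vr σ vM) ≡ X (suc j) + Y (k ∸ suc j)
    new≡ = cong₂ _+_ (isXj im) (trans (cong (ar σ aVEC (vr σ vYs)) (trans (proj₂ (proj₂ rk)) (cong (λ u → (vr σ vYo + (k ∸ u)) % suc B) (isJ im))))
             (isY sd (k ∸ suc j) kj≤))
    better : X (suc j) + Y (k ∸ suc j) < value j k →
             value (suc j) k ≡ X (suc j) + Y (k ∸ suc j) × choice (suc j) k ≡ suc j
    better lt rewrite dj | Equivalence.to T-≡ (<⇒<ᵇ j<k) | Equivalence.to T-≡ (<⇒<ᵇ lt) = refl , refl
    worse : value j k ≤ X (suc j) + Y (k ∸ suc j) → value (suc j) k ≡ value j k × choice (suc j) k ≡ choice j k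
    worse le rewrite dj | Equivalence.to T-≡ (<⇒<ᵇ j<k) with X (suc j) + Y (k ∸ suc j) <ᵇ value j k in e
    ... | false = refl , refl
    ... | true  = contradiction le (<⇒≱ (<ᵇ⇒< _ _ (Equivalence.from T-≡ e)))

  record Sampled (σ₀ : Store) (j ns i lst : ℕ) (vec ch : ℕ → ℕ → ℕ) : Set where
    field
      isLast : lst ≡ last j
      rows   : ∀ l → l ≤ B → vec ns l ≡ value j l × ch i l ≡ choice j l
      local′ : Local σ₀ ns i vec ch

  open Sampled

  sampled : Store → ℕ → Store → Set
  sampled σ₀ j σ = Sampled σ₀ j (vr σ vNs) (vr σ vI) (vr σ vLast) (ar σ aVEC) (ar σ aCH)

  rowTime : ℕ
  rowTime = suc B * (cost improve + 9)

  private
    last-drop : ∀ j → drops j ≡ true → last (suc j) ≡ X (suc j) × samples (suc j) ≡ suc (samples j)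
    last-drop j e rewrite e = refl , refl

    last-keep : ∀ j → drops j ≡ false → last (suc j) ≡ last j × samples (suc j) ≡ samples j ×
                (∀ l → value (suc j) l ≡ value j l × choice (suc j) l ≡ choice j l)
    last-keep j e rewrite e = refl , refl , λ l → refl , refl

  scanning : Store → ℕ → ℕ → Store → Set
  scanning σ₀ j k σ = sides σ × improving σ₀ j k σ × vr σ vLast ≡ X (suc j)

  SampledBy : Store → ℕ → ℕ → Store → Set
  SampledBy σ₀ t j σ = sides σ × sampled σ₀ (suc j) σ × clk σ + 9 ≤ t + suc j * 60 + samples (suc j) * rowTime

  -- The time is charged as 60 per examined point and a full row per sample. The slack of 9 covers
  -- the increment and the jump of the surrounding loop.
  sample-step : ∀ σ₀ t j σ → suc j ≤ B → vr σ vJ ≡ suc j → sides σ → sampled σ₀ j σ →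
    clk σ ≤ t + j * 60 + samples j * rowTime →
    Ends sampleAt (SampledBy σ₀ t j) (tick 4 σ)
  sample-step σ₀ t j σ j<B vJ≡ sd sp time≤ = ends (
    z≤V , proj₁ rk , proj₁ (proj₂ rk) , subst (_≤ V) (sym xg) (Xg≤V (suc j) j<B) ,
    (λ ne → for-clk vK vM improve (scanning σ₀ j) (suc j) (suc B)
        refl refl refl m≤V _ (m≤n⇒m≤1+n j<B) _ vJ≡ (width sd)
        (λ { k σ′ f refl j<k k<m (sd′ , im , la) → andThen (λ σ″ → scanning σ₀ j (suc k) (setv vK (suc k) (tick 5 σ″)))
             (improve-step σ₀ j k (tick 4 σ′) (isDrop ne) j<k (≤-pred k<m) refl sd′ im)
             (λ σ″ (sd″ , im″) f′ → sd″ , im″ , trans (fv f′ vLast refl) la) })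
        (λ { σ′ f (sd′ , im , la) c → sd′ , record
             { isLast = trans la (sym (proj₁ (last-drop j (isDrop ne))))
             ; rows = λ l l≤ → done im l (s≤s l≤) l≤ ; local′ = local im } ,
             (subst (λ s → clk (tick 5 σ′) + 9 ≤ t + suc j * 60 + s * rowTime) (sym (proj₂ (last-drop j (isDrop ne))))
               (lin 6 (λ c z c₀ t j s → (c ≼ z ⊞ (κ 35 ⊞ c₀)) ∷ (c₀ ≼ t ⊞ j ⊠ κ 60 ⊞ s) ∷ [] ⊢ κ 5 ⊞ c ⊞ κ 9 ≼ t ⊞ (κ 1 ⊞ j) ⊠ κ 60 ⊞ (z ⊞ s))
                 (clk σ′) rowTime (clk σ) t j (samples j * rowTime)
                 (≤-trans c (+-monoˡ-≤ (35 + clk σ) (*-monoˡ-≤ (cost improve + 9) (m∸n≤m (suc B) (suc j))))) time≤)) })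
        (sd , record { isJ = vJ≡ ; isXj = x≡ ; done = low
                     ; todo = λ l _ l≤ → rows sp l l≤ ; local = local′ sp } , x≡)) ,
    (λ eq → let nd = noDrop eq ; la , sa , ro = last-keep j nd in
      sd , record { isLast = trans (isLast sp) (sym la)
                  ; rows = λ l l≤ → let u , v = rows sp l l≤ ; p , q = ro l in trans u (sym p) , trans v (sym q)
                  ; local′ = local′ sp } ,
      subst (λ s → 31 + clk σ + 9 ≤ t + suc j * 60 + s * rowTime) (sym sa)
        (lin 4 (λ c t j s → (c ≼ t ⊞ j ⊠ κ 60 ⊞ s) ∷ [] ⊢ κ 31 ⊞ c ⊞ κ 9 ≼ t ⊞ (κ 1 ⊞ j) ⊠ κ 60 ⊞ s) (clk σ) t j (samples j * rowTime) time≤)))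
    where
    z : ℕ
    z = vr σ vXo + vr σ vJ
    z≤V : z ≤ V
    z≤V = ≤-trans (+-monoʳ-≤ (vr σ vXo) (≤-trans (≤-reflexive vJ≡) j<B)) (xo≤ sd)
    rk : ⟦ div ⟧ z (vr σ vM) * vr σ vM ≤ V × z ∸ ⟦ div ⟧ z (vr σ vM) * vr σ vM ≤ B × z ∸ ⟦ div ⟧ z (vr σ vM) * vr σ vM ≡ z % suc B
    rk = ring-ok (width sd) z≤V
    x≡ : ar σ aVEC (vr σ vXs) (z ∸ ⟦ div ⟧ z (vr σ vM) * vr σ vM) ≡ X (suc j)
    x≡ = trans (cong (ar σ aVEC (vr σ vXs)) (trans (proj₂ (proj₂ rk)) (cong (λ u → (vr σ vXo + u) % suc B) vJ≡))) (isX sd (suc j) j<B)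
    xg : ar σ aVEC (vr σ vXs) (z ∸ ⟦ div ⟧ z (vr σ vM) * vr σ vM) + vr σ vGr ≡ X (suc j) + g
    xg = cong₂ _+_ x≡ (isG sd)
    low : ∀ l → l < suc j → l ≤ B → ar σ aVEC (vr σ vNs) l ≡ value (suc j) l × ar σ aCH (vr σ vI) l ≡ choice (suc j) l
    low l l< l≤ = let u , v = rows sp l l≤ ; p , q = value-low j l l< in trans u (sym p) , trans v (sym q)
    isDrop : vr σ vLast ∸ (ar σ aVEC (vr σ vXs) (z ∸ ⟦ div ⟧ z (vr σ vM) * vr σ vM) + vr σ vGr) ≢ 0 → drops j ≡ true
    isDrop ne = Equivalence.to T-≡ (<⇒<ᵇ (m∸n≢0⇒n<m {last j} {X (suc j) + g} (subst₂ (λ u v → u ∸ v ≢ 0) (isLast sp) xg ne)))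
    noDrop : vr σ vLast ∸ (ar σ aVEC (vr σ vXs) (z ∸ ⟦ div ⟧ z (vr σ vM) * vr σ vM) + vr σ vGr) ≡ 0 → drops j ≡ false
    noDrop eq with drops j in e
    ... | false = refl
    ... | true  = contradiction (m∸n≡0⇒m≤n {last j} {X (suc j) + g} (subst₂ (λ u v → u ∸ v ≡ 0) (isLast sp) xg eq)) (<⇒≱ (<ᵇ⇒< (X (suc j) + g) (last j) (Equivalence.from T-≡ e)))

  record Starting (σ₀ : Store) (k ns i lst : ℕ) (vec ch : ℕ → ℕ → ℕ) : Set where
    field
      isFirst : lst ≡ X 0
      filled  : ∀ l → l < k → vec ns l ≡ X 0 + Y l × ch i l ≡ 0
      local″  : Local σ₀ ns i vec ch

  open Starting

  starting : Store → ℕ → Store → Set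
  starting σ₀ k σ = Starting σ₀ k (vr σ vNs) (vr σ vI) (vr σ vLast) (ar σ aVEC) (ar σ aCH)

  private
    fill-step : ∀ {σ₀ k ns i lst} vec ch {x} → Starting σ₀ k ns i lst vec ch → x ≡ X 0 + Y k →
                Starting σ₀ (suc k) ns i lst (upd₂ vec ns k x) (upd₂ ch i k 0)
    fill-step {σ₀} {k} {ns} {i} vec ch {x} st e = record
      { isFirst = isFirst st ; filled = filled′ ; local″ = Local-ch _ (Local-vec _ (local″ st)) }
      where
      filled′ : ∀ l → l < suc k → upd₂ vec ns k x ns l ≡ X 0 + Y l × upd₂ ch i k 0 i l ≡ 0
      filled′ l l< rewrite upd₂-same vec ns k x l | upd₂-same ch i k 0 l with k Data.Nat.Properties.≟ l
      ... | yes refl rewrite ≡ᵇ-refl k = e , refl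
      ... | no k≢l rewrite ≢⇒≡ᵇ k≢l = filled st l (≤∧≢⇒< (≤-pred l<) (k≢l ∘ sym))

  first-step : ∀ σ₀ k σ → k ≤ B → vr σ vK ≡ k → sides σ → starting σ₀ k σ →
    wp firstRow (λ σ′ → sides σ′ × starting σ₀ (suc k) σ′) σ
  first-step σ₀ k σ k≤B refl sd st =
    z≤V , proj₁ rk , proj₁ (proj₂ rk) , subst (_≤ V) (sym new≡) (XY≤V 0 k z≤n k≤B) , k≤B , k≤B ,
    Sides-vec (ar σ aVEC) _ sd , fill-step (ar σ aVEC) (ar σ aCH) st new≡
    where
    z : ℕ
    z = vr σ vYo + k
    z≤V : z ≤ V
    z≤V = ≤-trans (+-monoʳ-≤ (vr σ vYo) k≤B) (yo≤ sd)
    rk : ⟦ div ⟧ z (vr σ vM) * vr σ vM ≤ V × z ∸ ⟦ div ⟧ z (vr σ vM) * vr σ vM ≤ B × z ∸ ⟦ div ⟧ z (vr σ vM) * vr σ vM ≡ z % suc B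
    rk = ring-ok (width sd) z≤V
    new≡ : vr σ vLast + ar σ aVEC (vr σ vYs) (z ∸ ⟦ div ⟧ z (vr σ vM) * vr σ vM) ≡ X 0 + Y k
    new≡ = cong₂ _+_ (isFirst st) (trans (cong (ar σ aVEC (vr σ vYs)) (proj₂ (proj₂ rk))) (isY sd k k≤B))

  convolveTime : ℕ
  convolveTime = 100 + suc B * (cost firstRow + 9) + B * 60 + samples B * rowTime

  sampling : Store → ℕ → ℕ → Store → Set
  sampling σ₀ t j σ = Σ ℕ λ j′ → j ≡ suc j′ × j′ ≤ B × sides σ × sampled σ₀ j′ σ × clk σ ≤ t + j′ * 60 + samples j′ * rowTime

  convolve-rule : ∀ σ → sides σ → Ends convolve (λ σ′ → sampled σ B σ′ × clk σ′ ≤ clk σ + convolveTime) σ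
  convolve-rule σ sd = ends (
    proj₁ rk , proj₁ (proj₂ rk) ,
    for-clk vK vM firstRow (λ k σ′ → sides σ′ × starting σ k σ′) 0 (suc B) refl refl refl m≤V _ z≤n _ refl (width sd)
      (λ { k σ′ f refl _ k<m (sd′ , st) → first-step σ k (tick 4 σ′) (≤-pred k<m) refl sd′ st })
      (λ σ₁ f₁ (sd₁ , st₁) c₁ →
        for-rule vJ vM sampleAt (sampling σ (6 + clk σ₁))
          1 (suc B) refl refl refl m≤V _ refl (width sd₁)
          (λ { .(suc j′) σ′ f vj _ j<m (j′ , refl , j′≤ , sd′ , sp , c) → andThen (λ σ″ → sampling σ (6 + clk σ₁) (suc (suc j′)) (setv vJ (suc (suc j′)) (tick 5 σ″)))
                 (sample-step σ (6 + clk σ₁) j′ σ′ (≤-pred j<m) vj sd′ sp c)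
                 (λ σ″ (sd″ , sp″ , c″) _ → suc j′ , refl , ≤-pred j<m , sd″ , sp″ ,
                    lin 2 (λ c x → (c ⊞ κ 9 ≼ x) ∷ [] ⊢ κ 5 ⊞ c ≼ x) (clk σ″) (6 + clk σ₁ + suc j′ * 60 + samples (suc j′) * rowTime) c″) })
          (λ { .(suc j′) σ′ f vj _ m≤j (j′ , refl , j′≤ , sd′ , sp , c) →
                 finish σ′ j′ (≤-antisym j′≤ (≤-pred m≤j)) sp c c₁ })
          (0 , refl , z≤n , sd₁ , record { isLast = isFirst st₁ ; rows = λ l l≤ → filled st₁ l (s≤s l≤) ; local′ = local″ st₁ } ,
             lin 2 (λ x y → [] ⊢ κ 6 ⊞ x ≼ κ 6 ⊞ x ⊞ κ 0 ⊞ κ 0) (clk σ₁) 0))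
      (sd , record { isFirst = x≡ ; filled = λ _ () ; local″ = Local-refl σ _ _ }))
    where
    z : ℕ
    z = vr σ vXo
    rk : ⟦ div ⟧ z (vr σ vM) * vr σ vM ≤ V × z ∸ ⟦ div ⟧ z (vr σ vM) * vr σ vM ≤ B × z ∸ ⟦ div ⟧ z (vr σ vM) * vr σ vM ≡ z % suc B
    rk = ring-ok (width sd) (≤-trans (m≤m+n z B) (xo≤ sd))
    x≡ : ar σ aVEC (vr σ vXs) (z ∸ ⟦ div ⟧ z (vr σ vM) * vr σ vM) ≡ X 0
    x≡ = trans (cong (ar σ aVEC (vr σ vXs)) (trans (proj₂ (proj₂ rk)) (cong (_% suc B) (sym (+-identityʳ z))))) (isX sd 0 z≤n)
    finish : ∀ {c₁} σ′ j → j ≡ B → sampled σ j σ′ → clk σ′ ≤ 6 + c₁ + j * 60 + samples j * rowTime →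
             c₁ ≤ suc B * (cost firstRow + 9) + (21 + clk σ) → sampled σ B (tick 4 σ′) × clk (tick 4 σ′) ≤ clk σ + convolveTime
    finish {c₁} σ′ j refl sp c c≤ = sp ,
      lin 6 (λ c c₁ a c₀ d e → (c ≼ κ 6 ⊞ c₁ ⊞ d ⊞ e) ∷ (c₁ ≼ a ⊞ (κ 21 ⊞ c₀)) ∷ [] ⊢ κ 4 ⊞ c ≼ c₀ ⊞ (κ 100 ⊞ a ⊞ d ⊞ e))
        (clk σ′) c₁ (suc B * (cost firstRow + 9)) (clk σ) (B * 60) (samples B * rowTime) c c≤

-- The bottom-up pass: vectors in ring buffers

ring-distinct : ∀ B o {x y} → x ≤ B → y ≤ B → (o + x) % suc B ≡ (o + y) % suc B → x ≡ y
ring-distinct B o {x} {y} x≤ y≤ e = trans (sym (back x x≤)) (trans (cong (λ z → (z + s % suc B) % suc B) e) (back y y≤))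
  where
  s : ℕ
  -- The inverse of the offset modulo `suc B`: adding it recovers `x`.
  s = suc B ∸ o % suc B
  back : ∀ x → x ≤ B → ((o + x) % suc B + s % suc B) % suc B ≡ x
  back x x≤ = trans (sym (%-distribˡ-+ (o + x) s (suc B))) (trans (cong (_% suc B) reorder)
    (trans ([m+kn]%n≡m%n x (suc (o / suc B)) (suc B)) (m<n⇒m%n≡m (s≤s x≤))))
    where
    reorder : o + x + s ≡ x + suc (o / suc B) * suc B
    reorder = trans (cong (λ z → z + x + s) (m≡m%n+[m/n]*n o (suc B)))
      (trans (ring 4 (λ r q x s → [] ⊢ r ⊞ q ⊞ x ⊞ s ≼ x ⊞ ((r ⊞ s) ⊞ q)) (o % suc B) (o / suc B * suc B) x s)
        (cong (λ z → x + (z + o / suc B * suc B)) (m+[n∸m]≡n (<⇒≤ (m%n<n o (suc B))))))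

ring-next : ∀ B o k → (o + B + suc k) % suc B ≡ (o + k) % suc B
ring-next B o k = trans (cong (_% suc B) (ring 3 (λ o B k → [] ⊢ o ⊞ B ⊞ (κ 1 ⊞ k) ≼ o ⊞ k ⊞ κ 1 ⊠ (κ 1 ⊞ B)) o B k)) ([m+kn]%n≡m%n (o + k) 1 (suc B))

unitCost : (k₁ k₂ k₃ f g C : ℕ) → ℕ
unitCost k₁ k₂ k₃ f g C = 160 + f + C * g + (k₁ + k₂ + k₃)

-- `suc P` stands for `(l + 1)(l + 2)` and `s` for the number of samples. The 160 combines the fixed
-- 100 with the 60 per examined point.
unitCost-bound : ∀ k₁ k₂ k₃ f g C B P s → s ≤ C * suc P →
  k₁ + (k₂ + (100 + suc B * f + B * 60 + s * (suc B * g) + k₃)) ≤ suc B * (unitCost k₁ k₂ k₃ f g C * suc P)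
unitCost-bound k₁ k₂ k₃ f g C B P s h =
  lin 9 (λ k₁ k₂ k₃ f g C B P s →
      (s ⊠ ((κ 1 ⊞ B) ⊠ g) ≼ C ⊠ (κ 1 ⊞ P) ⊠ ((κ 1 ⊞ B) ⊠ g)) ∷ [] ⊢
      k₁ ⊞ (k₂ ⊞ (κ 100 ⊞ (κ 1 ⊞ B) ⊠ f ⊞ B ⊠ κ 60 ⊞ s ⊠ ((κ 1 ⊞ B) ⊠ g) ⊞ k₃)) ≼
      (κ 1 ⊞ B) ⊠ ((κ 160 ⊞ f ⊞ C ⊠ g ⊞ (k₁ ⊞ k₂ ⊞ k₃)) ⊠ (κ 1 ⊞ P)))
    k₁ k₂ k₃ f g C B P s (*-monoˡ-≤ (suc B * g) h)

module BottomUp (n : ℕ) (par : ℕ → ℕ) (par< : ∀ i → 1 ≤ i → i < n → par i < i) (1≤n : 1 ≤ n)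
                (b c : ℕ) (a : ℕ → ℕ) (V R : ℕ) (8≤V : 8 ≤ V)
                (n≤V : 2 * n + 2 ≤ V) (weights≤V : suc n * sumN n a ≤ V) (offsets≤V : suc b * suc n ≤ V)
                (m≤V : suc (suc b) ≤ V) (quota≤V : suc c * (suc n * suc (suc n)) ≤ V) where

  open Staged n par par<
  open Approximation b c a
  open Logic B V R
  open Names
  open Code B V R C

  Cells Rows₂ : Set
  Cells = ℕ → ℕ → ℕ
  Rows₂ = ℕ → ℕ → ℕ

  record Inputs (n′ B′ m′ : ℕ) (PAR WT : Cells) : Set where
    field
      isN  : n′ ≡ n
      isB  : B′ ≡ B
      isM  : m′ ≡ suc B
      isP  : ∀ v → 1 ≤ v → v < n → PAR v 0 ≡ par v
      isW  : ∀ v → v < n → WT v 0 ≡ a v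

  inputs : Store → Set
  inputs σ = Inputs (vr σ vN) (vr σ vB) (vr σ vM) (ar σ aPAR) (ar σ aWT)

  record Sums (i : ℕ) (SZ TAU : Cells) : Set where
    field
      isSize : ∀ v → v < i → SZ v 0 ≡ nodes (acc i v)
      isMass : ∀ v → v < i → TAU v 0 ≡ mass (acc i v)

  -- The vector of v < i is that of the forest f v; lim bounds the row numbers
  -- in use, where rows n + v hold the results of merges.
  record Vectors (i lim : ℕ) (f : ℕ → Forest) (RK SL OF VEC : Cells) : Set where
    field
      isRank : ∀ v → v < i → RK v 0 ≡ rank (f v)
      isVec  : ∀ v → v < i → rank (f v) ≢ 0 → ∀ k → k ≤ B → VEC (SL v 0) ((OF v 0 + k) % suc B) ≡ approx (f v) k
      offset : ∀ v → v < i → rank (f v) ≢ 0 → OF v 0 ≤ B * nodes (f v)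
      slot   : ∀ v → v < i → rank (f v) ≢ 0 → lim ≤ SL v 0 × (SL v 0 < n ⊎ n + lim ≤ SL v 0)
      apart  : ∀ u v → u < i → v < i → rank (f u) ≢ 0 → rank (f v) ≢ 0 → u ≢ v → SL u 0 ≢ SL v 0
      zeros  : ∀ s → s < i → ∀ l → VEC s l ≡ 0

  open Inputs
  open Sums
  open Vectors

  vectors : ℕ → ℕ → (ℕ → Forest) → Store → Set
  vectors i lim f σ = Vectors i lim f (ar σ aRK) (ar σ aSL) (ar σ aOF) (ar σ aVEC)

  record Own (i : ℕ) (F : ℕ → ℕ) (size′ : ℕ) (f : ℕ → Forest) (sl of′ : ℕ) (SL VEC : Cells) : Set where
    field
      ownVec    : ∀ k → k ≤ B → VEC sl ((of′ + k) % suc B) ≡ F k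
      ownOffset : of′ ≤ B * size′
      ownSlot   : i ≤ sl × (sl < n ⊎ n + suc i ≤ sl)
      ownApart  : ∀ v → v < i → rank (f v) ≢ 0 → SL v 0 ≢ sl

  open Own

  Vectors-restrict : ∀ {i f RK SL OF VEC} → Vectors (suc i) (suc i) f RK SL OF VEC → Vectors i (suc i) f RK SL OF VEC
  Vectors-restrict vs = record
    { isRank = λ v v< → isRank vs v (m≤n⇒m≤1+n v<) ; isVec = λ v v< → isVec vs v (m≤n⇒m≤1+n v<)
    ; offset = λ v v< → offset vs v (m≤n⇒m≤1+n v<) ; slot = λ v v< → slot vs v (m≤n⇒m≤1+n v<)
    ; apart = λ u v u< v< → apart vs u v (m≤n⇒m≤1+n u<) (m≤n⇒m≤1+n v<) ; zeros = λ s s< → zeros vs s (m≤n⇒m≤1+n s<) }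

  Located : (i : ℕ) (rx sl of′ : ℕ) (RK SL OF VEC : Cells) → Set
  Located i rx sl of′ RK SL OF VEC =
    rx ≡ childRank (rank (acc (suc i) i)) ×
    Own i (approx (acc (suc i) i)) (nodes (acc (suc i) i)) (acc (suc i)) sl of′ SL VEC ×
    Vectors i (suc i) (acc (suc i)) RK SL OF VEC

  located : ℕ → Store → Set
  located i σ = Located i (vr σ vRx) (vr σ vSl) (vr σ vOf) (ar σ aRK) (ar σ aSL) (ar σ aOF) (ar σ aVEC)

  locate-rule : ∀ i σ → vr σ vI ≡ i → i < n → vectors (suc i) (suc i) (acc (suc i)) σ → Ends locate (located i) σ
  locate-rule i σ refl i<n vs = ends (
    (λ ne → let ne′ = λ z → ne (trans (isRank vs i ≤-refl) z) ; s₁ , s₂ = slot vs i ≤-refl ne′ in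
      trans (isRank vs i ≤-refl) (sym (m≤n⇒m⊔n≡n (n≢0⇒n>0 ne′))) ,
      record { ownVec = isVec vs i ≤-refl ne′ ; ownOffset = offset vs i ≤-refl ne′
             ; ownSlot = <⇒≤ s₁ , s₂
             ; ownApart = λ v v< nv → apart vs v i (m≤n⇒m≤1+n v<) ≤-refl nv ne′ (<⇒≢ v<) } ,
      Vectors-restrict vs) ,
    (λ eq → let z = trans (sym (isRank vs i ≤-refl)) eq in
      cong childRank (sym z) ,
      record { ownVec = λ k _ → trans (zeros vs i ≤-refl _) (sym (approx-rank0 (acc (suc i) i) k z)) ; ownOffset = z≤n
             ; ownSlot = ≤-refl , inj₁ i<n
             ; ownApart = λ v v< nv e → <⇒≢ (≤-trans ≤-refl (proj₁ (slot vs v (m≤n⇒m≤1+n v<) nv))) (sym e) } ,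
      Vectors-restrict vs))

  ring-ok : ∀ {z m} → m ≡ suc B → z ≤ V →
            ⟦ div ⟧ z m * m ≤ V × z ∸ ⟦ div ⟧ z m * m ≤ B × z ∸ ⟦ div ⟧ z m * m ≡ z % suc B
  ring-ok {z} refl z≤ = ≤-trans (m/n*n≤m z (suc B)) z≤ ,
    ≤-trans (≤-reflexive (sym (m%n≡m∸m/n*n z (suc B)))) (≤-pred (m%n<n z (suc B))) , sym (m%n≡m∸m/n*n z (suc B))

  Extended : (i : ℕ) (rx ry sl of′ : ℕ) (RK SL OF VEC : Cells) → Set
  Extended i rx ry sl of′ RK SL OF VEC =
    rx ≡ childRank (rank (acc (suc i) i)) ×
    ry ≡ rank (acc (suc i) (par i)) ×
    Own i (above i (acc (suc i) i)) (suc (nodes (acc (suc i) i))) (acc (suc i)) sl of′ SL VEC ×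
    Vectors i (suc i) (acc (suc i)) RK SL OF VEC

  extended : ℕ → Store → Set
  extended i σ = Extended i (vr σ vRx) (vr σ vRy) (vr σ vSl) (vr σ vOf) (ar σ aRK) (ar σ aSL) (ar σ aOF) (ar σ aVEC)

  nodes-≤ : ∀ i → 1 ≤ i → i < n → suc (nodes (acc (suc i) i) + nodes (acc (suc i) (par i))) ≤ n
  nodes-≤ i 1≤i i<n = ≤-trans (≤-trans (≤-reflexive (cong nodes (sym (acc-par i i<n))))
    (≤-trans (m≤n+m (nodes (acc i (par i))) 1) (sumN-≥ i (λ v → 1 + nodes (acc i v)) (par i) (par< i 1≤i i<n))))
    (≤-trans (≤-reflexive (additive (λ _ → 1) nodes refl (λ _ _ _ → refl) i 1≤i (<⇒≤ i<n))) (≤-reflexive (count n)))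
    where
    count : ∀ n → sumN n (λ _ → 1) ≡ n
    count zero    = refl
    count (suc n) = trans (cong (_+ 1) (count n)) (+-comm n 1)

  mass-≤ : ∀ i → 1 ≤ i → i < n → a i + mass (acc (suc i) i) + mass (acc (suc i) (par i)) ≤ sumN n a
  mass-≤ i 1≤i i<n = ≤-trans (≤-trans (≤-reflexive (cong mass (sym (acc-par i i<n))))
    (≤-trans (m≤n+m (mass (acc i (par i))) (a (par i))) (sumN-≥ i (λ v → a v + mass (acc i v)) (par i) (par< i 1≤i i<n))))
    (≤-reflexive (additive a mass refl (λ _ _ _ → refl) i 1≤i (<⇒≤ i<n)))

  approx≤V : ∀ i → 1 ≤ i → i < n → ∀ j k → above i (acc (suc i) i) j + approx (acc (suc i) (par i)) k ≤ n * sumN n a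
  approx≤V i 1≤i i<n j k = ≤-trans
    (+-mono-≤ (above-≤ i (acc (suc i) i) _ (≤-trans (m≤m+n _ (mass (acc (suc i) (par i)))) (mass-≤ i 1≤i i<n)) j)
              (approx-≤ (acc (suc i) (par i)) _ (≤-trans (m≤n+m _ _) (mass-≤ i 1≤i i<n)) k))
    (≤-trans (≤-reflexive (sym (*-distribʳ-+ (sumN n a) (suc (nodes (acc (suc i) i))) (nodes (acc (suc i) (par i))))))
      (*-monoˡ-≤ (sumN n a) (nodes-≤ i 1≤i i<n)))

  extend-rule : ∀ i σ → vr σ vI ≡ i → 1 ≤ i → i < n → vr σ vP ≡ par i → vr σ vT ≡ a i + mass (acc (suc i) i) →
    inputs σ → located i σ → Ends extend (extended i) σ
  extend-rule i σ refl 1≤i i<n p≡ t≡ inp (rx≡ , own , vs) = ends (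
    z≤V , proj₁ rk , proj₁ (proj₂ rk) , z′≤V ,
    proj₁ rk′ , subst (_≤ V) (sym x≡) x≤V , proj₁ (proj₂ rk′) ,
    rx≡ , trans (cong (λ u → ar σ aRK u 0) p≡) (isRank vs (par i) (par< i 1≤i i<n)) ,
    record { ownVec = vec′ ; ownOffset = ≤-trans (≤-reflexive (cong (vr σ vOf +_) (isB inp)))
               (lin 3 (λ o B N → (o ≼ B ⊠ N) ∷ [] ⊢ o ⊞ B ≼ B ⊠ (κ 1 ⊞ N)) (vr σ vOf) B (nodes cs) (ownOffset own))
           ; ownSlot = ownSlot own ; ownApart = ownApart own } ,
    record { isRank = isRank vs
           ; isVec = λ v v< nv k k≤ → trans (cong (λ h → h ((ar σ aOF v 0 + k) % suc B)) (upd-other (ar σ aVEC) _ (λ e → ownApart own v v< nv (sym e)))) (isVec vs v v< nv k k≤)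
           ; offset = offset vs ; slot = slot vs ; apart = apart vs
           ; zeros = λ s s< l → trans (cong (λ h → h l) (upd-other (ar σ aVEC) _ (λ e → <⇒≱ s< (≤-trans (proj₁ (ownSlot own)) (≤-reflexive e))))) (zeros vs s s< l) })
    where
    cs : Forest
    cs = acc (suc i) i
    N≤n : suc (nodes cs) ≤ n
    N≤n = ≤-trans (s≤s (m≤m+n _ _)) (nodes-≤ i 1≤i i<n)
    z z′ : ℕ
    z = vr σ vOf + (vr σ vB ∸ 1)
    z′ = vr σ vOf + vr σ vB
    z′≤V : z′ ≤ V
    z′≤V = ≤-trans (≤-reflexive (cong (vr σ vOf +_) (isB inp))) (≤-trans (lin 4 (λ o B N n → (o ≼ B ⊠ N) ∷ (B ⊠ N ≼ B ⊠ n) ∷ [] ⊢ o ⊞ B ≼ B ⊠ (κ 1 ⊞ n))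
      (vr σ vOf) B (nodes cs) n (ownOffset own) (*-monoʳ-≤ B (≤-trans (n≤1+n _) N≤n))) offsets≤V)
    z≤V : z ≤ V
    z≤V = ≤-trans (+-monoʳ-≤ (vr σ vOf) (m∸n≤m (vr σ vB) 1)) z′≤V
    rk : ⟦ div ⟧ z (vr σ vM) * vr σ vM ≤ V × z ∸ ⟦ div ⟧ z (vr σ vM) * vr σ vM ≤ B × z ∸ ⟦ div ⟧ z (vr σ vM) * vr σ vM ≡ z % suc B
    rk = ring-ok (isM inp) z≤V
    rk′ : ⟦ div ⟧ z′ (vr σ vM) * vr σ vM ≤ V × z′ ∸ ⟦ div ⟧ z′ (vr σ vM) * vr σ vM ≤ B × z′ ∸ ⟦ div ⟧ z′ (vr σ vM) * vr σ vM ≡ z′ % suc B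
    rk′ = ring-ok (isM inp) z′≤V
    x≡ : vr σ vT + ar σ aVEC (vr σ vSl) (z ∸ ⟦ div ⟧ z (vr σ vM) * vr σ vM) ≡ above i cs 0
    x≡ = cong₂ _+_ t≡ (trans (cong (ar σ aVEC (vr σ vSl)) (trans (proj₂ (proj₂ rk)) (cong (λ u → (vr σ vOf + (u ∸ 1)) % suc B) (isB inp))))
           (ownVec own b (n≤1+n b)))
    x≤V : above i cs 0 ≤ V
    x≤V = ≤-trans (≤-trans (m≤m+n _ _) (approx≤V i 1≤i i<n 0 0)) (≤-trans (m≤n+m _ (sumN n a)) weights≤V)
    vec′ : ∀ k → k ≤ B → upd (ar σ aVEC) (vr σ vSl) (upd (ar σ aVEC (vr σ vSl)) (z′ ∸ ⟦ div ⟧ z′ (vr σ vM) * vr σ vM)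
             (vr σ vT + ar σ aVEC (vr σ vSl) (z ∸ ⟦ div ⟧ z (vr σ vM) * vr σ vM))) (vr σ vSl) ((z′ + k) % suc B) ≡ above i cs k
    vec′ k k≤ rewrite upd-same (ar σ aVEC) (vr σ vSl) (upd (ar σ aVEC (vr σ vSl)) (z′ ∸ ⟦ div ⟧ z′ (vr σ vM) * vr σ vM)
             (vr σ vT + ar σ aVEC (vr σ vSl) (z ∸ ⟦ div ⟧ z (vr σ vM) * vr σ vM))) | proj₂ (proj₂ rk′) = entry k k≤
      where
      entry : ∀ k → k ≤ B → upd (ar σ aVEC (vr σ vSl)) (z′ % suc B) (vr σ vT + ar σ aVEC (vr σ vSl) (z ∸ ⟦ div ⟧ z (vr σ vM) * vr σ vM)) ((z′ + k) % suc B) ≡ above i cs k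
      entry zero k≤ rewrite +-identityʳ z′ = trans (upd-same (ar σ aVEC (vr σ vSl)) (z′ % suc B) _) x≡
      -- The new entry `suc k` is the old entry `k < B`, whereas the cell just overwritten held the
      -- old entry `B`.
      entry (suc k) (s≤s k≤) = trans (upd-other (ar σ aVEC (vr σ vSl)) _ differ) (trans (cong (ar σ aVEC (vr σ vSl)) next) (ownVec own k (m≤n⇒m≤1+n k≤)))
        where
        next : (z′ + suc k) % suc B ≡ (vr σ vOf + k) % suc B
        next = trans (cong (λ u → (vr σ vOf + u + suc k) % suc B) (isB inp)) (ring-next B (vr σ vOf) k)
        differ : z′ % suc B ≢ (z′ + suc k) % suc B
        differ e = <⇒≢ (s≤s k≤) (ring-distinct B (vr σ vOf) (m≤n⇒m≤1+n k≤) ≤-refl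
          (trans (sym next) (trans (sym e) (cong (λ u → (vr σ vOf + u) % suc B) (isB inp)))))

  cells : Cells → ℕ → ℕ → Cells
  cells f p x = upd f p (upd (f p) 0 x)

  cells-same : ∀ f p x → cells f p x p 0 ≡ x
  cells-same f p x = cong (λ h → h 0) (upd-same f p (upd (f p) 0 x))

  cells-other : ∀ f p x {v} → p ≢ v → cells f p x v 0 ≡ f v 0
  cells-other f p x ne = cong (λ h → h 0) (upd-other f (upd (f p) 0 x) ne)

  -- Common to both ways in which the parent obtains a vector: taking over the one of the child, and
  -- storing a merge in the fresh row `n + i`.
  install : ∀ {i RK SL OF VEC} rk sl of′ → 1 ≤ i → i < n → Vectors i (suc i) (acc (suc i)) RK SL OF VEC →
    rk ≡ rank (acc i (par i)) →
    (∀ k → k ≤ B → VEC sl ((of′ + k) % suc B) ≡ approx (acc i (par i)) k) →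
    of′ ≤ B * nodes (acc i (par i)) → i ≤ sl × (sl < n ⊎ n + i ≤ sl) →
    (∀ v → v < i → v ≢ par i → rank (acc (suc i) v) ≢ 0 → SL v 0 ≢ sl) →
    Vectors i i (acc i) (cells RK (par i) rk) (cells SL (par i) sl) (cells OF (par i) of′) VEC
  install {i} {RK} {SL} {OF} {VEC} rk sl of′ 1≤i i<n vs rk≡ vec≡ of≤ slot≡ apart≡ = record
    { isRank = at-p (λ v → cells RK p rk v 0 ≡ rank (acc i v)) (trans (cells-same RK p rk) rk≡)
        (λ v v< ne → trans (cells-other RK p rk ne) (trans (isRank vs v v<) (cong rank (sym (same v ne)))))
    ; isVec = at-p (λ v → rank (acc i v) ≢ 0 → ∀ k → k ≤ B → VEC (cells SL p sl v 0) ((cells OF p of′ v 0 + k) % suc B) ≡ approx (acc i v) k)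
        (λ _ k k≤ → trans (cong₂ (λ s o → VEC s ((o + k) % suc B)) (cells-same SL p sl) (cells-same OF p of′)) (vec≡ k k≤))
        (λ v v< ne nz k k≤ → trans (cong₂ (λ s o → VEC s ((o + k) % suc B)) (cells-other SL p sl ne) (cells-other OF p of′ ne))
          (trans (isVec vs v v< (old v ne nz) k k≤) (cong (λ t → approx t k) (sym (same v ne)))))
    ; offset = at-p (λ v → rank (acc i v) ≢ 0 → cells OF p of′ v 0 ≤ B * nodes (acc i v))
        (λ _ → ≤-trans (≤-reflexive (cells-same OF p of′)) of≤)
        (λ v v< ne nz → ≤-trans (≤-reflexive (cells-other OF p of′ ne)) (≤-trans (offset vs v v< (old v ne nz)) (≤-reflexive (cong (λ t → B * nodes t) (sym (same v ne))))))
    ; slot = at-p (λ v → rank (acc i v) ≢ 0 → i ≤ cells SL p sl v 0 × (cells SL p sl v 0 < n ⊎ n + i ≤ cells SL p sl v 0))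
        (λ _ → subst (λ s → i ≤ s × (s < n ⊎ n + i ≤ s)) (sym (cells-same SL p sl)) slot≡)
        (λ v v< ne nz → subst (λ s → i ≤ s × (s < n ⊎ n + i ≤ s)) (sym (cells-other SL p sl ne)) (weaken (slot vs v v< (old v ne nz))))
    ; apart = apart′
    ; zeros = zeros vs }
    where
    p : ℕ
    p = par i
    same : ∀ v → p ≢ v → acc i v ≡ acc (suc i) v
    same v = acc-other i v i<n
    old : ∀ v → p ≢ v → rank (acc i v) ≢ 0 → rank (acc (suc i) v) ≢ 0
    old v ne nz z = nz (trans (cong rank (same v ne)) z)
    at-p : (Q : ℕ → Set) → Q p → (∀ v → v < i → p ≢ v → Q v) → ∀ v → v < i → Q v
    at-p Q q h v v< with p Data.Nat.Properties.≟ v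
    ... | yes refl = q
    ... | no ne    = h v v< ne
    weaken : ∀ {s} → suc i ≤ s × (s < n ⊎ n + suc i ≤ s) → i ≤ s × (s < n ⊎ n + i ≤ s)
    weaken (x , inj₁ y) = <⇒≤ x , inj₁ y
    weaken (x , inj₂ y) = <⇒≤ x , inj₂ (≤-trans (+-monoʳ-≤ n (n≤1+n i)) y)
    apart′ : ∀ u v → u < i → v < i → rank (acc i u) ≢ 0 → rank (acc i v) ≢ 0 → u ≢ v → cells SL p sl u 0 ≢ cells SL p sl v 0
    apart′ u v u< v< nu nv u≢v with p Data.Nat.Properties.≟ u | p Data.Nat.Properties.≟ v
    ... | yes refl | yes refl = contradiction refl u≢v
    ... | yes refl | no ne = λ e → apart≡ v v< (ne ∘ sym) (old v ne nv) (trans (sym (cells-other SL p sl ne)) (trans (sym e) (cells-same SL p sl)))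
    ... | no ne | yes refl = λ e → apart≡ u u< (ne ∘ sym) (old u ne nu) (trans (sym (cells-other SL p sl ne)) (trans e (cells-same SL p sl)))
    ... | no nu′ | no nv′ = λ e → apart vs u v u< v< (old u nu′ nu) (old v nv′ nv) u≢v
            (trans (sym (cells-other SL p sl nu′)) (trans e (cells-other SL p sl nv′)))

  -- Decodes `aMG`: 0 if the vector was taken over, 1 if `aCH` holds the cells of the child, 2 if it
  -- holds those of the siblings merged before.
  share : ℕ → ℕ → ℕ → ℕ
  share zero          x k = k
  share (suc zero)    x k = x
  share (suc (suc _)) x k = k ∸ x

  Shares : ℕ → ℕ → (ℕ → ℕ) → Set
  Shares u mg ch = ∀ k → k ≤ B → share mg (ch k) k ≡ amount u (acc (suc u) u) (acc (suc u) (par u)) k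

  module Node (i : ℕ) (1≤i : 1 ≤ i) (i<n : i < n) where

    p : ℕ
    p = par i
    p<i : p < i
    p<i = par< i 1≤i i<n
    cs r : Forest
    cs = acc (suc i) i
    r  = acc (suc i) p
    x y M N : ℕ
    x = childRank (rank cs)
    y = rank r
    M = a i + mass cs
    N = mass r

    Handled : (RK SL OF VEC MG CH : Cells) → Set
    Handled RK SL OF VEC MG CH = Vectors i i (acc i) RK SL OF VEC × Shares i (MG i 0) (CH i)

    handled : Store → Set
    handled σ = Handled (ar σ aRK) (ar σ aSL) (ar σ aOF) (ar σ aVEC) (ar σ aMG) (ar σ aCH)

    Rest : Store → Store → Set
    Rest σ₀ σ = ∀ u → i ≢ u → ar σ aMG u ≡ ar σ₀ aMG u × ar σ aCH u ≡ ar σ₀ aCH u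

    module _ (bg : big cs ≡ true) where

      rank-node : rank (acc i p) ≡ joinRank x y
      rank-node = trans (cong rank (acc-par i i<n)) (cong (λ z → if z then joinRank x y else y) bg)

      move-rule : ∀ σ → vr σ vP ≡ p → y ≡ 0 → ar σ aMG i 0 ≡ 0 → extended i σ → Ends moveInto handled σ
      move-rule σ p≡ y≡0 mg≡ (rx≡ , _ , own , vs) = ends (
        subst (λ q → Vectors i i (acc i) (cells (ar σ aRK) q (vr σ vRx)) (cells (ar σ aSL) q (vr σ vSl)) (cells (ar σ aOF) q (vr σ vOf)) (ar σ aVEC)) (sym p≡)
          (install (vr σ vRx) (vr σ vSl) (vr σ vOf) 1≤i i<n vs
            (trans rx≡ (sym (trans rank-node (cong (λ z → if z ≡ᵇ 0 then x else high x z ⊔ suc (low x z)) y≡0))))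
            (λ k k≤ → trans (ownVec own k k≤) (sym (trans (cong (λ t → approx t k) (acc-par i i<n)) (moved k))))
            (≤-trans (ownOffset own) (*-monoʳ-≤ B (≤-trans (s≤s (m≤m+n (nodes cs) (nodes r))) (≤-reflexive (cong nodes (sym (acc-par i i<n)))))))
            (proj₁ (ownSlot own) , below-i (proj₂ (ownSlot own)))
            (λ v v< _ nz → ownApart own v v< nz)) ,
        λ k k≤ → trans (cong (λ m → share m (ar σ aCH i k) k) mg≡) (sym (cong (λ z → if z ≡ᵇ 0 then k else mergedAmount (above i cs) (approx r) M N x z k) y≡0)))
        where
        moved : ∀ k → approx (node i cs r) k ≡ above i cs k
        moved k rewrite bg | y≡0 = refl
        below-i : ∀ {s} → (s < n ⊎ n + suc i ≤ s) → (s < n ⊎ n + i ≤ s)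
        below-i (inj₁ q) = inj₁ q
        below-i (inj₂ q) = inj₂ (≤-trans (+-monoʳ-≤ n (n≤1+n i)) q)

      module Merge (y≢0 : y ≢ 0) where

        F G : ℕ → ℕ
        F = above i cs
        G = approx r

        X Y : ℕ → ℕ
        X = sparse F G M N x y
        Y = dense F G M N x y

        node-≡ : acc i p ≡ node i cs r
        node-≡ = acc-par i i<n

        y≡ᵇ0 : (y ≡ᵇ 0) ≡ false
        y≡ᵇ0 = ≢⇒≡ᵇ y≢0

        approx-node : ∀ k → approx (acc i p) k ≡ merged F G M N x y k
        approx-node k rewrite node-≡ | bg | y≡ᵇ0 = refl

        joined : rank (acc i p) ≡ high x y ⊔ suc (low x y)
        joined = trans rank-node (cong (λ z → if z then x else high x y ⊔ suc (low x y)) y≡ᵇ0)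

        x≤n : x ≤ n
        x≤n = ≤-trans (⊔-bound {1} {rank cs} (s≤s z≤n) (m≤n⇒m≤1+n (rank-≤ cs))) (≤-trans (s≤s (m≤m+n _ _)) (nodes-≤ i 1≤i i<n))
        y≤n : y ≤ n
        y≤n = ≤-trans (rank-≤ r) (≤-trans (m≤n⇒m≤1+n (m≤n+m _ _)) (nodes-≤ i 1≤i i<n))
        low≤n : low x y ≤ n
        low≤n with lighter x y
        ... | true  = y≤n
        ... | false = x≤n

        XY≤ : ∀ j k → X j + Y k ≤ n * sumN n a
        XY≤ j k with lighter x y
        ... | true  = ≤-trans (≤-reflexive (+-comm (G j) (F k))) (approx≤V i 1≤i i<n k j)
        ... | false = approx≤V i 1≤i i<n j k

        grain≤ : grain M x N y ≤ sumN n a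
        grain≤ = ≤-trans (div≤ (if lighter x y then N else M) (quota (low x y))) light≤
          where
          div≤ : ∀ m q → ⟦ div ⟧ m q ≤ m
          div≤ m zero    = z≤n
          div≤ m (suc q) = m/n≤m m (suc q)
          light≤ : (if lighter x y then N else M) ≤ sumN n a
          light≤ with lighter x y
          ... | true  = ≤-trans (m≤n+m N M) (mass-≤ i 1≤i i<n)
          ... | false = ≤-trans (m≤m+n M N) (mass-≤ i 1≤i i<n)

        open Convolution b V R c X Y (grain M x N y)
          (λ j k _ _ → ≤-trans (XY≤ j k) (≤-trans (m≤n+m _ (sumN n a)) weights≤V))
          (λ j _ → ≤-trans (≤-trans (+-mono-≤ (≤-trans (m≤m+n (X j) (Y 0)) (XY≤ j 0)) grain≤) (≤-reflexive (+-comm (n * sumN n a) (sumN n a)))) weights≤V)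
          m≤V using (Sides; sides; Sampled; sampled; Local; convolveTime; convolve-rule; rowTime)

        record Side (H : ℕ → ℕ) (s o : ℕ) (VEC : Cells) : Set where
          field
            side-vec : ∀ k → k ≤ B → VEC s ((o + k) % suc B) ≡ H k
            side-off : o + B ≤ V
            side-new : n + i ≢ s

        open Side

        Picked : (xs xo ys yo lo hi mm mg : ℕ) (VEC : Cells) → Set
        Picked xs xo ys yo lo hi mm mg VEC =
          Side X xs xo VEC × Side Y ys yo VEC × lo ≡ low x y × hi ≡ high x y ×
          mm ≡ (if lighter x y then N else M) × mg ≡ (if lighter x y then 2 else 1)

        picked : Store → Set
        picked σ = Picked (vr σ vXs) (vr σ vXo) (vr σ vYs) (vr σ vYo) (vr σ vLo) (vr σ vHi) (vr σ vMm) (ar σ aMG i 0) (ar σ aVEC)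

        Ready : (iI pP tT rx ry sl of′ : ℕ) (RK SL OF VEC TAU : Cells) → Set
        Ready iI pP tT rx ry sl of′ RK SL OF VEC TAU =
          iI ≡ i × pP ≡ p × tT ≡ M × TAU p 0 ≡ N × Extended i rx ry sl of′ RK SL OF VEC

        ready : Store → Set
        ready σ = Ready (vr σ vI) (vr σ vP) (vr σ vT) (vr σ vRx) (vr σ vRy) (vr σ vSl) (vr σ vOf)
                        (ar σ aRK) (ar σ aSL) (ar σ aOF) (ar σ aVEC) (ar σ aTAU)

        row-fresh : ∀ {s} → (s < n ⊎ n + suc i ≤ s) → n + i ≢ s
        row-fresh (inj₁ q) e = <⇒≱ q (≤-trans (m≤m+n n i) (≤-reflexive e))
        row-fresh (inj₂ q) e = <⇒≱ (+-monoʳ-< n (n<1+n i)) (≤-trans q (≤-reflexive (sym e)))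

        offset-ok : ∀ {o N} → o ≤ B * N → N ≤ n → o + B ≤ V
        offset-ok {o} {N} h k = ≤-trans (lin 4 (λ o B N n → (o ≼ B ⊠ N) ∷ (B ⊠ N ≼ B ⊠ n) ∷ [] ⊢ o ⊞ B ≼ B ⊠ (κ 1 ⊞ n)) o B N n h (*-monoʳ-≤ B k)) offsets≤V

        child-side : ∀ {sl of′ SL VEC} → Own i F (suc (nodes cs)) (acc (suc i)) sl of′ SL VEC → Side F sl of′ VEC
        child-side o = record { side-vec = ownVec o ; side-off = offset-ok (ownOffset o) (≤-trans (s≤s (m≤m+n _ _)) (nodes-≤ i 1≤i i<n))
                              ; side-new = row-fresh (proj₂ (ownSlot o)) }

        acc-side : ∀ {RK SL OF VEC} → Vectors i (suc i) (acc (suc i)) RK SL OF VEC → Side G (SL p 0) (OF p 0) VEC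
        acc-side vs = record { side-vec = isVec vs p p<i y≢0
                             ; side-off = offset-ok (offset vs p p<i y≢0) (≤-trans (m≤n⇒m≤1+n (m≤n+m _ _)) (nodes-≤ i 1≤i i<n))
                             ; side-new = row-fresh (proj₂ (slot vs p p<i y≢0)) }

        private
          side-cong : ∀ H H′ {s o VEC} → (∀ k → H k ≡ H′ k) → Side H s o VEC → Side H′ s o VEC
          side-cong H H′ h s = record { side-vec = λ k k≤ → trans (side-vec s k k≤) (h k) ; side-off = side-off s ; side-new = side-new s }

          pick-light : ∀ {xs xo ys yo lo hi mm mg VEC} → lighter x y ≡ true → Side G xs xo VEC → Side F ys yo VEC →
            lo ≡ y → hi ≡ x → mm ≡ N → mg ≡ 2 → Picked xs xo ys yo lo hi mm mg VEC
          pick-light e sx sy lo≡ hi≡ mm≡ mg≡ =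
            side-cong G X (λ k → cong (λ z → (if z then G else F) k) (sym e)) sx ,
            side-cong F Y (λ k → cong (λ z → (if z then F else G) k) (sym e)) sy ,
            trans lo≡ (cong (λ z → if z then y else x) (sym e)) , trans hi≡ (cong (λ z → if z then x else y) (sym e)) ,
            trans mm≡ (cong (λ z → if z then N else M) (sym e)) , trans mg≡ (cong (λ z → if z then 2 else 1) (sym e))

          pick-heavy : ∀ {xs xo ys yo lo hi mm mg VEC} → lighter x y ≡ false → Side F xs xo VEC → Side G ys yo VEC →
            lo ≡ x → hi ≡ y → mm ≡ M → mg ≡ 1 → Picked xs xo ys yo lo hi mm mg VEC
          pick-heavy e sx sy lo≡ hi≡ mm≡ mg≡ =
            side-cong F X (λ k → cong (λ z → (if z then G else F) k) (sym e)) sx ,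
            side-cong G Y (λ k → cong (λ z → (if z then F else G) k) (sym e)) sy ,
            trans lo≡ (cong (λ z → if z then y else x) (sym e)) , trans hi≡ (cong (λ z → if z then x else y) (sym e)) ,
            trans mm≡ (cong (λ z → if z then N else M) (sym e)) , trans mg≡ (cong (λ z → if z then 2 else 1) (sym e))

        pick-rule : ∀ σ → ready σ → Ends pickSides (λ σ′ → picked σ′ × (∀ u → i ≢ u → ar σ′ aMG u ≡ ar σ aMG u)) σ
        pick-rule σ (refl , p≡ , t≡ , tau≡ , (rx≡ , ry≡ , own , vs)) = ends (
          (λ ne → pick-light (light ne) accSide (child-side own) ry≡ rx≡ (trans (cong (λ q → ar σ aTAU q 0) p≡) tau≡) (cells-same (ar σ aMG) i 2) ,
                  λ u ne′ → upd-other (ar σ aMG) _ ne′) ,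
          (λ eq → pick-heavy (heavy eq) (child-side own) accSide rx≡ ry≡ t≡ (cells-same (ar σ aMG) i 1) ,
                  λ u ne′ → upd-other (ar σ aMG) _ ne′))
          where
          accSide : Side G (ar σ aSL (vr σ vP) 0) (ar σ aOF (vr σ vP) 0) (ar σ aVEC)
          accSide = subst (λ q → Side G (ar σ aSL q 0) (ar σ aOF q 0) (ar σ aVEC)) (sym p≡) (acc-side vs)
          light : vr σ vRx ∸ vr σ vRy ≢ 0 → lighter x y ≡ true
          light ne = Equivalence.to T-≡ (<⇒<ᵇ (m∸n≢0⇒n<m {x} {y} (subst₂ (λ u v → u ∸ v ≢ 0) rx≡ ry≡ ne)))
          heavy : vr σ vRx ∸ vr σ vRy ≡ 0 → lighter x y ≡ false
          heavy eq with lighter x y in e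
          ... | false = refl
          ... | true  = contradiction (m∸n≡0⇒m≤n {x} {y} (subst₂ (λ u v → u ∸ v ≡ 0) rx≡ ry≡ eq)) (<⇒≱ (<ᵇ⇒< y x (Equivalence.from T-≡ e)))

        chosen : Store → Set
        chosen σ = sides σ × vr σ vNs ≡ n + i × picked σ

        quota-≡ : ∀ {l} → l ≡ low x y → C * ((l + 1) * (l + 2)) ≡ quota (low x y)
        quota-≡ refl = ring 2 (λ C l → [] ⊢ C ⊠ ((l ⊞ κ 1) ⊠ (l ⊞ κ 2)) ≼ C ⊠ ((κ 1 ⊞ l) ⊠ (κ 2 ⊞ l))) C (low x y)

        quota-≤ : quota (low x y) ≤ V
        quota-≤ = ≤-trans (*-monoʳ-≤ C (*-mono-≤ (s≤s low≤n) (s≤s (s≤s low≤n)))) quota≤V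

        prepare-rule : ∀ σ → vr σ vN ≡ n → vr σ vI ≡ i → vr σ vM ≡ suc B → picked σ → Ends prepareMerge chosen σ
        prepare-rule σ n≡ i≡ m≡ pk@(sx , sy , lo≡ , hi≡ , mm≡ , mg≡) = ends (
          ≤-trans (m≤m*n C (suc n * suc (suc n))) quota≤V ,
          ≤-trans (+-monoʳ-≤ (vr σ vLo) (s≤s z≤n)) small₂ ,
          small₂ ,
          ≤-trans (m≤m+n _ (c * ((vr σ vLo + 1) * (vr σ vLo + 2)))) quota≤ , quota≤ ,
          ≤-trans (≤-reflexive ns≡) (≤-trans (lin 2 (λ n i → (i ≼ n) ∷ [] ⊢ n ⊞ i ≼ κ 2 ⊠ n ⊞ κ 2) n i (<⇒≤ i<n)) n≤V) ,
          record { width = m≡ ; isX = side-vec sx ; isY = side-vec sy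
                 ; xo≤ = side-off sx ; yo≤ = side-off sy
                 ; ns≢xs = λ e → side-new sx (trans (sym ns≡) e) ; ns≢ys = λ e → side-new sy (trans (sym ns≡) e)
                 ; isG = cong₂ (λ m q → ⟦ div ⟧ m q) mm≡ (quota-≡ lo≡) } , ns≡ , pk)
          where
          ns≡ : vr σ vN + vr σ vI ≡ n + i
          ns≡ = cong₂ _+_ n≡ i≡
          small₂ : vr σ vLo + 2 ≤ V
          small₂ = ≤-trans (lin 2 (λ l n → (l ≼ n) ∷ [] ⊢ l ⊞ κ 2 ≼ κ 2 ⊠ n ⊞ κ 2) (vr σ vLo) n (≤-trans (≤-reflexive lo≡) low≤n)) n≤V
          quota≤ : C * ((vr σ vLo + 1) * (vr σ vLo + 2)) ≤ V
          quota≤ = ≤-trans (≤-reflexive (quota-≡ lo≡)) quota-≤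

        -- A write to row `n + i` spares all vectors in use: by `i < lim` their rows lie below `n`
        -- or beyond `n + i`.
        Vectors-cong : ∀ {lim f RK SL OF VEC RK′ SL′ OF′ VEC′} → RK′ ≡ RK → SL′ ≡ SL → OF′ ≡ OF →
          (∀ s → n + i ≢ s → VEC′ s ≡ VEC s) → i < lim → Vectors i lim f RK SL OF VEC → Vectors i lim f RK′ SL′ OF′ VEC′
        Vectors-cong {lim} {f} {RK} {SL} {OF} {VEC} {VEC′ = VEC′} refl refl refl h i<lim vs = record
          { isRank = isRank vs
          ; isVec = λ v v< nz k k≤ → trans (cong (λ q → q ((OF v 0 + k) % suc B)) (h (SL v 0) (new v v< nz))) (isVec vs v v< nz k k≤)
          ; offset = offset vs ; slot = slot vs ; apart = apart vs
          ; zeros = λ s s< l → trans (cong (λ q → q l) (h s (λ e → <⇒≱ s< (≤-trans (m≤n+m i n) (≤-reflexive e))))) (zeros vs s s< l) }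
          where
          new : ∀ v → v < i → rank (f v) ≢ 0 → n + i ≢ SL v 0
          new v v< nz e with proj₂ (slot vs v v< nz)
          ... | inj₁ q = <⇒≱ q (≤-trans (m≤m+n n i) (≤-reflexive e))
          ... | inj₂ q = <⇒≱ (+-monoʳ-< n i<lim) (≤-trans q (≤-reflexive (sym e)))

        share-if : ∀ l k j → share (if l then 2 else 1) j k ≡ (if l then k ∸ j else j)
        share-if true  k j = refl
        share-if false k j = refl

        mergeCost : ℕ
        mergeCost = cost pickSides + (cost prepareMerge + (convolveTime + cost storeMerge))

        Merged : Store → Store → Set
        Merged σ₀ σ = handled σ × Rest σ₀ σ × clk σ ≤ mergeCost + clk σ₀

        store-rule : ∀ σ₀ σ → vr σ vI ≡ i → vr σ vP ≡ p → vr σ vNs ≡ n + i → vr σ vLo ≡ low x y → vr σ vHi ≡ high x y →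
          ar σ aMG i 0 ≡ (if lighter x y then 2 else 1) →
          Vectors i (suc i) (acc (suc i)) (ar σ aRK) (ar σ aSL) (ar σ aOF) (ar σ aVEC) →
          (∀ k → k ≤ B → ar σ aVEC (n + i) k ≡ Scan.value X Y (grain M x N y) B k × ar σ aCH i k ≡ Scan.choice X Y (grain M x N y) B k) →
          Rest σ₀ σ → clk σ + cost storeMerge ≤ mergeCost + clk σ₀ → Ends storeMerge (Merged σ₀) σ
        store-rule σ₀ σ i≡ p≡ ns≡ lo≡ hi≡ mg≡ vs rows rest time = ends (
          ≤-trans (+-monoʳ-≤ (vr σ vLo) (s≤s z≤n)) small₂ , subst (_≤ V) (sym nr≡) nr≤ ,
          (subst₂ (λ q s → Vectors i i (acc i) (cells (ar σ aRK) q (vr σ vHi + (vr σ vLo + 1 ∸ vr σ vHi))) (cells (ar σ aSL) q s) (cells (ar σ aOF) q 0) (ar σ aVEC))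
             (sym p≡) (sym ns≡)
             (install _ (n + i) 0 1≤i i<n vs (trans nr≡ (sym joined))
               (λ k k≤ → trans (cong (ar σ aVEC (n + i)) (m<n⇒m%n≡m (s≤s k≤))) (trans (proj₁ (rows k k≤)) (sym (approx-node k))))
               z≤n (m≤n+m i n , inj₂ ≤-refl) new) ,
           λ k k≤ → trans (cong₂ (λ m j → share m j k) mg≡ (proj₂ (rows k k≤))) (trans (share-if (lighter x y) k _)
             (sym (cong (λ z → if z then k else mergedAmount F G M N x y k) y≡ᵇ0)))) ,
          rest , ≤-trans (≤-reflexive (+-comm (cost storeMerge) (clk σ))) time)
          where
          small₂ : vr σ vLo + 2 ≤ V
          small₂ = ≤-trans (lin 2 (λ l n → (l ≼ n) ∷ [] ⊢ l ⊞ κ 2 ≼ κ 2 ⊠ n ⊞ κ 2) (vr σ vLo) n (≤-trans (≤-reflexive lo≡) low≤n)) n≤V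
          nr≡ : vr σ vHi + (vr σ vLo + 1 ∸ vr σ vHi) ≡ high x y ⊔ suc (low x y)
          nr≡ = trans (cong₂ (λ h l → h + (l ∸ h)) hi≡ (trans (cong (_+ 1) lo≡) (+-comm (low x y) 1))) (sym (m⊔n≡m+n∸m (high x y) (suc (low x y))))
            where
            m⊔n≡m+n∸m : ∀ m n → m ⊔ n ≡ m + (n ∸ m)
            m⊔n≡m+n∸m zero    n       = refl
            m⊔n≡m+n∸m (suc m) zero    = cong suc (sym (+-identityʳ m))
            m⊔n≡m+n∸m (suc m) (suc n) = cong suc (m⊔n≡m+n∸m m n)
          nr≤ : high x y ⊔ suc (low x y) ≤ V
          nr≤ = ⊔-bound {high x y} high≤ (≤-trans (s≤s low≤n) (≤-trans (lin 1 (λ n → [] ⊢ κ 1 ⊞ n ≼ κ 2 ⊠ n ⊞ κ 2) n) n≤V))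
            where
            high≤ : high x y ≤ V
            high≤ with lighter x y
            ... | true  = ≤-trans x≤n (≤-trans (lin 1 (λ n → [] ⊢ n ≼ κ 2 ⊠ n ⊞ κ 2) n) n≤V)
            ... | false = ≤-trans y≤n (≤-trans (lin 1 (λ n → [] ⊢ n ≼ κ 2 ⊠ n ⊞ κ 2) n) n≤V)
          new : ∀ v → v < i → v ≢ p → rank (acc (suc i) v) ≢ 0 → ar σ aSL v 0 ≢ n + i
          new v v< _ nz e with proj₂ (slot vs v v< nz)
          ... | inj₁ q = <⇒≱ q (≤-trans (m≤m+n n i) (≤-reflexive (sym e)))
          ... | inj₂ q = <⇒≱ (+-monoʳ-< n (n<1+n i)) (≤-trans q (≤-reflexive e))

        merge-rule : ∀ σ → inputs σ → ready σ → Ends mergeInto (Merged σ) σ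
        merge-rule σ inp rd = seqTimed _ (pick-rule σ rd) after-pick
          where
          after-pick : ∀ σ₁ → picked σ₁ × (∀ u → i ≢ u → ar σ₁ aMG u ≡ ar σ aMG u) → Frame pickSides σ σ₁ → clk σ₁ ≤ cost pickSides + clk σ →
                       Ends (prepareMerge ⨾ convolve ⨾ storeMerge) (Merged σ) σ₁
          after-pick σ₁ (pk , mgs) f₁ t₁ = seqTimed _
            (prepare-rule σ₁ (trans (fv f₁ vN refl) (isN inp)) (trans (fv f₁ vI refl) (proj₁ rd)) (trans (fv f₁ vM refl) (isM inp)) pk) after-prepare
            where
            after-prepare : ∀ σ₂ → chosen σ₂ → Frame prepareMerge σ₁ σ₂ → clk σ₂ ≤ cost prepareMerge + clk σ₁ →
                            Ends (convolve ⨾ storeMerge) (Merged σ) σ₂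
            after-prepare σ₂ (sd , ns≡ , _ , _ , lo≡ , hi≡ , _ , mg≡) f₂ t₂ = seq (convolve-rule σ₂ sd) after-convolve
              where
              after-convolve : ∀ σ₃ → sampled σ₂ B σ₃ × clk σ₃ ≤ clk σ₂ + convolveTime → Frame convolve σ₂ σ₃ → Ends storeMerge (Merged σ) σ₃
              after-convolve σ₃ (sp , t₃) f₃ = (store-rule σ σ₃ i≡ (trans (fv f₃ vP refl) (trans (fv f₂ vP refl) (trans (fv f₁ vP refl) (proj₁ (proj₂ rd)))))
                ns₃ (trans (fv f₃ vLo refl) lo≡) (trans (fv f₃ vHi refl) hi≡)
                (trans (cong (λ q → q i 0) (fa f₃ aMG refl)) mg≡)
                (Vectors-cong (trans (fa f₃ aRK refl) (trans (fa f₂ aRK refl) (fa f₁ aRK refl)))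
                  (trans (fa f₃ aSL refl) (trans (fa f₂ aSL refl) (fa f₁ aSL refl)))
                  (trans (fa f₃ aOF refl) (trans (fa f₂ aOF refl) (fa f₁ aOF refl)))
                  (λ s ne → trans (Local.vecs (Sampled.local′ sp) s (λ e → ne (trans (sym ns₃) e))) (cong (λ q → q s) (trans (fa f₂ aVEC refl) (fa f₁ aVEC refl))))
                  ≤-refl (proj₂ (proj₂ (proj₂ (proj₂ (proj₂ (proj₂ (proj₂ rd))))))))
                (λ k k≤ → subst₂ (λ s j → ar σ₃ aVEC s k ≡ Scan.value X Y (grain M x N y) B k × ar σ₃ aCH j k ≡ Scan.choice X Y (grain M x N y) B k) ns₃ i≡ (Sampled.rows sp k k≤))
                (λ u ne → trans (cong (λ q → q u) (trans (fa f₃ aMG refl) (fa f₂ aMG refl))) (mgs u ne) ,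
                  trans (Local.chs (Sampled.local′ sp) u (λ e → ne (trans (sym i≡) e))) (cong (λ q → q u) (trans (fa f₂ aCH refl) (fa f₁ aCH refl))))
                (lin 8 (λ c₃ c₂ c₁ c₀ s p q v → (c₃ ≼ c₂ ⊞ v) ∷ (c₂ ≼ q ⊞ c₁) ∷ (c₁ ≼ p ⊞ c₀) ∷ [] ⊢ c₃ ⊞ s ≼ p ⊞ (q ⊞ (v ⊞ s)) ⊞ c₀)
                  (clk σ₃) (clk σ₂) (clk σ₁) (clk σ) (cost storeMerge) (cost pickSides) (cost prepareMerge) convolveTime t₃ t₂ t₁))
                where
                ns₃ : vr σ₃ vNs ≡ n + i
                ns₃ = trans (fv f₃ vNs refl) ns≡
                i≡ : vr σ₃ vI ≡ i
                i≡ = trans (fv f₃ vI refl) (trans (fv f₂ vI refl) (trans (fv f₁ vI refl) (proj₁ rd)))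

        E′ : ℕ
        E′ = unitCost (cost pickSides) (cost prepareMerge) (cost storeMerge) (cost firstRow + 9) (cost improve + 9) C

        -- The samples are within the quota, so the measured time is covered by the time that the
        -- potential accounts for.
        mergeCost-≤ : mergeCost ≤ Time.mergeTime E′ x y
        mergeCost-≤ = ≤-trans
          (unitCost-bound (cost pickSides) (cost prepareMerge) (cost storeMerge) (cost firstRow + 9) (cost improve + 9) C B _
            (mergedSamples F G M N x y) (samples-≤ {F} {G} {M} {N} x y (above-vector i cs) (approx-vector r)))
          (≤-reflexive (cong (λ z → if z then 0 else suc B * (E′ * (suc (low x y) * suc (suc (low x y))))) (sym y≡ᵇ0)))

-- Costs count instructions and do not change with the bounds `B`, `V` and `R`.
mergeUnit : (B V R c : ℕ) → ℕ
mergeUnit B V R c = unitCost (cost pickSides) (cost prepareMerge) (cost storeMerge) (cost firstRow + 9) (cost improve + 9) (suc c)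
  where
  open Logic B V R
  open Code B V R (suc c)

-- The bottom-up loop and its amortised time

module Elimination (n : ℕ) (par : ℕ → ℕ) (par< : ∀ i → 1 ≤ i → i < n → par i < i) (1≤n : 1 ≤ n)
                   (b c : ℕ) (a : ℕ → ℕ) (V R : ℕ) (8≤V : 8 ≤ V)
                   (n≤V : 2 * n + 2 ≤ V) (weights≤V : suc n * sumN n a ≤ V) (offsets≤V : suc b * suc n ≤ V)
                   (m≤V : suc (suc b) ≤ V) (quota≤V : suc c * (suc n * suc (suc n)) ≤ V) (E : ℕ)
                   (unit≤E : mergeUnit (suc b) V R c ≤ E) where

  open Staged n par par<
  open Approximation b c a
  open Logic B V R
  open Names
  open Code B V R C
  open BottomUp n par par< 1≤n b c a V R 8≤V n≤V weights≤V offsets≤V m≤V quota≤V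

  open Time E

  mergeTime-mono : ∀ {e x y} → e ≤ E → Time.mergeTime e x y ≤ mergeTime x y
  mergeTime-mono {e} {x} {y} h with y ≡ᵇ 0
  ... | true  = z≤n
  ... | false = *-monoʳ-≤ (suc B) (*-monoˡ-≤ (suc (low x y) * suc (suc (low x y))) h)

  -- `clean` matters because `moveInto` does not write `aMG`: the initial 0 is what tells the
  -- top-down pass that a vector was taken over.
  record Done (i : ℕ) (BIG MG CH : Cells) : Set where
    field
      isBIG  : ∀ u → i ≤ u → u < n → BIG u 0 ≡ suc (nodes (acc (suc u) u)) ∸ B
      shares : ∀ u → i ≤ u → u < n → big (acc (suc u) u) ≡ true → Shares u (MG u 0) (CH u)
      clean  : ∀ u → u < i → MG u 0 ≡ 0

  open Done

  done′ : ℕ → Store → Set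
  done′ i σ = Done i (ar σ aBIG) (ar σ aMG) (ar σ aCH)

  Loop : ℕ → Store → Set
  Loop i σ = vr σ vI ≡ i × inputs σ × Sums i (ar σ aSZ) (ar σ aTAU) × vectors i i (acc i) σ × done′ i σ

  time-small : ∀ t → nodes t < B → time t ≡ 0
  time-small nil           _ = refl
  time-small (node i cs r) h with big cs in e
  ... | true  = contradiction (≤ᵇ⇒≤ B (nodes cs) (Equivalence.from T-≡ e)) (<⇒≱ (≤-trans (s≤s (m≤n⇒m≤1+n (m≤m+n _ _))) h))
  ... | false = time-small r (≤-trans (s≤s (m≤n⇒m≤1+n (m≤n+m (nodes r) (nodes cs)))) h)

  module Step (i : ℕ) (1≤i : 1 ≤ i) (i<n : i < n) where

    open Node i 1≤i i<n

    Entered : (iI pP sS tT gG : ℕ) (BIG : Cells) → Set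
    Entered iI pP sS tT gG BIG = iI ≡ i × pP ≡ p × sS ≡ suc (nodes cs) × tT ≡ M × gG ≡ suc (nodes cs) ∸ B ×
      (∀ u → suc i ≤ u → u < n → BIG u 0 ≡ suc (nodes (acc (suc u) u)) ∸ B) × BIG i 0 ≡ suc (nodes cs) ∸ B

    entered : Store → Set
    entered σ = Entered (vr σ vI) (vr σ vP) (vr σ vS) (vr σ vT) (vr σ vG) (ar σ aBIG)

    enter-rule : ∀ σ → Loop (suc i) σ → Ends enter entered σ
    enter-rule σ (i≡ , inp , sums , vs , dn) = ends (go (vr σ vI ∸ 1) (cong (_∸ 1) i≡))
      where
      open Inputs
      open Sums
      size≡ : ar σ aSZ i 0 ≡ nodes cs
      size≡ = isSize sums i ≤-refl
      t≡ : ar σ aWT i 0 + ar σ aTAU i 0 ≡ M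
      t≡ = cong₂ _+_ (isW inp i i<n) (isMass sums i ≤-refl)
      g≡ : ar σ aSZ i 0 + 1 ∸ vr σ vB ≡ suc (nodes cs) ∸ B
      g≡ = cong₂ _∸_ (trans (cong (_+ 1) size≡) (+-comm (nodes cs) 1)) (isB inp)
      N≤V : suc (nodes cs) ≤ V
      N≤V = ≤-trans (≤-trans (s≤s (m≤m+n _ _)) (nodes-≤ i 1≤i i<n)) (≤-trans (lin 1 (λ n → [] ⊢ n ≼ κ 2 ⊠ n ⊞ κ 2) n) n≤V)
      M≤V : M ≤ V
      M≤V = ≤-trans (≤-trans (m≤m+n M N) (mass-≤ i 1≤i i<n)) (≤-trans (m≤m+n _ (n * sumN n a)) weights≤V)
      go : ∀ j → j ≡ i → wp examine entered (setv vI j (tick 4 σ))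
      go j refl =
        ≤-trans (≤-reflexive (trans (cong (_+ 1) size≡) (+-comm (nodes cs) 1))) N≤V ,
        ≤-trans (≤-reflexive t≡) M≤V ,
        refl , isP inp i 1≤i i<n , trans (cong (_+ 1) size≡) (+-comm (nodes cs) 1) , t≡ , g≡ ,
        (λ u i<u u<n → trans (cells-other (ar σ aBIG) i (ar σ aSZ i 0 + 1 ∸ vr σ vB) (<⇒≢ i<u)) (isBIG dn u i<u u<n)) ,
        trans (cells-same (ar σ aBIG) i (ar σ aSZ i 0 + 1 ∸ vr σ vB)) g≡

    nodeTime : ℕ
    nodeTime = if big cs then mergeTime x y else 0

    nodeCost : ℕ
    nodeCost = cost locate + cost extend + cost moveInto + 10

    Treated : Store → Store → Set
    Treated σ₀ σ = Vectors i i (acc i) (ar σ aRK) (ar σ aSL) (ar σ aOF) (ar σ aVEC) ×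
      (big cs ≡ true → Shares i (ar σ aMG i 0) (ar σ aCH i)) × Rest σ₀ σ ×
      clk σ ≤ nodeCost + nodeTime + clk σ₀

    Vectors-pass : ∀ {RK SL OF VEC} → big cs ≡ false → Vectors (suc i) (suc i) (acc (suc i)) RK SL OF VEC → Vectors i i (acc i) RK SL OF VEC
    Vectors-pass sm vs = record
      { isRank = λ v v< → trans (isRank vs v (m≤n⇒m≤1+n v<)) (sym (rank-same v))
      ; isVec = λ v v< nz k k≤ → trans (isVec vs v (m≤n⇒m≤1+n v<) (nz ∘ trans (rank-same v)) k k≤) (sym (approx-same v k))
      ; offset = λ v v< nz → ≤-trans (offset vs v (m≤n⇒m≤1+n v<) (nz ∘ trans (rank-same v))) (*-monoʳ-≤ B (nodes-more v))
      ; slot = λ v v< nz → lower (slot vs v (m≤n⇒m≤1+n v<) (nz ∘ trans (rank-same v)))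
      ; apart = λ u v u< v< nu nv → apart vs u v (m≤n⇒m≤1+n u<) (m≤n⇒m≤1+n v<) (nu ∘ trans (rank-same u)) (nv ∘ trans (rank-same v))
      ; zeros = λ s s< → zeros vs s (m≤n⇒m≤1+n s<) }
      where
      open Vectors
      rank-same : ∀ v → rank (acc i v) ≡ rank (acc (suc i) v)
      rank-same v with p Data.Nat.Properties.≟ v
      ... | yes refl = trans (cong rank (acc-par i i<n)) (cong (λ z → if z then joinRank x y else y) sm)
      ... | no ne    = cong rank (acc-other i v i<n ne)
      approx-same : ∀ v k → approx (acc i v) k ≡ approx (acc (suc i) v) k
      approx-same v k with p Data.Nat.Properties.≟ v
      ... | yes refl = trans (cong (λ t → approx t k) (acc-par i i<n)) here
        where
        here : approx (node i cs r) k ≡ approx r k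
        here rewrite sm = refl
      ... | no ne    = cong (λ t → approx t k) (acc-other i v i<n ne)
      nodes-more : ∀ v → nodes (acc (suc i) v) ≤ nodes (acc i v)
      nodes-more v with p Data.Nat.Properties.≟ v
      ... | yes refl = ≤-trans (m≤n⇒m≤1+n (m≤n+m (nodes r) (nodes cs))) (≤-reflexive (cong nodes (sym (acc-par i i<n))))
      ... | no ne    = ≤-reflexive (cong nodes (sym (acc-other i v i<n ne)))
      lower : ∀ {s} → suc i ≤ s × (s < n ⊎ n + suc i ≤ s) → i ≤ s × (s < n ⊎ n + i ≤ s)
      lower (u , inj₁ v) = <⇒≤ u , inj₁ v
      lower (u , inj₂ v) = <⇒≤ u , inj₂ (≤-trans (+-monoʳ-≤ n (n≤1+n i)) v)

    big-rule : ∀ σ₀ σ → big cs ≡ true → vr σ vI ≡ i → vr σ vP ≡ p → vr σ vT ≡ M → inputs σ → ar σ aMG i 0 ≡ 0 →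
      ar σ aTAU p 0 ≡ N → vectors (suc i) (suc i) (acc (suc i)) σ → Rest σ₀ σ → clk σ ≤ 2 + clk σ₀ →
      Ends bigNode (λ σ′ → Treated σ₀ (tick 1 σ′)) σ
    big-rule σ₀ σ bg i≡ p≡ t≡ inp mg≡ tau≡ vs rest t₀ = seqTimed _ (locate-rule i σ i≡ i<n vs) after-locate
      where
      Q : Store → Set
      Q σ′ = Treated σ₀ (tick 1 σ′)
      after-locate : ∀ σ₁ → located i σ₁ → Frame locate σ σ₁ → clk σ₁ ≤ cost locate + clk σ → Ends (extend ⨾ ite (var vRy) mergeInto moveInto) Q σ₁
      after-locate σ₁ lo f₁ t₁ = seqTimed _
        (extend-rule i σ₁ (trans (fv f₁ vI refl) i≡) 1≤i i<n (trans (fv f₁ vP refl) p≡) (trans (fv f₁ vT refl) t≡) inp₁ lo) after-extend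
        where
        open Inputs
        inp₁ : inputs σ₁
        inp₁ = record { isN = trans (fv f₁ vN refl) (isN inp) ; isB = trans (fv f₁ vB refl) (isB inp) ; isM = trans (fv f₁ vM refl) (isM inp)
                      ; isP = λ v u w → trans (cong (λ q → q v 0) (fa f₁ aPAR refl)) (isP inp v u w)
                      ; isW = λ v u → trans (cong (λ q → q v 0) (fa f₁ aWT refl)) (isW inp v u) }
        after-extend : ∀ σ₂ → extended i σ₂ → Frame extend σ₁ σ₂ → clk σ₂ ≤ cost extend + clk σ₁ → Ends (ite (var vRy) mergeInto moveInto) Q σ₂
        after-extend σ₂ ex f₂ t₂ = branch (λ ne → merges (λ z → ne (trans (proj₁ (proj₂ ex)) z))) (λ eq → moves (trans (sym (proj₁ (proj₂ ex))) eq))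
          where
          inp₂ : inputs σ₂
          inp₂ = record { isN = trans (fv f₂ vN refl) (isN inp₁) ; isB = trans (fv f₂ vB refl) (isB inp₁) ; isM = trans (fv f₂ vM refl) (isM inp₁)
                      ; isP = λ v u w → trans (cong (λ q → q v 0) (fa f₂ aPAR refl)) (isP inp₁ v u w)
                      ; isW = λ v u → trans (cong (λ q → q v 0) (fa f₂ aWT refl)) (isW inp₁ v u) }
          i≡₂ : vr σ₂ vI ≡ i
          i≡₂ = trans (fv f₂ vI refl) (trans (fv f₁ vI refl) i≡)
          p≡₂ : vr σ₂ vP ≡ p
          p≡₂ = trans (fv f₂ vP refl) (trans (fv f₁ vP refl) p≡)
          t≡₂ : vr σ₂ vT ≡ M
          t≡₂ = trans (fv f₂ vT refl) (trans (fv f₁ vT refl) t≡)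
          tau≡₂ : ar σ₂ aTAU p 0 ≡ N
          tau≡₂ = trans (cong (λ q → q p 0) (trans (fa f₂ aTAU refl) (fa f₁ aTAU refl))) tau≡
          mg≡₂ : ar σ₂ aMG i 0 ≡ 0
          mg≡₂ = trans (cong (λ q → q i 0) (trans (fa f₂ aMG refl) (fa f₁ aMG refl))) mg≡
          rest₂ : Rest σ₀ σ₂
          rest₂ u nu = trans (cong (λ q → q u) (trans (fa f₂ aMG refl) (fa f₁ aMG refl))) (proj₁ (rest u nu)) ,
                       trans (cong (λ q → q u) (trans (fa f₂ aCH refl) (fa f₁ aCH refl))) (proj₂ (rest u nu))
          t₂′ : clk σ₂ ≤ cost locate + cost extend + 2 + clk σ₀
          t₂′ = lin 6 (λ c₂ c₁ c c₀ l e → (c₂ ≼ e ⊞ c₁) ∷ (c₁ ≼ l ⊞ c) ∷ (c ≼ κ 2 ⊞ c₀) ∷ [] ⊢ c₂ ≼ l ⊞ e ⊞ κ 2 ⊞ c₀)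
                  (clk σ₂) (clk σ₁) (clk σ) (clk σ₀) (cost locate) (cost extend) t₂ t₁ t₀
          moves : y ≡ 0 → Ends moveInto Q (tick 2 σ₂)
          moves y≡0 = ensureTimed _ (move-rule bg (tick 2 σ₂) p≡₂ y≡0 mg≡₂ ex) after-move
            where
            after-move : ∀ σ₃ → handled σ₃ → Frame moveInto (tick 2 σ₂) σ₃ → clk σ₃ ≤ cost moveInto + clk (tick 2 σ₂) → Q σ₃
            after-move σ₃ han f₃ t₃ = proj₁ han , (λ _ → proj₂ han) ,
              (λ u nu → trans (cong (λ q → q u) (fa f₃ aMG refl)) (proj₁ (rest₂ u nu)) , trans (cong (λ q → q u) (fa f₃ aCH refl)) (proj₂ (rest₂ u nu))) ,
              lin 7 (λ c₃ c₂ c₀ l e m mt → (c₃ ≼ m ⊞ (κ 2 ⊞ c₂)) ∷ (c₂ ≼ l ⊞ e ⊞ κ 2 ⊞ c₀) ∷ [] ⊢ κ 1 ⊞ c₃ ≼ l ⊞ e ⊞ m ⊞ κ 10 ⊞ mt ⊞ c₀)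
                (clk σ₃) (clk σ₂) (clk σ₀) (cost locate) (cost extend) (cost moveInto) nodeTime t₃ t₂′
          merges : y ≢ 0 → Ends mergeInto (λ σ′ → Q (tick 1 σ′)) (tick 2 σ₂)
          merges y≢0 = ensure (merge-rule (tick 2 σ₂) inp₂ (i≡₂ , p≡₂ , t≡₂ , tau≡₂ , ex)) after-merge
            where
            open Merge bg y≢0 using (merge-rule; Merged; mergeCost; mergeCost-≤)
            mergeCost≤ : mergeCost ≤ nodeTime
            mergeCost≤ = ≤-trans (≤-trans mergeCost-≤ (mergeTime-mono {x = x} {y} unit≤E)) (≤-reflexive (cong (λ z → if z then mergeTime x y else 0) (sym bg)))
            after-merge : ∀ σ₃ → Merged (tick 2 σ₂) σ₃ → Frame mergeInto (tick 2 σ₂) σ₃ → Q (tick 1 σ₃)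
            after-merge σ₃ (han , rst , t₃) f₃ = proj₁ han , (λ _ → proj₂ han) ,
              (λ u nu → trans (proj₁ (rst u nu)) (proj₁ (rest₂ u nu)) , trans (proj₂ (rst u nu)) (proj₂ (rest₂ u nu))) ,
              lin 8 (λ c₃ c₂ c₀ l e m mt mc → (c₃ ≼ mc ⊞ (κ 2 ⊞ c₂)) ∷ (mc ≼ mt) ∷ (c₂ ≼ l ⊞ e ⊞ κ 2 ⊞ c₀) ∷ [] ⊢ κ 2 ⊞ c₃ ≼ l ⊞ e ⊞ m ⊞ κ 10 ⊞ mt ⊞ c₀)
                (clk σ₃) (clk σ₂) (clk σ₀) (cost locate) (cost extend) (cost moveInto) nodeTime mergeCost t₃ mergeCost≤ t₂′

    Vectors-frame : ∀ {j lim f RK SL OF VEC RK′ SL′ OF′ VEC′} → RK′ ≡ RK → SL′ ≡ SL → OF′ ≡ OF → VEC′ ≡ VEC →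
      Vectors j lim f RK SL OF VEC → Vectors j lim f RK′ SL′ OF′ VEC′
    Vectors-frame refl refl refl refl vs = vs

    inputs-frame : ∀ {s σ σ′} → wv s vN ≡ false → wv s vB ≡ false → wv s vM ≡ false → wa s aPAR ≡ false → wa s aWT ≡ false →
      Frame s σ σ′ → inputs σ → inputs σ′
    inputs-frame a₁ a₂ a₃ a₄ a₅ f inp = record
      { isN = trans (fv f vN a₁) (isN inp) ; isB = trans (fv f vB a₂) (isB inp) ; isM = trans (fv f vM a₃) (isM inp)
      ; isP = λ v u w → trans (cong (λ q → q v 0) (fa f aPAR a₄)) (isP inp v u w)
      ; isW = λ v u → trans (cong (λ q → q v 0) (fa f aWT a₅)) (isW inp v u) }
      where open Inputs

    big-yes : suc (nodes cs) ∸ B ≢ 0 → big cs ≡ true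
    big-yes ne = Equivalence.to T-≡ (≤⇒≤ᵇ (≤-pred (m∸n≢0⇒n<m {suc (nodes cs)} {B} ne)))

    big-no : suc (nodes cs) ∸ B ≡ 0 → big cs ≡ false
    big-no eq with big cs in e
    ... | false = refl
    ... | true  = contradiction (m∸n≡0⇒m≤n {suc (nodes cs)} {B} eq) (<⇒≱ (s≤s (≤ᵇ⇒≤ B (nodes cs) (Equivalence.from T-≡ e))))

    stepCost : ℕ
    stepCost = cost enter + (nodeCost + cost settle) + 20

    Eliminated : ℕ → Store → Set
    Eliminated t σ = Loop i (tick 1 σ) × clk σ ≤ stepCost + nodeTime + t

    settle-rule : ∀ t σ → vr σ vI ≡ i → vr σ vP ≡ p → vr σ vS ≡ suc (nodes cs) → vr σ vT ≡ M → inputs σ →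
      Sums (suc i) (ar σ aSZ) (ar σ aTAU) → vectors i i (acc i) σ → done′ i σ →
      clk σ + cost settle ≤ stepCost + nodeTime + t → Ends settle (Eliminated t) σ
    settle-rule t σ i≡ p≡ s≡ t≡ inp sums vs dn time≤ = ends (
      ≤-trans (≤-reflexive size≡) (≤-trans (≤-trans (≤-reflexive (+-comm (nodes r) (suc (nodes cs)))) (nodes-≤ i 1≤i i<n))
        (≤-trans (lin 1 (λ n → [] ⊢ n ≼ κ 2 ⊠ n ⊞ κ 2) n) n≤V)) ,
      ≤-trans (≤-reflexive mass≡) (≤-trans (≤-trans (≤-reflexive (+-comm N M)) (mass-≤ i 1≤i i<n)) (≤-trans (m≤m+n _ (n * sumN n a)) weights≤V)) ,
      (i≡ , inp ,
       subst (λ q → Sums i (cells (ar σ aSZ) q (ar σ aSZ q 0 + vr σ vS)) (cells (ar σ aTAU) q (ar σ aTAU q 0 + vr σ vT))) (sym p≡) sums′ ,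
       vs , dn) ,
      ≤-trans (≤-reflexive (+-comm (cost settle) (clk σ))) time≤)
      where
      open Sums
      size≡ : ar σ aSZ (vr σ vP) 0 + vr σ vS ≡ nodes r + suc (nodes cs)
      size≡ = cong₂ _+_ (trans (cong (λ q → ar σ aSZ q 0) p≡) (isSize sums p (m≤n⇒m≤1+n p<i))) s≡
      mass≡ : ar σ aTAU (vr σ vP) 0 + vr σ vT ≡ N + M
      mass≡ = cong₂ _+_ (trans (cong (λ q → ar σ aTAU q 0) p≡) (isMass sums p (m≤n⇒m≤1+n p<i))) t≡
      sums′ : Sums i (cells (ar σ aSZ) p (ar σ aSZ p 0 + vr σ vS)) (cells (ar σ aTAU) p (ar σ aTAU p 0 + vr σ vT))
      sums′ = record { isSize = sz ; isMass = ms }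
        where
        sz : ∀ v → v < i → cells (ar σ aSZ) p (ar σ aSZ p 0 + vr σ vS) v 0 ≡ nodes (acc i v)
        sz v v< with p Data.Nat.Properties.≟ v
        ... | yes refl = trans (cells-same (ar σ aSZ) p _) (trans (cong₂ _+_ (isSize sums p (m≤n⇒m≤1+n p<i)) s≡)
                (trans (+-comm (nodes r) (suc (nodes cs))) (cong nodes (sym (acc-par i i<n)))))
        ... | no ne    = trans (cells-other (ar σ aSZ) p _ ne) (trans (isSize sums v (m≤n⇒m≤1+n v<)) (cong nodes (sym (acc-other i v i<n ne))))
        ms : ∀ v → v < i → cells (ar σ aTAU) p (ar σ aTAU p 0 + vr σ vT) v 0 ≡ mass (acc i v)
        ms v v< with p Data.Nat.Properties.≟ v
        ... | yes refl = trans (cells-same (ar σ aTAU) p _) (trans (cong₂ _+_ (isMass sums p (m≤n⇒m≤1+n p<i)) t≡)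
                (trans (+-comm N M) (cong mass (sym (acc-par i i<n)))))
        ... | no ne    = trans (cells-other (ar σ aTAU) p _ ne) (trans (isMass sums v (m≤n⇒m≤1+n v<)) (cong mass (sym (acc-other i v i<n ne))))

    elim-rule : ∀ σ → Loop (suc i) σ → Ends eliminate (Eliminated (clk σ)) σ
    elim-rule σ lp@(_ , inp , sums , vs , dn) = seqTimed _ (enter-rule σ lp) after-enter
      where
      after-enter : ∀ σ₁ → entered σ₁ → Frame enter σ σ₁ → clk σ₁ ≤ cost enter + clk σ → Ends (ite (var vG) bigNode skip ⨾ settle) (Eliminated (clk σ)) σ₁
      after-enter σ₁ (i≡ , p≡ , s≡ , t≡ , g≡ , bigs , big-i) f₁ t₁ =
        seq (branch (λ ne → big-rule σ₁ (tick 2 σ₁) (big-yes (λ z → ne (trans g≡ z))) i≡ p≡ t≡ inp₁ mg≡ tau≡ vs₁ (λ u _ → refl , refl) ≤-refl)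
                    (λ eq → ends (Vectors-pass (big-no (trans (sym g≡) eq)) vs₁ ,
                       (λ bg → contradiction (trans (sym bg) (big-no (trans (sym g≡) eq))) (λ ())) , (λ u _ → refl , refl) ,
                       lin 5 (λ l e m mt c → [] ⊢ κ 2 ⊞ c ≼ l ⊞ e ⊞ m ⊞ κ 10 ⊞ mt ⊞ c) (cost locate) (cost extend) (cost moveInto) nodeTime (clk σ₁))))
            after-node
        where
        inp₁ : inputs σ₁
        inp₁ = inputs-frame {enter} refl refl refl refl refl f₁ inp
        vs₁ : vectors (suc i) (suc i) (acc (suc i)) σ₁
        vs₁ = Vectors-frame (fa f₁ aRK refl) (fa f₁ aSL refl) (fa f₁ aOF refl) (fa f₁ aVEC refl) vs
        mg≡ : ar σ₁ aMG i 0 ≡ 0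
        mg≡ = trans (cong (λ q → q i 0) (fa f₁ aMG refl)) (clean dn i ≤-refl)
        sums₁ : Sums (suc i) (ar σ₁ aSZ) (ar σ₁ aTAU)
        sums₁ = subst₂ (Sums (suc i)) (sym (fa f₁ aSZ refl)) (sym (fa f₁ aTAU refl)) sums
        tau≡ : ar σ₁ aTAU p 0 ≡ N
        tau≡ = Sums.isMass sums₁ p (m≤n⇒m≤1+n p<i)
        after-node : ∀ σ₂ → Treated σ₁ σ₂ → Frame (ite (var vG) bigNode skip) σ₁ σ₂ → Ends settle (Eliminated (clk σ)) σ₂
        after-node σ₂ (vs₂ , sh , rest , t₂) f₂ = settle-rule (clk σ) σ₂ (trans (fv f₂ vI refl) i≡) (trans (fv f₂ vP refl) p≡)
          (trans (fv f₂ vS refl) s≡) (trans (fv f₂ vT refl) t≡) (inputs-frame {ite (var vG) bigNode skip} refl refl refl refl refl f₂ inp₁)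
          (subst₂ (Sums (suc i)) (sym (fa f₂ aSZ refl)) (sym (fa f₂ aTAU refl)) sums₁) vs₂ dn₂
          (lin 7 (λ c₂ c₁ c e s k mt → (c₂ ≼ k ⊞ mt ⊞ c₁) ∷ (c₁ ≼ e ⊞ c) ∷ [] ⊢ c₂ ⊞ s ≼ e ⊞ (k ⊞ s) ⊞ κ 20 ⊞ mt ⊞ c)
            (clk σ₂) (clk σ₁) (clk σ) (cost enter) (cost settle) nodeCost nodeTime t₂ t₁)
          where
          MG≡ : ∀ u → i ≢ u → ar σ₂ aMG u ≡ ar σ aMG u
          MG≡ u ne = trans (proj₁ (rest u ne)) (cong (λ q → q u) (fa f₁ aMG refl))
          CH≡ : ∀ u → i ≢ u → ar σ₂ aCH u ≡ ar σ aCH u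
          CH≡ u ne = trans (proj₂ (rest u ne)) (cong (λ q → q u) (fa f₁ aCH refl))
          dn₂ : done′ i σ₂
          dn₂ = record { isBIG = bigs₂ ; shares = shares₂ ; clean = λ u u< → trans (cong (λ q → q 0) (MG≡ u (≢-sym (<⇒≢ u<)))) (clean dn u (m≤n⇒m≤1+n u<)) }
            where
            bigs₂ : ∀ u → i ≤ u → u < n → ar σ₂ aBIG u 0 ≡ suc (nodes (acc (suc u) u)) ∸ B
            bigs₂ u i≤u u<n with m≤n⇒m<n∨m≡n i≤u
            ... | inj₁ i<u  = trans (cong (λ q → q u 0) (fa f₂ aBIG refl)) (bigs u i<u u<n)
            ... | inj₂ refl = trans (cong (λ q → q i 0) (fa f₂ aBIG refl)) big-i
            shares₂ : ∀ u → i ≤ u → u < n → big (acc (suc u) u) ≡ true → Shares u (ar σ₂ aMG u 0) (ar σ₂ aCH u)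
            shares₂ u i≤u u<n bg with m≤n⇒m<n∨m≡n i≤u
            ... | inj₂ refl = sh bg
            ... | inj₁ i<u  = subst₂ (λ m h → Shares u (m 0) h) (sym (MG≡ u (<⇒≢ i<u))) (sym (CH≡ u (<⇒≢ i<u))) (shares dn u i<u u<n bg)

  module _ where

    unitStep : ℕ
    unitStep = cost enter + (cost locate + cost extend + cost moveInto + 10 + cost settle) + 30

    -- `Φ` of `time` is the merge time accounted for so far. At a small node nothing is merged, and
    -- the forest that disappears there has no merge time by `time-small`.
    Φ-time : ∀ i (1≤i : 1 ≤ i) (i<n : i < n) → Φ (λ _ → time) (suc i) + Step.nodeTime i 1≤i i<n ≤ Φ (λ _ → time) i
    Φ-time i 1≤i i<n with Φ-step (λ _ → time) i 1≤i i<n | time-small (acc (suc i) i)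
    ... | e | ts = move (big (acc (suc i) i)) refl e
      where
      p : ℕ
      p = par i
      cs r : Forest
      cs = acc (suc i) i
      r  = acc (suc i) p
      move : ∀ bg → big cs ≡ bg → Φ (λ _ → time) (suc i) + time (node i cs r) ≡ Φ (λ _ → time) i + (time r + time cs) →
        Φ (λ _ → time) (suc i) + (if big cs then mergeTime (childRank (rank cs)) (rank r) else 0) ≤ Φ (λ _ → time) i
      move true bg e rewrite bg = lin 5 (λ a b tc tr m → (a ⊞ (tc ⊞ tr ⊞ m) ≼ b ⊞ (tr ⊞ tc)) ∷ [] ⊢ a ⊞ m ≼ b)
        (Φ (λ _ → time) (suc i)) (Φ (λ _ → time) i) (time cs) (time r) (mergeTime (childRank (rank cs)) (rank r)) (≤-reflexive e)
      move false bg e rewrite bg = lin 4 (λ a b tr tc → (a ⊞ tr ≼ b ⊞ (tr ⊞ tc)) ∷ (tc ≼ κ 0) ∷ [] ⊢ a ⊞ κ 0 ≼ b)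
        (Φ (λ _ → time) (suc i)) (Φ (λ _ → time) i) (time r) (time cs) (≤-reflexive e)
        (≤-reflexive (ts (≰⇒> (λ le → subst T bg (≤⇒≤ᵇ le)))))

    bottomUp-rule : ∀ σ → vr σ vN ≡ n → inputs σ → (∀ v → ar σ aSZ v 0 ≡ 0) → (∀ v → ar σ aTAU v 0 ≡ 0) → (∀ v → ar σ aRK v 0 ≡ 0) →
      (∀ v → ar σ aMG v 0 ≡ 0) → (∀ s l → ar σ aVEC s l ≡ 0) →
      Ends bottomUp (λ σ′ → Loop 1 σ′ × clk σ′ ≤ 20 + n * unitStep + Φ (λ _ → time) 1 + clk σ) σ
    bottomUp-rule σ n≡ inp sz tau rk mg vec = ends (while-rule (var vI ⊖ lit 1) eliminate Inv (λ _ _ k → k) (setv vI (vr σ vN) (tick 2 σ))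
      step′ n start)
      where
      Inv : ℕ → Store → Set
      Inv i σ′ = 1 ≤ i × i ≤ n × Loop i σ′ × clk σ′ ≤ 2 + (n ∸ i) * unitStep + Φ (λ _ → time) i + clk σ
      zero-forest : ∀ (μ : Forest → ℕ) → μ nil ≡ 0 → ∀ v → 0 ≡ μ (acc n v)
      zero-forest μ e v = sym (trans (cong μ (acc-n v)) e)
      start : Inv n (setv vI (vr σ vN) (tick 2 σ))
      start = 1≤n , ≤-refl , (n≡ , inp ,
        record { isSize = λ v _ → trans (sz v) (zero-forest nodes refl v) ; isMass = λ v _ → trans (tau v) (zero-forest mass refl v) } ,
        record { isRank = λ v _ → trans (rk v) (zero-forest rank refl v)
               ; isVec = λ v _ nz → contradiction (sym (zero-forest rank refl v)) nz
               ; offset = λ v _ nz → contradiction (sym (zero-forest rank refl v)) nz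
               ; slot = λ v _ nz → contradiction (sym (zero-forest rank refl v)) nz
               ; apart = λ u v _ _ nz → contradiction (sym (zero-forest rank refl u)) nz
               ; zeros = λ s _ l → vec s l } ,
        record { isBIG = λ u n≤u u<n → contradiction n≤u (<⇒≱ u<n) ; shares = λ u n≤u u<n → contradiction n≤u (<⇒≱ u<n) ; clean = λ u _ → mg u }) ,
        lin 3 (λ c x y → [] ⊢ κ 2 ⊞ c ≼ κ 2 ⊞ x ⊞ y ⊞ c) (clk σ) ((n ∸ n) * unitStep) (Φ (λ _ → time) n)
      step′ : ∀ k σ′ → Frame eliminate _ σ′ → Inv k σ′ →
        (vr σ′ vI ∸ 1 ≡ 0 → Loop 1 (tick 4 σ′) × clk (tick 4 σ′) ≤ 20 + n * unitStep + Φ (λ _ → time) 1 + clk σ) ×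
        (vr σ′ vI ∸ 1 ≢ 0 → wp eliminate (λ σ″ → Σ ℕ λ k′ → k′ < k × Inv k′ (tick 1 σ″)) (tick 4 σ′))
      step′ (suc zero) σ′ _ (_ , _ , lp , t) = (λ _ → lp ,
          lin 6 (λ c x φ y z n → (c ≼ κ 2 ⊞ x ⊞ φ ⊞ z) ∷ (x ≼ y) ∷ [] ⊢ κ 4 ⊞ c ≼ κ 20 ⊞ y ⊞ φ ⊞ z)
            (clk σ′) ((n ∸ 1) * unitStep) (Φ (λ _ → time) 1) (n * unitStep) (clk σ) n t (*-monoˡ-≤ unitStep (m∸n≤m n 1))) ,
        (λ ne → contradiction (cong (_∸ 1) (proj₁ lp)) ne)
      step′ (suc (suc i)) σ′ _ (_ , i<n , lp , t) = (λ z → contradiction (trans (sym (cong (_∸ 1) (proj₁ lp))) z) (λ ())) ,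
        (λ _ → andThen (λ σ″ → Σ ℕ λ k′ → k′ < suc (suc i) × Inv k′ (tick 1 σ″)) (Step.elim-rule (suc i) (s≤s z≤n) i<n (tick 4 σ′) lp) after)
        where
        after : ∀ σ″ → Step.Eliminated (suc i) (s≤s z≤n) i<n (clk (tick 4 σ′)) σ″ → Frame eliminate (tick 4 σ′) σ″ → Σ ℕ λ k′ → k′ < suc (suc i) × Inv k′ (tick 1 σ″)
        after σ″ (lp″ , t″) _ = suc i , ≤-refl , s≤s z≤n , <⇒≤ i<n , lp″ , bound
          where
          bound : clk (tick 1 σ″) ≤ 2 + (n ∸ suc i) * unitStep + Φ (λ _ → time) (suc i) + clk σ
          bound = lin 13 (λ c″ c e l x m s d φ₂ φ₁ mt z d′ →
              (c″ ≼ e ⊞ (l ⊞ x ⊞ m ⊞ κ 10 ⊞ s) ⊞ κ 20 ⊞ mt ⊞ (κ 4 ⊞ c)) ∷ (c ≼ κ 2 ⊞ d ⊞ φ₂ ⊞ z) ∷ (φ₂ ⊞ mt ≼ φ₁) ∷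
              ((e ⊞ (l ⊞ x ⊞ m ⊞ κ 10 ⊞ s) ⊞ κ 30) ⊞ d ≼ d′) ∷ [] ⊢
              κ 1 ⊞ c″ ≼ κ 2 ⊞ d′ ⊞ φ₁ ⊞ z)
            (clk σ″) (clk σ′) (cost enter) (cost locate) (cost extend) (cost moveInto) (cost settle) ((n ∸ suc (suc i)) * unitStep)
            (Φ (λ _ → time) (suc (suc i))) (Φ (λ _ → time) (suc i)) (Step.nodeTime (suc i) (s≤s z≤n) i<n) (clk σ) ((n ∸ suc i) * unitStep)
            t″ t (Φ-time (suc i) (s≤s z≤n) i<n) (≤-reflexive (cong (_* unitStep) (sym (+-∸-assoc 1 i<n))))

-- The top-down pass

module Placement (n : ℕ) (par : ℕ → ℕ) (par< : ∀ i → 1 ≤ i → i < n → par i < i) (1≤n : 1 ≤ n)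
                 (b c : ℕ) (a : ℕ → ℕ) (V R : ℕ) (8≤V : 8 ≤ V)
                 (n≤V : 2 * n + 2 ≤ V) (weights≤V : suc n * sumN n a ≤ V) (offsets≤V : suc b * suc n ≤ V)
                 (m≤V : suc (suc b) ≤ V) (quota≤V : suc c * (suc n * suc (suc n)) ≤ V) where

  open Staged n par par<
  open Approximation b c a
  open Logic B V R
  open Names
  open Code B V R C
  open BottomUp n par par< 1≤n b c a V R 8≤V n≤V weights≤V offsets≤V m≤V quota≤V
    using (Cells; Inputs; inputs; cells; cells-same; cells-other; share; Shares)
  open TopDown n par par< 1≤n b c a

  record Known (n′ B′ : ℕ) (PAR BIG MG : Cells) (CH : Cells) : Set where
    field
      isN    : n′ ≡ n
      isB    : B′ ≡ B
      isP    : ∀ v → 1 ≤ v → v < n → PAR v 0 ≡ par v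
      isBIG  : ∀ u → u < n → BIG u 0 ≡ suc (nodes (acc (suc u) u)) ∸ B
      shares : ∀ u → 1 ≤ u → u < n → isBig u ≡ true → Shares u (MG u 0) (CH u)

  open Known

  known : Store → Set
  known σ = Known (vr σ vN) (vr σ vB) (ar σ aPAR) (ar σ aBIG) (ar σ aMG) (ar σ aCH)

  placed : ℕ → (ℕ → ℕ) → Store → Set
  placed i H σ = Top i (λ v → ar σ aLAB v 0) H (λ v → ar σ aREM v 0)

  -- The heights `H` are not stored by the program; they are carried along for the cost bound.
  Placing : ℕ → Store → Set
  Placing i σ = known σ × Σ (ℕ → ℕ) λ H → placed i H σ

  module _ (i : ℕ) (1≤i : 1 ≤ i) (i<n : i < n) where

    private
      p : ℕ
      p = par i
      p<i : p < i
      p<i = par< i 1≤i i<n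
      cs r : Forest
      cs = acc (suc i) i
      r  = acc (suc i) p

    find-rule : ∀ σ → vr σ vI ≡ i → vr σ vP ≡ p → ar σ aREM p 0 ≤ b → Shares i (ar σ aMG i 0) (ar σ aCH i) →
      Ends findShare (λ σ′ → vr σ′ vK ≡ ar σ aREM p 0 × vr σ′ vJ ≡ amount i cs r (ar σ aREM p 0)) σ
    find-rule σ refl p≡ k≤b sh = ends (
      (λ ne → subst (_≤ B) (sym k≡) k≤B ,
         (λ ne₂ → k≡ , trans (cong₂ _∸_ k≡ (cong (ar σ aCH i) k≡)) (two (ar σ aMG i 0) ne ne₂ (sh k k≤B))) ,
         (λ eq₂ → k≡ , trans (cong (ar σ aCH i) k≡) (one′ (ar σ aMG i 0) ne eq₂ (sh k k≤B)))) ,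
      (λ eq → k≡ , trans k≡ (none (ar σ aMG i 0) eq (sh k k≤B))))
      where
      k : ℕ
      k = ar σ aREM p 0
      k≤B : k ≤ B
      k≤B = m≤n⇒m≤1+n k≤b
      k≡ : ar σ aREM (vr σ vP) 0 ≡ k
      k≡ = cong (λ q → ar σ aREM q 0) p≡
      two : ∀ m {x y} → m ≢ 0 → m ∸ 1 ≢ 0 → share m x k ≡ y → k ∸ x ≡ y
      two zero          ne _   e = contradiction refl ne
      two (suc zero)    _  ne₂ e = contradiction refl ne₂
      two (suc (suc m)) _  _   e = e
      one′ : ∀ m {x y} → m ≢ 0 → m ∸ 1 ≡ 0 → share m x k ≡ y → x ≡ y
      one′ zero          ne _ e = contradiction refl ne
      one′ (suc zero)    _  _ e = e
      one′ (suc (suc m)) _  () e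
      none : ∀ m {x y} → m ≡ 0 → share m x k ≡ y → k ≡ y
      none zero _ e = e

    big-place : ∀ σ → vr σ vI ≡ i → vr σ vP ≡ p → isBig i ≡ true → Placing i σ → Ends placeBig (Placing (suc i)) σ
    big-place σ i≡ p≡ bg (kn , H , top) = seq (find-rule σ i≡ p≡ (Top.rem≤ top p p<i (isBig-par i 1≤i i<n bg)) (shares kn i 1≤i i<n bg)) after
      where
      k : ℕ
      k = ar σ aREM p 0
      after : ∀ σ₁ → vr σ₁ vK ≡ k × vr σ₁ vJ ≡ amount i cs r k → Frame findShare σ σ₁ →
        Ends (put aREM (var vP) (lit 0) (var vK ⊖ var vJ) ⨾
              ite (var vJ)
                (put aLAB (var vI) (lit 0) (fld aLAB (var vP)) ⨾ put aREM (var vI) (lit 0) (var vJ ⊖ lit 1))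
                (put aLAB (var vI) (lit 0) (var vI) ⨾ put aREM (var vI) (lit 0) (var vB ⊖ lit 1))) (Placing (suc i)) σ₁
      after σ₁ (k≡ , j≡) f = ends ((λ ne → kn₁ , H′ joinH , joined ne) , (λ eq → kn₁ , H′ openH , opened eq))
        where
        kn₁ : known σ₁
        kn₁ = record { isN = trans (fv f vN refl) (isN kn) ; isB = trans (fv f vB refl) (isB kn)
                     ; isP = λ v u w → trans (cong (λ q → q v 0) (fa f aPAR refl)) (isP kn v u w)
                     ; isBIG = λ v u → trans (cong (λ q → q v 0) (fa f aBIG refl)) (isBIG kn v u)
                     ; shares = λ u v w bb → subst₂ (λ m h → Shares u (m u 0) (h u)) (sym (fa f aMG refl)) (sym (fa f aCH refl)) (shares kn u v w bb) }
        H′ : ℕ → ℕ → ℕ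
        H′ x = upd H i x
        joinH openH : ℕ
        joinH = H p
        openH = suc (H p)
        i₁ : vr σ₁ vI ≡ i
        i₁ = trans (fv f vI refl) i≡
        p₁ : vr σ₁ vP ≡ p
        p₁ = trans (fv f vP refl) p≡
        LAB≡ : ar σ₁ aLAB ≡ ar σ aLAB
        LAB≡ = fa f aLAB refl
        REM≡ : ar σ₁ aREM ≡ ar σ aREM
        REM≡ = fa f aREM refl
        go : ∀ x y h (L Rm : Cells) (iI pP : ℕ) → L ≡ ar σ aLAB → Rm ≡ ar σ aREM → iI ≡ i → pP ≡ p → ∀ d →
          Move i k (λ v → ar σ aLAB v 0) H (λ v → ar σ aREM v 0)
            (λ v → cells (ar σ aLAB) i x v 0) (upd H i h) (λ v → cells (cells (ar σ aREM) p d) i y v 0) →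
          Top (suc i) (λ v → cells L iI x v 0) (upd H i h) (λ v → cells (cells Rm pP d) iI y v 0)
        go x y h .(ar σ aLAB) .(ar σ aREM) .i .p refl refl refl refl d mv = top-step i _ H _ _ _ _ 1≤i i<n top
          (λ v v< → cells-other (ar σ aLAB) i x (≢-sym (<⇒≢ v<)))
          (λ v v< → upd-other H h (≢-sym (<⇒≢ v<)))
          (λ v v< ne → trans (cells-other (cells (ar σ aREM) p d) i y (≢-sym (<⇒≢ v<))) (cells-other (ar σ aREM) p d (≢-sym ne))) mv
        rem-p : ∀ y d → cells (cells (ar σ aREM) p d) i y p 0 ≡ d
        rem-p y d = trans (cells-other (cells (ar σ aREM) p d) i y (≢-sym (<⇒≢ p<i))) (cells-same (ar σ aREM) p d)
        joined : vr σ₁ vJ ≢ 0 → Top (suc i) (λ v → cells (ar σ₁ aLAB) (vr σ₁ vI) (ar σ₁ aLAB (vr σ₁ vP) 0) v 0) (H′ joinH)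
          (λ v → cells (cells (ar σ₁ aREM) (vr σ₁ vP) (vr σ₁ vK ∸ vr σ₁ vJ)) (vr σ₁ vI) (vr σ₁ vJ ∸ 1) v 0)
        joined ne = by (vr σ₁ vJ) refl ne
          where
          by : ∀ j → vr σ₁ vJ ≡ j → j ≢ 0 → Top (suc i) (λ v → cells (ar σ₁ aLAB) (vr σ₁ vI) (ar σ₁ aLAB (vr σ₁ vP) 0) v 0) (H′ joinH)
            (λ v → cells (cells (ar σ₁ aREM) (vr σ₁ vP) (vr σ₁ vK ∸ vr σ₁ vJ)) (vr σ₁ vI) (vr σ₁ vJ ∸ 1) v 0)
          by zero    _ ne = contradiction refl ne
          by (suc j) e _  = go _ _ _ _ _ _ _ LAB≡ REM≡ i₁ p₁ _
            (joins j bg (trans (sym j≡) e) (trans (cells-same (ar σ aLAB) i _) (cong₂ (λ L q → L q 0) LAB≡ p₁)) (upd-same H i _)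
              (trans (cells-same (cells (ar σ aREM) p _) i _) (cong (_∸ 1) e)) (trans (rem-p _ _) (cong₂ _∸_ k≡ e)))
        opened : vr σ₁ vJ ≡ 0 → Top (suc i) (λ v → cells (ar σ₁ aLAB) (vr σ₁ vI) (vr σ₁ vI) v 0) (H′ openH)
          (λ v → cells (cells (ar σ₁ aREM) (vr σ₁ vP) (vr σ₁ vK ∸ vr σ₁ vJ)) (vr σ₁ vI) (vr σ₁ vB ∸ 1) v 0)
        opened eq = go _ _ _ _ _ _ _ LAB≡ REM≡ i₁ p₁ _
          (opens bg (trans (sym j≡) eq) (trans (cells-same (ar σ aLAB) i _) i₁) (upd-same H i _)
            (trans (cells-same (cells (ar σ aREM) p _) i _) (cong (_∸ 1) (isB kn₁))) (trans (rem-p _ _) (cong₂ _∸_ k≡ eq)))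

    small-place : ∀ σ → vr σ vI ≡ i → vr σ vP ≡ p → vr σ vS ≡ suc (nodes (acc (suc p) p)) ∸ B → isBig i ≡ false → Placing i σ →
      Ends placeSmall (Placing (suc i)) σ
    small-place σ i≡ p≡ s≡ sm (kn , H , top) = ends (
      (λ ne → kn , upd H i (suc (H p)) , go _ _ i≡ (small sm (yes-big ne) refl (trans (cells-same (ar σ aLAB) i _) i≡) (upd-same H i _))) ,
      (λ eq → kn , upd H i (H p) , go _ _ i≡ (inner sm (no-big eq) (trans (cells-same (ar σ aLAB) i _) (cong (λ q → ar σ aLAB q 0) p≡)) (upd-same H i _))))
      where
      go : ∀ x h {iI} → iI ≡ i →
        Move i (ar σ aREM p 0) (λ v → ar σ aLAB v 0) H (λ v → ar σ aREM v 0) (λ v → cells (ar σ aLAB) i x v 0) (upd H i h) (λ v → ar σ aREM v 0) →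
        Top (suc i) (λ v → cells (ar σ aLAB) iI x v 0) (upd H i h) (λ v → ar σ aREM v 0)
      go x h refl mv = top-step i _ H _ _ _ _ 1≤i i<n top
        (λ v v< → cells-other (ar σ aLAB) i x (≢-sym (<⇒≢ v<))) (λ v v< → upd-other H h (≢-sym (<⇒≢ v<))) (λ v v< ne → refl) mv
      yes-big : vr σ vS ≢ 0 → isBig p ≡ true
      yes-big ne = Equivalence.to T-≡ (≤⇒≤ᵇ (≤-pred (m∸n≢0⇒n<m {suc (nodes (acc (suc p) p))} {B} (λ z → ne (trans s≡ z)))))
      no-big : vr σ vS ≡ 0 → isBig p ≡ false
      no-big eq with isBig p in e
      ... | false = refl
      ... | true  = contradiction (m∸n≡0⇒m≤n {suc (nodes (acc (suc p) p))} {B} (trans (sym s≡) eq)) (<⇒≱ (s≤s (≤ᵇ⇒≤ B _ (Equivalence.from T-≡ e))))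

    place-rule : ∀ σ → vr σ vI ≡ i → Placing i σ → Ends place (Placing (suc i)) σ
    place-rule σ i≡ pl@(kn , _) = ends (Ends.holds (branch {vG} {placeBig} {placeSmall} {Placing (suc i)}
        {setv vS (ar σ aBIG (ar σ aPAR (vr σ vI) 0) 0) (tick 11 (setv vG (ar σ aBIG (vr σ vI) 0) (tick 11 (setv vP (ar σ aPAR (vr σ vI) 0) (tick 11 σ)))))}
      (λ ne → ensure (big-place _ i≡ p≡ (big-i ne) pl) (λ σ′ q _ → q))
      (λ eq → small-place _ i≡ p≡ (trans (cong (λ q → ar σ aBIG q 0) p≡) (isBIG kn p (<-trans p<i i<n))) (small-i eq) pl)))
      where
      p≡ : ar σ aPAR (vr σ vI) 0 ≡ p
      p≡ = trans (cong (λ q → ar σ aPAR q 0) i≡) (isP kn i 1≤i i<n)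
      g≡ : ar σ aBIG (vr σ vI) 0 ≡ suc (nodes cs) ∸ B
      g≡ = trans (cong (λ q → ar σ aBIG q 0) i≡) (isBIG kn i i<n)
      big-i : ar σ aBIG (vr σ vI) 0 ≢ 0 → isBig i ≡ true
      big-i ne = Equivalence.to T-≡ (≤⇒≤ᵇ (≤-pred (m∸n≢0⇒n<m {suc (nodes cs)} {B} (λ z → ne (trans g≡ z)))))
      small-i : ar σ aBIG (vr σ vI) 0 ≡ 0 → isBig i ≡ false
      small-i eq with isBig i in e
      ... | false = refl
      ... | true  = contradiction (m∸n≡0⇒m≤n {suc (nodes cs)} {B} (trans (sym g≡) eq)) (<⇒≱ (s≤s (≤ᵇ⇒≤ B (nodes cs) (Equivalence.from T-≡ e))))

  Labelled : Store → Set
  Labelled σ = Σ (ℕ → ℕ) λ H → placed n H σ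

  topDown-rule : ∀ σ → inputs σ → ar σ aSZ 0 0 ≡ nodes (acc 1 0) →
    (∀ u → 1 ≤ u → u < n → ar σ aBIG u 0 ≡ suc (nodes (acc (suc u) u)) ∸ B) →
    (∀ u → 1 ≤ u → u < n → isBig u ≡ true → Shares u (ar σ aMG u 0) (ar σ aCH u)) →
    Ends topDown (λ σ′ → Labelled σ′ × clk σ′ ≤ 60 + n * (cost place + 9) + clk σ) σ
  topDown-rule σ inp size≡ bigs shs = ends (
    sz≤ ,
    for-clk vI vN place Placing 1 n refl refl refl (≤-trans (lin 1 (λ n → [] ⊢ n ≼ κ 2 ⊠ n ⊞ κ 2) n) n≤V) _ 1≤n _ refl (Inputs.isN inp)
      (λ i σ′ f i≡ 1≤i i<n pl → andThen (λ σ″ → Placing (suc i) (setv vI (suc i) (tick 5 σ″))) (place-rule i 1≤i i<n (tick 4 σ′) i≡ pl) (λ σ″ q _ → q))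
      (λ σ′ f (_ , lb) c → lb , lin 5 (λ c x y z k → (c ≼ x ⊞ (κ 50 ⊞ z)) ∷ (x ≼ y) ∷ [] ⊢ κ 4 ⊞ c ≼ κ 60 ⊞ y ⊞ z)
        (clk σ′) ((n ∸ 1) * (cost place + 9)) (n * (cost place + 9)) (clk σ) 0 c (*-monoˡ-≤ (cost place + 9) (m∸n≤m n 1)))
      (kn , (λ _ → 1) , top-start _ _ _ (cells-same (ar σ aLAB) 0 0) refl (trans (cells-same (ar σ aREM) 0 _) (cong (_∸ 1) (Inputs.isB inp)))))
    where
    sz≤ : ar σ aSZ 0 0 + 1 ≤ V
    sz≤ = ≤-trans (≤-reflexive (trans (cong (_+ 1) size≡) (+-comm _ 1))) (≤-trans (≤-reflexive all) (≤-trans (lin 1 (λ n → [] ⊢ n ≼ κ 2 ⊠ n ⊞ κ 2) n) n≤V))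
      where
      all : suc (nodes (acc 1 0)) ≡ n
      all = trans (additive (λ _ → 1) nodes refl (λ _ _ _ → refl) 1 ≤-refl 1≤n) (count n)
        where
        count : ∀ n → sumN n (λ _ → 1) ≡ n
        count zero    = refl
        count (suc n) = trans (cong (_+ 1) (count n)) (+-comm n 1)
    kn : Known (vr σ vN) (vr σ vB) (ar σ aPAR) (cells (ar σ aBIG) 0 (ar σ aSZ 0 0 + 1 ∸ vr σ vB)) (ar σ aMG) (ar σ aCH)
    kn = record { isN = Inputs.isN inp ; isB = Inputs.isB inp ; isP = Inputs.isP inp ; isBIG = bigs′ ; shares = shs }
      where
      bigs′ : ∀ u → u < n → cells (ar σ aBIG) 0 (ar σ aSZ 0 0 + 1 ∸ vr σ vB) u 0 ≡ suc (nodes (acc (suc u) u)) ∸ B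
      bigs′ zero    _   = trans (cells-same (ar σ aBIG) 0 (ar σ aSZ 0 0 + 1 ∸ vr σ vB)) (cong₂ _∸_ (trans (cong (_+ 1) size≡) (+-comm _ 1)) (Inputs.isB inp))
      bigs′ (suc u) u<n = trans (cells-other (ar σ aBIG) 0 (ar σ aSZ 0 0 + 1 ∸ vr σ vB) (λ ())) (bigs (suc u) (s≤s z≤n) u<n)

-- A numbering in which parents precede their children

iterate-suc : ∀ {A : Set} (f : A → A) k x → f (f ^[ k ] x) ≡ f ^[ suc k ] x
iterate-suc f zero    x = refl
iterate-suc f (suc k) x = iterate-suc f k (f x)

injection-≤ : ∀ m n (f : ℕ → ℕ) → (∀ i → i < m → f i < n) → (∀ i j → i < m → j < m → f i ≡ f j → i ≡ j) → m ≤ n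
injection-≤ m n f f< inj = injective⇒≤ {f = λ i → fromℕ< (f< (toℕ i) (toℕ<n i))} λ {i} {j} e →
  toℕ-injective (inj _ _ (toℕ<n i) (toℕ<n j) (trans (sym (toℕ-fromℕ< _)) (trans (cong toℕ e) (toℕ-fromℕ< _))))

record Numbering (n : ℕ) (up : ℕ → ℕ) (rt : ℕ) (ord pos : ℕ → ℕ) : Set where
  field
    ord<    : ∀ e → e < n → ord e < n
    pos<    : ∀ v → v < n → pos v < n
    pos-ord : ∀ e → e < n → pos (ord e) ≡ e
    ord-pos : ∀ v → v < n → ord (pos v) ≡ v
    pos-rt  : pos rt ≡ 0
    pos-up  : ∀ v → v < n → v ≢ rt → pos (up v) < pos v

  par : ℕ → ℕ
  par e = pos (up (ord e))

  par< : ∀ i → 1 ≤ i → i < n → par i < i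
  par< i 1≤i i<n = subst (par i <_) (pos-ord i i<n) (pos-up (ord i) (ord< i i<n)
    (λ z → <-irrefl (trans (sym pos-rt) (trans (cong pos (sym z)) (pos-ord i i<n))) 1≤i))

module Ordering (n : ℕ) (up : ℕ → ℕ) (up< : ∀ v → v < n → up v < n) (rt : ℕ) (rt<n : rt < n) (up-rt : up rt ≡ rt)
                (dep : ℕ → ℕ) (dep< : ∀ v → v < n → v ≢ rt → dep (up v) < dep v)
                (num den : ℕ → ℕ) (B V c : ℕ) (n≤V : 5 * n + 5 ≤ V) (con≤V : suc c * (n * n) ≤ V)
                (num≤V : ∀ v → v < n → num v * (suc c * (n * n)) ≤ V) where

  R : ℕ
  R = 2 + 3 * n

  open Logic B V R
  open Names
  open Code B V R (suc c)

  Cells : Set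
  Cells = ℕ → ℕ → ℕ

  cells : Cells → ℕ → ℕ → Cells
  cells f p x = upd f p (upd (f p) 0 x)

  cells-same : ∀ f p x → cells f p x p 0 ≡ x
  cells-same f p x = cong (λ h → h 0) (upd-same f p (upd (f p) 0 x))

  cells-other : ∀ f p x {v} → p ≢ v → cells f p x v 0 ≡ f v 0
  cells-other f p x ne = cong (λ h → h 0) (upd-other f (upd (f p) 0 x) ne)

  record Given (n′ : ℕ) (raw′ : ℕ → ℕ) : Set where
    field
      isN   : n′ ≡ n
      isUp  : ∀ v → v < n → raw′ (2 + 3 * v) ≡ up v
      isNum : ∀ v → v < n → raw′ (3 + 3 * v) ≡ num v
      isDen : ∀ v → v < n → raw′ (4 + 3 * v) ≡ den v

  open Given

  given : Store → Set
  given σ = Given (vr σ vN) (rw σ)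

  in-V : ∀ {x} k → k ≤ 5 → x ≤ k * n + 5 → x ≤ V
  in-V {x} k k≤ h = ≤-trans h (≤-trans (+-monoˡ-≤ 5 (*-monoˡ-≤ n k≤)) n≤V)

  n≤ : n ≤ V
  n≤ = in-V 1 (s≤s z≤n) (lin 1 (λ n → [] ⊢ n ≼ κ 1 ⊠ n ⊞ κ 5) n)

  raw-in : ∀ j {v} → j ≤ 2 → v < n → 2 + j + 3 * v < R
  raw-in j {v} j≤ v<n = lin 3 (λ j v n → (j ≼ κ 2) ∷ (κ 3 ⊠ (κ 1 ⊞ v) ≼ κ 3 ⊠ n) ∷ [] ⊢ κ 1 ⊞ (κ 2 ⊞ j ⊞ κ 3 ⊠ v) ≼ κ 2 ⊞ κ 3 ⊠ n) j v n j≤ (*-monoʳ-≤ 3 v<n)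

  triple≤ : ∀ {v} → v < n → 3 * v ≤ V
  triple≤ {v} v<n = in-V 3 (s≤s (s≤s (s≤s z≤n))) (≤-trans (*-monoʳ-≤ 3 (<⇒≤ v<n)) (m≤m+n (3 * n) 5))

  raw≤ : ∀ j {v} → j ≤ 2 → v < n → 2 + j + 3 * v ≤ V
  raw≤ j j≤ v<n = in-V 3 (s≤s (s≤s (s≤s z≤n))) (≤-trans (<⇒≤ (raw-in j j≤ v<n)) (≤-trans (≤-reflexive (+-comm 2 (3 * n))) (+-monoʳ-≤ (3 * n) (s≤s (s≤s z≤n)))))

  up-fixed : ∀ v → v < n → up v ≡ v → v ≡ rt
  up-fixed v v<n e with v Data.Nat.Properties.≟ rt
  ... | yes r = r
  ... | no ne = contradiction (dep< v v<n ne) (<-irrefl (cong dep e))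

  RootBelow : ℕ → ℕ → Set
  RootBelow k x = rt < k → x ≡ rt

  findRoot-rule : ∀ σ → given σ → Ends findRoot (λ σ′ → vr σ′ vRt ≡ rt × clk σ′ ≤ 10 + n * 60 + clk σ) σ
  findRoot-rule σ gv = ends (for-clk vV vN body (λ k σ′ → given σ′ × RootBelow k (vr σ′ vRt)) 0 n refl refl refl n≤ _ z≤n _ refl (isN gv)
    step′ (λ σ′ f (_ , rb) c → rb rt<n ,
      lin 4 (λ c n k z → (c ≼ n ⊠ k ⊞ (κ 2 ⊞ z)) ∷ (n ⊠ k ≼ n ⊠ κ 60) ∷ [] ⊢ κ 4 ⊞ c ≼ κ 10 ⊞ n ⊠ κ 60 ⊞ z) (clk σ′) n (cost body + 9) (clk σ) c (*-monoʳ-≤ n (≤ᵇ⇒≤ (cost body + 9) 60 _)))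
    (gv , λ ()))
    where
    body : Stmt
    body = vX ≔ parentOf vV ⨾ ite ((var vX ⊖ var vV) ⊕ (var vV ⊖ var vX)) skip (vRt ≔ var vV)
    step′ : ∀ k σ′ → Frame (body ⨾ vV ≔ var vV ⊕ lit 1) _ σ′ → vr σ′ vV ≡ k → 0 ≤ k → k < n → given σ′ × RootBelow k (vr σ′ vRt) →
      wp body (λ σ″ → given σ″ × RootBelow (suc k) (vr σ″ vRt)) (tick 4 σ′)
    step′ k σ′ _ refl _ k<n (gv′ , rb) =
      triple≤ k<n , raw≤ 0 z≤n k<n , raw-in 0 z≤n k<n ,
      in-V 2 (s≤s (s≤s z≤n)) (≤-trans (+-mono-≤ (≤-trans (m∸n≤m (rw σ′ (2 + 3 * k)) k) (≤-trans (≤-reflexive (isUp gv′ k k<n)) (<⇒≤ (up< k k<n)))) (≤-trans (m∸n≤m k (rw σ′ (2 + 3 * k))) (<⇒≤ k<n)))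
        (lin 1 (λ n → [] ⊢ n ⊞ n ≼ κ 2 ⊠ n ⊞ κ 5) n)) ,
      (λ ne → gv′ , λ { (s≤s rt≤k) → keep ne (m≤n⇒m<n∨m≡n rt≤k) }) ,
      (λ eq → gv′ , λ _ → up-fixed k k<n (trans (sym (isUp gv′ k k<n)) (≤-antisym
        (m∸n≡0⇒m≤n (m+n≡0⇒m≡0 (rw σ′ (2 + 3 * k) ∸ k) eq)) (m∸n≡0⇒m≤n (m+n≡0⇒n≡0 (rw σ′ (2 + 3 * k) ∸ k) eq)))))
      where
      keep : (rw σ′ (2 + 3 * k) ∸ k) + (k ∸ rw σ′ (2 + 3 * k)) ≢ 0 → rt < k ⊎ rt ≡ k → vr σ′ vRt ≡ rt
      keep ne (inj₁ lt)   = rb lt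
      keep ne (inj₂ refl) = contradiction (trans (cong (λ z → (z ∸ rt) + (rt ∸ z)) (trans (isUp gv′ rt k<n) up-rt)) (cong₂ _+_ (n∸n≡0 rt) (n∸n≡0 rt))) ne

  anc : ℕ → ℕ → ℕ
  anc k v = up ^[ k ] v

  anc< : ∀ k v → v < n → anc k v < n
  anc< zero    v v< = v<
  anc< (suc k) v v< = anc< k (up v) (up< v v<)

  anc-dep : ∀ d v → v < n → (∀ i → i < d → anc i v ≢ rt) → ∀ i j → i < j → j ≤ d → dep (anc j v) < dep (anc i v)
  anc-dep d v v<n nr i (suc j) (s≤s i≤j) j<d with m≤n⇒m<n∨m≡n i≤j
  ... | inj₁ i<j = <-trans one′ (anc-dep d v v<n nr i j i<j (<⇒≤ j<d))
    where
    one′ : dep (anc (suc j) v) < dep (anc j v)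
    one′ = subst (λ z → dep z < dep (anc j v)) (iterate-suc up j v) (dep< (anc j v) (anc< j v v<n) (nr j j<d))
  ... | inj₂ refl = subst (λ z → dep z < dep (anc j v)) (iterate-suc up j v) (dep< (anc j v) (anc< j v v<n) (nr j j<d))

  -- Depth falls strictly along the chain, so its nodes are distinct.
  anc-bound : ∀ d v → v < n → (∀ i → i < d → anc i v ≢ rt) → d ≤ n
  anc-bound d v v<n nr = injection-≤ d n (λ i → anc i v) (λ i _ → anc< i v v<n) inj
    where
    inj : ∀ i j → i < d → j < d → anc i v ≡ anc j v → i ≡ j
    inj i j i<d j<d e with <-cmp i j
    ... | tri< i<j _ _ = contradiction (anc-dep d v v<n nr i j i<j (<⇒≤ j<d)) (<-irrefl (cong dep (sym e)))
    ... | tri≈ _ eq _  = eq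
    ... | tri> _ _ j<i = contradiction (anc-dep d v v<n nr j i j<i (<⇒≤ i<d)) (<-irrefl (cong dep e))

  -- POS v is the position of v plus one, or 0 as long as v has none.
  record Partial (cnt : ℕ) (ORD POS : Cells) : Set where
    field
      posLt   : ∀ v → v < n → POS v 0 ≢ 0 → POS v 0 ≤ cnt
      back    : ∀ v → v < n → POS v 0 ≢ 0 → ORD (POS v 0 ∸ 1) 0 ≡ v
      ordLt   : ∀ e → e < cnt → ORD e 0 < n × POS (ORD e 0) 0 ≡ suc e
      parLt   : ∀ v → v < n → POS v 0 ≢ 0 → v ≢ rt → POS (up v) 0 ≢ 0 × POS (up v) 0 < POS v 0
      rootPos : POS rt 0 ≡ 1

  open Partial

  count-≤ : ∀ {cnt ORD POS} → Partial cnt ORD POS → cnt ≤ n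
  count-≤ {cnt} {ORD} {POS} pt = injection-≤ cnt n (λ e → ORD e 0) (λ e e< → proj₁ (ordLt pt e e<))
    (λ e e′ e< e′< eq → suc-injective (trans (sym (proj₂ (ordLt pt e e<))) (trans (cong (λ z → POS z 0) eq) (proj₂ (ordLt pt e′ e′<)))))

  -- the part of the chain of unnumbered nodes that starts in u and has r nodes
  record Middle (cnt top r u : ℕ) (ORD POS : Cells) : Set where
    field
      posLt′ : ∀ v → v < n → POS v 0 ≢ 0 → POS v 0 ≤ cnt ⊎ (cnt + r < POS v 0 × POS v 0 ≤ top)
      back′  : ∀ v → v < n → POS v 0 ≢ 0 → ORD (POS v 0 ∸ 1) 0 ≡ v
      ordLt′ : ∀ e → e < cnt ⊎ (cnt + r ≤ e × e < top) → ORD e 0 < n × POS (ORD e 0) 0 ≡ suc e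
      parLt′ : ∀ v → v < n → POS v 0 ≢ 0 → v ≢ rt → (POS (up v) 0 ≢ 0 × POS (up v) 0 < POS v 0) ⊎ (up v ≡ u × POS v 0 ≡ suc (cnt + r))
      root′  : POS rt 0 ≡ 1
      new    : ∀ i → i < r → POS (anc i u) 0 ≡ 0
      old    : POS (anc r u) 0 ≢ 0 × POS (anc r u) 0 ≤ cnt
      u<     : u < n
      r≤     : cnt + r ≤ top

  open Middle

  private
    0≢1′ : 0 ≢ 1
    0≢1′ ()

  -- Numbers are given out from the top. The only numbered node with an unnumbered parent is the one
  -- treated last, the second alternative of `parLt′`; numbering `u` settles it and puts `u` in its
  -- place.
  middle-step : ∀ {cnt top r u ORD POS} → Middle cnt top (suc r) u ORD POS →
    Middle cnt top r (up u) (cells ORD (cnt + r) u) (cells POS u (suc (cnt + r)))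
  middle-step {cnt} {top} {r} {u} {ORD} {POS} md = record
    { posLt′ = pos₁ ; back′ = back₁ ; ordLt′ = ord₁ ; parLt′ = par₁
    ; root′ = trans (other rt (u≢ rt (λ z → 0≢1′ (trans (sym z) (root′ md))))) (root′ md)
    ; new = λ i i<r → trans (other (anc i (up u)) (acyclic i i<r)) (new md (suc i) (s≤s i<r))
    ; old = subst (λ z → z ≢ 0 × z ≤ cnt) (sym (other (anc r (up u)) (u≢ (anc r (up u)) (proj₁ (old md))))) (old md)
    ; u< = up< u (u< md) ; r≤ = ≤-trans (+-monoʳ-≤ cnt (n≤1+n r)) (r≤ md) }
    where
    e₀ : ℕ
    e₀ = cnt + r
    POS₁ ORD₁ : Cells
    POS₁ = cells POS u (suc e₀)
    ORD₁ = cells ORD e₀ u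
    u-new : POS u 0 ≡ 0
    u-new = new md 0 (s≤s z≤n)
    u≢ : ∀ w → POS w 0 ≢ 0 → u ≢ w
    u≢ w nz refl = nz u-new
    other : ∀ w → u ≢ w → POS₁ w 0 ≡ POS w 0
    other w ne = cells-other POS u (suc e₀) ne
    same : POS₁ u 0 ≡ suc e₀
    same = cells-same POS u (suc e₀)
    -- The rest of the chain keeps its zeros, as a return to `u` would contradict the fall of the
    -- depth.
    acyclic : ∀ i → i < r → u ≢ anc i (up u)
    acyclic i i<r eq = <-irrefl (cong dep (sym eq)) (anc-dep (suc r) u (u< md) (λ j j< z → 0≢1′ (trans (sym (new md j j<)) (trans (cong (λ q → POS q 0) z) (root′ md)))) 0 (suc i) (s≤s z≤n) (m≤n⇒m≤1+n i<r))
    e₀<top : e₀ < top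
    e₀<top = ≤-trans (≤-reflexive (sym (+-suc cnt r))) (r≤ md)
    pos₁ : ∀ v → v < n → POS₁ v 0 ≢ 0 → POS₁ v 0 ≤ cnt ⊎ (cnt + r < POS₁ v 0 × POS₁ v 0 ≤ top)
    pos₁ v v<n nz with u Data.Nat.Properties.≟ v
    ... | yes refl = inj₂ (≤-reflexive (sym same) , ≤-trans (≤-reflexive same) e₀<top)
    ... | no ne with posLt′ md v v<n (λ z → nz (trans (other v ne) z))
    ...   | inj₁ l       = inj₁ (≤-trans (≤-reflexive (other v ne)) l)
    ...   | inj₂ (l , m) = inj₂ (≤-trans (≤-trans (s≤s (+-monoʳ-≤ cnt (n≤1+n r))) l) (≤-reflexive (sym (other v ne))) , ≤-trans (≤-reflexive (other v ne)) m)
    back₁ : ∀ v → v < n → POS₁ v 0 ≢ 0 → ORD₁ (POS₁ v 0 ∸ 1) 0 ≡ v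
    back₁ v v<n nz with u Data.Nat.Properties.≟ v
    ... | yes refl = trans (cong (λ z → ORD₁ (z ∸ 1) 0) same) (cells-same ORD e₀ u)
    ... | no ne = trans (cong (λ z → ORD₁ (z ∸ 1) 0) (other v ne)) (trans (cells-other ORD e₀ u away) (back′ md v v<n nz′))
      where
      nz′ : POS v 0 ≢ 0
      nz′ z = nz (trans (other v ne) z)
      away : e₀ ≢ POS v 0 ∸ 1
      away e with POS v 0 | nz′ | posLt′ md v v<n nz′
      ... | zero  | q | _ = q refl
      ... | suc x | _ | inj₁ l       = <⇒≱ l (≤-trans (m≤m+n cnt r) (≤-reflexive e))
      ... | suc x | _ | inj₂ (l , _) = <⇒≱ (≤-trans (≤-reflexive (sym (+-suc cnt r))) (≤-pred l)) (≤-reflexive (sym e))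
    ord₁ : ∀ e → e < cnt ⊎ (cnt + r ≤ e × e < top) → ORD₁ e 0 < n × POS₁ (ORD₁ e 0) 0 ≡ suc e
    ord₁ e h with e₀ Data.Nat.Properties.≟ e
    ... | yes refl = subst (λ z → z < n × POS₁ z 0 ≡ suc e₀) (sym (cells-same ORD e₀ u)) (u< md , same)
    ... | no ne with ordLt′ md e (shift′ h)
      where
      shift′ : e < cnt ⊎ (cnt + r ≤ e × e < top) → e < cnt ⊎ (cnt + suc r ≤ e × e < top)
      shift′ (inj₁ l) = inj₁ l
      shift′ (inj₂ (l , m)) = inj₂ (≤-trans (≤-reflexive (+-suc cnt r)) (≤∧≢⇒< l ne) , m)
    ...   | l , q = subst (λ z → z < n × POS₁ z 0 ≡ suc e) (sym (cells-other ORD e₀ u ne))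
                      (l , trans (other _ (u≢ _ (λ z → 0≢1+n (trans (sym z) q)))) q)
    par₁ : ∀ v → v < n → POS₁ v 0 ≢ 0 → v ≢ rt → (POS₁ (up v) 0 ≢ 0 × POS₁ (up v) 0 < POS₁ v 0) ⊎ (up v ≡ up u × POS₁ v 0 ≡ suc (cnt + r))
    par₁ v v<n nz nr with u Data.Nat.Properties.≟ v
    ... | yes refl = inj₂ (refl , same)
    ... | no ne with parLt′ md v v<n (λ z → nz (trans (other v ne) z)) nr
    ...   | inj₁ (m , l) = inj₁ (subst₂ (λ x y → x ≢ 0 × x < y) (sym (other (up v) (u≢ (up v) m))) (sym (other v ne)) (m , l))
    ...   | inj₂ (refl , q) = inj₁ (subst₂ (λ x y → x ≢ 0 × x < y) (sym same) (sym (trans (other v ne) q)) ((λ ()) , s≤s (≤-reflexive (sym (+-suc cnt r)))))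

  middle-start : ∀ {cnt d u ORD POS} → Partial cnt ORD POS → u < n → (∀ i → i < d → POS (anc i u) 0 ≡ 0) → POS (anc d u) 0 ≢ 0 →
    Middle cnt (cnt + d) d u ORD POS
  middle-start {cnt} {d} {u} pt u<n nw od = record
    { posLt′ = λ v v< nz → inj₁ (posLt pt v v< nz) ; back′ = back pt
    ; ordLt′ = λ { e (inj₁ l) → ordLt pt e l ; e (inj₂ (l , m)) → contradiction l (<⇒≱ m) }
    ; parLt′ = λ v v< nz nr → inj₁ (parLt pt v v< nz nr) ; root′ = rootPos pt
    ; new = nw ; old = od , posLt pt (anc d u) (anc< d u u<n) od ; u< = u<n ; r≤ = ≤-refl }

  middle-end : ∀ {cnt top u ORD POS} → Middle cnt top 0 u ORD POS → Partial top ORD POS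
  middle-end {cnt} {top} {u} {ORD} {POS} md = record
    { posLt = λ v v< nz → pos₁ (posLt′ md v v< nz) ; back = back′ md
    ; ordLt = λ e e< → ordLt′ md e (side e e<)
    ; parLt = λ v v< nz nr → par₁ v (parLt′ md v v< nz nr) ; rootPos = root′ md }
    where
    cnt≤top : cnt ≤ top
    cnt≤top = ≤-trans (m≤m+n cnt 0) (r≤ md)
    pos₁ : ∀ {x} → x ≤ cnt ⊎ (cnt + 0 < x × x ≤ top) → x ≤ top
    pos₁ (inj₁ l)       = ≤-trans l cnt≤top
    pos₁ (inj₂ (_ , m)) = m
    side : ∀ e → e < top → e < cnt ⊎ (cnt + 0 ≤ e × e < top)
    side e e< with <-≤-connex e cnt
    ... | inj₁ l = inj₁ l
    ... | inj₂ g = inj₂ (≤-trans (≤-reflexive (+-identityʳ cnt)) g , e<)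
    par₁ : ∀ v → (POS (up v) 0 ≢ 0 × POS (up v) 0 < POS v 0) ⊎ (up v ≡ u × POS v 0 ≡ suc (cnt + 0)) → POS (up v) 0 ≢ 0 × POS (up v) 0 < POS v 0
    par₁ v (inj₁ h)          = h
    par₁ v (inj₂ (refl , q)) = proj₁ (old md) , ≤-trans (s≤s (≤-trans (proj₂ (old md)) (m≤m+n cnt 0))) (≤-reflexive (sym q))

  climbBody assignBody visit : Stmt
  climbBody = vD ≔ var vD ⊕ lit 1 ⨾ vU ≔ parentOf vU
  assignBody = vD ≔ var vD ⊖ lit 1 ⨾ vE ≔ var vE ⊖ lit 1 ⨾
    put aORD (var vE) (lit 0) (var vU) ⨾ put aPOS (var vU) (lit 0) (var vE ⊕ lit 1) ⨾ vU ≔ parentOf vU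
  visit = vU ≔ var vV ⨾ vD ≔ lit 0 ⨾ climb ⨾ vE ≔ var vCnt ⊕ var vD ⨾ vCnt ≔ var vE ⨾ vU ≔ var vV ⨾ assign

  partial : ℕ → Store → Set
  partial cnt σ = Partial cnt (ar σ aORD) (ar σ aPOS)

  Climbed : ℕ → ℕ → ℕ → Store → Set
  Climbed v t d σ = vr σ vD ≡ d × vr σ vU ≡ anc d v × given σ × (∀ i → i < d → ar σ aPOS (anc i v) 0 ≡ 0) × clk σ ≤ d * 60 + t

  private
    positive : ∀ {x} → x ≢ 0 → 1 ∸ x ≡ 0
    positive {zero}  ne = contradiction refl ne
    positive {suc x} ne = 0∸n≡0 x

    nonroot : ∀ {POS : Cells} {u} → POS rt 0 ≡ 1 → POS u 0 ≡ 0 → u ≢ rt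
    nonroot r z refl = 0≢1′ (trans (sym z) r)

  climb-rule : ∀ cnt v σ → v < n → vr σ vU ≡ v → vr σ vD ≡ 0 → given σ → partial cnt σ →
    Ends climb (λ σ′ → Σ ℕ λ d → Climbed v (20 + clk σ) d σ′ × ar σ′ aPOS (anc d v) 0 ≢ 0) σ
  climb-rule cnt v σ v<n u≡ d≡ gv pt = ends (while-rule (lit 1 ⊖ fld aPOS (var vU)) climbBody Inv (λ _ _ k → k) σ step′ (dep v)
    (0 , (d≡ , u≡ , gv , (λ _ ()) , ≤-refl) , refl , rootPos pt))
    where
    Inv : ℕ → Store → Set
    Inv k σ′ = Σ ℕ λ d → Climbed v (clk σ) d σ′ × k ≡ dep (anc d v) × ar σ′ aPOS rt 0 ≡ 1
    step′ : ∀ k σ′ → Frame climbBody σ σ′ → Inv k σ′ →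
      (1 ∸ ar σ′ aPOS (vr σ′ vU) 0 ≡ 0 → Σ ℕ λ d → Climbed v (20 + clk σ) d (tick 13 σ′) × ar σ′ aPOS (anc d v) 0 ≢ 0) ×
      (1 ∸ ar σ′ aPOS (vr σ′ vU) 0 ≢ 0 → wp climbBody (λ σ″ → Σ ℕ λ k′ → k′ < k × Inv k′ (tick 1 σ″)) (tick 13 σ′))
    step′ k σ′ _ (d , (d≡ , u≡ , gv′ , nw , t) , refl , rp) =
      (λ z → d , (d≡ , u≡ , gv′ , nw , lin 3 (λ c x y → (c ≼ x ⊞ y) ∷ [] ⊢ κ 13 ⊞ c ≼ x ⊞ (κ 20 ⊞ y)) (clk σ′) (d * 60) (clk σ) t) ,
        λ p → 1≢0 (trans (sym (cong (1 ∸_) (trans (cong (λ q → ar σ′ aPOS q 0) u≡) p))) z)) ,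
      (λ nz → subst (λ x → x + 1 ≤ V) (sym d≡) (≤-trans (≤-reflexive (+-comm d 1)) (≤-trans (anc-bound (suc d) v v<n (nr nz)) n≤)) ,
        triple≤ (u<n σ′ u≡) , raw≤ 0 z≤n (u<n σ′ u≡) , raw-in 0 z≤n (u<n σ′ u≡) ,
        dep (anc (suc d) v) , subst (λ z → dep z < dep (anc d v)) (iterate-suc up d v) (dep< (anc d v) (anc< d v v<n) (nr nz d ≤-refl)) , suc d ,
        (trans (cong (_+ 1) d≡) (+-comm d 1) , trans (isUp gv′ _ (u<n σ′ u≡)) (trans (cong up u≡) (iterate-suc up d v)) , gv′ , new₁ nz ,
         lin 3 (λ c x y → (c ≼ x ⊞ y) ∷ [] ⊢ κ 1 ⊞ (κ 24 ⊞ c) ≼ κ 60 ⊞ x ⊞ y) (clk σ′) (d * 60) (clk σ) t) , refl , rp)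
      where
      1≢0 : 1 ≢ 0
      1≢0 ()
      u<n : ∀ σ′ → vr σ′ vU ≡ anc d v → vr σ′ vU < n
      u<n σ′ e = subst (_< n) (sym e) (anc< d v v<n)
      unnumbered : 1 ∸ ar σ′ aPOS (vr σ′ vU) 0 ≢ 0 → ar σ′ aPOS (anc d v) 0 ≡ 0
      unnumbered nz with ar σ′ aPOS (anc d v) 0 Data.Nat.Properties.≟ 0
      ... | yes z = z
      ... | no ne = contradiction (positive (λ z → ne (trans (cong (λ q → ar σ′ aPOS q 0) (sym u≡)) z))) nz
      new₁ : 1 ∸ ar σ′ aPOS (vr σ′ vU) 0 ≢ 0 → ∀ i → i < suc d → ar σ′ aPOS (anc i v) 0 ≡ 0
      new₁ nz i i< with m≤n⇒m<n∨m≡n i<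
      ... | inj₁ (s≤s i<d) = nw i i<d
      ... | inj₂ refl      = unnumbered nz
      nr : 1 ∸ ar σ′ aPOS (vr σ′ vU) 0 ≢ 0 → ∀ i → i < suc d → anc i v ≢ rt
      nr nz i i< = nonroot {ar σ′ aPOS} rp (new₁ nz i i<)

  Numbered : ℕ → ℕ → Cells → Store → Set
  Numbered v cnt POS₀ σ = given σ × partial cnt σ × (∀ w → POS₀ w 0 ≢ 0 → ar σ aPOS w 0 ≢ 0) × ar σ aPOS v 0 ≢ 0

  assign-rule : ∀ v cnt d σ → v < n → vr σ vU ≡ v → vr σ vD ≡ d → vr σ vE ≡ cnt + d → cnt + d ≤ 2 * n → given σ → partial cnt σ →
    (∀ i → i < d → ar σ aPOS (anc i v) 0 ≡ 0) → ar σ aPOS (anc d v) 0 ≢ 0 →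
    Ends assign (λ σ′ → Numbered v (cnt + d) (ar σ aPOS) σ′ × clk σ′ ≤ 10 + d * 60 + clk σ) σ
  assign-rule v cnt d σ v<n u≡ d≡ e≡ top≤ gv pt nw od = ends (while-rule (var vD) assignBody Inv (λ _ _ k → k) σ step′ d
    (v , d≡ , e≡ , u≡ , gv , middle-start pt v<n nw od , (λ w nz → nz) , start od ,
      subst (λ z → clk σ ≤ z * 60 + clk σ) (sym (n∸n≡0 d)) ≤-refl , ≤-refl))
    where
    start : ar σ aPOS (anc d v) 0 ≢ 0 → (d ≡ d × v ≡ v) ⊎ ar σ aPOS v 0 ≢ 0
    start _ = inj₁ (refl , refl)
    Inv : ℕ → Store → Set
    Inv r σ′ = Σ ℕ λ u → vr σ′ vD ≡ r × vr σ′ vE ≡ cnt + r × vr σ′ vU ≡ u × given σ′ ×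
      Middle cnt (cnt + d) r u (ar σ′ aORD) (ar σ′ aPOS) × (∀ w → ar σ aPOS w 0 ≢ 0 → ar σ′ aPOS w 0 ≢ 0) ×
      ((r ≡ d × u ≡ v) ⊎ ar σ′ aPOS v 0 ≢ 0) × clk σ′ ≤ (d ∸ r) * 60 + clk σ × r ≤ d
    step′ : ∀ r σ′ → Frame assignBody σ σ′ → Inv r σ′ →
      (vr σ′ vD ≡ 0 → Numbered v (cnt + d) (ar σ aPOS) (tick 2 σ′) × clk (tick 2 σ′) ≤ 10 + d * 60 + clk σ) ×
      (vr σ′ vD ≢ 0 → wp assignBody (λ σ″ → Σ ℕ λ k′ → k′ < r × Inv k′ (tick 1 σ″)) (tick 2 σ′))
    step′ zero σ′ _ (u , d₁ , e₁ , u₁ , gv′ , md , keep , vis , t , _) =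
      (λ _ → (gv′ , middle-end md , keep , fin vis) ,
        lin 3 (λ c x y → (c ≼ x ⊞ y) ∷ [] ⊢ κ 2 ⊞ c ≼ κ 10 ⊞ x ⊞ y) (clk σ′) (d * 60) (clk σ) t) ,
      (λ ne → contradiction d₁ ne)
      where
      fin : (0 ≡ d × u ≡ v) ⊎ ar σ′ aPOS v 0 ≢ 0 → ar σ′ aPOS v 0 ≢ 0
      fin (inj₁ (_ , refl)) = proj₁ (old md)
      fin (inj₂ nz)         = nz
    step′ (suc r) σ′ _ (u , d₁ , e₁ , refl , gv′ , md , keep , vis , t , r<d) =
      (λ z → contradiction (trans (sym d₁) z) (λ ())) ,
      (λ _ → subst (λ z → z + 1 ≤ V) (sym e₂) small-e , triple≤ (u< md) , raw≤ 0 z≤n (u< md) , raw-in 0 z≤n (u< md) ,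
        r , ≤-refl , up u , cong (_∸ 1) d₁ , e₂ , isUp gv′ u (u< md) , gv′ , md₁ , keep₁ , inj₂ vis₁ ,
        lin 4 (λ c x y x′ → (c ≼ x ⊞ y) ∷ (κ 60 ⊞ x ≼ x′) ∷ [] ⊢ κ 1 ⊞ (κ 41 ⊞ c) ≼ x′ ⊞ y) (clk σ′) ((d ∸ suc r) * 60) (clk σ) ((d ∸ r) * 60) t
          (≤-reflexive (cong (_* 60) {suc (d ∸ suc r)} {d ∸ r} (sym (+-∸-assoc 1 {d} {suc r} r<d)))) , <⇒≤ r<d)
      where
      e₂ : vr σ′ vE ∸ 1 ≡ cnt + r
      e₂ = trans (cong (_∸ 1) e₁) (cong (_∸ 1) (+-suc cnt r))
      small-e : cnt + r + 1 ≤ V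
      small-e = in-V 2 (s≤s (s≤s z≤n)) (≤-trans (≤-trans (≤-reflexive (trans (+-comm (cnt + r) 1) (sym (+-suc cnt r)))) (≤-trans (r≤ md) top≤)) (m≤m+n (2 * n) 5))
      md₁ : Middle cnt (cnt + d) r (up u) (cells (ar σ′ aORD) (vr σ′ vE ∸ 1) u) (cells (ar σ′ aPOS) u (vr σ′ vE ∸ 1 + 1))
      md₁ = subst₂ (λ e p → Middle cnt (cnt + d) r (up u) (cells (ar σ′ aORD) e u) (cells (ar σ′ aPOS) u p)) (sym e₂)
              (sym (trans (cong (_+ 1) e₂) (+-comm (cnt + r) 1))) (middle-step md)
      marked : ∀ w → ar σ′ aPOS w 0 ≢ 0 ⊎ u ≡ w → cells (ar σ′ aPOS) u (vr σ′ vE ∸ 1 + 1) w 0 ≢ 0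
      marked w h z with u Data.Nat.Properties.≟ w | h
      ... | yes refl | _        = contradiction (trans (sym (+-comm (vr σ′ vE ∸ 1) 1)) (trans (sym (cells-same (ar σ′ aPOS) u (vr σ′ vE ∸ 1 + 1))) z)) (λ ())
      ... | no ne    | inj₁ nz  = nz (trans (sym (cells-other (ar σ′ aPOS) u (vr σ′ vE ∸ 1 + 1) ne)) z)
      ... | no ne    | inj₂ eq  = ne eq
      keep₁ : ∀ w → ar σ aPOS w 0 ≢ 0 → cells (ar σ′ aPOS) u (vr σ′ vE ∸ 1 + 1) w 0 ≢ 0
      keep₁ w nz = marked w (inj₁ (keep w nz))
      vis₁ : cells (ar σ′ aPOS) u (vr σ′ vE ∸ 1 + 1) v 0 ≢ 0
      vis₁ = case vis
        where
        case : (suc r ≡ d × u ≡ v) ⊎ ar σ′ aPOS v 0 ≢ 0 → cells (ar σ′ aPOS) u (vr σ′ vE ∸ 1 + 1) v 0 ≢ 0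
        case (inj₁ (_ , e)) = marked v (inj₂ e)
        case (inj₂ nz)      = marked v (inj₁ nz)

  given-frame : ∀ {s σ σ′} → wv s vN ≡ false → wr s ≡ false → Frame s σ σ′ → given σ → given σ′
  given-frame {σ = σ} {σ′} a₁ a₂ f gv = subst₂ Given (sym (fv f vN a₁)) (sym (fr f a₂)) gv

  -- Amortisation: a visit pays 200 for its constant part and 120 for each node that it numbers, 60
  -- for climbing and 60 for assigning.
  Visited : ℕ → ℕ → Store → Set
  Visited t k σ = Σ ℕ λ cnt → k ≤ n × given σ × partial cnt σ × vr σ vCnt ≡ cnt × (∀ w → w < k → ar σ aPOS w 0 ≢ 0) × clk σ ≤ k * 200 + cnt * 120 + t

  visit-rule : ∀ t k σ → k < n → vr σ vV ≡ k → Visited t k σ → Ends visit (λ σ′ → Visited t (suc k) (tick 9 σ′)) σ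
  visit-rule t k σ k<n refl (cnt , _ , gv , pt , c≡ , seen , t₀) = ends (andThen (wp (vE ≔ var vCnt ⊕ var vD ⨾ vCnt ≔ var vE ⨾ vU ≔ var vV ⨾ assign) Q)
    (climb-rule cnt k (setv vD 0 (tick 2 (setv vU k (tick 2 σ)))) k<n refl refl gv pt) after-climb)
    where
    Q : Store → Set
    Q σ′ = Visited t (suc k) (tick 9 σ′)
    after-climb : ∀ σ₁ → (Σ ℕ λ d → Climbed k (24 + clk σ) d σ₁ × ar σ₁ aPOS (anc d k) 0 ≢ 0) →
      Frame climb (setv vD 0 (tick 2 (setv vU k (tick 2 σ)))) σ₁ → wp (vE ≔ var vCnt ⊕ var vD ⨾ vCnt ≔ var vE ⨾ vU ≔ var vV ⨾ assign) Q σ₁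
    after-climb σ₁ (d , (d≡ , _ , gv₁ , nw , t₁) , od) f =
      subst (λ z → z ≤ V) (sym e≡) (in-V 2 (s≤s (s≤s z≤n)) (≤-trans top≤ (m≤m+n (2 * n) 5))) ,
      andThen Q (assign-rule k cnt d (setv vU (vr σ₁ vV) (tick 2 (setv vCnt (vr σ₁ vCnt + vr σ₁ vD) (tick 2 (setv vE (vr σ₁ vCnt + vr σ₁ vD) (tick 4 σ₁))))))
        k<n (fv f vV refl) d≡ e≡ top≤ gv₁ pt₁ nw od) after-assign
      where
      pt₁ : partial cnt σ₁
      pt₁ = subst₂ (Partial cnt) (sym (fa f aORD refl)) (sym (fa f aPOS refl)) pt
      e≡ : vr σ₁ vCnt + vr σ₁ vD ≡ cnt + d
      e≡ = cong₂ _+_ (trans (fv f vCnt refl) c≡) d≡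
      d≤n : d ≤ n
      d≤n = anc-bound d k k<n (λ i i<d → nonroot {ar σ₁ aPOS} (rootPos pt₁) (nw i i<d))
      top≤ : cnt + d ≤ 2 * n
      top≤ = lin 3 (λ c d n → (c ≼ n) ∷ (d ≼ n) ∷ [] ⊢ c ⊞ d ≼ κ 2 ⊠ n) cnt d n (count-≤ pt) d≤n
      after-assign : ∀ σ₂ → Numbered k (cnt + d) (ar σ₁ aPOS) σ₂ × clk σ₂ ≤ 10 + d * 60 + (8 + clk σ₁) → Frame assign _ σ₂ → Q σ₂
      after-assign σ₂ ((gv₂ , pt₂ , keep , vis) , t₂) f₂ = cnt + d , k<n , gv₂ , pt₂ , trans (fv f₂ vCnt refl) e≡ , seen₂ ,
        ≤-trans (lin 4 (λ c₂ c₁ c d → (c₂ ≼ κ 10 ⊞ d ⊠ κ 60 ⊞ (κ 8 ⊞ c₁)) ∷ (c₁ ≼ d ⊠ κ 60 ⊞ (κ 24 ⊞ c)) ∷ [] ⊢ κ 9 ⊞ c₂ ≼ κ 100 ⊞ d ⊠ κ 120 ⊞ c)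
            (clk σ₂) (clk σ₁) (clk σ) d t₂ t₁)
          (lin 5 (λ c k cnt d t → (c ≼ k ⊠ κ 200 ⊞ cnt ⊠ κ 120 ⊞ t) ∷ [] ⊢ κ 100 ⊞ d ⊠ κ 120 ⊞ c ≼ (κ 1 ⊞ k) ⊠ κ 200 ⊞ (cnt ⊞ d) ⊠ κ 120 ⊞ t)
            (clk σ) k cnt d t t₀)
        where
        seen₂ : ∀ w → w < suc k → ar σ₂ aPOS w 0 ≢ 0
        seen₂ w w< with m≤n⇒m<n∨m≡n w<
        ... | inj₁ (s≤s w<k) = keep w (λ z → seen w w<k (trans (sym (cong (λ q → q w 0) (fa f aPOS refl))) z))
        ... | inj₂ refl      = vis

  Ordered : Store → Set
  Ordered σ = given σ × partial n σ × (∀ w → w < n → ar σ aPOS w 0 ≢ 0)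

  order-rule : ∀ σ → given σ → (∀ v → ar σ aPOS v 0 ≡ 0) → 1 ≤ n → Ends order (λ σ′ → Ordered σ′ × clk σ′ ≤ 60 + n * 380 + clk σ) σ
  order-rule σ gv pos0 1≤n = seq (findRoot-rule σ gv) after-root
    where
    after-root : ∀ σ₁ → vr σ₁ vRt ≡ rt × clk σ₁ ≤ 10 + n * 60 + clk σ → Frame findRoot σ σ₁ →
      Ends (put aORD (lit 0) (lit 0) (var vRt) ⨾ put aPOS (var vRt) (lit 0) (lit 1) ⨾ vCnt ≔ lit 1 ⨾ vV ≔ lit 0 ⨾ for vV vN visit) (λ σ′ → Ordered σ′ × clk σ′ ≤ 60 + n * 380 + clk σ) σ₁
    after-root σ₁ (r≡ , t₁) f = ends (for-rule vV vN visit (Visited (40 + clk σ₁)) 0 n refl refl refl n≤ _ refl (isN gv₁)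
      (λ k σ′ _ k≡ _ k<n vs → andThen (λ σ″ → Visited (40 + clk σ₁) (suc k) (setv vV (suc k) (tick 5 σ″)))
          (visit-rule (44 + clk σ₁) k (tick 4 σ′) k<n k≡ (later σ′ vs)) λ σ″ vs″ _ → earlier k σ″ vs″)
      finish (1 , z≤n , gv₁ , initial-order , refl , (λ _ ()) , lin 1 (λ c → [] ⊢ κ 26 ⊞ c ≼ κ 120 ⊞ (κ 40 ⊞ c)) (clk σ₁)))
      where
      gv₁ : given σ₁
      gv₁ = given-frame {findRoot} refl refl f gv
      later : ∀ {k} σ′ → Visited (40 + clk σ₁) k σ′ → Visited (44 + clk σ₁) k (tick 4 σ′)
      later {k} σ′ (cnt , l , g , p , c , s , t) = cnt , l , g , p , c , s , lin 4 (λ c k cnt z → (c ≼ k ⊠ κ 200 ⊞ cnt ⊠ κ 120 ⊞ (κ 40 ⊞ z)) ∷ [] ⊢ κ 4 ⊞ c ≼ k ⊠ κ 200 ⊞ cnt ⊠ κ 120 ⊞ (κ 44 ⊞ z)) (clk σ′) k cnt (clk σ₁) t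
      earlier : ∀ k σ″ → Visited (44 + clk σ₁) (suc k) (tick 9 σ″) → Visited (40 + clk σ₁) (suc k) (setv vV (suc k) (tick 5 σ″))
      earlier k σ″ (cnt , l , g , p , c , s , t) = cnt , l , g , p , c , s , lin 4 (λ c k cnt z → (κ 9 ⊞ c ≼ (κ 1 ⊞ k) ⊠ κ 200 ⊞ cnt ⊠ κ 120 ⊞ (κ 44 ⊞ z)) ∷ [] ⊢ κ 5 ⊞ c ≼ (κ 1 ⊞ k) ⊠ κ 200 ⊞ cnt ⊠ κ 120 ⊞ (κ 40 ⊞ z)) (clk σ″) k cnt (clk σ₁) t
      POS₁ : Cells
      POS₁ = cells (ar σ₁ aPOS) (vr σ₁ vRt) 1
      pos₁ : ∀ v → ar σ₁ aPOS v 0 ≡ 0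
      pos₁ v = trans (cong (λ q → q v 0) (fa f aPOS refl)) (pos0 v)
      root₁ : POS₁ rt 0 ≡ 1
      root₁ = subst (λ z → cells (ar σ₁ aPOS) z 1 rt 0 ≡ 1) (sym r≡) (cells-same (ar σ₁ aPOS) rt 1)
      only : ∀ v → POS₁ v 0 ≢ 0 → v ≡ rt
      only v nz with rt Data.Nat.Properties.≟ v
      ... | yes e = sym e
      ... | no ne = contradiction (trans (cells-other (ar σ₁ aPOS) (vr σ₁ vRt) 1 (λ z → ne (trans (sym r≡) z))) (pos₁ v)) nz
      ord₁ : cells (ar σ₁ aORD) 0 (vr σ₁ vRt) 0 0 ≡ rt
      ord₁ = trans (cells-same (ar σ₁ aORD) 0 (vr σ₁ vRt)) r≡
      initial-order : Partial 1 (cells (ar σ₁ aORD) 0 (vr σ₁ vRt)) POS₁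
      initial-order = record
        { posLt = λ v _ nz → ≤-reflexive (trans (cong (λ z → POS₁ z 0) (only v nz)) root₁)
        ; back = λ v _ nz → trans (cong (λ z → cells (ar σ₁ aORD) 0 (vr σ₁ vRt) (z ∸ 1) 0) (trans (cong (λ z → POS₁ z 0) (only v nz)) root₁)) (trans ord₁ (sym (only v nz)))
        ; ordLt = λ { .0 (s≤s z≤n) → subst (λ z → z < n × POS₁ z 0 ≡ 1) (sym ord₁) (rt<n , root₁) }
        ; parLt = λ v _ nz nr → contradiction (only v nz) nr
        ; rootPos = root₁ }
      finish : ∀ k σ′ → Frame (visit ⨾ vV ≔ var vV ⊕ lit 1) _ σ′ → vr σ′ vV ≡ k → 0 ≤ k → n ≤ k → Visited (40 + clk σ₁) k σ′ →
        Ordered (tick 4 σ′) × clk (tick 4 σ′) ≤ 60 + n * 380 + clk σ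
      finish k σ′ _ _ _ n≤k (cnt , k≤n , g , p , c , s , t) = (g , subst (λ z → partial z σ′) cnt≡ p , λ w w< → s w (≤-trans w< n≤k)) ,
        cap (≤-antisym k≤n n≤k) cnt≡ t
        where
        cnt≡ : cnt ≡ n
        -- All nodes have distinct numbers among the `cnt` ones given out, and these belong to
        -- distinct nodes.
        cnt≡ = ≤-antisym (count-≤ p) (injection-≤ n cnt (λ v → ar σ′ aPOS v 0 ∸ 1)
          (λ v v< → pred< (ar σ′ aPOS v 0) (s v (≤-trans v< n≤k)) (posLt p v v< (s v (≤-trans v< n≤k))))
          (λ u v u< v< e → trans (sym (back p u u< (s u (≤-trans u< n≤k)))) (trans (cong (λ z → ar σ′ aORD z 0) e) (back p v v< (s v (≤-trans v< n≤k))))))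
          where
          pred< : ∀ x → x ≢ 0 → x ≤ cnt → x ∸ 1 < cnt
          pred< zero    nz _ = contradiction refl nz
          pred< (suc x) _  l = l
        cap : ∀ {k cnt} → k ≡ n → cnt ≡ n → clk σ′ ≤ k * 200 + cnt * 120 + (40 + clk σ₁) → 4 + clk σ′ ≤ 60 + n * 380 + clk σ
        cap refl refl t = lin 4 (λ c c₁ c₀ n → (c ≼ n ⊠ κ 200 ⊞ n ⊠ κ 120 ⊞ (κ 40 ⊞ c₁)) ∷ (c₁ ≼ κ 10 ⊞ n ⊠ κ 60 ⊞ c₀) ∷ [] ⊢ κ 4 ⊞ c ≼ κ 60 ⊞ n ⊠ κ 380 ⊞ c₀)
          (clk σ′) (clk σ₁) (clk σ) n t t₁

  numbering : ∀ {σ} → Ordered σ → Numbering n up rt (λ e → ar σ aORD e 0) (λ v → ar σ aPOS v 0 ∸ 1)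
  numbering {σ} (gv , pt , all) = record
    { ord< = λ e e< → proj₁ (ordLt pt e e<)
    ; pos< = λ v v< → pred< (all v v<) (posLt pt v v< (all v v<))
    ; pos-ord = λ e e< → cong (_∸ 1) (proj₂ (ordLt pt e e<))
    ; ord-pos = λ v v< → back pt v v< (all v v<)
    ; pos-rt = cong (_∸ 1) (rootPos pt)
    ; pos-up = λ v v< nr → let u≢0 , l = parLt pt v v< (all v v<) nr in
        pred< (λ z → u≢0 (m+n≡0⇒n≡0 0 z)) (pred≤ u≢0 l) }
    where
    pred< : ∀ {x y} → x ≢ 0 → x ≤ y → x ∸ 1 < y
    pred< {zero}  nz _ = contradiction refl nz
    pred< {suc x} _  l = l
    pred≤ : ∀ {x y} → x ≢ 0 → x < y → x ≤ y ∸ 1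
    pred≤ {y = suc y} _ (s≤s l) = l

  weight : ℕ → ℕ
  weight v = ⟦ div ⟧ (num v * (suc c * (n * n))) (den v)

  relabelBody : Stmt
  relabelBody =
    vV ≔ fld aORD (var vE) ⨾ vX ≔ parentOf vV ⨾
    put aPAR (var vE) (lit 0) (fld aPOS (var vX) ⊖ lit 1) ⨾
    put aWT (var vE) (lit 0) (raw (lit 3 ⊕ lit 3 ⊛ var vV) ⊛ var vW ⊘ raw (lit 4 ⊕ lit 3 ⊛ var vV))

  Relabelled : Cells → Cells → ℕ → Store → Set
  Relabelled ORD POS k σ = ∀ e → e < k → ar σ aPAR e 0 ≡ POS (up (ORD e 0)) 0 ∸ 1 × ar σ aWT e 0 ≡ weight (ORD e 0)

  relabel-rule : ∀ σ → Ordered σ → Ends relabel (λ σ′ → Relabelled (ar σ aORD) (ar σ aPOS) n σ′ × clk σ′ ≤ 20 + n * 100 + clk σ) σ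
  relabel-rule σ (gv , pt , all) = ends (con-V , nn≤V , W≤V ,
    for-clk vE vN relabelBody Inv 0 n refl refl refl n≤ _ z≤n _ refl (isN gv) each
      (λ σ′ _ (_ , _ , h) t → h , lin 3 (λ c z m → (c ≼ m ⊞ (κ 8 ⊞ z)) ∷ [] ⊢ κ 4 ⊞ c ≼ κ 20 ⊞ m ⊞ z) (clk σ′) (clk σ) (n * 100) (≤-trans t (+-monoˡ-≤ (8 + clk σ) (*-monoʳ-≤ n (≤ᵇ⇒≤ (cost relabelBody + 9) 100 _)))))
      (gv , W≡ , λ e ()))
    where
    Inv : ℕ → Store → Set
    Inv k σ′ = given σ′ × vr σ′ vW ≡ suc c * (n * n) × Relabelled (ar σ aORD) (ar σ aPOS) k σ′
    W≡ : suc c * (vr σ vN * vr σ vN) ≡ suc c * (n * n)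
    W≡ = cong (λ z → suc c * (z * z)) (isN gv)
    W≤V : suc c * (vr σ vN * vr σ vN) ≤ V
    W≤V = ≤-trans (≤-reflexive W≡) con≤V
    1≤n : 1 ≤ n
    1≤n = ≤-trans (s≤s z≤n) rt<n
    nn≤V : vr σ vN * vr σ vN ≤ V
    nn≤V = ≤-trans (m≤m+n (vr σ vN * vr σ vN) (c * (vr σ vN * vr σ vN))) W≤V
    con-V : suc c ≤ V
    con-V = ≤-trans (≤-trans (≤-reflexive (sym (*-identityʳ (suc c)))) (*-monoʳ-≤ (suc c) (*-mono-≤ 1≤n 1≤n))) con≤V
    each : ∀ k σ′ → Frame (relabelBody ⨾ vE ≔ var vE ⊕ lit 1) _ σ′ → vr σ′ vE ≡ k → 0 ≤ k → k < n → Inv k σ′ →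
      wp relabelBody (λ σ″ → Inv (suc k) (setv vE (suc k) (tick 5 σ″))) (tick 4 σ′)
    each k σ′ f refl _ k<n (gv′ , w≡ , h) =
      triple≤ v< , raw≤ 0 z≤n v< , raw-in 0 z≤n v< ,
      triple≤ v< , raw≤ 1 (s≤s z≤n) v< , raw-in 1 (s≤s z≤n) v< ,
      subst (_≤ V) (sym (cong₂ _*_ (isNum gv′ v v<) w≡)) (num≤V v v<) ,
      triple≤ v< , raw≤ 2 (s≤s (s≤s z≤n)) v< , raw-in 2 (s≤s (s≤s z≤n)) v< ,
      gv′ , w≡ , fresh
      where
      v : ℕ
      v = ar σ′ aORD k 0
      ord≡ : ar σ′ aORD ≡ ar σ aORD
      ord≡ = fa f aORD refl
      pos≡ : ar σ′ aPOS ≡ ar σ aPOS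
      pos≡ = fa f aPOS refl
      v≡ : v ≡ ar σ aORD k 0
      v≡ = cong (λ q → q k 0) ord≡
      v< : v < n
      v< = subst (_< n) (sym v≡) (proj₁ (ordLt pt k k<n))
      p′ w′ : ℕ
      p′ = ar σ′ aPOS (rw σ′ (2 + 3 * v)) 0 ∸ 1
      w′ = ⟦ div ⟧ (rw σ′ (3 + 3 * v) * vr σ′ vW) (rw σ′ (4 + 3 * v))
      p≡ : p′ ≡ ar σ aPOS (up (ar σ aORD k 0)) 0 ∸ 1
      p≡ = cong₂ (λ q x → q x 0 ∸ 1) pos≡ (trans (isUp gv′ v v<) (cong up v≡))
      w′≡ : w′ ≡ weight (ar σ aORD k 0)
      w′≡ = trans (cong₂ ⟦ div ⟧ (cong₂ _*_ (isNum gv′ v v<) w≡) (isDen gv′ v v<)) (cong weight v≡)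
      fresh : ∀ e → e < suc k → cells (ar σ′ aPAR) k p′ e 0 ≡ ar σ aPOS (up (ar σ aORD e 0)) 0 ∸ 1 × cells (ar σ′ aWT) k w′ e 0 ≡ weight (ar σ aORD e 0)
      fresh e e< with m≤n⇒m<n∨m≡n e<
      ... | inj₁ (s≤s e<k) = trans (cells-other (ar σ′ aPAR) k p′ k≢e) (proj₁ (h e e<k)) , trans (cells-other (ar σ′ aWT) k w′ k≢e) (proj₂ (h e e<k))
        where
        k≢e : k ≢ e
        k≢e z = <-irrefl (sym z) e<k
      ... | inj₂ refl = trans (cells-same (ar σ′ aPAR) k p′) p≡ , trans (cells-same (ar σ′ aWT) k w′) w′≡

  outputBody : Stmt
  outputBody = vX ≔ fld aPOS (var vV) ⊖ lit 1 ⨾ raw≔ (var vV) (fld aLAB (var vX))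

  output-rule : ∀ σ → vr σ vN ≡ n →
    Ends output (λ σ′ → (∀ v → v < n → rw σ′ v ≡ ar σ aLAB (ar σ aPOS v 0 ∸ 1) 0) × clk σ′ ≤ 20 + n * 100 + clk σ) σ
  output-rule σ isN′ = ends (for-clk vV vN outputBody Inv 0 n refl refl refl n≤ _ z≤n _ refl isN′ each
      (λ σ′ _ h t → h , lin 3 (λ c z m → (c ≼ m ⊞ (κ 2 ⊞ z)) ∷ [] ⊢ κ 4 ⊞ c ≼ κ 20 ⊞ m ⊞ z) (clk σ′) (clk σ) (n * 100) (≤-trans t (+-monoˡ-≤ (2 + clk σ) (*-monoʳ-≤ n (≤ᵇ⇒≤ (cost outputBody + 9) 100 _)))))
      (λ v ()))
    where
    Inv : ℕ → Store → Set
    Inv k σ′ = ∀ v → v < k → rw σ′ v ≡ ar σ aLAB (ar σ aPOS v 0 ∸ 1) 0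
    each : ∀ k σ′ → Frame (outputBody ⨾ vV ≔ var vV ⊕ lit 1) _ σ′ → vr σ′ vV ≡ k → 0 ≤ k → k < n → Inv k σ′ →
      wp outputBody (λ σ″ → Inv (suc k) (setv vV (suc k) (tick 5 σ″))) (tick 4 σ′)
    each k σ′ f refl _ k<n h = m≤n⇒m≤1+n (m≤n⇒m≤1+n (≤-trans k<n (m≤m+n n (2 * n)))) , fresh
      where
      x′ : ℕ
      x′ = ar σ′ aLAB (ar σ′ aPOS k 0 ∸ 1) 0
      fresh : ∀ v → v < suc k → upd (rw σ′) k x′ v ≡ ar σ aLAB (ar σ aPOS v 0 ∸ 1) 0
      fresh v v< with m≤n⇒m<n∨m≡n v<
      ... | inj₁ (s≤s v<k) = trans (upd-other (rw σ′) x′ (λ z → <-irrefl (sym z) v<k)) (h v v<k)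
      ... | inj₂ refl = trans (upd-same (rw σ′) k x′) (cong₂ (λ q p → q (p k 0 ∸ 1) 0) (fa f aLAB refl) (fa f aPOS refl))

-- The whole program

sumN-≤ : ∀ n {f k} → (∀ v → v < n → f v ≤ k) → sumN n f ≤ n * k
sumN-≤ zero    h = z≤n
sumN-≤ (suc n) {f} {k} h = ≤-trans (+-mono-≤ (sumN-≤ n (λ v v< → h v (m≤n⇒m≤1+n v<))) (h n ≤-refl)) (≤-reflexive (+-comm (n * k) k))

unit : ℕ → ℕ
unit = mergeUnit 0 0 0

-- 3000 covers the linear passes and all fixed costs, spread over `n ≥ 1` nodes; the other term is
-- the amortised time of the merges.
stepsPerNode : ℕ → ℕ
stepsPerNode c = 3000 + 14 * unit c

module Whole (n : ℕ) (up : ℕ → ℕ) (up< : ∀ v → v < n → up v < n) (rt : ℕ) (rt<n : rt < n) (up-rt : up rt ≡ rt)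
             (dep : ℕ → ℕ) (dep< : ∀ v → v < n → v ≢ rt → dep (up v) < dep v) (num den : ℕ → ℕ) (b c V : ℕ)
             (8≤V : 8 ≤ V) (n≤V : 5 * n + 5 ≤ V) (num≤V : ∀ v → v < n → num v * (suc c * (n * n)) ≤ V)
             (weight≤ : ∀ v → v < n → ⟦ div ⟧ (num v * (suc c * (n * n))) (den v) ≤ suc c * (n * n))
             (weights≤V : suc n * (n * (suc c * (n * n))) ≤ V) (offsets≤V : suc b * suc n ≤ V)
             (m≤V : suc (suc b) ≤ V) (quota≤V : suc c * (suc n * suc (suc n)) ≤ V) where

  1≤n : 1 ≤ n
  1≤n = ≤-trans (s≤s z≤n) rt<n

  private
    ≤-times : ∀ {k} x → 1 ≤ k → x ≤ k * x
    ≤-times {k} x 1≤k = ≤-trans (≤-reflexive (sym (*-identityˡ x))) (*-monoˡ-≤ x 1≤k)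

  con≤V : suc c * (n * n) ≤ V
  con≤V = ≤-trans (≤-times _ 1≤n) (≤-trans (≤-times {suc n} _ (s≤s z≤n)) weights≤V)

  open Ordering n up up< rt rt<n up-rt dep dep< num den (suc b) V c n≤V con≤V num≤V public

  module Renumbered {ord pos : ℕ → ℕ} (nb : Numbering n up rt ord pos) where

    open Numbering nb

    a : ℕ → ℕ
    a e = weight (ord e)

    sum≤V : suc n * sumN n a ≤ V
    sum≤V = ≤-trans (*-monoʳ-≤ (suc n) (sumN-≤ n (λ e e< → weight≤ (ord e) (ord< e e<)))) weights≤V

    2n≤V : 2 * n + 2 ≤ V
    2n≤V = ≤-trans (lin 1 (λ n → [] ⊢ κ 2 ⊠ n ⊞ κ 2 ≼ κ 5 ⊠ n ⊞ κ 5) n) n≤V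

    open Staged n par par<

    inputs : Store → Set
    inputs = BottomUp.inputs n par par< 1≤n b c a V R 8≤V 2n≤V sum≤V offsets≤V m≤V quota≤V

    -- `unit c` is `mergeUnit` at other bounds, and both evaluate alike; hence `≤-refl`.
    bottomUp-rule = Elimination.bottomUp-rule n par par< 1≤n b c a V R 8≤V 2n≤V sum≤V offsets≤V m≤V quota≤V (unit c) ≤-refl
    topDown-rule = Placement.topDown-rule n par par< 1≤n b c a V R 8≤V 2n≤V sum≤V offsets≤V m≤V quota≤V

    mergeTimes : ℕ
    mergeTimes = Φ (λ _ → Approximation.Time.time b c a (unit c)) 1

    count : ∀ n → sumN n (λ _ → 1) ≡ n
    count zero    = refl
    count (suc n) = trans (cong (_+ 1) (count n)) (+-comm n 1)

    Φ-time-≤ : mergeTimes ≤ 14 * unit c * n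
    Φ-time-≤ = ≤-trans (m≤m+n _ (suc (suc b) * Approximation.Time.pot b c a (unit c) (Approximation.rank b c a (acc 1 0))))
      (≤-trans (Approximation.Time.time-≤ b c a (unit c) (acc 1 0)) (*-monoʳ-≤ (14 * unit c) (≤-trans (n≤1+n _) (≤-reflexive
        (trans (additive (λ _ → 1) nodes refl (λ _ _ _ → refl) 1 ≤-refl 1≤n) (count n))))))

  open Numbering using (par; par<)

  record Solved (raw′ : ℕ → ℕ) : Set where
    field
      ord pos   : ℕ → ℕ
      numbered  : Numbering n up rt ord pos
      lab H rem : ℕ → ℕ
      labelled  : TopDown.Top n (par numbered) (par< numbered) 1≤n b c (weight ∘ ord) n lab H rem
      written   : ∀ v → v < n → raw′ v ≡ lab (pos v)

  module _ {raw′} (solved : Solved raw′) where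

    open Solved solved

    lab< : ∀ v → v < n → lab v < n
    lab< = TopDown.Finish.lab< n (par numbered) (par< numbered) 1≤n b c (weight ∘ ord) labelled

    block-size : ∀ ℓ → sumN n (λ v → ind (lab v ≡ᵇ ℓ)) ≤ suc b
    block-size = TopDown.Finish.block-size n (par numbered) (par< numbered) 1≤n b c (weight ∘ ord) labelled

    distinct : (ℕ → ℕ) → ℕ → ℕ
    distinct = Staged.distinct n (par numbered) (par< numbered)

    near-optimal : ∀ lab* → (∀ v → v < n → lab* v < n) → (∀ ℓ → sumN n (λ v → ind (lab* v ≡ᵇ ℓ)) ≤ suc b) →
      Σ ℕ λ e → e * suc c ≤ sumN n (weight ∘ ord) ×
        sumN n (λ v → weight (ord v) * distinct lab v) ≤ sumN n (λ v → weight (ord v) * distinct lab* v) + sumN n (weight ∘ ord) + e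
    near-optimal = TopDown.Finish.near-optimal n (par numbered) (par< numbered) 1≤n b c (weight ∘ ord) labelled

  open Logic (suc b) V R
  open Names
  open Code (suc b) V R (suc c)

  main-rule : ∀ σ → given σ → vr σ vB ≡ suc b → (∀ a i j → ar σ a i j ≡ 0) →
    Ends main (λ σ′ → Solved (rw σ′) × clk σ′ ≤ stepsPerNode c * n + clk σ) σ
  main-rule σ gv b≡ blank = seq first λ σ₁ (m≡ , t₁) f₁ →
    seq (order-rule σ₁ (given-frame {vM ≔ var vB ⊕ lit 1} refl refl f₁ gv) (λ v → trans (cong (λ q → q v 0) (fa f₁ aPOS refl)) (blank aPOS v 0)) 1≤n) λ σ₂ (od , t₂) f₂ →
    seq (relabel-rule σ₂ od) λ σ₃ (rl , t₃) f₃ →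
    let nb = numbering {σ₂} od
        open Renumbered nb using (inputs; bottomUp-rule; topDown-rule; mergeTimes; Φ-time-≤)
        n₃ = trans (fv f₃ vN refl) (Given.isN (proj₁ od))
        inp : inputs σ₃
        inp = record
          { isN = n₃ ; isB = trans (fv f₃ vB refl) (trans (fv f₂ vB refl) (trans (fv f₁ vB refl) b≡))
          ; isM = trans (fv f₃ vM refl) (trans (fv f₂ vM refl) m≡)
          ; isP = λ v _ v< → proj₁ (rl v v<) ; isW = λ v v< → proj₂ (rl v v<) }
        untouched : ∀ {a} → wa (vM ≔ var vB ⊕ lit 1) a ≡ false → wa order a ≡ false → wa relabel a ≡ false → ∀ i j → ar σ₃ a i j ≡ 0
        untouched {a} p q r i j = trans (cong (λ h → h i j) (trans (fa f₃ a r) (trans (fa f₂ a q) (fa f₁ a p)))) (blank a i j)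
    in seq (bottomUp-rule σ₃ n₃ inp (λ v → untouched {aSZ} refl refl refl v 0) (λ v → untouched {aTAU} refl refl refl v 0) (λ v → untouched {aRK} refl refl refl v 0)
              (λ v → untouched {aMG} refl refl refl v 0) (λ v j → untouched {aVEC} refl refl refl v j)) λ σ₄ ((i≡ , inp₄ , sm , vs , dn) , t₄) f₄ →
    seq (topDown-rule σ₄ inp₄ (BottomUp.Sums.isSize sm 0 (s≤s z≤n)) (Elimination.Done.isBIG dn) (Elimination.Done.shares dn)) λ σ₅ ((H , top) , t₅) f₅ →
    ensure (output-rule σ₅ (trans (fv f₅ vN refl) (trans (fv f₄ vN refl) n₃))) λ σ₆ (wr′ , t₆) f₆ →
      record { numbered = nb ; labelled = top
             ; written = λ v v< → trans (wr′ v v<) (cong (λ q → ar σ₅ aLAB (q v 0 ∸ 1) 0) (trans (fa f₅ aPOS refl) (trans (fa f₄ aPOS refl) (fa f₃ aPOS refl)))) } ,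
      timing {clk σ} {clk σ₁} {clk σ₂} {clk σ₃} {clk σ₄} {clk σ₅} {clk σ₆} {mergeTimes} t₁ t₂ t₃ t₄ Φ-time-≤ t₅ t₆
    where
    first : Ends (vM ≔ var vB ⊕ lit 1) (λ σ₁ → vr σ₁ vM ≡ suc (suc b) × clk σ₁ ≤ 4 + clk σ) σ
    first = ends (subst (_≤ V) (sym m≡) m≤V , m≡ , ≤-refl)
      where
      m≡ : vr σ vB + 1 ≡ suc (suc b)
      m≡ = trans (cong (_+ 1) b≡) (+-comm (suc b) 1)
    unitStep′ : ℕ
    unitStep′ = cost enter + (cost locate + cost extend + cost moveInto + 10 + cost settle) + 30
    timing : ∀ {c₀ c₁ c₂ c₃ c₄ c₅ c₆ Φ₁} → c₁ ≤ 4 + c₀ → c₂ ≤ 60 + n * 380 + c₁ → c₃ ≤ 20 + n * 100 + c₂ → c₄ ≤ 20 + n * unitStep′ + Φ₁ + c₃ →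
      Φ₁ ≤ 14 * unit c * n → c₅ ≤ 60 + n * (cost place + 9) + c₄ → c₆ ≤ 20 + n * 100 + c₅ →
      c₆ ≤ (3000 + 14 * unit c) * n + c₀
    timing {c₀} {c₁} {c₂} {c₃} {c₄} {c₅} {c₆} {Φ₁} h₁ h₂ h₃ h₄ hΦ h₅ h₆ =
      lin 12 (λ c₀ c₁ c₂ c₃ c₄ c₅ c₆ Φ₁ n e u p → (c₁ ≼ κ 4 ⊞ c₀) ∷ (c₂ ≼ κ 60 ⊞ n ⊠ κ 380 ⊞ c₁) ∷ (c₃ ≼ κ 20 ⊞ n ⊠ κ 100 ⊞ c₂) ∷
          (c₄ ≼ κ 20 ⊞ u ⊞ Φ₁ ⊞ c₃) ∷ (Φ₁ ≼ e ⊠ n) ∷ (c₅ ≼ κ 60 ⊞ p ⊞ c₄) ∷ (c₆ ≼ κ 20 ⊞ n ⊠ κ 100 ⊞ c₅) ∷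
          (u ≼ n ⊠ κ 1000) ∷ (p ≼ n ⊠ κ 1000) ∷ (κ 200 ≼ κ 200 ⊠ n) ∷ [] ⊢ c₆ ≼ (κ 3000 ⊞ e) ⊠ n ⊞ c₀)
        c₀ c₁ c₂ c₃ c₄ c₅ c₆ Φ₁ n (14 * unit c) (n * unitStep′) (n * (cost place + 9)) h₁ h₂ h₃ h₄ hΦ h₅ h₆
        (*-monoʳ-≤ n (≤ᵇ⇒≤ unitStep′ 1000 _)) (*-monoʳ-≤ n (≤ᵇ⇒≤ (cost place + 9) 1000 _)) (*-monoʳ-≤ 200 1≤n)

-- Counting blocks

onFin : ∀ {n} (P : ℕ → Set) → (∀ (i : Fin n) → P (toℕ i)) → ∀ v → v < n → P v
onFin P h v v<n = subst P (toℕ-fromℕ< v<n) (h (fromℕ< v<n))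

onℕ : ∀ {n} → (Fin n → ℕ) → ℕ → ℕ
onℕ {n} f v with v <? n
... | yes v<n = f (fromℕ< v<n)
... | no _    = 0

onℕ-toℕ : ∀ {n} (f : Fin n → ℕ) i → onℕ f (toℕ i) ≡ f i
onℕ-toℕ {n} f i with toℕ i <? n
... | yes l = cong f (fromℕ<-toℕ i l)
... | no ¬l = contradiction (toℕ<n i) ¬l

T-ext : ∀ {a b} → (T a → T b) → (T b → T a) → a ≡ b
T-ext {true}  {true}  _ _ = refl
T-ext {true}  {false} f _ = ⊥-elim (f tt)
T-ext {false} {true}  _ g = ⊥-elim (g tt)
T-ext {false} {false} _ _ = refl

¬T⇒false : ∀ {a} → ¬ T a → a ≡ false
¬T⇒false {true}  h = ⊥-elim (h tt)
¬T⇒false {false} h = refl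

sumN-front : ∀ n f → sumN (suc n) f ≡ f 0 + sumN n (f ∘ suc)
sumN-front zero    f = +-comm 0 (f 0)
sumN-front (suc n) f = trans (cong (_+ f (suc n)) (sumN-front n f)) (+-assoc (f 0) _ _)

sumN-+ : ∀ n f g → sumN n (λ v → f v + g v) ≡ sumN n f + sumN n g
sumN-+ zero    f g = refl
sumN-+ (suc n) f g = trans (cong (_+ (f n + g n)) (sumN-+ n f g))
  (ring 4 (λ a b c d → [] ⊢ a ⊞ b ⊞ (c ⊞ d) ≼ a ⊞ c ⊞ (b ⊞ d)) (sumN n f) (sumN n g) (f n) (g n))

sumN-swap : ∀ m n (h : ℕ → ℕ → ℕ) → sumN m (λ i → sumN n (h i)) ≡ sumN n (λ j → sumN m (λ i → h i j))
sumN-swap zero    n h = sym (sumN-zero n (λ _ _ → refl))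
sumN-swap (suc m) n h = trans (cong (_+ sumN n (h m)) (sumN-swap m n h)) (sym (sumN-+ n (λ j → sumN m (λ i → h i j)) (h m)))

sumN-pick : ∀ n (f : ℕ → ℕ) k → k < n → sumN n (λ v → if k ≡ᵇ v then f v else 0) ≡ f k
sumN-pick n f k k<n = trans (sym (+-identityʳ _)) (trans (sumN-update n k g (λ _ → 0) k<n other)
  (trans (cong (_+ g k) (sumN-zero n (λ _ _ → refl))) (cong (λ z → if z then f k else 0) (≡ᵇ-refl k))))
  where
  g : ℕ → ℕ
  g v = if k ≡ᵇ v then f v else 0
  other : ∀ v → v < n → v ≢ k → g v ≡ 0
  other v _ ne = cong (λ z → if z then f v else 0) (≢⇒≡ᵇ (≢-sym ne))

-- Write `f (ord e)` as a sum over all `v` that picks `v = ord e`, exchange the sums, and read the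
-- condition as `e = pos v`.
sumN-reindex : ∀ {n up rt ord pos} → Numbering n up rt ord pos → ∀ f → sumN n (f ∘ ord) ≡ sumN n f
sumN-reindex {n} {ord = ord} {pos} nb f = trans (sumN-cong n (λ e e< → sym (sumN-pick n f (ord e) (ord< e e<))))
  (trans (sumN-swap n n (λ e v → if ord e ≡ᵇ v then f v else 0)) (sumN-cong n (λ v v< →
    trans (sumN-cong n (λ e e< → cong (λ z → if z then f v else 0) (same e v e< v<))) (sumN-pick n (λ _ → f v) (pos v) (pos< v v<)))))
  where
  open Numbering nb
  same : ∀ e v → e < n → v < n → (ord e ≡ᵇ v) ≡ (pos v ≡ᵇ e)
  same e v e< v< = T-ext
    (λ t → ≡⇒≡ᵇ (pos v) e (trans (cong pos (sym (≡ᵇ⇒≡ (ord e) v t))) (pos-ord e e<)))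
    (λ t → ≡⇒≡ᵇ (ord e) v (trans (cong ord (sym (≡ᵇ⇒≡ (pos v) e t))) (ord-pos v v<)))

elem : ∀ {n} → ℕ → List (Fin n) → Bool
elem ℓ []       = false
elem ℓ (x ∷ xs) = (toℕ x ≡ᵇ ℓ) ∨ elem ℓ xs

elem-sound : ∀ {n} ℓ (xs : List (Fin n)) → T (elem ℓ xs) → ∃[ x ] x ∈ xs × toℕ x ≡ ℓ
elem-sound ℓ (x ∷ xs) t = find (Equivalence.to T-∨ t)
  where
  find : T (toℕ x ≡ᵇ ℓ) ⊎ T (elem ℓ xs) → ∃[ y ] y ∈ x ∷ xs × toℕ y ≡ ℓ
  find (inj₁ e) = x , Any.here refl , ≡ᵇ⇒≡ (toℕ x) ℓ e
  find (inj₂ u) = let y , y∈ , e = elem-sound ℓ xs u in y , Any.there y∈ , e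

elem-complete : ∀ {n} {x : Fin n} {xs} → x ∈ xs → T (elem (toℕ x) xs)
elem-complete {x = x} (Any.here refl)            = Equivalence.from T-∨ (inj₁ (≡⇒≡ᵇ (toℕ x) (toℕ x) refl))
elem-complete {x = x} {y ∷ _} (Any.there x∈) = Equivalence.from (T-∨ {toℕ y ≡ᵇ toℕ x}) (inj₂ (elem-complete x∈))

length-unique : ∀ {n} (xs : List (Fin n)) → Unique xs → length xs ≡ sumN n (λ ℓ → ind (elem ℓ xs))
length-unique {n} []       _        = sym (sumN-zero n (λ _ _ → refl))
length-unique {n} (x ∷ xs) (x∉ ∷ u) = trans (cong suc (length-unique xs u)) (sym (trans (sym (+-identityʳ _))
  (trans (cong (sumN n f +_) (sym g≡)) (trans (sumN-update n (toℕ x) f g (toℕ<n x) other) (trans (cong (sumN n g +_) f≡) (+-comm (sumN n g) 1))))))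
  where
  f g : ℕ → ℕ
  f ℓ = ind (elem ℓ (x ∷ xs))
  g ℓ = ind (elem ℓ xs)
  f≡ : f (toℕ x) ≡ 1
  f≡ = cong (λ z → ind (z ∨ elem (toℕ x) xs)) (≡ᵇ-refl (toℕ x))
  g≡ : g (toℕ x) ≡ 0
  g≡ = cong ind (¬T⇒false λ t → let y , y∈ , e = elem-sound (toℕ x) xs t in All.lookup x∉ y∈ (sym (toℕ-injective e)))
  other : ∀ ℓ → ℓ < n → ℓ ≢ toℕ x → f ℓ ≡ g ℓ
  other ℓ _ ne = cong (λ z → ind (z ∨ elem ℓ xs)) (≢⇒≡ᵇ (≢-sym ne))

length-deduplicate : ∀ {n} (xs : List (Fin n)) → length (deduplicate Fin._≟_ xs) ≡ sumN n (λ ℓ → ind (elem ℓ xs))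
length-deduplicate {n} xs = trans (length-unique _ (deduplicate-! Fin._≟_ xs)) (sumN-cong n (λ ℓ _ → cong ind (T-ext
  (λ t → let y , y∈ , e = elem-sound ℓ _ t in subst (λ z → T (elem z xs)) e (elem-complete (∈-deduplicate⁻ Fin._≟_ xs y∈)))
  (λ t → let y , y∈ , e = elem-sound ℓ xs t in subst (λ z → T (elem z (deduplicate Fin._≟_ xs))) e (elem-complete (∈-deduplicate⁺ Fin._≟_ y∈))))))

length-filter-tabulate : ∀ {A : Set} {P : A → Set} (P? : Decidable P) {m} (g : Fin m → A) (h : ℕ → ℕ) →
  (∀ i → h (toℕ i) ≡ ind (does (P? (g i)))) → length (filter P? (tabulate g)) ≡ sumN m h
length-filter-tabulate P? {zero}  g h e = refl
length-filter-tabulate P? {suc m} g h e = trans (head′ (g Fin.zero) (tabulate (g ∘ Fin.suc)))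
  (trans (cong₂ _+_ (sym (e Fin.zero)) (length-filter-tabulate P? (g ∘ Fin.suc) (h ∘ suc) (e ∘ Fin.suc))) (sym (sumN-front m h)))
  where
  head′ : ∀ x xs → length (filter P? (x ∷ xs)) ≡ ind (does (P? x)) + length (filter P? xs)
  head′ x xs with does (P? x)
  ... | true  = refl
  ... | false = refl

iterate-∈⁻ : ∀ {A : Set} (f : A → A) m {x y} → y ∈ iterate f x m → ∃[ k ] y ≡ f ^[ k ] x
iterate-∈⁻ f (suc m) (Any.here e)  = 0 , e
iterate-∈⁻ f (suc m) (Any.there p) = let k , e = iterate-∈⁻ f m p in suc k , e

iterate-∈⁺ : ∀ {A : Set} (f : A → A) m k x → k < m → f ^[ k ] x ∈ iterate f x m
iterate-∈⁺ f (suc m) zero    x _         = Any.here refl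
iterate-∈⁺ f (suc m) (suc k) x (s≤s k<m) = Any.there (iterate-∈⁺ f m k (f x) k<m)

iterate-+ : ∀ {A : Set} (f : A → A) k d x → f ^[ k + d ] x ≡ f ^[ d ] (f ^[ k ] x)
iterate-+ f zero    d x = refl
iterate-+ f (suc k) d x = iterate-+ f k d (f x)

module Tree {n : ℕ} (tree : RootedTree n) where

  rt : ℕ
  rt = toℕ (root tree)

  up : ℕ → ℕ
  up = onℕ (λ i → toℕ (parent tree i))

  up-toℕ : ∀ i → up (toℕ i) ≡ toℕ (parent tree i)
  up-toℕ = onℕ-toℕ (λ i → toℕ (parent tree i))

  up< : ∀ v → v < n → up v < n
  up< = onFin (λ v → up v < n) (λ i → subst (_< n) (sym (up-toℕ i)) (toℕ<n (parent tree i)))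

  up-rt : up rt ≡ rt
  up-rt = trans (up-toℕ (root tree)) (cong toℕ (rootParent tree))

  anc-toℕ : ∀ k i → up ^[ k ] toℕ i ≡ toℕ (parent tree ^[ k ] i)
  anc-toℕ zero    i = refl
  anc-toℕ (suc k) i = trans (cong (up ^[ k ]_) (up-toℕ i)) (anc-toℕ k (parent tree i))

  anc-rt : ∀ k → up ^[ k ] rt ≡ rt
  anc-rt zero    = refl
  anc-rt (suc k) = trans (cong (up ^[ k ]_) up-rt) (anc-rt k)

  -- A common number of steps after which every node has arrived at the root; the sum of all
  -- individual numbers is a convenient choice.
  height : ℕ
  height = sumN n (onℕ (λ i → proj₁ (reachRoot tree i)))

  anc-height : ∀ v → v < n → up ^[ height ] v ≡ rt
  anc-height = onFin (λ v → up ^[ height ] v ≡ rt) λ i →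
    let k , e = reachRoot tree i
        k≤ : k ≤ height
        k≤ = ≤-trans (≤-reflexive (sym (onℕ-toℕ (λ j → proj₁ (reachRoot tree j)) i))) (sumN-≥ n _ (toℕ i) (toℕ<n i))
    in trans (cong (up ^[_] toℕ i) (sym (m+[n∸m]≡n k≤))) (trans (iterate-+ up k (height ∸ k) (toℕ i))
         (trans (cong (up ^[ height ∸ k ]_) (trans (anc-toℕ k i) (cong toℕ e))) (anc-rt (height ∸ k))))

  dep : ℕ → ℕ
  dep v = sumN height (λ k → ind (not (up ^[ k ] v ≡ᵇ rt)))

  -- Moving up one step drops the first term of the count, which is 1, and appends a last one, which
  -- is 0 since the root has been reached by then.
  dep< : ∀ v → v < n → v ≢ rt → dep (up v) < dep v
  dep< v v<n ne = ≤-reflexive (trans (cong (λ z → ind (not z) + dep (up v)) (sym (≢⇒≡ᵇ ne)))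
    (trans (sym (sumN-front height (λ k → ind (not (up ^[ k ] v ≡ᵇ rt)))))
      (trans (cong (λ z → dep v + ind (not z)) (trans (cong (_≡ᵇ rt) (anc-height v v<n)) (≡ᵇ-refl rt))) (+-identityʳ (dep v)))))

  module Paths {ord pos : ℕ → ℕ} (nb : Numbering n up rt ord pos) (lab : ℕ → ℕ) (f : Fin n → Fin n)
               (agree : ∀ i → lab (pos (toℕ i)) ≡ toℕ (f i)) where

    open Numbering nb
    open Staged n par par<

    private
      up-par : ∀ e → e < n → ord (par e) ≡ up (ord e)
      up-par e e< = ord-pos (up (ord e)) (up< (ord e) (ord< e e<))

      -- Numbers fall from child to parent, so `k ≤ e < n` steps suffice; this matches the length
      -- `n` of `pathToRoot`.
      seen-sound : ∀ fuel e ℓ → e < fuel → e < n → T (seen lab e ℓ) → Σ ℕ λ k → k ≤ e × lab (pos (up ^[ k ] ord e)) ≡ ℓ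
      seen-sound (suc fuel) zero ℓ _ e<n t = 0 , z≤n , trans (cong lab (pos-ord 0 e<n)) (≡ᵇ⇒≡ (lab 0) ℓ (start (Equivalence.to T-∨ t)))
        where
        start : T (lab 0 ≡ᵇ ℓ) ⊎ ⊥ → T (lab 0 ≡ᵇ ℓ)
        start (inj₁ u) = u
      seen-sound (suc fuel) (suc e) ℓ (s≤s e<) e<n t = find (Equivalence.to (T-∨ {lab (suc e) ≡ᵇ ℓ}) (subst (λ S → T (S ℓ)) (seen-suc lab (suc e) (s≤s z≤n) e<n) t))
        where
        p<e : par (suc e) < suc e
        p<e = par< (suc e) (s≤s z≤n) e<n
        find : T (lab (suc e) ≡ᵇ ℓ) ⊎ T (seen lab (par (suc e)) ℓ) → Σ ℕ λ k → k ≤ suc e × lab (pos (up ^[ k ] ord (suc e))) ≡ ℓ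
        find (inj₁ u) = 0 , z≤n , trans (cong lab (pos-ord (suc e) e<n)) (≡ᵇ⇒≡ (lab (suc e)) ℓ u)
        find (inj₂ u) = let k , k≤ , q = seen-sound fuel (par (suc e)) ℓ (≤-trans p<e e<) (<-trans p<e e<n) u in
          suc k , ≤-trans (s≤s k≤) p<e , trans (cong (λ v → lab (pos (up ^[ k ] v))) (sym (up-par (suc e) e<n))) q

      seen-own : ∀ e → e < n → T (seen lab e (lab e))
      seen-own zero    _   = Equivalence.from T-∨ (inj₁ (≡⇒≡ᵇ (lab 0) (lab 0) refl))
      seen-own (suc e) e<n = subst (λ S → T (S (lab (suc e)))) (sym (seen-suc lab (suc e) (s≤s z≤n) e<n))
        (Equivalence.from T-∨ (inj₁ (≡⇒≡ᵇ (lab (suc e)) (lab (suc e)) refl)))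

      seen-complete : ∀ k v → v < n → T (seen lab (pos v) (lab (pos (up ^[ k ] v))))
      seen-complete zero    v v<n = seen-own (pos v) (pos< v v<n)
      seen-complete (suc k) v v<n with v Data.Nat.Properties.≟ rt
      ... | yes refl = subst (λ u → T (seen lab (pos rt) (lab (pos (up ^[ k ] u))))) (sym up-rt) (seen-complete k rt v<n)
      ... | no ne    = subst (λ S → T (S ℓ)) (sym (seen-suc lab (pos v) (≤-trans (s≤s z≤n) (pos-up v v<n ne)) (pos< v v<n)))
        (Equivalence.from (T-∨ {lab (pos v) ≡ᵇ ℓ}) (inj₂ (subst (λ u → T (seen lab (pos (up u)) ℓ)) (sym (ord-pos v v<n)) (seen-complete k (up v) (up< v v<n)))))
        where
        ℓ : ℕ
        ℓ = lab (pos (up ^[ suc k ] v))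

      on-path : ∀ k i → lab (pos (up ^[ k ] toℕ i)) ≡ toℕ (f (parent tree ^[ k ] i))
      on-path k i = trans (cong (lab ∘ pos) (anc-toℕ k i)) (agree (parent tree ^[ k ] i))

    blocks-distinct : ∀ i → blocksOnPath tree f i ≡ distinct lab (pos (toℕ i))
    blocks-distinct i = trans (length-deduplicate (map f (pathToRoot tree i))) (sumN-cong n (λ ℓ _ → cong ind (T-ext (to ℓ) (from ℓ))))
      where
      to : ∀ ℓ → T (elem ℓ (map f (pathToRoot tree i))) → T (seen lab (pos (toℕ i)) ℓ)
      to ℓ t = let y , y∈ , e = elem-sound ℓ _ t
                   x , x∈ , q = ∈-map⁻ f y∈
                   k , r = iterate-∈⁻ (parent tree) n x∈
        in subst (λ z → T (seen lab (pos (toℕ i)) z)) (trans (on-path k i) (trans (cong toℕ (trans (cong f (sym r)) (sym q))) e)) (seen-complete k (toℕ i) (toℕ<n i))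
      from : ∀ ℓ → T (seen lab (pos (toℕ i)) ℓ) → T (elem ℓ (map f (pathToRoot tree i)))
      from ℓ t = let k , k≤ , e = seen-sound (suc (pos (toℕ i))) (pos (toℕ i)) ℓ ≤-refl (pos< _ (toℕ<n i)) t
        in subst (λ z → T (elem z (map f (pathToRoot tree i)))) (trans (sym (on-path k i)) (trans (cong (λ v → lab (pos (up ^[ k ] v))) (sym (ord-pos (toℕ i) (toℕ<n i)))) e))
             (elem-complete (∈-map⁺ f (iterate-∈⁺ (parent tree) n k i (≤-<-trans k≤ (pos< _ (toℕ<n i))))))

    block-count : ∀ k → blockSize f k ≡ sumN n (λ e → ind (lab e ≡ᵇ toℕ k))
    block-count k = trans (length-filter-tabulate (λ v → f v Fin.≟ k) (λ v → v) (λ v → ind (lab (pos v) ≡ᵇ toℕ k)) hit)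
      (trans (sym (sumN-reindex nb (λ v → ind (lab (pos v) ≡ᵇ toℕ k)))) (sumN-cong n (λ e e< → cong (λ z → ind (lab z ≡ᵇ toℕ k)) (pos-ord e e<))))
      where
      hit : ∀ i → ind (lab (pos (toℕ i)) ≡ᵇ toℕ k) ≡ ind (does (f i Fin.≟ k))
      hit i = cong ind (trans (cong (_≡ᵇ toℕ k) (agree i)) (decide (f i Fin.≟ k)))
        where
        decide : (d : Dec (f i ≡ k)) → (toℕ (f i) ≡ᵇ toℕ k) ≡ does d
        decide (yes e) = trans (cong (λ z → toℕ z ≡ᵇ toℕ k) e) (≡ᵇ-refl (toℕ k))
        decide (no ne) = ≢⇒≡ᵇ (λ e → ne (toℕ-injective e))

-- Rounding of the probabilities

ι : ℕ → ℚ
ι k = ℤ.+ k ℚ./ 1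

ι-unnormalised : ∀ k → toℚᵘ (ι k) ℚᵘ.≃ mkℚᵘ (ℤ.+ k) 0
ι-unnormalised k = ℚ.toℚᵘ-fromℚᵘ (mkℚᵘ (ℤ.+ k) 0)

ι-+ : ∀ a b → ι (a + b) ≡ ι a ℚ.+ ι b
ι-+ a b = ℚ.toℚᵘ-injective (ℚᵘ.≃-trans (ι-unnormalised (a + b)) (ℚᵘ.≃-trans
  (*≡* (cong (ℤ._* (ℤ.+ 1)) (sym (cong₂ ℤ._+_ (ℤ.*-identityʳ (ℤ.+ a)) (ℤ.*-identityʳ (ℤ.+ b))))))
  (ℚᵘ.≃-sym (ℚᵘ.≃-trans (ℚ.toℚᵘ-homo-+ (ι a) (ι b)) (ℚᵘ.+-cong (ι-unnormalised a) (ι-unnormalised b))))))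

ι-* : ∀ a b → ι (a * b) ≡ ι a ℚ.* ι b
ι-* a b = ℚ.toℚᵘ-injective (ℚᵘ.≃-trans (ι-unnormalised (a * b)) (ℚᵘ.≃-trans
  (*≡* (cong (ℤ._* (ℤ.+ 1)) (ℤ.pos-* a b)))
  (ℚᵘ.≃-sym (ℚᵘ.≃-trans (ℚ.toℚᵘ-homo-* (ι a) (ι b)) (ℚᵘ.*-cong (ι-unnormalised a) (ι-unnormalised b))))))

ι-nonNeg : ∀ k → ℚ.NonNegative (ι k)
ι-nonNeg k = ℚ.normalize-nonNeg k 1

ι-pos : ∀ k → 1 ≤ k → ℚ.Positive (ι k)
ι-pos (suc k) _ = ℚ.normalize-pos (suc k) 1

ι-mono : ∀ {a b} → a ≤ b → ι a ℚ.≤ ι b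
ι-mono {a} {b} a≤b = ℚ.toℚᵘ-cancel-≤ (ℚᵘ.≤-respˡ-≃ (ℚᵘ.≃-sym (ι-unnormalised a)) (ℚᵘ.≤-respʳ-≃ (ℚᵘ.≃-sym (ι-unnormalised b))
  (*≤* (subst₂ ℤ._≤_ (sym (ℤ.*-identityʳ (ℤ.+ a))) (sym (ℤ.*-identityʳ (ℤ.+ b))) (ℤ.+≤+ a≤b)))))

ι-cancel : ∀ {a b} → ι a ℚ.≤ ι b → a ≤ b
ι-cancel {a} {b} h = go (ℚᵘ.≤-respˡ-≃ (ι-unnormalised a) (ℚᵘ.≤-respʳ-≃ (ι-unnormalised b) (ℚ.toℚᵘ-mono-≤ h)))
  where
  go : mkℚᵘ (ℤ.+ a) 0 ℚᵘ.≤ mkℚᵘ (ℤ.+ b) 0 → a ≤ b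
  go (*≤* q) = ℤ.drop‿+≤+ (subst₂ ℤ._≤_ (ℤ.*-identityʳ (ℤ.+ a)) (ℤ.*-identityʳ (ℤ.+ b)) q)

-- Clearing the denominator turns comparisons of rationals into comparisons of naturals;
-- nonnegativity makes the absolute value harmless.
scaled : ∀ p → 0ℚ ℚ.≤ p → p ℚ.* ι (↧ₙ p) ≡ ι ∣ ↥ p ∣
scaled p@(mkℚ (ℤ.+ m) d _) _ = ℚ.toℚᵘ-injective (ℚᵘ.≃-trans (ℚ.toℚᵘ-homo-* p (ι (suc d)))
  (ℚᵘ.≃-trans (ℚᵘ.*-cong (ℚᵘ.≃-refl {toℚᵘ p}) (ι-unnormalised (suc d)))
    (ℚᵘ.≃-trans (*≡* (trans (ℤ.*-identityʳ _) (cong (λ z → ℤ.+ m ℤ.* ℤ.+ suc z) (sym (*-identityʳ d))))) (ℚᵘ.≃-sym (ι-unnormalised m)))))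
scaled (mkℚ (ℤ.-[1+ m ]) d _) (ℚ.*≤* ())

div-bounds : ∀ x d → 1 ≤ d → ⟦ div ⟧ x d * d ≤ x × x ≤ suc (⟦ div ⟧ x d) * d
div-bounds x (suc d) _ = m/n*n≤m x (suc d) ,
  ≤-trans (≤-reflexive (m≡m%n+[m/n]*n x (suc d))) (+-monoˡ-≤ (x / suc d * suc d) (<⇒≤ (m%n<n x (suc d))))

sum-mono : ∀ {n} {f g : Fin n → ℚ} → (∀ i → f i ℚ.≤ g i) → sum f ℚ.≤ sum g
sum-mono {zero}  h = ℚ.≤-refl
sum-mono {suc n} h = ℚ.+-mono-≤ (h Fin.zero) (sum-mono (h ∘ Fin.suc))

sum-*ʳ : ∀ {n} (f : Fin n → ℚ) x → sum f ℚ.* x ≡ sum (λ i → f i ℚ.* x)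
sum-*ʳ {zero}  f x = ℚ.*-zeroˡ x
sum-*ʳ {suc n} f x = trans (ℚ.*-distribʳ-+ x (f Fin.zero) (sum (f ∘ Fin.suc))) (cong (λ z → (f Fin.zero ℚ.* x) ℚ.+ z) (sum-*ʳ (f ∘ Fin.suc) x))

sum-ι : ∀ n (g : ℕ → ℕ) → sum {n} (λ i → ι (g (toℕ i))) ≡ ι (sumN n g)
sum-ι zero    g = refl
sum-ι (suc n) g = trans (cong (ι (g 0) ℚ.+_) (sum-ι n (g ∘ suc))) (trans (sym (ι-+ (g 0) _)) (cong ι (sym (sumN-front n g))))

module Rounding {n : ℕ} (prob : Fin n → ℚ) (0≤prob : ∀ i → 0ℚ ℚ.≤ prob i) (unit-mass : sum prob ≡ 1ℚ) (c : ℕ) (1≤n : 1 ≤ n) where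

  W : ℕ
  W = suc c * (n * n)

  1≤W : 1 ≤ W
  1≤W = *-mono-≤ (s≤s (z≤n {c})) (*-mono-≤ 1≤n 1≤n)

  num den w : ℕ → ℕ
  num = onℕ (λ i → ∣ ↥ prob i ∣)
  den = onℕ (λ i → ↧ₙ prob i)
  w v = ⟦ div ⟧ (num v * W) (den v)

  expected : (Fin n → ℕ) → ℚ
  expected d = sum (λ i → prob i ℚ.* ι (d i))

  private
    num-toℕ : ∀ i → num (toℕ i) ≡ ∣ ↥ prob i ∣
    num-toℕ = onℕ-toℕ (λ i → ∣ ↥ prob i ∣)

    den-toℕ : ∀ i → den (toℕ i) ≡ ↧ₙ prob i
    den-toℕ = onℕ-toℕ (λ i → ↧ₙ prob i)

    1≤den : ∀ i → 1 ≤ den (toℕ i)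
    1≤den i = subst (1 ≤_) (sym (den-toℕ i)) (s≤s z≤n)

    exact : ∀ i → (prob i ℚ.* ι W) ℚ.* ι (den (toℕ i)) ≡ ι (num (toℕ i) * W)
    exact i = trans (ℚ.*-assoc (prob i) (ι W) _) (trans (cong (prob i ℚ.*_) (ℚ.*-comm (ι W) _)) (trans (sym (ℚ.*-assoc (prob i) _ (ι W)))
      (trans (cong (ℚ._* ι W) (trans (cong (λ z → prob i ℚ.* ι z) (den-toℕ i)) (trans (scaled (prob i) (0≤prob i)) (cong ι (sym (num-toℕ i))))))
        (sym (ι-* (num (toℕ i)) W)))))

    low : ∀ i → ι (w (toℕ i)) ℚ.≤ prob i ℚ.* ι W
    low i = ℚ.*-cancelʳ-≤-pos (ι (den (toℕ i))) ⦃ ι-pos _ (1≤den i) ⦄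
      (ℚ.≤-trans (ℚ.≤-reflexive (sym (ι-* (w (toℕ i)) (den (toℕ i)))))
        (ℚ.≤-trans (ι-mono (proj₁ (div-bounds (num (toℕ i) * W) (den (toℕ i)) (1≤den i)))) (ℚ.≤-reflexive (sym (exact i)))))

    high : ∀ i → prob i ℚ.* ι W ℚ.≤ ι (suc (w (toℕ i)))
    high i = ℚ.*-cancelʳ-≤-pos (ι (den (toℕ i))) ⦃ ι-pos _ (1≤den i) ⦄
      (ℚ.≤-trans (ℚ.≤-reflexive (exact i))
        (ℚ.≤-trans (ι-mono (proj₂ (div-bounds (num (toℕ i) * W) (den (toℕ i)) (1≤den i)))) (ℚ.≤-reflexive (ι-* (suc (w (toℕ i))) (den (toℕ i))))))

    swap : ∀ p d → (p ℚ.* ι d) ℚ.* ι W ≡ (p ℚ.* ι W) ℚ.* ι d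
    swap p d = trans (ℚ.*-assoc p (ι d) (ι W)) (trans (cong (p ℚ.*_) (ℚ.*-comm (ι d) (ι W))) (sym (ℚ.*-assoc p (ι W) (ι d))))

  -- A rounded weight is at most 1 below the scaled probability, hence the successor.
  upper : ∀ d → expected d ℚ.* ι W ℚ.≤ ι (sumN n (λ v → suc (w v) * onℕ d v))
  upper d = ℚ.≤-trans (ℚ.≤-reflexive (sum-*ʳ (λ i → prob i ℚ.* ι (d i)) (ι W)))
    (ℚ.≤-trans (sum-mono each) (ℚ.≤-reflexive (sum-ι n (λ v → suc (w v) * onℕ d v))))
    where
    each : ∀ i → (prob i ℚ.* ι (d i)) ℚ.* ι W ℚ.≤ ι (suc (w (toℕ i)) * onℕ d (toℕ i))
    each i = ℚ.≤-trans (ℚ.≤-reflexive (swap (prob i) (d i))) (ℚ.≤-trans (ℚ.*-monoʳ-≤-nonNeg (ι (d i)) ⦃ ι-nonNeg (d i) ⦄ (high i))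
      (ℚ.≤-reflexive (trans (sym (ι-* (suc (w (toℕ i))) (d i))) (cong (λ z → ι (suc (w (toℕ i)) * z)) (sym (onℕ-toℕ d i))))))

  lower : ∀ d → ι (sumN n (λ v → w v * onℕ d v)) ℚ.≤ expected d ℚ.* ι W
  lower d = ℚ.≤-trans (ℚ.≤-reflexive (sym (sum-ι n (λ v → w v * onℕ d v))))
    (ℚ.≤-trans (sum-mono each) (ℚ.≤-reflexive (sym (sum-*ʳ (λ i → prob i ℚ.* ι (d i)) (ι W)))))
    where
    each : ∀ i → ι (w (toℕ i) * onℕ d (toℕ i)) ℚ.≤ (prob i ℚ.* ι (d i)) ℚ.* ι W
    each i = ℚ.≤-trans (ℚ.≤-reflexive (trans (cong (λ z → ι (w (toℕ i) * z)) (onℕ-toℕ d i)) (ι-* (w (toℕ i)) (d i))))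
      (ℚ.≤-trans (ℚ.*-monoʳ-≤-nonNeg (ι (d i)) ⦃ ι-nonNeg (d i) ⦄ (low i)) (ℚ.≤-reflexive (sym (swap (prob i) (d i)))))

  mass-≤ : sumN n w ≤ W
  mass-≤ = ι-cancel (ℚ.≤-trans (ℚ.≤-reflexive (sym (sum-ι n w))) (ℚ.≤-trans (sum-mono low)
    (ℚ.≤-reflexive (trans (sym (sum-*ʳ prob (ι W))) (trans (cong (ℚ._* ι W) unit-mass) (ℚ.*-identityˡ (ι W)))))))

  weight≤ : ∀ v → v < n → w v ≤ W
  weight≤ v v<n = ≤-trans (sumN-≥ n w v v<n) mass-≤

  -- That probabilities are at most 1 enters as `w v ≤ W`. It bounds the numerators by the
  -- denominators, to which the word length refers.
  numerator≤ : ∀ v → v < n → num v * W ≤ suc W * den v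
  numerator≤ v v<n = ≤-trans (onFin (λ v → num v * W ≤ suc (w v) * den v) (λ i → proj₂ (div-bounds (num (toℕ i) * W) (den (toℕ i)) (1≤den i))) v v<n)
    (*-monoˡ-≤ (den v) (s≤s (weight≤ v v<n)))

  -- Rounding down costs at most n per node, that is 1/C in total since W = C n².
  expected-≤ : ∀ (δ : ℚ) → ι 2 ℚ.≤ δ ℚ.* ι (suc c) → ∀ d d* e → (∀ i → d i ≤ n) → e * suc c ≤ sumN n w →
    sumN n (λ v → w v * onℕ d v) ≤ sumN n (λ v → w v * onℕ d* v) + sumN n w + e →
    expected d ℚ.≤ expected d* ℚ.+ (1ℚ ℚ.+ δ)
  expected-≤ δ 2≤δC d d* e d≤n e≤ h = ℚ.*-cancelʳ-≤-pos (ι W) ⦃ ι-pos W 1≤W ⦄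
    (ℚ.≤-trans (upper d) (ℚ.≤-trans (ι-mono total≤) (ℚ.≤-trans (ℚ.≤-reflexive (trans (ι-+ Y (W + 2 * (n * n))) (cong (ι Y ℚ.+_) (ι-+ W (2 * (n * n))))))
      (ℚ.≤-trans (ℚ.+-mono-≤ (lower d*) (ℚ.+-mono-≤ (ℚ.≤-reflexive (sym (ℚ.*-identityˡ (ι W)))) two≤))
        (ℚ.≤-reflexive (sym (trans (ℚ.*-distribʳ-+ (ι W) (expected d*) (1ℚ ℚ.+ δ)) (cong (λ z → (expected d* ℚ.* ι W) ℚ.+ z) (ℚ.*-distribʳ-+ (ι W) 1ℚ δ)))))))))
    where
    Y : ℕ
    Y = sumN n (λ v → w v * onℕ d* v)
    e-≤ : e ≤ n * n
    e-≤ = *-cancelˡ-≤ (suc c) (≤-trans (≤-reflexive (*-comm (suc c) e)) (≤-trans e≤ mass-≤))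
    d-≤ : ∀ v → v < n → onℕ d v ≤ n
    d-≤ = onFin (λ v → onℕ d v ≤ n) (λ i → ≤-trans (≤-reflexive (onℕ-toℕ d i)) (d≤n i))
    total≤ : sumN n (λ v → suc (w v) * onℕ d v) ≤ Y + (W + 2 * (n * n))
    total≤ = lin 8 (λ X D Z Y S e W q → (X ≼ D ⊞ Z) ∷ (D ≼ q) ∷ (Z ≼ Y ⊞ S ⊞ e) ∷ (S ≼ W) ∷ (e ≼ q) ∷ [] ⊢ X ≼ Y ⊞ (W ⊞ κ 2 ⊠ q))
      _ (sumN n (onℕ d)) (sumN n (λ v → w v * onℕ d v)) Y (sumN n w) e W (n * n)
      (≤-reflexive (sumN-+ n (onℕ d) (λ v → w v * onℕ d v))) (sumN-≤ n d-≤) h mass-≤ e-≤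
    two≤ : ι (2 * (n * n)) ℚ.≤ δ ℚ.* ι W
    two≤ = ℚ.≤-trans (ℚ.≤-reflexive (ι-* 2 (n * n))) (ℚ.≤-trans (ℚ.*-monoʳ-≤-nonNeg (ι (n * n)) ⦃ ι-nonNeg (n * n) ⦄ 2≤δC)
      (ℚ.≤-reflexive (trans (ℚ.*-assoc δ (ι (suc c)) (ι (n * n))) (cong (δ ℚ.*_) (sym (ι-* (suc c) (n * n)))))))

-- For `δ = (m + 1) / (d + 1)` the choice `C = 2 (d + 1)` gives `δ C = 2 (m + 1) ≥ 2`; as `C` is
-- `suc c`, this means `c = d + suc d`.
precision : ∀ (δ : ℚ) → 0ℚ ℚ.< δ → ∃[ c ] ι 2 ℚ.≤ δ ℚ.* ι (suc c)
precision δ@(mkℚ (ℤ.+ suc m) d _) 0<δ = d + suc d , ℚ.≤-trans (ι-mono (m≤m+n 2 (m * 2))) (ℚ.≤-reflexive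
  (trans (ι-* (suc m) 2) (trans (cong (ℚ._* ι 2) (sym (scaled δ (ℚ.<⇒≤ 0<δ)))) (trans (ℚ.*-assoc δ (ι (suc d)) (ι 2))
    (cong (δ ℚ.*_) (trans (sym (ι-* (suc d) 2)) (cong ι (ring 1 (λ d → [] ⊢ (κ 1 ⊞ d) ⊠ κ 2 ≼ κ 1 ⊞ (d ⊞ (κ 1 ⊞ d))) d))))))))
precision (mkℚ (ℤ.+ zero) d _) (ℚ.*<* (ℤ.+<+ ()))
precision (mkℚ (ℤ.-[1+ m ]) d _) (ℚ.*<* ())

-- Encoding of the input and the word length

module _ {A : Set} (f g h : A → ℕ) where

  private
    cells : List A → List ℕ
    cells = concatMap (λ v → f v ∷ g v ∷ h v ∷ [])

    Holds : List ℕ → A → ℕ → Set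
    Holds xs v t = contents xs t ≡ f v × contents xs (1 + t) ≡ g v × contents xs (2 + t) ≡ h v

  contents-triples : ∀ {m} (k : Fin m → A) i → Holds (cells (tabulate k)) (k i) (3 * toℕ i)
  contents-triples k Fin.zero    = refl , refl , refl
  contents-triples k (Fin.suc i) = subst (Holds (cells (tabulate k)) (k (Fin.suc i))) (sym (*-suc 3 (toℕ i))) (contents-triples (k ∘ Fin.suc) i)

  contents-past : ∀ {m} (k : Fin m → A) t → contents (cells (tabulate k)) (3 * m + t) ≡ 0
  contents-past {zero}  k t = refl
  contents-past {suc m} k t = subst (λ x → contents (cells (tabulate k)) (x + t) ≡ 0) (sym (*-suc 3 m)) (contents-past (k ∘ Fin.suc) t)

  contents-≤ : ∀ {m} V (k : Fin m → A) → (∀ i → f (k i) ≤ V × g (k i) ≤ V × h (k i) ≤ V) → ∀ r → contents (cells (tabulate k)) r ≤ V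
  contents-≤ {zero}  V k le r = z≤n
  contents-≤ {suc m} V k le zero                = proj₁ (le Fin.zero)
  contents-≤ {suc m} V k le (suc zero)          = proj₁ (proj₂ (le Fin.zero))
  contents-≤ {suc m} V k le (suc (suc zero))    = proj₂ (proj₂ (le Fin.zero))
  contents-≤ {suc m} V k le (suc (suc (suc r))) = contents-≤ V (k ∘ Fin.suc) (le ∘ Fin.suc) r

-- The maximum is one of the given numbers and so inherits `P`. This allows all bounds to be stated
-- in powers of a single number.
common-bound : ∀ {m} (P : ℕ → Set) (f : Fin m → ℕ) x → P x → (∀ i → P (f i)) → Σ ℕ λ y → x ≤ y × (∀ i → f i ≤ y) × P y
common-bound {zero}  P f x px pf = x , ≤-refl , (λ ()) , px
common-bound {suc m} P f x px pf =
  let y , x≤ , f≤ , py = common-bound P (f ∘ Fin.suc) (x ⊔ f Fin.zero) (pick (⊔-sel x (f Fin.zero))) (pf ∘ Fin.suc)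
  in y , ≤-trans (m≤m⊔n x _) x≤ , (λ { Fin.zero → ≤-trans (m≤n⊔m x _) x≤ ; (Fin.suc i) → f≤ i }) , py
  where
  pick : x ⊔ f Fin.zero ≡ x ⊎ x ⊔ f Fin.zero ≡ f Fin.zero → P (x ⊔ f Fin.zero)
  pick (inj₁ e) = subst P (sym e) px
  pick (inj₂ e) = subst P (sym e) (pf Fin.zero)

n<2^n : ∀ n → n < 2 ^ n
n<2^n zero    = s≤s z≤n
n<2^n (suc n) = lin 2 (λ n p → (κ 1 ⊞ n ≼ p) ∷ (κ 1 ⊞ n ≼ p) ∷ [] ⊢ κ 2 ⊞ n ≼ κ 2 ⊠ p) n (2 ^ n) (n<2^n n) (n<2^n n)

module Powers (X n B c : ℕ) (2≤X : 2 ≤ X) (n<X : suc n ≤ X) (B<X : suc B ≤ X) where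

  private
    instance
      X-nonZero : NonZero X
      X-nonZero = >-nonZero (≤-trans (s≤s z≤n) 2≤X)

    -- x ≤ X ^ k, as a record from which k can be inferred
    record Within (k x : ℕ) : Set where
      constructor within
      field bound : x ≤ X ^ k

    infixr 7 _·_
    _·_ : ∀ {k l x y} → Within k x → Within l y → Within (k + l) (x * y)
    _·_ {k} {l} (within p) (within q) = within (≤-trans (*-mono-≤ p q) (≤-reflexive (sym (^-distribˡ-+-* X k l))))

    shrink : ∀ {k x y} → x ≤ y → Within k y → Within k x
    shrink p (within q) = within (≤-trans p q)

    first : ∀ {x} → x ≤ X → Within 1 x
    first p = within (≤-trans p (≤-reflexive (sym (*-identityʳ X))))

    C≤ : Within (suc c) (suc c)
    C≤ = within (≤-trans (<⇒≤ (n<2^n (suc c))) (^-monoˡ-≤ (suc c) 2≤X))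

    two : ∀ k → Within k (2 ^ k)
    two k = within (^-monoˡ-≤ k 2≤X)

    n≤ : Within 1 n
    n≤ = first (≤-trans (n≤1+n n) n<X)

  -- The exponent comes from the largest product, the one in `weights≤V`: 2 for `suc n * n`, `suc c`
  -- for the constant and 2 for `n * n`. The constant `C` is below `X ^ C` since `2 ≤ X`.
  V : ℕ
  V = X ^ (suc c + 4)

  private
    in-V : ∀ {k x} → Within k x → k ≤ suc c + 4 → x ≤ V
    in-V (within p) k≤ = ≤-trans p (^-monoʳ-≤ X k≤)

  small≤V : ∀ {x} → x ≤ X → x ≤ V
  small≤V p = in-V (first p) (s≤s z≤n)

  8≤V : 8 ≤ V
  8≤V = in-V (two 3) (lin 1 (λ c → [] ⊢ κ 3 ≼ κ 1 ⊞ c ⊞ κ 4) c)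

  n≤V : 5 * n + 5 ≤ V
  n≤V = in-V (shrink (lin 1 (λ n → [] ⊢ κ 5 ⊠ n ⊞ κ 5 ≼ κ 8 ⊠ (κ 1 ⊞ n)) n) (two 3 · first n<X)) (m≤n+m 4 (suc c))

  private
    W≤ : Within (suc c + 2) (suc (suc c * (n * n)))
    W≤ = shrink (lin 2 (λ c n → [] ⊢ κ 1 ⊞ (κ 1 ⊞ c) ⊠ (n ⊠ n) ≼ (κ 1 ⊞ c) ⊠ ((κ 1 ⊞ n) ⊠ (κ 1 ⊞ n))) c n) (C≤ · first n<X · first n<X)

  scaled≤V : ∀ {d} → d ≤ X → suc (suc c * (n * n)) * d ≤ V
  scaled≤V d≤ = in-V (W≤ · first d≤) (lin 1 (λ c → [] ⊢ κ 1 ⊞ c ⊞ κ 2 ⊞ κ 1 ≼ κ 1 ⊞ c ⊞ κ 4) c)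

  weights≤V : suc n * (n * (suc c * (n * n))) ≤ V
  weights≤V = in-V (first n<X · n≤ · shrink (n≤1+n _) W≤) (lin 1 (λ c → [] ⊢ κ 2 ⊞ (κ 1 ⊞ c ⊞ κ 2) ≼ κ 1 ⊞ c ⊞ κ 4) c)

  offsets≤V : B * suc n ≤ V
  offsets≤V = in-V (first (≤-trans (n≤1+n B) B<X) · first n<X) (lin 1 (λ c → [] ⊢ κ 2 ≼ κ 1 ⊞ c ⊞ κ 4) c)

  quota≤V : suc c * (suc n * suc (suc n)) ≤ V
  quota≤V = in-V (C≤ · first n<X · shrink (lin 1 (λ n → [] ⊢ κ 2 ⊞ n ≼ κ 2 ⊠ (κ 1 ⊞ n)) n) (two 1 · first n<X))
    (lin 1 (λ c → [] ⊢ κ 1 ⊞ c ⊞ κ 3 ≼ κ 1 ⊞ c ⊞ κ 4) c)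

  fits : 2 + 3 * n + 16 * (V * suc B + B) + 32 ≤ X ^ (12 + suc c)
  -- The summands make up 65 multiples of `U`, fewer than `2 ^ 7`; the exponent `7 + (suc c + 5)` is
  -- the origin of the 12.
  fits = ≤-trans (lin 4 (λ R V′ B U → (R ≼ U) ∷ (κ 16 ⊠ V′ ≼ κ 16 ⊠ U) ∷ (κ 16 ⊠ B ≼ κ 16 ⊠ U) ∷ (κ 32 ≼ κ 32 ⊠ U) ∷ [] ⊢
      R ⊞ κ 16 ⊠ (V′ ⊞ B) ⊞ κ 32 ≼ κ 128 ⊠ U) (2 + 3 * n) (V * suc B) B U R≤ (*-monoʳ-≤ 16 V≤) (*-monoʳ-≤ 16 B≤) (*-monoʳ-≤ 32 1≤U))
    (≤-trans (Within.bound (two 7 · within {suc c + 4 + 1} {U} ≤-refl)) (^-monoʳ-≤ X (lin 1 (λ c → [] ⊢ κ 7 ⊞ (κ 1 ⊞ c ⊞ κ 4 ⊞ κ 1) ≼ κ 12 ⊞ (κ 1 ⊞ c)) c)))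
    where
    U : ℕ
    U = X ^ (suc c + 4 + 1)
    V≤U : V ≤ U
    V≤U = ^-monoʳ-≤ X (m≤m+n (suc c + 4) 1)
    V≤ : V * suc B ≤ U
    V≤ = Within.bound (within {suc c + 4} {V} ≤-refl · first B<X)
    R≤ : 2 + 3 * n ≤ U
    R≤ = ≤-trans (≤-trans (lin 1 (λ n → [] ⊢ κ 2 ⊞ κ 3 ⊠ n ≼ κ 5 ⊠ n ⊞ κ 5) n) n≤V) V≤U
    B≤ : B ≤ U
    B≤ = ≤-trans (small≤V (≤-trans (n≤1+n B) B<X)) V≤U
    1≤U : 1 ≤ U
    1≤U = ≤-trans (≤-trans (s≤s z≤n) 8≤V) V≤U

set-≤ : ∀ {V} {f : ℕ → ℕ} i {x} → x ≤ V → (∀ r → f r ≤ V) → ∀ r → (f [ i ↦ x ]) r ≤ V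
set-≤ i x≤ h r with does (r Data.Nat.Properties.≟ i)
... | true  = x≤
... | false = h r

-- Registers: n and B in usr 0 and usr 1, B + 1 in tmp 1, the first address
-- after the input in tmp 2.
prologue : Program
prologue =
  load 0 1 ∷ const 7 1 ∷ load 2 7 ∷ arith add 3 2 7 ∷
  const 9 3 ∷ arith mul 5 9 0 ∷ const 9 2 ∷ arith add 5 9 5 ∷ []

fetch-end : ∀ P → fetch P (length P) ≡ nothing
fetch-end []      = refl
fetch-end (_ ∷ P) = fetch-end P

fetch-shift : ∀ (P Q : Program) k → fetch (P ++ Q) (length P + k) ≡ fetch Q k
fetch-shift []      Q k = refl
fetch-shift (_ ∷ P) Q k = fetch-shift P Q k

code-at-++ : ∀ P Q → CodeAt (P ++ Q) 0 P × CodeAt (P ++ Q) (length P) Q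
code-at-++ P Q = codeAt-++ (P ++ Q) 0 P Q (length P) refl ([] , sym (++-identityʳ (P ++ Q)))

halted-at-end : ∀ (P Q : Program) {k} → length Q ≡ k → ∀ ρ M → Halted (P ++ Q) ⟨ length P + k , ρ , M ⟩
halted-at-end P Q refl ρ M = trans (fetch-shift P Q (length Q)) (fetch-end Q)

step-halted : ∀ w P s → Halted P s → step w P s ≡ s
step-halted w P s h rewrite h = refl

run-halted : ∀ w P t s → Halted P s → run w P t s ≡ s
run-halted w P zero    s h = refl
run-halted w P (suc t) s h = trans (cong (run w P t) (step-halted w P s h)) (run-halted w P t s h)

-- From labels in memory to layouts

module Layouts (c : ℕ) {n : ℕ} (tree : RootedTree n) (p : LeafDistribution tree) (b : ℕ) (1≤n : 1 ≤ n)
               {ord pos : ℕ → ℕ} (nb : Numbering n (Tree.up tree) (Tree.rt tree) ord pos) (lab : ℕ → ℕ) where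

  open Tree tree
  open Numbering nb
  open Staged n par par< using (distinct)
  open Rounding (prob p) (nonNegative p) (total p) c 1≤n using (expected-≤) renaming (w to weight)

  NearOptimal : Set
  NearOptimal = ∀ lab* → (∀ v → v < n → lab* v < n) → (∀ ℓ → sumN n (λ v → ind (lab* v ≡ᵇ ℓ)) ≤ suc b) →
    Σ ℕ λ e → e * suc c ≤ sumN n (weight ∘ ord) ×
      sumN n (λ v → weight (ord v) * distinct lab v) ≤ sumN n (λ v → weight (ord v) * distinct lab* v) + sumN n (weight ∘ ord) + e

  module Result (lab< : ∀ v → v < n → lab v < n) (block-size : ∀ ℓ → sumN n (λ v → ind (lab v ≡ᵇ ℓ)) ≤ suc b) (near-optimal : NearOptimal) where

    layout : Layout n (suc b)
    layout = record { block = f ; capacity = λ k → ≤-trans (≤-reflexive (Paths.block-count nb lab f agree k)) (block-size (toℕ k)) }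
      where
      f : Fin n → Fin n
      f i = fromℕ< (lab< (pos (toℕ i)) (pos< (toℕ i) (toℕ<n i)))
      agree : ∀ i → lab (pos (toℕ i)) ≡ toℕ (f i)
      agree i = sym (toℕ-fromℕ< _)

    agree : ∀ i → lab (pos (toℕ i)) ≡ toℕ (block layout i)
    agree i = sym (toℕ-fromℕ< _)

    blocks : Layout n (suc b) → Fin n → ℕ
    blocks L = blocksOnPath tree (block L)

    reorder : ∀ L lab′ → (∀ i → lab′ (pos (toℕ i)) ≡ toℕ (block L i)) →
      sumN n (λ v → weight v * onℕ (blocks L) v) ≡ sumN n (λ e → weight (ord e) * distinct lab′ e)
    reorder L lab′ ag = trans (sym (sumN-reindex nb (λ v → weight v * onℕ (blocks L) v))) (sumN-cong n (λ e e< → cong (weight (ord e) *_)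
      (trans (onFin (λ v → onℕ (blocks L) v ≡ distinct lab′ (pos v)) (λ i → trans (onℕ-toℕ (blocks L) i) (Paths.blocks-distinct nb lab′ (block L) ag i)) (ord e) (ord< e e<))
        (cong (distinct lab′) (pos-ord e e<)))))

    blocks-≤ : ∀ i → blocks layout i ≤ n
    blocks-≤ i = ≤-trans (≤-reflexive (Paths.blocks-distinct nb lab (block layout) agree i))
      (≤-trans (sumN-≤ n (λ ℓ _ → ind≤1 _)) (≤-reflexive (*-identityʳ n)))
      where
      ind≤1 : ∀ x → ind x ≤ 1
      ind≤1 true  = ≤-refl
      ind≤1 false = z≤n

    approximates : ∀ δ → ι 2 ℚ.≤ δ ℚ.* ι (suc c) → (L* : Layout n (suc b)) →
      expectedCost tree p layout ℚ.≤ expectedCost tree p L* ℚ.+ (1ℚ ℚ.+ δ)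
    approximates δ 2≤δC L* =
      let e , e≤ , h = near-optimal lab* lab*< cap*
          mass≡ = sumN-reindex nb weight
      in expected-≤ δ 2≤δC (blocks layout) (blocks L*) e blocks-≤ (≤-trans e≤ (≤-reflexive mass≡))
           (≤-trans (≤-reflexive (reorder layout lab agree)) (≤-trans h (≤-reflexive (cong (_+ e) (cong₂ _+_ (sym (reorder L* lab* agree*)) mass≡)))))
      where
      label* lab* : ℕ → ℕ
      label* = onℕ (λ i → toℕ (block L* i))
      lab* e = label* (ord e)
      agree* : ∀ i → lab* (pos (toℕ i)) ≡ toℕ (block L* i)
      agree* i = trans (cong label* (ord-pos (toℕ i) (toℕ<n i))) (onℕ-toℕ (λ i → toℕ (block L* i)) i)
      lab*< : ∀ e → e < n → lab* e < n
      lab*< e e<n = onFin (λ v → label* v < n) (λ i → subst (_< n) (sym (onℕ-toℕ (λ i → toℕ (block L* i)) i)) (toℕ<n (block L* i))) (ord e) (ord< e e<n)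
      cap* : ∀ ℓ → sumN n (λ e → ind (lab* e ≡ᵇ ℓ)) ≤ suc b
      cap* ℓ with ℓ <? n
      ... | yes ℓ<n = onFin (λ ℓ → sumN n (λ e → ind (lab* e ≡ᵇ ℓ)) ≤ suc b)
        (λ k → ≤-trans (≤-reflexive (sym (Paths.block-count nb lab* (block L*) agree* k))) (capacity L* k)) ℓ ℓ<n
      ... | no ℓ≮n  = ≤-trans (≤-reflexive (sumN-zero n (λ e e<n → cong ind (≢⇒≡ᵇ {lab* e} {ℓ} (λ { refl → ℓ≮n (lab*< e e<n) }))))) z≤n

-- The code and its running time are parameters, so that they are never unfolded.
module Solution (c : ℕ) (code : Stmt) (same : ∀ B V R → Code.main B V R (suc c) ≡ code) (K : ℕ) (K≥ : stepsPerNode c ≤ K)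
                {n : ℕ} (tree : RootedTree n) (p : LeafDistribution tree) (b w : ℕ)
                (X : ℕ) (n<X : suc n ≤ X) (B<X : suc (suc b) ≤ X) (den<X : ∀ i → suc (↧ₙ (prob p i)) ≤ X) (X≤ : X ^ (12 + suc c) ≤ 2 ^ w) where

  program : Program
  program = prologue ++ compile code 8

  open Tree tree

  1≤n : 1 ≤ n
  1≤n = ≤-trans (s≤s z≤n) (toℕ<n (root tree))

  open Rounding (prob p) (nonNegative p) (total p) c 1≤n using (W; 1≤W; num; den; weight≤; numerator≤; expected-≤) renaming (w to weight)

  den≤X : ∀ v → v < n → den v ≤ X
  den≤X = onFin (λ v → den v ≤ X) (λ i → ≤-trans (≤-reflexive (onℕ-toℕ (λ i → ↧ₙ (prob p i)) i)) (≤-trans (n≤1+n _) (den<X i)))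

  open Powers X n (suc b) c (≤-trans (s≤s 1≤n) n<X) n<X B<X hiding (fits)

  fits : 2 + 3 * n + 16 * (V * suc (suc b) + suc b) + 32 ≤ 2 ^ w
  fits = ≤-trans (Powers.fits X n (suc b) c (≤-trans (s≤s 1≤n) n<X) n<X B<X) X≤

  num≤V : ∀ v → v < n → num v * W ≤ V
  num≤V v v<n = ≤-trans (numerator≤ v v<n) (scaled≤V (den≤X v v<n))

  main-rule = Whole.main-rule n up up< rt (toℕ<n (root tree)) up-rt dep dep< num den b c V 8≤V n≤V num≤V weight≤ weights≤V offsets≤V (small≤V B<X) quota≤V
  given = Ordering.given n up up< rt (toℕ<n (root tree)) up-rt dep dep< num den (suc b) V c n≤V
    (Whole.con≤V n up up< rt (toℕ<n (root tree)) up-rt dep dep< num den b c V 8≤V n≤V num≤V weight≤ weights≤V offsets≤V (small≤V B<X) quota≤V) num≤V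

  Solved : (ℕ → ℕ) → Set
  Solved = Whole.Solved n up up< rt (toℕ<n (root tree)) up-rt dep dep< num den b c V 8≤V n≤V num≤V weight≤ weights≤V offsets≤V (small≤V B<X) quota≤V

  open Machine w (suc b) V (2 + 3 * n) fits program
  open Logic (suc b) V (2 + 3 * n)

  input : ℕ → ℕ
  input = contents (inputCells tree p (suc b))

  input-node : ∀ i → input (2 + 3 * toℕ i) ≡ toℕ (parent tree i) × input (3 + 3 * toℕ i) ≡ ∣ ↥ prob p i ∣ × input (4 + 3 * toℕ i) ≡ ↧ₙ (prob p i)
  input-node = contents-triples (λ v → toℕ (parent tree v)) (λ v → ∣ ↥ prob p v ∣) (λ v → ↧ₙ (prob p v)) (λ v → v)

  -- Memory behind the input is 0, so all arrays start out cleared and no time is spent on this.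
  input-past : ∀ t → input (t + (2 + 3 * n)) ≡ 0
  input-past t = trans (cong input (+-comm t (2 + 3 * n)))
    (contents-past (λ v → toℕ (parent tree v)) (λ v → ∣ ↥ prob p v ∣) (λ v → ↧ₙ (prob p v)) (λ v → v) t)

  n-≤V : n ≤ V
  n-≤V = small≤V (≤-trans (n≤1+n n) n<X)

  B≤V : suc b ≤ V
  B≤V = small≤V (≤-trans (n≤1+n (suc b)) B<X)

  input≤V : ∀ r → input r ≤ V
  input≤V zero          = n-≤V
  input≤V (suc zero)    = B≤V
  input≤V (suc (suc r)) = contents-≤ (λ v → toℕ (parent tree v)) (λ v → ∣ ↥ prob p v ∣) (λ v → ↧ₙ (prob p v)) V (λ v → v)
    (λ i → ≤-trans (<⇒≤ (toℕ<n (parent tree i))) n-≤V ,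
           ≤-trans (≤-trans (≤-reflexive (sym (onℕ-toℕ (λ i → ∣ ↥ prob p i ∣) i))) (≤-trans (≤-reflexive (sym (*-identityʳ _))) (*-monoʳ-≤ (num (toℕ i)) 1≤W))) (num≤V (toℕ i) (toℕ<n i)) ,
           ≤-trans (≤-trans (≤-reflexive (sym (onℕ-toℕ (λ i → ↧ₙ (prob p i)) i))) (den≤X (toℕ i) (toℕ<n i))) (small≤V ≤-refl)) r

  regs₀ : (one′ three two B+1 3n R : ℕ) → ℕ → ℕ
  regs₀ one′ three two B+1 3n R =
    ((((((((λ _ → 0) [ 0 ↦ n ]) [ 7 ↦ one′ ]) [ 2 ↦ input one′ ]) [ 3 ↦ B+1 ]) [ 9 ↦ three ]) [ 5 ↦ 3n ]) [ 9 ↦ two ]) [ 5 ↦ R ]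

  ρ₀ : ℕ → ℕ
  ρ₀ = regs₀ 1 3 2 (suc b + 1) (3 * n) (2 + 3 * n)

  R≤V : 2 + 3 * n ≤ V
  R≤V = ≤-trans (lin 1 (λ n → [] ⊢ κ 2 ⊞ κ 3 ⊠ n ≼ κ 5 ⊠ n ⊞ κ 5) n) n≤V

  B+1≤V : suc b + 1 ≤ V
  B+1≤V = ≤-trans (≤-reflexive (+-comm (suc b) 1)) (small≤V B<X)

  ρ₀≤V : ∀ r → ρ₀ r ≤ V
  ρ₀≤V = set-≤ 5 R≤V (set-≤ 9 (small 2) (set-≤ 5 (≤-trans (m≤n+m (3 * n) 2) R≤V) (set-≤ 9 (small 3) (set-≤ 3 B+1≤V (set-≤ 2 B≤V (set-≤ 7 (small 1) (set-≤ 0 n-≤V (λ _ → z≤n))))))))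
    where
    small : ∀ k {k≤ : T (k ≤ᵇ 8)} → k ≤ V
    small k {k≤} = ≤-trans (≤ᵇ⇒≤ k 8 k≤) 8≤V
  code-at : CodeAt program 0 prologue × CodeAt program 8 (compile code 8)
  code-at = code-at-++ prologue (compile code 8)

  prologue-runs : Steps 8 (initial tree p (suc b)) ⟨ 8 , ρ₀ , input ⟩
  prologue-runs = run-straight prologue tt (initial tree p (suc b)) (proj₁ code-at) ▹
    words≡ (word-small (16<2^w (≤ᵇ⇒≤ 1 16 _))) (word-small (16<2^w (≤ᵇ⇒≤ 3 16 _))) (word-small (16<2^w (≤ᵇ⇒≤ 2 16 _)))
    where
    le : ∀ {x} → x ≤ V → word w x ≡ x
    le h = word-small (≤-<-trans h V<2^w)
    words≡ : word w 1 ≡ 1 → word w 3 ≡ 3 → word w 2 ≡ 2 → execs prologue (initial tree p (suc b)) ≡ ⟨ 8 , ρ₀ , input ⟩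
    words≡ e₁ e₃ e₂ = trans (go (word w 1) (word w 3) (word w 2) e₁ e₃ e₂)
      (cong (λ f → ⟨ 8 , f , input ⟩) (trans (cong (λ z → regs₀ 1 3 2 z (word w (3 * n)) (word w (2 + word w (3 * n)))) (le B+1≤V))
        (cong₂ (regs₀ 1 3 2 (suc b + 1)) (le (≤-trans (m≤n+m (3 * n) 2) R≤V)) (trans (cong (λ z → word w (2 + z)) (le (≤-trans (m≤n+m (3 * n) 2) R≤V))) (le R≤V)))))
      where
      go : ∀ x y z → x ≡ 1 → y ≡ 3 → z ≡ 2 →
        ⟨ 8 , regs₀ x y z (word w (input x + x)) (word w (y * n)) (word w (z + word w (y * n))) , input ⟩ ≡
        ⟨ 8 , regs₀ 1 3 2 (word w (suc b + 1)) (word w (3 * n)) (word w (2 + word w (3 * n))) , input ⟩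
      go _ _ _ refl refl refl = refl

  σ₀ : Store
  σ₀ = store (λ x → ρ₀ (usr x)) (λ _ _ _ → 0) input 0

  registers : Registers σ₀ ρ₀
  registers = record { user = λ _ → refl ; boundV = λ x → ρ₀≤V (usr x) ; zero′ = refl ; width = +-comm (suc b) 1 ; start = refl }

  memory : Memory σ₀ input
  memory = record { cells = λ a i j _ _ → input-past ((i * suc (suc b) + j) * 16 + a) ; input = λ _ _ → refl
                  ; boundA = λ _ _ _ → z≤n ; boundR = λ r _ → input≤V r }

  given₀ : given σ₀
  given₀ = record
    { isN = refl
    ; isUp  = onFin (λ v → input (2 + 3 * v) ≡ up v) (λ i → trans (proj₁ (input-node i)) (sym (up-toℕ i)))
    ; isNum = onFin (λ v → input (3 + 3 * v) ≡ num v) (λ i → trans (proj₁ (proj₂ (input-node i))) (sym (onℕ-toℕ (λ i → ∣ ↥ prob p i ∣) i)))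
    ; isDen = onFin (λ v → input (4 + 3 * v) ≡ den v) (λ i → trans (proj₂ (proj₂ (input-node i))) (sym (onℕ-toℕ (λ i → ↧ₙ (prob p i)) i))) }

  Outcome : Set
  Outcome = Reaches ⟨ 8 , ρ₀ , input ⟩ (size code) σ₀ (λ σ′ → Solved (rw σ′) × clk σ′ ≤ K * n + 0)

  reached : Outcome
  reached = sound-ends 8≤V 8 (proj₂ code-at) registers memory
    (subst (λ s → Ends s (λ σ′ → Solved (rw σ′) × clk σ′ ≤ K * n + 0) σ₀) (same (suc b) V (2 + 3 * n))
      (ensure (main-rule σ₀ given₀ refl (λ _ _ _ → refl)) (λ σ′ (sv , t) _ → sv , ≤-trans t (+-monoˡ-≤ 0 (*-monoˡ-≤ n K≥)))))

  -- The outcome is a parameter, so that the simulation is never evaluated.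
  module Evaluation (outcome : Outcome) where

    open Reaches outcome

    end : State
    end = ⟨ 8 + size code , fregs , fmem ⟩

    halted : Halted program end
    halted = halted-at-end prologue (compile code 8) (length-compile code 8) fregs fmem

    -- The 8 steps of the prologue are spread over `n ≥ 1` nodes.
    enough : 8 + time ≤ (8 + K) * n
    enough = lin 4 (λ t K n z → (t ≼ K ⊠ n) ∷ (κ 8 ≼ κ 8 ⊠ n) ∷ [] ⊢ κ 8 ⊞ t ≼ (κ 8 ⊞ K) ⊠ n) time K n 0
      (≤-trans (≤-reflexive (trans (sym (+-identityʳ time)) (sym timeOk))) (≤-trans (proj₂ post) (≤-reflexive (+-identityʳ _)))) (*-monoʳ-≤ 8 1≤n)

    -- A halted machine keeps its state, so running on until the time bound changes nothing.
    ends-at : run w program ((8 + K) * n) (initial tree p (suc b)) ≡ end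
    ends-at = trans (cong (λ t → run w program t (initial tree p (suc b))) (sym (m+[n∸m]≡n enough)))
      (trans (run-+ (8 + time) ((8 + K) * n ∸ (8 + time)) (initial tree p (suc b)))
        (trans (cong (run w program ((8 + K) * n ∸ (8 + time))) (ran-eq (prologue-runs ▸ runs)))
          (run-halted w program ((8 + K) * n ∸ (8 + time)) end halted)))

    open Whole.Solved (proj₁ post)
    open Numbering numbered

    open Layouts c tree p b 1≤n numbered lab using (NearOptimal; module Result)

    near-optimal : NearOptimal
    near-optimal = Whole.near-optimal n up up< rt (toℕ<n (root tree)) up-rt dep dep< num den b c V 8≤V n≤V num≤V weight≤ weights≤V offsets≤V (small≤V B<X) quota≤V (proj₁ post)

    open Result
      (Whole.lab< n up up< rt (toℕ<n (root tree)) up-rt dep dep< num den b c V 8≤V n≤V num≤V weight≤ weights≤V offsets≤V (small≤V B<X) quota≤V (proj₁ post))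
      (Whole.block-size n up up< rt (toℕ<n (root tree)) up-rt dep dep< num den b c V 8≤V n≤V num≤V weight≤ weights≤V offsets≤V (small≤V B<X) quota≤V (proj₁ post))
      near-optimal public using (layout; agree; approximates)

    outputs : Outputs end layout
    outputs i = trans (Memory.input memOk (toℕ i) (≤-trans (toℕ<n i) (≤-trans (m≤m+n n (2 * n)) (m≤n+m (3 * n) 2)))) (trans (written (toℕ i) (toℕ<n i)) (agree i))

    conclusion : ∀ δ → ι 2 ℚ.≤ δ ℚ.* ι (suc c) →
      let s = run w program ((8 + K) * n) (initial tree p (suc b)) in
      Halted program s × Σ (Layout n (suc b)) λ L → Outputs s L ×
        (∀ (L* : Layout n (suc b)) → IsOptimal tree p L* → expectedCost tree p L ℚ.≤ expectedCost tree p L* ℚ.+ (1ℚ ℚ.+ δ))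
    conclusion δ 2≤δC = subst
      (λ s → Halted program s × Σ (Layout n (suc b)) λ L → Outputs s L ×
        (∀ (L* : Layout n (suc b)) → IsOptimal tree p L* → expectedCost tree p L ℚ.≤ expectedCost tree p L* ℚ.+ (1ℚ ℚ.+ δ)))
      (sym ends-at) (halted , layout , outputs , λ L* _ → approximates δ 2≤δC L*)

  solution : ∀ δ → ι 2 ℚ.≤ δ ℚ.* ι (suc c) →
    let s = run w program ((8 + K) * n) (initial tree p (suc b)) in
    Halted program s × Σ (Layout n (suc b)) λ L → Outputs s L ×
      (∀ (L* : Layout n (suc b)) → IsOptimal tree p L* → expectedCost tree p L ℚ.≤ expectedCost tree p L* ℚ.+ (1ℚ ℚ.+ δ))
  solution = Evaluation.conclusion reached

solve : ∀ c code → (∀ B V R → Code.main B V R (suc c) ≡ code) → ∀ K → stepsPerNode c ≤ K → ∀ δ → ι 2 ℚ.≤ δ ℚ.* ι (suc c) →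
  ∀ {n} (tree : RootedTree n) (p : LeafDistribution tree) (B : ℕ) → 1 ≤ B → (w : ℕ) → WordsLargeEnough (12 + suc c) w tree p B →
  let P = prologue ++ compile code 8
      s = run w P ((8 + K) * n) (initial tree p B) in
  Halted P s × Σ (Layout n B) λ L → Outputs s L ×
    (∀ (L* : Layout n B) → IsOptimal tree p L* → expectedCost tree p L ℚ.≤ expectedCost tree p L* ℚ.+ (1ℚ ℚ.+ δ))
solve c code same K K≥ δ 2≤δC {n} tree p (suc b) _ w (n-words , B-words , den-words) =
  let X , sizes≤X , den<X , X≤ = common-bound fitting (λ i → suc (↧ₙ (prob p i))) (suc n ⊔ suc (suc b)) (pick (⊔-sel (suc n) (suc (suc b)))) den-words
  in Solution.solution c code same K K≥ tree p b w X
       (≤-trans (m≤m⊔n (suc n) (suc (suc b))) sizes≤X) (≤-trans (m≤n⊔m (suc n) (suc (suc b))) sizes≤X) den<X X≤ δ 2≤δC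
  where
  fitting : ℕ → Set
  fitting y = y ^ (12 + suc c) ≤ 2 ^ w
  pick : suc n ⊔ suc (suc b) ≡ suc n ⊎ suc n ⊔ suc (suc b) ≡ suc (suc b) → fitting (suc n ⊔ suc (suc b))
  pick (inj₁ e) = subst fitting (sym e) n-words
  pick (inj₂ e) = subst fitting (sym e) B-words

mainTheorem3 : (δ : ℚ) → 0ℚ ℚ.< δ →
    Σ Program λ P → ∃[ c ] ∃[ κ ]
    (∀ {n} (T : RootedTree n) (p : LeafDistribution T) (B : ℕ) .{{_ : NonZero B}}
    (w : ℕ) → WordsLargeEnough κ w T p B →
    let s = run w P (c * n) (initial T p B) in
    Halted P s ×
    Σ (Layout n B) λ L →
    Outputs s L ×
    (∀ (L* : Layout n B) → IsOptimal T p L* →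
    expectedCost T p L ℚ.≤ expectedCost T p L* ℚ.+ (1ℚ ℚ.+ δ)))
mainTheorem3 δ 0<δ =
  let c , 2≤δC = precision δ 0<δ
  -- The bounds given to `Code.main` do not occur in its statements, so one program serves all `B`
  -- and `n`; the added 8 is the prologue.
  in prologue ++ compile (Code.main 0 0 0 (suc c)) 8 , 8 + stepsPerNode c , 12 + suc c ,
     λ T p B w words → solve c (Code.main 0 0 0 (suc c)) (λ _ _ _ → refl) (stepsPerNode c) ≤-refl δ 2≤δC T p B (>-nonZero⁻¹ B) w words
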